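{- Fix an integer $p\ge 3$. Let $\theta$, $\Phi_1$, $\Phi_2$ be the doubly hypergeometric series $$\theta(x,y)=\sum_{i\ge0}\sum_{j\ge0} t^c_{2i+j}\binom{2i+j}{i,i,j}x^iy^j,\qquad \Phi_1(x,y)=\sum_{i\ge1}\sum_{j\ge0} t_{2i+j}\binom{2i+j-1}{i-1,i,j}x^iy^j,$$ $$\Phi_2(x,y)=\sum_{i\ge0}\sum_{j\ge0} t_{2i+j+1}\binom{2i+j}{i,i,j}x^iy^j,$$ where $\binom{a+b+c}{a,b,c}=(a+b+c)!/(a!\,b!\,c!)$. Then there exists a unique pair $(R,S)$ of formal power series in $z$ with constant term $0$ and coefficients in $\mathbb{Q}[u]$ such that $$R=z+u\,\Phi_1(R,S),\qquad S=u\,\Phi_2(R,S).$$ Moreover, the generating function $F(z,u)$ of $p$-valent forested maps is characterized by $F(0,u)=0$ and $$\frac{\partial F}{\partial z}(z,u)=\theta(R,S).$$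
   Context: A planar map is a proper embedding of a connected graph (loops and multiple edges allowed) in the oriented sphere, up to continuous deformation; its faces are the connected components of the complement. A corner is a pair $(e_1,e_2)$ of half-edges at a common vertex with $e_2$ immediately following $e_1$ counterclockwise; a rooted map has a marked corner; all maps are rooted. A map is $p$-valent if every vertex has degree $p$. A spanning forest of a map $M$ is a subset of its edges containing no cycle (viewed as a spanning subgraph on all vertices; its connected components, including isolated vertices, are trees). A $p$-valent forested map is a pair $(M,F)$ with $M$ a rooted $p$-valent planar map and $F$ a spanning forest of $M$. The generating function is $F(z,u)=\sum_{(M,F)} z^{\mathrm{f}(M)}u^{\mathrm{c}(F)-1}$, where $\mathrm{f}$ is the number of faces and $\mathrm{c}$ the number of connected components. The numbers $t_k$, $t^c_k$ (numbers of $p$-valent plane trees with $k$ leaves rooted at a leaf, resp. at a corner) are: if $k=(p-2)\ell+2$ with $\ell\ge1$, $t_k=\frac{((p-1)\ell)!}{\ell!\,((p-2)\ell+1)!}$ and $t^c_k=p\,\frac{((p-1)\ell)!}{(\ell-1)!\,((p-2)\ell+2)!}$; otherwise $t_k=t^c_k=0$. -}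

module Defs where

open import Data.Nat as ℕ using (ℕ; zero; suc; _+_; _*_; _∸_; _≤_; _<_; _≡ᵇ_; _≤ᵇ_; _!)
open import Data.Integer using (+_)
open import Data.Rational as ℚ using (ℚ; 0ℚ; 1ℚ)
open import Data.Bool using (Bool; true; false; if_then_else_; _∨_; not)
open import Data.Fin as Fin using (Fin; toℕ; inject₁; fromℕ)
open import Data.List as List using (List; []; _∷_; _++_; allFin; upTo; length)
open import Data.Nat.ListAction using () renaming (sum to sumℕ)
open import Data.Bool.ListAction using () renaming (all to allB; any to anyB)
open import Data.List.Relation.Unary.All using (All)
open import Data.List.Relation.Unary.Any using (Any)
open import Data.List.Relation.Unary.AllPairs using (AllPairs)
open import Data.Product using (Σ; _×_; ∃; _,_)
open import Relation.Binary.PropositionalEquality using (_≡_; _≢_)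
open import Relation.Nullary using (¬_)

-- a / b as a rational number (only used with b ≠ 0; b = 0 gives 0)
_÷_ : ℕ → ℕ → ℚ
a ÷ zero = 0ℚ
a ÷ suc b = (+ a) ℚ./ suc b

ℕtoℚ : ℕ → ℚ
ℕtoℚ n = n ÷ 1

sumTo : ℕ → (ℕ → ℚ) → ℚ
sumTo zero f = f 0
sumTo (suc n) f = sumTo n f ℚ.+ f (suc n)

-- The numbers t_k and t^c_k (for valency p)
-- t_k = ((p-1)l)! / (l! ((p-2)l+1)!)        if k = (p-2)l+2, l ≥ 1, else 0
-- t^c_k = p ((p-1)l)! / ((l-1)! ((p-2)l+2)!) if k = (p-2)l+2, l ≥ 1, else 0
-- (for p ≥ 3 at most one l ≤ k satisfies k = (p-2)l+2)

tval : ℕ → ℕ → ℚ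
tval p l = (((p ∸ 1) * l) !) ÷ ((l !) * ((((p ∸ 2) * l) + 1) !))

tcval : ℕ → ℕ → ℚ
tcval p l = (p * (((p ∸ 1) * l) !)) ÷ (((l ∸ 1) !) * ((((p ∸ 2) * l) + 2) !))

matches : ℕ → ℕ → ℕ → Bool
matches p k zero = false
matches p k (suc l) = ((p ∸ 2) * suc l + 2) ≡ᵇ k

t : ℕ → ℕ → ℚ
t p k = sumTo k (λ l → if matches p k l then tval p l else 0ℚ)

tc : ℕ → ℕ → ℚ
tc p k = sumTo k (λ l → if matches p k l then tcval p l else 0ℚ)

multinom : ℕ → ℕ → ℕ → ℚ
multinom a b c = ((a + b + c) !) ÷ ((a !) * (b !) * (c !))

θc : ℕ → ℕ → ℕ → ℚ
θc p i j = tc p (2 * i + j) ℚ.* multinom i i j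

Φ₁c : ℕ → ℕ → ℕ → ℚ
Φ₁c p zero j = 0ℚ
Φ₁c p (suc i) j = t p (2 * suc i + j) ℚ.* multinom i (suc i) j

Φ₂c : ℕ → ℕ → ℕ → ℚ
Φ₂c p i j = t p (2 * i + j + 1) ℚ.* multinom i i j

-- Formal power series in z with coefficients in Q[u], represented inside
-- Q[[z,u]]:  A n k = coefficient of z^n u^k.

Series : Set
Series = ℕ → ℕ → ℚ

PolyCoeffs : Series → Set
PolyCoeffs A = ∀ n → ∃ λ d → ∀ k → d < k → A n k ≡ 0ℚ

ZeroConst : Series → Set
ZeroConst A = ∀ k → A 0 k ≡ 0ℚ

oneS : Series
oneS zero zero = 1ℚ
oneS _ _ = 0ℚ

zS : Series
zS 1 zero = 1ℚ
zS _ _ = 0ℚ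

_⊕_ : Series → Series → Series
(A ⊕ B) n k = A n k ℚ.+ B n k

uMul : Series → Series
uMul A n zero = 0ℚ
uMul A n (suc k) = A n k

_⊛_ : Series → Series → Series
(A ⊛ B) n k = sumTo n (λ a → sumTo k (λ b → A a b ℚ.* B (n ∸ a) (k ∸ b)))

powS : Series → ℕ → Series
powS A zero = oneS
powS A (suc i) = A ⊛ powS A i

-- substitution of (R, S) (both with zero constant term in z) into the
-- bivariate series  Σ_{i,j} c i j x^i y^j :  since R^i S^j has z-valuation
-- ≥ i + j, only the terms with i + j ≤ n contribute to [z^n].
subst₂ : (ℕ → ℕ → ℚ) → Series → Series → Series
subst₂ c R S n k =
  sumTo n (λ i → sumTo (n ∸ i) (λ j → c i j ℚ.* (powS R i ⊛ powS S j) n k))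

-- Combinatorial maps.  A map with m half-edges (darts) Fin m is given by
-- a vertex rotation σ (with inverse σ⁻), and a fixed-point-free involution α
-- (edges).  The root corner (e₁, σ e₁) is encoded by the dart e₁.
-- A forest is a set of darts closed under α (i.e. a set of edges).

record FMap (m : ℕ) : Set where
  field
    σ σ⁻ α : Fin m → Fin m
    root   : Fin m
    forest : Fin m → Bool
open FMap public

iter : ∀ {m} → (Fin m → Fin m) → ℕ → Fin m → Fin m
iter f zero d = d
iter f (suc i) d = f (iter f i d)

countB : ∀ {m} → (Fin m → Bool) → ℕ
countB {m} b = sumℕ (List.map (λ d → if b d then 1 else 0) (allFin m))

-- number of cycles of a permutation f of Fin m
-- (= number of darts that are the smallest of their f-orbit)
cycles : ∀ {m} → (Fin m → Fin m) → ℕ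
cycles {m} f =
  countB (λ d → allB (λ i → toℕ d ≤ᵇ toℕ (iter f i d)) (upTo m))

reach : ∀ {m} → ℕ → (Fin m → List (Fin m)) → Fin m → Fin m → Bool
reach zero nb d e = toℕ d ≡ᵇ toℕ e
reach (suc s) nb d e = reach s nb d e ∨ anyB (λ x → reach s nb x e) (nb d)

forestNb : ∀ {m} → FMap m → Fin m → List (Fin m)
forestNb M d = σ M d ∷ σ⁻ M d ∷ (if forest M d then α M d ∷ [] else [])

-- number of connected components of the spanning forest
-- (classes of darts under forest-reachability; walks of length ≤ m suffice)
components : ∀ {m} → FMap m → ℕ
components {m} M =
  countB (λ d → allB (λ e → not (reach m (forestNb M) d e) ∨ (toℕ d ≤ᵇ toℕ e))
                         (allFin m))

vertices : ∀ {m} → FMap m → ℕ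
vertices M = cycles (σ M)

faces : ∀ {m} → FMap m → ℕ
faces M = cycles (λ d → σ M (α M d))

SameV : ∀ {m} → FMap m → Fin m → Fin m → Set
SameV M d e = ∃ λ i → iter (σ M) i d ≡ e

-- a cycle of the underlying graph using only forest edges:
-- k+1 pairwise distinct edges {dᵢ, α dᵢ} going from vertex(dᵢ) to
-- vertex(α dᵢ) = vertex(dᵢ₊₁), cyclically, through pairwise distinct vertices
record ForestCycle {m} (M : FMap m) : Set where
  field
    k      : ℕ
    ds     : Fin (suc k) → Fin m
    inF    : ∀ i → forest M (ds i) ≡ true
    edgesDistinct : ∀ i j → i ≢ j → (ds i ≢ ds j) × (ds i ≢ α M (ds j))
    consec : ∀ (i : Fin k) → SameV M (α M (ds (inject₁ i))) (ds (Fin.suc i))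
    close  : SameV M (α M (ds (fromℕ k))) (ds Fin.zero)
    vertsDistinct : ∀ i j → i ≢ j → ¬ SameV M (ds i) (ds j)

data Conn {m} (M : FMap m) : Fin m → Set where
  cRoot : Conn M (root M)
  cσ    : ∀ {d} → Conn M d → Conn M (σ M d)
  cα    : ∀ {d} → Conn M d → Conn M (α M d)

record Valid (p : ℕ) {m} (M : FMap m) : Set where
  field
    σ-left   : ∀ d → σ⁻ M (σ M d) ≡ d
    σ-right  : ∀ d → σ M (σ⁻ M d) ≡ d
    α-invol  : ∀ d → α M (α M d) ≡ d
    α-nofix  : ∀ d → α M d ≢ d
    connected : ∀ d → Conn M d
    -- genus 0 (Euler's formula V - E + F = 2 with 2E = m)
    planar   : 2 * (vertices M + faces M) ≡ m + 4
    valent   : ∀ d → iter (σ M) p d ≡ d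
    valent-min : ∀ i → 0 < i → i < p → ∀ d → iter (σ M) i d ≢ d
    forest-α : ∀ d → forest M (α M d) ≡ forest M d
    acyclic  : ¬ ForestCycle M

record Iso {m m'} (M : FMap m) (M' : FMap m') : Set where
  field
    ψ  : Fin m → Fin m'
    ψ⁻ : Fin m' → Fin m
    ψ-left  : ∀ d → ψ⁻ (ψ d) ≡ d
    ψ-right : ∀ d → ψ (ψ⁻ d) ≡ d
    ψ-σ : ∀ d → ψ (σ M d) ≡ σ M' (ψ d)
    ψ-α : ∀ d → ψ (α M d) ≡ α M' (ψ d)
    ψ-root : ψ (root M) ≡ root M'
    ψ-forest : ∀ d → forest M' (ψ d) ≡ forest M d

AnyMap : Set
AnyMap = Σ ℕ FMap

IsoA : AnyMap → AnyMap → Set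
IsoA (_ , M) (_ , M') = Iso M M'

Good : ℕ → ℕ → ℕ → AnyMap → Set
Good p f k (_ , M) = Valid p M × faces M ≡ f × components M ≡ suc k

-- N is the number of isomorphism classes of p-valent forested maps with
-- f faces and k+1 forest components, i.e. N = [z^f u^k] F(z,u):
-- witnessed by a list of pairwise non-isomorphic representatives
-- meeting every class.
ClassCount : ℕ → ℕ → ℕ → ℕ → Set
ClassCount p f k N =
  Σ (List AnyMap) λ L →
    length L ≡ N
    × All (Good p f k) L
    × AllPairs (λ x y → ¬ IsoA x y) L
    × (∀ x → Good p f k x → Any (IsoA x) L)

{-# OPTIONS --safe #-}
-- Explore a forested map from its root, forest edges first: an edge that discovers a vertex is contracted, and an edge
-- with both ends on the current contour splits it. The steps form a word from which the map can be rebuilt. Joining two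
-- contours is the only step that creates a handle, so by Euler's relation the planar maps are those whose words have no
-- such step. Counting these words gives, for M_k counting configurations with k darts on the contour, the equation
--     M_0 = z,   M_{k+1} = Σ M_i M_{k-1-i} + u Σ_j t_j M_{k+j-1}.
-- It is solved by M_k = ∫ B_k dz with B_k = [t⁰](t + S + R/t)^k. Indeed w = Σ B_k y^k satisfies Δ w² = 1 with
-- Δ = (1 - S y)² - 4 R y², which yields a linear recurrence for the defect
-- B_{k+1} - u Σ_j t_j B_{k+j-1} - 2 Σ M_i B_{k-1-i}; it vanishes for all k as soon as it does for k = 0 and k = 1, and
-- these two cases are the equations for R and S. Finally ∂F/∂z = Σ_k t^c_k B_k = θ(R,S).
module Submission where

-- Each emptied contour closes a face, so z counts these steps; u counts the trees opened after the
-- first. In the second term of the equation a tree with j leaves is attached by one leaf and the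
-- other j - 1 join the contour. It is attached dart by dart, which brings in the numbers `P` of
-- plane forests; t^c_k appears because the p darts of the root vertex all start undetermined.
--
-- Planarity is given as a numerical relation, so a handle cannot be seen locally. For any word the
-- rebuilt map has at most as many faces as there are emptied contours, and Euler's relation then
-- leaves no room for a joining step. The reverse inequality is proved only for words without such
-- steps, by counting identifications of corners.
--
-- The square root of Δ is never formed: w is given by its coefficients, and the two derivations y
-- d/dy and d/dz, together with constant terms, do the rest. R and S are constructed by iteration
-- modulo powers of u; giving z weight 2 and u weight -1 bounds their degrees in u.

-- Commutative rings, finite sums and formal power series

module PowerSeriesRings where

  open import Algebra.Bundles using (CommutativeRing; RawRing)
  open import Algebra.Solver.Ring.AlmostCommutativeRing using (fromCommutativeRing; _-Raw-AlmostCommutative⟶_)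
  import Algebra.Solver.Ring
  import Algebra.Properties.Ring
  import Algebra.Properties.AbelianGroup
  open import Level using (Level; 0ℓ)
  open import Data.Nat.Base as ℕ using (ℕ; zero; suc)
  import Data.Nat.Properties as ℕ
  open import Data.Product using (_×_; _,_)
  open import Data.Maybe.Base using (Maybe; just; nothing)
  open import Relation.Nullary using (yes; no)
  import Relation.Binary.PropositionalEquality as ≡
  import Relation.Binary.Reasoning.Setoid

  module RingKit {c ℓ : Level} (A : CommutativeRing c ℓ) where
    open CommutativeRing A
    open Algebra.Properties.Ring ring
    open Algebra.Properties.AbelianGroup +-abelianGroup using (⁻¹-∙-comm)
    open Relation.Binary.Reasoning.Setoid setoid
    open import Algebra.Properties.Semiring.Mult semiring public using () renaming (_×_ to _·_)
    open import Algebra.Properties.Semiring.Mult semiring using (×-homo-+; ×1-homo-*)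

    ι : ℕ → Carrier
    ι n = n · 1#

    ι-+ : ∀ m n → ι (m ℕ.+ n) ≈ ι m + ι n
    ι-+ m n = ×-homo-+ 1# m n

    ι-* : ∀ m n → ι (m ℕ.* n) ≈ ι m * ι n
    ι-* = ×1-homo-*

    -- The solver below computes with integer coefficients, an integer being a formal difference of naturals.
    cancelled : ℕ × ℕ → ℕ × ℕ
    cancelled (suc a , suc b) = cancelled (a , b)
    cancelled x = x

    Coeff : RawRing 0ℓ 0ℓ
    Coeff = record
      { Carrier = ℕ × ℕ
      ; _≈_ = ≡._≡_
      ; _+_ = λ (a , b) (c , d) → cancelled (a ℕ.+ c , b ℕ.+ d)
      ; _*_ = λ (a , b) (c , d) → cancelled (a ℕ.* c ℕ.+ b ℕ.* d , a ℕ.* d ℕ.+ b ℕ.* c)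
      ; -_ = λ (a , b) → b , a
      ; 0# = 0 , 0
      ; 1# = 1 , 0
      }

    -- The first two clauses make the solver's constants 0 and 1 the ring's own.
    ⟪_⟫ : ℕ × ℕ → Carrier
    ⟪ 0 , 0 ⟫ = 0#
    ⟪ 1 , 0 ⟫ = 1#
    ⟪ a , b ⟫ = ι a + - ι b

    ⟪⟫-ι : ∀ a b → ⟪ a , b ⟫ ≈ ι a + - ι b
    ⟪⟫-ι 0 0 = sym (-‿inverseʳ 0#)
    ⟪⟫-ι 1 0 = sym (trans (+-cong (+-identityʳ 1#) -0#≈0#) (+-identityʳ 1#))
    ⟪⟫-ι 0 (suc b) = refl
    ⟪⟫-ι 1 (suc b) = refl
    ⟪⟫-ι (suc (suc a)) b = refl

    interchange : ∀ a b c d → (a + b) + (c + d) ≈ (a + c) + (b + d)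
    interchange a b c d = begin
      (a + b) + (c + d) ≈⟨ +-assoc a b (c + d) ⟩
      a + (b + (c + d)) ≈⟨ +-congˡ (sym (+-assoc b c d)) ⟩
      a + ((b + c) + d) ≈⟨ +-congˡ (+-congʳ (+-comm b c)) ⟩
      a + ((c + b) + d) ≈⟨ +-congˡ (+-assoc c b d) ⟩
      a + (c + (b + d)) ≈⟨ sym (+-assoc a c (b + d)) ⟩
      (a + c) + (b + d) ∎

    ⟪cancelled⟫ : ∀ a b → ⟪ cancelled (a , b) ⟫ ≈ ι a + - ι b
    ⟪cancelled⟫ zero b = ⟪⟫-ι 0 b
    ⟪cancelled⟫ (suc a) zero = ⟪⟫-ι (suc a) 0
    ⟪cancelled⟫ (suc a) (suc b) = begin
      ⟪ cancelled (a , b) ⟫ ≈⟨ ⟪cancelled⟫ a b ⟩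
      ι a + - ι b ≈⟨ sym (+-identityˡ _) ⟩
      0# + (ι a + - ι b) ≈⟨ +-congʳ (sym (-‿inverseʳ 1#)) ⟩
      (1# + - 1#) + (ι a + - ι b) ≈⟨ interchange _ _ _ _ ⟩
      (1# + ι a) + (- 1# + - ι b) ≈⟨ +-congˡ (⁻¹-∙-comm 1# (ι b)) ⟩
      (1# + ι a) + - (1# + ι b) ∎

    +-hom : ∀ x y → ⟪ RawRing._+_ Coeff x y ⟫ ≈ ⟪ x ⟫ + ⟪ y ⟫
    +-hom (a , b) (c , d) = begin
      _ ≈⟨ ⟪cancelled⟫ (a ℕ.+ c) (b ℕ.+ d) ⟩
      ι (a ℕ.+ c) + - ι (b ℕ.+ d) ≈⟨ +-cong (ι-+ a c) (trans (-‿cong (ι-+ b d)) (sym (⁻¹-∙-comm (ι b) (ι d)))) ⟩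
      (ι a + ι c) + (- ι b + - ι d) ≈⟨ interchange _ _ _ _ ⟩
      (ι a + - ι b) + (ι c + - ι d) ≈⟨ sym (+-cong (⟪⟫-ι a b) (⟪⟫-ι c d)) ⟩
      ⟪ a , b ⟫ + ⟪ c , d ⟫ ∎

    *-hom : ∀ x y → ⟪ RawRing._*_ Coeff x y ⟫ ≈ ⟪ x ⟫ * ⟪ y ⟫
    *-hom (a , b) (c , d) = begin
      _ ≈⟨ ⟪cancelled⟫ (a ℕ.* c ℕ.+ b ℕ.* d) (a ℕ.* d ℕ.+ b ℕ.* c) ⟩
      ι (a ℕ.* c ℕ.+ b ℕ.* d) + - ι (a ℕ.* d ℕ.+ b ℕ.* c)
        ≈⟨ +-cong (trans (ι-+ (a ℕ.* c) (b ℕ.* d)) (+-cong (ι-* a c) (trans (ι-* b d) (sym neg²))))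
                  (trans (-‿cong (trans (ι-+ (a ℕ.* d) (b ℕ.* c)) (trans (+-cong (ι-* a d) (ι-* b c)) (+-comm _ _)))) (sym (⁻¹-∙-comm _ _))) ⟩
      (ι a * ι c + - ι b * - ι d) + (- (ι b * ι c) + - (ι a * ι d))
        ≈⟨ +-congˡ (+-cong (-‿distribˡ-* _ _) (-‿distribʳ-* _ _)) ⟩
      (ι a * ι c + - ι b * - ι d) + (- ι b * ι c + ι a * - ι d)
        ≈⟨ interchange _ _ _ _ ⟩
      (ι a * ι c + - ι b * ι c) + (- ι b * - ι d + ι a * - ι d)
        ≈⟨ +-cong (sym (distribʳ _ _ _)) (trans (+-comm _ _) (sym (distribʳ _ _ _))) ⟩
      (ι a + - ι b) * ι c + (ι a + - ι b) * - ι d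
        ≈⟨ sym (distribˡ _ _ _) ⟩
      (ι a + - ι b) * (ι c + - ι d) ≈⟨ sym (*-cong (⟪⟫-ι a b) (⟪⟫-ι c d)) ⟩
      ⟪ a , b ⟫ * ⟪ c , d ⟫ ∎
      where
      neg² : - ι b * - ι d ≈ ι b * ι d
      neg² = trans (sym (-‿distribˡ-* _ _)) (trans (-‿cong (sym (-‿distribʳ-* _ _))) (-‿involutive _))

    morphism : Coeff -Raw-AlmostCommutative⟶ fromCommutativeRing A
    morphism = record
      { ⟦_⟧ = ⟪_⟫
      ; +-homo = +-hom
      ; *-homo = *-hom
      ; -‿homo = λ (a , b) → trans (⟪⟫-ι b a) (trans (trans (+-comm _ _) (trans (+-congˡ (sym (-‿involutive _))) (⁻¹-∙-comm _ _))) (-‿cong (sym (⟪⟫-ι a b))))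
      ; 0-homo = refl
      ; 1-homo = refl
      }

    _≟_ : ∀ x y → Maybe (⟪ x ⟫ ≈ ⟪ y ⟫)
    (a , b) ≟ (c , d) with a ℕ.+ d ℕ.≟ c ℕ.+ b
    ... | no _ = nothing
    ... | yes e = just (begin
      ⟪ a , b ⟫ ≈⟨ ⟪⟫-ι a b ⟩
      ι a + - ι b ≈⟨ sym (trans (+-congˡ (-‿inverseʳ (ι d))) (+-identityʳ _)) ⟩
      (ι a + - ι b) + (ι d + - ι d) ≈⟨ interchange _ _ _ _ ⟩
      (ι a + ι d) + (- ι b + - ι d) ≈⟨ +-congʳ (trans (sym (ι-+ a d)) (trans (reflexive (≡.cong ι e)) (ι-+ c b))) ⟩
      (ι c + ι b) + (- ι b + - ι d) ≈⟨ +-congˡ (+-comm _ _) ⟩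
      (ι c + ι b) + (- ι d + - ι b) ≈⟨ interchange _ _ _ _ ⟩
      (ι c + - ι d) + (ι b + - ι b) ≈⟨ trans (+-congˡ (-‿inverseʳ (ι b))) (+-identityʳ _) ⟩
      ι c + - ι d ≈⟨ sym (⟪⟫-ι c d) ⟩
      ⟪ c , d ⟫ ∎)

    open Algebra.Solver.Ring Coeff (fromCommutativeRing A) morphism _≟_ public
      using (Polynomial; solve; _:=_; _:+_; _:*_; :-_; con)

  module Sums {c ℓ : Level} (A : CommutativeRing c ℓ) where
    open CommutativeRing A
    open RingKit A using (interchange)

    Σ≤ : ℕ → (ℕ → Carrier) → Carrier
    Σ≤ zero f = f 0
    Σ≤ (suc n) f = Σ≤ n f + f (suc n)

    Σ-cong≤ : ∀ n {f g : ℕ → Carrier} → (∀ i → i ℕ.≤ n → f i ≈ g i) → Σ≤ n f ≈ Σ≤ n g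
    Σ-cong≤ zero h = h 0 ℕ.z≤n
    Σ-cong≤ (suc n) h = +-cong (Σ-cong≤ n (λ i p → h i (ℕ.m≤n⇒m≤1+n p))) (h (suc n) ℕ.≤-refl)

    Σ-cong : ∀ n {f g : ℕ → Carrier} → (∀ i → f i ≈ g i) → Σ≤ n f ≈ Σ≤ n g
    Σ-cong n h = Σ-cong≤ n (λ i _ → h i)

    Σ-0 : ∀ n {f : ℕ → Carrier} → (∀ i → i ℕ.≤ n → f i ≈ 0#) → Σ≤ n f ≈ 0#
    Σ-0 zero h = h 0 ℕ.z≤n
    Σ-0 (suc n) h = trans (+-cong (Σ-0 n (λ i p → h i (ℕ.m≤n⇒m≤1+n p))) (h (suc n) ℕ.≤-refl)) (+-identityʳ 0#)

    Σ-+ : ∀ n (f g : ℕ → Carrier) → Σ≤ n (λ i → f i + g i) ≈ Σ≤ n f + Σ≤ n g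
    Σ-+ zero f g = refl
    Σ-+ (suc n) f g = trans (+-congʳ (Σ-+ n f g)) (interchange _ _ _ _)

    Σ-* : ∀ n c (f : ℕ → Carrier) → c * Σ≤ n f ≈ Σ≤ n (λ i → c * f i)
    Σ-* zero c f = refl
    Σ-* (suc n) c f = trans (distribˡ c _ _) (+-congʳ (Σ-* n c f))

    Σ-swap : ∀ m n (f : ℕ → ℕ → Carrier) → Σ≤ m (λ i → Σ≤ n (f i)) ≈ Σ≤ n (λ j → Σ≤ m (λ i → f i j))
    Σ-swap zero n f = refl
    Σ-swap (suc m) n f = trans (+-congʳ (Σ-swap m n f)) (sym (Σ-+ n _ _))

    Σ-suc : ∀ n (f : ℕ → Carrier) → Σ≤ (suc n) f ≈ f 0 + Σ≤ n (λ i → f (suc i))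
    Σ-suc zero f = refl
    Σ-suc (suc n) f = trans (+-congʳ (Σ-suc n f)) (+-assoc _ _ _)

    Σ-extend′ : ∀ {n N} → n ℕ.≤′ N → (f : ℕ → Carrier) → (∀ i → n ℕ.< i → f i ≈ 0#) → Σ≤ N f ≈ Σ≤ n f
    Σ-extend′ (ℕ.≤′-reflexive ≡.refl) f h = refl
    Σ-extend′ (ℕ.≤′-step {m} p) f h = trans (+-cong (Σ-extend′ p f h) (h (suc m) (ℕ.s≤s (ℕ.≤′⇒≤ p)))) (+-identityʳ _)

    Σ-extend : ∀ {n N} → n ℕ.≤ N → (f : ℕ → Carrier) → (∀ i → n ℕ.< i → f i ≈ 0#) → Σ≤ N f ≈ Σ≤ n f
    Σ-extend p = Σ-extend′ (ℕ.≤⇒≤′ p)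

  module PowerSeries {c ℓ : Level} (A : CommutativeRing c ℓ) where
    open CommutativeRing A
    open RingKit A
    open Sums A
    open Relation.Binary.Reasoning.Setoid setoid

    S : Set c
    S = ℕ → Carrier

    _≋_ : S → S → Set ℓ
    a ≋ b = ∀ n → a n ≈ b n

    tail : S → S
    tail a n = a (suc n)

    -- The Cauchy product is defined by recursion on its first factor, (a₀ + y a′) b = a₀ b + y (a′
    -- b), so that the ring laws go through by induction on the degree; `⊛-Σ` recovers the
    -- convolution sum.
    _⊕_ _⊛_ : S → S → S
    (a ⊕ b) n = a n + b n
    (a ⊛ b) zero = a 0 * b 0
    (a ⊛ b) (suc n) = a 0 * b (suc n) + (tail a ⊛ b) n

    ⊖_ : S → S
    (⊖ a) n = - a n

    𝟘 𝟙 : S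
    𝟘 _ = 0#
    𝟙 zero = 1#
    𝟙 (suc _) = 0#

    _•_ : Carrier → S → S
    (x • a) n = x * a n

    -- Needed where a substitution is truncated: inside a product the truncation only has to be
    -- right up to the degree that is read off.
    ⊛-cong≤ : ∀ n {a a′ b b′ : S} → (∀ m → m ℕ.≤ n → a m ≈ a′ m) → (∀ m → m ℕ.≤ n → b m ≈ b′ m) → (a ⊛ b) n ≈ (a′ ⊛ b′) n
    ⊛-cong≤ zero p q = *-cong (p 0 ℕ.z≤n) (q 0 ℕ.z≤n)
    ⊛-cong≤ (suc n) p q = +-cong (*-cong (p 0 ℕ.z≤n) (q (suc n) ℕ.≤-refl))
      (⊛-cong≤ n (λ m h → p (suc m) (ℕ.s≤s h)) (λ m h → q m (ℕ.m≤n⇒m≤1+n h)))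

    ⊛-cong : ∀ {a a′ b b′} → a ≋ a′ → b ≋ b′ → (a ⊛ b) ≋ (a′ ⊛ b′)
    ⊛-cong p q n = ⊛-cong≤ n (λ m _ → p m) (λ m _ → q m)

    -- Peeling the second factor instead of the first; with both forms at hand commutativity is a
    -- plain induction.
    ⊛-suc : ∀ a b n → (a ⊛ b) (suc n) ≈ a (suc n) * b 0 + (a ⊛ tail b) n
    ⊛-suc a b zero = +-comm _ _
    ⊛-suc a b (suc n) = begin
      a 0 * b (suc (suc n)) + (tail a ⊛ b) (suc n) ≈⟨ +-congˡ (⊛-suc (tail a) b n) ⟩
      a 0 * b (suc (suc n)) + (a (suc (suc n)) * b 0 + (tail a ⊛ tail b) n)
        ≈⟨ solve 3 (λ x y z → x :+ (y :+ z) := y :+ (x :+ z)) refl _ _ _ ⟩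
      a (suc (suc n)) * b 0 + (a 0 * b (suc (suc n)) + (tail a ⊛ tail b) n) ∎

    ⊛-comm : ∀ a b → (a ⊛ b) ≋ (b ⊛ a)
    ⊛-comm a b zero = *-comm _ _
    ⊛-comm a b (suc n) = trans (+-cong (*-comm _ _) (⊛-comm (tail a) b n)) (sym (⊛-suc b a n))

    ⊛-distribʳ : ∀ a b c → ((b ⊕ c) ⊛ a) ≋ ((b ⊛ a) ⊕ (c ⊛ a))
    ⊛-distribʳ a b c zero = distribʳ _ _ _
    ⊛-distribʳ a b c (suc n) = trans (+-cong (distribʳ _ _ _) (⊛-distribʳ a (tail b) (tail c) n)) (interchange _ _ _ _)

    ⊛-distribˡ : ∀ a b c → (a ⊛ (b ⊕ c)) ≋ ((a ⊛ b) ⊕ (a ⊛ c))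
    ⊛-distribˡ a b c n = trans (⊛-comm a (b ⊕ c) n) (trans (⊛-distribʳ a b c n) (+-cong (⊛-comm b a n) (⊛-comm c a n)))

    •-⊛ : ∀ x a b → ((x • a) ⊛ b) ≋ (x • (a ⊛ b))
    •-⊛ x a b zero = *-assoc _ _ _
    •-⊛ x a b (suc n) = trans (+-cong (*-assoc _ _ _) (•-⊛ x (tail a) b n)) (sym (distribˡ _ _ _))

    ⊛-assoc : ∀ a b c → ((a ⊛ b) ⊛ c) ≋ (a ⊛ (b ⊛ c))
    ⊛-assoc a b c zero = *-assoc _ _ _
    ⊛-assoc a b c (suc n) = begin
      (a 0 * b 0) * c (suc n) + (((a 0 • tail b) ⊕ (tail a ⊛ b)) ⊛ c) n
        ≈⟨ +-congˡ (⊛-distribʳ c (a 0 • tail b) (tail a ⊛ b) n) ⟩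
      (a 0 * b 0) * c (suc n) + (((a 0 • tail b) ⊛ c) n + ((tail a ⊛ b) ⊛ c) n)
        ≈⟨ +-congˡ (+-cong (•-⊛ (a 0) (tail b) c n) (⊛-assoc (tail a) b c n)) ⟩
      (a 0 * b 0) * c (suc n) + (a 0 * (tail b ⊛ c) n + (tail a ⊛ (b ⊛ c)) n)
        ≈⟨ solve 5 (λ x y z v w → (x :* y) :* z :+ (x :* v :+ w) := x :* (y :* z :+ v) :+ w) refl _ _ _ _ _ ⟩
      a 0 * (b 0 * c (suc n) + (tail b ⊛ c) n) + (tail a ⊛ (b ⊛ c)) n ∎

    𝟘-⊛ : ∀ a → (𝟘 ⊛ a) ≋ 𝟘
    𝟘-⊛ a zero = zeroˡ _
    𝟘-⊛ a (suc n) = trans (+-cong (zeroˡ _) (𝟘-⊛ a n)) (+-identityˡ _)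

    𝟙-⊛ : ∀ a → (𝟙 ⊛ a) ≋ a
    𝟙-⊛ a zero = *-identityˡ _
    𝟙-⊛ a (suc n) = trans (+-cong (*-identityˡ _) (𝟘-⊛ a n)) (+-identityʳ _)

    ring′ : CommutativeRing c ℓ
    ring′ = record
      { Carrier = S ; _≈_ = _≋_ ; _+_ = _⊕_ ; _*_ = _⊛_ ; -_ = ⊖_ ; 0# = 𝟘 ; 1# = 𝟙
      ; isCommutativeRing = record
        { isRing = record
          { +-isAbelianGroup = record
            { isGroup = record
              { isMonoid = record
                { isSemigroup = record
                  { isMagma = record
                    { isEquivalence = record { refl = λ _ → refl ; sym = λ p n → sym (p n) ; trans = λ p q n → trans (p n) (q n) }
                    ; ∙-cong = λ p q n → +-cong (p n) (q n) }
                  ; assoc = λ _ _ _ _ → +-assoc _ _ _ }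
                ; identity = (λ _ _ → +-identityˡ _) , (λ _ _ → +-identityʳ _) }
              ; inverse = (λ _ _ → -‿inverseˡ _) , (λ _ _ → -‿inverseʳ _)
              ; ⁻¹-cong = λ p n → -‿cong (p n) }
            ; comm = λ _ _ _ → +-comm _ _ }
          ; *-cong = ⊛-cong
          ; *-assoc = ⊛-assoc
          ; *-identity = 𝟙-⊛ , (λ a n → trans (⊛-comm a 𝟙 n) (𝟙-⊛ a n))
          ; distrib = ⊛-distribˡ , ⊛-distribʳ }
        ; *-comm = ⊛-comm } }

    ι-⊛ : ∀ m a → (RingKit.ι ring′ m ⊛ a) ≋ (ι m • a)
    ι-⊛ zero a n = trans (𝟘-⊛ a n) (sym (zeroˡ _))
    ι-⊛ (suc m) a n = begin
      ((𝟙 ⊕ RingKit.ι ring′ m) ⊛ a) n ≈⟨ ⊛-distribʳ a 𝟙 (RingKit.ι ring′ m) n ⟩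
      (𝟙 ⊛ a) n + (RingKit.ι ring′ m ⊛ a) n ≈⟨ +-cong (𝟙-⊛ a n) (ι-⊛ m a n) ⟩
      a n + ι m * a n ≈⟨ +-congʳ (sym (*-identityˡ _)) ⟩
      1# * a n + ι m * a n ≈⟨ sym (distribʳ _ _ _) ⟩
      (1# + ι m) * a n ∎

    𝕩 : S
    𝕩 1 = 1#
    𝕩 _ = 0#

    𝕩-⊛-suc : ∀ a n → (𝕩 ⊛ a) (suc n) ≈ a n
    𝕩-⊛-suc a n = trans (+-cong (zeroˡ _) (trans (⊛-cong {tail 𝕩} {𝟙} (λ { zero → refl ; (suc _) → refl }) (λ _ → refl) n) (𝟙-⊛ a n))) (+-identityˡ _)

    -- The Euler operator y d/dy. It keeps degrees, so its Leibniz rule is proved by induction, and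
    -- the rule for `∂` is the same identity read one degree higher.
    𝔼 : S → S
    𝔼 a n = ι n * a n

    𝔼-⊛ : ∀ a b → 𝔼 (a ⊛ b) ≋ ((𝔼 a ⊛ b) ⊕ (a ⊛ 𝔼 b))
    𝔼-⊛ a b zero = trans (zeroˡ _) (sym (trans (+-cong (trans (*-congʳ (zeroˡ _)) (zeroˡ _)) (trans (*-congˡ (zeroˡ _)) (zeroʳ _))) (+-identityˡ _)))
    𝔼-⊛ a b (suc n) = begin
      ι (suc n) * (a 0 * b (suc n) + (tail a ⊛ b) n) ≈⟨ distribˡ _ _ _ ⟩
      ι (suc n) * (a 0 * b (suc n)) + (1# + ι n) * (tail a ⊛ b) n
        ≈⟨ +-congˡ (trans (distribʳ _ _ _) (+-cong (*-identityˡ _) (𝔼-⊛ (tail a) b n))) ⟩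
      ι (suc n) * (a 0 * b (suc n)) + ((tail a ⊛ b) n + ((𝔼 (tail a) ⊛ b) n + (tail a ⊛ 𝔼 b) n))
        ≈⟨ solve 6 (λ i x y u v w → i :* (x :* y) :+ (u :+ (v :+ w)) := (con (0 , 0) :* x :* y :+ (u :+ v)) :+ (x :* (i :* y) :+ w)) refl _ _ _ _ _ _ ⟩
      (0# * a 0 * b (suc n) + ((tail a ⊛ b) n + (𝔼 (tail a) ⊛ b) n)) + (a 0 * (ι (suc n) * b (suc n)) + (tail a ⊛ 𝔼 b) n)
        ≈⟨ +-congʳ (+-congˡ (trans (sym (⊛-distribʳ b (tail a) (𝔼 (tail a)) n)) (⊛-cong tail𝔼 (λ _ → refl) n))) ⟩
      (0# * a 0 * b (suc n) + (tail (𝔼 a) ⊛ b) n) + (a 0 * (ι (suc n) * b (suc n)) + (tail a ⊛ 𝔼 b) n) ∎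
      where
      tail𝔼 : (tail a ⊕ 𝔼 (tail a)) ≋ tail (𝔼 a)
      tail𝔼 m = trans (+-congʳ (sym (*-identityˡ _))) (sym (distribʳ _ _ _))

    ∂ : S → S
    ∂ a n = ι (suc n) * a (suc n)

    ∂-⊛ : ∀ a b → ∂ (a ⊛ b) ≋ ((∂ a ⊛ b) ⊕ (a ⊛ ∂ b))
    ∂-⊛ a b n = begin
      𝔼 (a ⊛ b) (suc n) ≈⟨ 𝔼-⊛ a b (suc n) ⟩
      (𝔼 a ⊛ b) (suc n) + (a ⊛ 𝔼 b) (suc n) ≈⟨ +-congˡ (⊛-suc a (𝔼 b) n) ⟩
      (0# * a 0 * b (suc n) + (∂ a ⊛ b) n) + (a (suc n) * (0# * b 0) + (a ⊛ ∂ b) n)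
        ≈⟨ +-cong (trans (+-congʳ (trans (*-congʳ (zeroˡ _)) (zeroˡ _))) (+-identityˡ _))
                  (trans (+-congʳ (trans (*-congˡ (zeroˡ _)) (zeroʳ _))) (+-identityˡ _)) ⟩
      (∂ a ⊛ b) n + (a ⊛ ∂ b) n ∎

    ⊛-Σ : ∀ n a b → (a ⊛ b) n ≈ Σ≤ n (λ i → a i * b (n ℕ.∸ i))
    ⊛-Σ zero a b = refl
    ⊛-Σ (suc n) a b = trans (+-congˡ (⊛-Σ n (tail a) b)) (sym (Σ-suc n (λ i → a i * b (suc n ℕ.∸ i))))

    Σ-coeff : ∀ N (F : ℕ → S) n → Sums.Σ≤ ring′ N F n ≈ Σ≤ N (λ i → F i n)
    Σ-coeff zero F n = refl
    Σ-coeff (suc N) F n = +-congʳ (Σ-coeff N F n)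

    ⊛-• : ∀ x a b → (a ⊛ (x • b)) ≋ (x • (a ⊛ b))
    ⊛-• x a b n = trans (⊛-comm a (x • b) n) (trans (•-⊛ x b a n) (*-congˡ (⊛-comm b a n)))

    -- Turns multiplication by a quadratic polynomial in y, such as Δ, into a relation between three
    -- consecutive coefficients.
    quadratic-⊛ : ∀ f a → (∀ n → f (suc (suc (suc n))) ≈ 0#) → ∀ k →
      (f ⊛ a) (suc (suc k)) ≈ f 0 * a (suc (suc k)) + (f 1 * a (suc k) + f 2 * a k)
    quadratic-⊛ f a h k = +-congˡ (+-congˡ (only k))
      where
      only : ∀ k → (tail (tail f) ⊛ a) k ≈ f 2 * a k
      only zero = refl
      only (suc k) = trans (+-congˡ (trans (⊛-cong {b = a} h (λ _ → refl) k) (𝟘-⊛ a k))) (+-identityʳ _)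

    -- When the coefficients are themselves series in z and D is d/dz, this is d/dz acting on series
    -- in y.
    module Pointwise (D : Carrier → Carrier) (D-+ : ∀ x y → D (x + y) ≈ D x + D y)
      (D-* : ∀ x y → D (x * y) ≈ D x * y + x * D y) where

      D̂ : S → S
      D̂ a n = D (a n)

      D̂-⊛ : ∀ a b → D̂ (a ⊛ b) ≋ ((D̂ a ⊛ b) ⊕ (a ⊛ D̂ b))
      D̂-⊛ a b zero = D-* _ _
      D̂-⊛ a b (suc n) = trans (D-+ _ _) (trans (+-cong (D-* _ _) (D̂-⊛ (tail a) b n)) (interchange _ _ _ _))

-- Rational numbers as quotients of natural numbers

module RationalNumbers where

  open import Defs using (_÷_; ℕtoℚ)
  open PowerSeriesRings
  open import Data.Nat.Base as ℕ using (ℕ; zero; suc)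
  import Data.Nat.Properties as ℕ
  open import Data.Integer.Base as ℤ using (+_)
  import Data.Integer.Properties as ℤ
  open import Data.Integer.Tactic.RingSolver using (solve-∀)
  open import Data.Rational as ℚ using (ℚ; 1ℚ; _+_; _*_; fromℚᵘ)
  import Data.Rational.Properties as ℚ
  open import Data.Rational.Unnormalised as ℚᵘ using (ℚᵘ; mkℚᵘ; *≡*)
  import Data.Rational.Unnormalised.Properties as ℚᵘ
  open import Relation.Binary.PropositionalEquality
  open import Relation.Nullary using (contradiction)
  open ≡-Reasoning

  module Q = RingKit ℚ.+-*-commutativeRing
  open Q using (ι; ι-+; ι-*) public

  -- Rational addition normalises its result, so the identity is obtained from unnormalised
  -- fractions, where equality is cross-multiplication.
  fromℚᵘ-+ : ∀ x y → fromℚᵘ (x ℚᵘ.+ y) ≡ fromℚᵘ x + fromℚᵘ y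
  fromℚᵘ-+ x y = trans (ℚ.fromℚᵘ-cong (ℚᵘ.≃-trans
      (ℚᵘ.+-cong (ℚᵘ.≃-sym (ℚ.toℚᵘ-fromℚᵘ x)) (ℚᵘ.≃-sym (ℚ.toℚᵘ-fromℚᵘ y)))
      (ℚᵘ.≃-sym (ℚ.toℚᵘ-homo-+ (fromℚᵘ x) (fromℚᵘ y)))))
    (ℚ.fromℚᵘ-toℚᵘ _)

  fromℚᵘ-* : ∀ x y → fromℚᵘ (x ℚᵘ.* y) ≡ fromℚᵘ x * fromℚᵘ y
  fromℚᵘ-* x y = trans (ℚ.fromℚᵘ-cong (ℚᵘ.≃-trans
      (ℚᵘ.*-cong (ℚᵘ.≃-sym (ℚ.toℚᵘ-fromℚᵘ x)) (ℚᵘ.≃-sym (ℚ.toℚᵘ-fromℚᵘ y)))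
      (ℚᵘ.≃-sym (ℚ.toℚᵘ-homo-* (fromℚᵘ x) (fromℚᵘ y)))))
    (ℚ.fromℚᵘ-toℚᵘ _)

  ℕtoℚ≡ι : ∀ n → ℕtoℚ n ≡ ι n
  ℕtoℚ≡ι zero = refl
  ℕtoℚ≡ι (suc n) = begin
    fromℚᵘ (mkℚᵘ (+ suc n) 0) ≡⟨ ℚ.fromℚᵘ-cong {mkℚᵘ (+ suc n) 0} {mkℚᵘ (+ 1) 0 ℚᵘ.+ mkℚᵘ (+ n) 0} (*≡* (lem (+ n))) ⟩
    fromℚᵘ (mkℚᵘ (+ 1) 0 ℚᵘ.+ mkℚᵘ (+ n) 0) ≡⟨ fromℚᵘ-+ (mkℚᵘ (+ 1) 0) (mkℚᵘ (+ n) 0) ⟩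
    1ℚ + ℕtoℚ n ≡⟨ cong (λ z → 1ℚ + z) (ℕtoℚ≡ι n) ⟩
    1ℚ + ι n ∎
    where
    lem : ∀ x → (+ 1 ℤ.+ x) ℤ.* (+ 1) ≡ (+ 1 ℤ.* + 1 ℤ.+ x ℤ.* + 1) ℤ.* + 1
    lem = solve-∀

  ÷-* : ∀ a b → (a ÷ suc b) * ι (suc b) ≡ ι a
  ÷-* a b = begin
    (a ÷ suc b) * ι (suc b) ≡⟨ cong ((a ÷ suc b) *_) (sym (ℕtoℚ≡ι (suc b))) ⟩
    fromℚᵘ (mkℚᵘ (+ a) b) * fromℚᵘ (mkℚᵘ (+ suc b) 0) ≡⟨ sym (fromℚᵘ-* (mkℚᵘ (+ a) b) (mkℚᵘ (+ suc b) 0)) ⟩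
    fromℚᵘ (mkℚᵘ (+ a) b ℚᵘ.* mkℚᵘ (+ suc b) 0) ≡⟨ ℚ.fromℚᵘ-cong {mkℚᵘ (+ a) b ℚᵘ.* mkℚᵘ (+ suc b) 0} {mkℚᵘ (+ a) 0}
        (*≡* (trans (ℤ.*-identityʳ (+ a ℤ.* + suc b)) (cong (λ z → + a ℤ.* + z) (sym (ℕ.*-identityʳ (suc b)))))) ⟩
    ℕtoℚ a ≡⟨ ℕtoℚ≡ι a ⟩
    ι a ∎

  ι-cancel : ∀ b {x y} → ι (suc b) * x ≡ ι (suc b) * y → x ≡ y
  ι-cancel b {x} {y} e = begin
    x ≡⟨ lem x ⟩
    (1 ÷ suc b) * (ι (suc b) * x) ≡⟨ cong ((1 ÷ suc b) *_) e ⟩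
    (1 ÷ suc b) * (ι (suc b) * y) ≡⟨ sym (lem y) ⟩
    y ∎
    where
    lem : ∀ z → z ≡ (1 ÷ suc b) * (ι (suc b) * z)
    lem z = begin
      z ≡⟨ sym (ℚ.*-identityˡ z) ⟩
      1ℚ * z ≡⟨ cong (_* z) (sym (÷-* 1 b)) ⟩
      ((1 ÷ suc b) * ι (suc b)) * z ≡⟨ ℚ.*-assoc (1 ÷ suc b) (ι (suc b)) z ⟩
      (1 ÷ suc b) * (ι (suc b) * z) ∎

  -- Lets quotients of factorials be recognised as integers without reducing any fraction.
  ÷-unique : ∀ a b {x} → b ≢ 0 → ι b * x ≡ ι a → a ÷ b ≡ x
  ÷-unique a zero h _ = contradiction refl h
  ÷-unique a (suc b) _ e = ι-cancel b (trans (trans (ℚ.*-comm (ι (suc b)) (a ÷ suc b)) (÷-* a b)) (sym e))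

  *-÷ : ∀ a b → b ≢ 0 → ι b * (a ÷ b) ≡ ι a
  *-÷ a zero h = contradiction refl h
  *-÷ a (suc b) h = trans (ℚ.*-comm (ι (suc b)) (a ÷ suc b)) (÷-* a b)

-- Series in z and u, and substitution into bivariate series

module BivariateSeries where

  open PowerSeriesRings
  open import Algebra.Bundles using (CommutativeRing)
  open import Level using (Level)
  open import Data.Nat.Base as ℕ using (ℕ; zero; suc)
  import Data.Nat.Properties as ℕ
  open import Data.Sum using (_⊎_; inj₁; inj₂)
  open import Relation.Nullary using (yes; no)
  import Relation.Binary.PropositionalEquality as ≡
  import Relation.Binary.Reasoning.Setoid

  module Series {c ℓ : Level} (A : CommutativeRing c ℓ) where
    open CommutativeRing A hiding (zero)
    module K = RingKit A
    open K using (ι)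
    open Sums A
    module U = PowerSeries A
    module Z = PowerSeries U.ring′
    T : CommutativeRing c ℓ
    T = Z.ring′
    module T = CommutativeRing T
    module KT = RingKit T
    module ΣT = Sums T
    open Relation.Binary.Reasoning.Setoid setoid

    Ser : Set c
    Ser = ℕ → ℕ → Carrier

    -- The common core of all the arguments by valuation or weight below: they only have to say
    -- which factor of each term is zero.
    vanish : ∀ (X Y : Ser) n k → (∀ i j → i ℕ.≤ n → j ℕ.≤ k → X i j ≈ 0# ⊎ Y (n ℕ.∸ i) (k ℕ.∸ j) ≈ 0#) → (X T.* Y) n k ≈ 0#
    vanish X Y n k h = trans (Z.⊛-Σ n X Y k) (trans (U.Σ-coeff n (λ i → X i U.⊛ Y (n ℕ.∸ i)) k)
      (Σ-0 n (λ i p → trans (U.⊛-Σ k (X i) (Y (n ℕ.∸ i))) (Σ-0 k (λ j q → zero? (h i j p q))))))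
      where
      zero? : ∀ {x y} → x ≈ 0# ⊎ y ≈ 0# → x * y ≈ 0#
      zero? (inj₁ e) = trans (*-congʳ e) (zeroˡ _)
      zero? (inj₂ e) = trans (*-congˡ e) (zeroʳ _)

    *-ΣΣ : ∀ (X Y : Ser) n k → (X T.* Y) n k ≈ Σ≤ n (λ i → Σ≤ k (λ j → X i j * Y (n ℕ.∸ i) (k ℕ.∸ j)))
    *-ΣΣ X Y n k = trans (Z.⊛-Σ n X Y k) (trans (U.Σ-coeff n (λ i → X i U.⊛ Y (n ℕ.∸ i)) k)
      (Σ-cong n (λ i → U.⊛-Σ k (X i) (Y (n ℕ.∸ i)))))

    κ : Carrier → Ser
    κ x zero zero = x
    κ x _ _ = 0#

    κ-* : ∀ x (Y : Ser) n k → (κ x T.* Y) n k ≈ x * Y n k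
    κ-* x Y n k = trans (*-ΣΣ (κ x) Y n k) (trans (only n (λ i → Σ≤ k (λ j → κ x i j * Y (n ℕ.∸ i) (k ℕ.∸ j)))
        (λ i → Σ-0 k (λ j _ → zeroˡ _)))
      (only k (λ j → κ x 0 j * Y n (k ℕ.∸ j)) (λ j → zeroˡ _)))
      where
      only : ∀ n (f : ℕ → Carrier) → (∀ i → f (suc i) ≈ 0#) → Σ≤ n f ≈ f 0
      only zero f h = refl
      only (suc n) f h = trans (Σ-suc n f) (trans (+-congˡ (Σ-0 n (λ i _ → h i))) (+-identityʳ _))

    𝕦 𝕫 : Ser
    𝕦 zero 1 = 1#
    𝕦 _ _ = 0#
    𝕫 1 zero = 1#
    𝕫 _ _ = 0#

    𝕦-* : ∀ (Y : Ser) n → ((𝕦 T.* Y) n zero ≈ 0#) 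
    𝕦-* Y n = vanish 𝕦 Y n 0 λ { zero .0 p ℕ.z≤n → inj₁ refl ; (suc i) j p q → inj₁ refl }

    𝕦-*-suc : ∀ (Y : Ser) n k → (𝕦 T.* Y) n (suc k) ≈ Y n k
    𝕦-*-suc Y zero k = trans (U.⊛-cong {𝕦 0} {U.𝕩} (λ { zero → refl ; 1 → refl ; (suc (suc _)) → refl }) (λ _ → refl) (suc k)) (U.𝕩-⊛-suc (Y 0) k)
    𝕦-*-suc Y (suc n) k = trans (+-cong (trans (U.⊛-cong {𝕦 0} {U.𝕩} (λ { zero → refl ; 1 → refl ; (suc (suc _)) → refl }) (λ _ → refl) (suc k)) (U.𝕩-⊛-suc (Y (suc n)) k))
        (vanish (λ n → 𝕦 (suc n)) Y n (suc k) (λ i j _ _ → inj₁ refl))) (+-identityʳ _)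

    ∂ : Ser → Ser
    ∂ = Z.∂

    ∂-coeff : ∀ X n k → ∂ X n k ≈ ι (suc n) * X (suc n) k
    ∂-coeff X n k = U.ι-⊛ (suc n) (X (suc n)) k

    ∂-cong : ∀ {X Y} → X T.≈ Y → ∂ X T.≈ ∂ Y
    ∂-cong {X} {Y} e n k = trans (∂-coeff X n k) (trans (*-congˡ (e (suc n) k)) (sym (∂-coeff Y n k)))

    ∂-+ : ∀ X Y → ∂ (X T.+ Y) T.≈ ∂ X T.+ ∂ Y
    ∂-+ X Y n k = trans (∂-coeff (X T.+ Y) n k) (trans (distribˡ _ _ _) (sym (+-cong (∂-coeff X n k) (∂-coeff Y n k))))

    ∂-const : ∀ X → (∀ n k → X (suc n) k ≈ 0#) → ∂ X T.≈ T.0#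
    ∂-const X h n k = trans (∂-coeff X n k) (trans (*-congˡ (h n k)) (zeroʳ _))

    pow : Ser → ℕ → Ser
    pow X zero = T.1#
    pow X (suc i) = X T.* pow X i

    monomial : Ser → Ser → ℕ → ℕ → Ser
    monomial R S i j = pow R i T.* pow S j

    -- Each coefficient is a finite sum whatever R and S are, so the expression also makes sense for
    -- iterates; it is the true substitution when R and S have no constant term in z.
    subst : Ser → Ser → (ℕ → ℕ → Carrier) → Ser
    subst R S c n k = Σ≤ n (λ i → Σ≤ (n ℕ.∸ i) (λ j → c i j * monomial R S i j n k))

    module Substitution (R S : Ser) (R0 : ∀ k → R 0 k ≈ 0#) (S0 : ∀ k → S 0 k ≈ 0#) where

      pw : ℕ → ℕ → Ser
      pw = monomial R S

      ev : (ℕ → ℕ → Carrier) → Ser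
      ev = subst R S

      split : ∀ n a b i → i ℕ.≤ n → n ℕ.< a ℕ.+ b → (i ℕ.< a) ⊎ (n ℕ.∸ i ℕ.< b)
      split n a b i i≤n h with i ℕ.<? a
      ... | yes p = inj₁ p
      ... | no q = inj₂ (ℕ.+-cancelˡ-< a (n ℕ.∸ i) b (ℕ.≤-<-trans (ℕ.+-monoˡ-≤ (n ℕ.∸ i) (ℕ.≮⇒≥ q)) (≡.subst (ℕ._< a ℕ.+ b) (≡.sym (ℕ.m+[n∸m]≡n i≤n)) h)))

      vanish-val : ∀ (X Y : Ser) a b → (∀ n k → n ℕ.< a → X n k ≈ 0#) → (∀ n k → n ℕ.< b → Y n k ≈ 0#) →
        ∀ n k → n ℕ.< a ℕ.+ b → (X T.* Y) n k ≈ 0#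
      vanish-val X Y a b p q n k h = vanish X Y n k λ i j i≤n _ → [p,q] (split n a b i i≤n h)
        where
        [p,q] : ∀ {i j l} → i ℕ.< a ⊎ l ℕ.< b → X i j ≈ 0# ⊎ Y l (k ℕ.∸ j) ≈ 0#
        [p,q] (inj₁ x) = inj₁ (p _ _ x)
        [p,q] (inj₂ y) = inj₂ (q _ _ y)

      pow-val : ∀ X → (∀ k → X 0 k ≈ 0#) → ∀ i n k → n ℕ.< i → pow X i n k ≈ 0#
      pow-val X X0 zero n k ()
      pow-val X X0 (suc i) = vanish-val X (pow X i) 1 i (λ { zero k _ → X0 k ; (suc n) k (ℕ.s≤s ()) }) (pow-val X X0 i)

      pw-val : ∀ i j n k → n ℕ.< i ℕ.+ j → pw i j n k ≈ 0#
      pw-val i j = vanish-val (pow R i) (pow S j) i j (pow-val R R0 i) (pow-val S S0 j)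

      EX : ℕ → ℕ → (ℕ → ℕ → Carrier) → (ℕ → ℕ → Ser) → Ser
      EX I J c F n k = Σ≤ I (λ i → Σ≤ J (λ j → c i j * F i j n k))

      -- The triangle i + j ≤ n may be enlarged to any rectangle containing it, because R^i S^j has
      -- z-order at least i + j. Over a rectangle the bounds of the two sums are independent, so
      -- shifts of i or j are easy to perform.
      ev-rect : ∀ c {I J} n k → n ℕ.≤ I → n ℕ.≤ J → ev c n k ≈ EX I J c pw n k
      ev-rect c {I} {J} n k p q = sym (trans (Σ-cong I (λ i → Σ-extend (ℕ.≤-trans (ℕ.m∸n≤m n i) q) (λ j → c i j * pw i j n k)
            (λ j h → trans (*-congˡ (pw-val i j n k (≡.subst (ℕ._≤ i ℕ.+ j) (ℕ.+-comm n 1) (lem i j h)))) (zeroʳ _))))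
          (Σ-extend p (λ i → Σ≤ (n ℕ.∸ i) (λ j → c i j * pw i j n k))
            (λ i h → Σ-0 (n ℕ.∸ i) (λ j _ → trans (*-congˡ (pw-val i j n k (ℕ.≤-trans h (ℕ.m≤m+n i j)))) (zeroʳ _)))))
        where
        lem : ∀ i j → n ℕ.∸ i ℕ.< j → n ℕ.+ 1 ℕ.≤ i ℕ.+ j
        lem i j h = ℕ.≤-trans (ℕ.+-monoˡ-≤ 1 (ℕ.m≤n+m∸n n i)) (≡.subst (ℕ._≤ i ℕ.+ j) (≡.trans (ℕ.+-suc i (n ℕ.∸ i)) (≡.sym (ℕ.+-comm (i ℕ.+ (n ℕ.∸ i)) 1))) (ℕ.+-monoʳ-≤ i h))

      EX-T : ∀ I J c F → EX I J c F T.≈ ΣT.Σ≤ I (λ i → ΣT.Σ≤ J (λ j → κ (c i j) T.* F i j))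
      EX-T I J c F n k = sym (trans (Z.Σ-coeff I _ n k) (trans (U.Σ-coeff I _ k) (Σ-cong I (λ i →
        trans (Z.Σ-coeff J _ n k) (trans (U.Σ-coeff J _ k) (Σ-cong J (λ j → κ-* (c i j) (F i j) n k)))))))

      EX-* : ∀ X I J c F → X T.* EX I J c F T.≈ EX I J c (λ i j → X T.* F i j)
      EX-* X I J c F = T.trans (T.*-congˡ {X} (EX-T I J c F)) (T.trans (ΣT.Σ-* I X _)
        (T.trans (ΣT.Σ-cong I (λ i → T.trans (ΣT.Σ-* J X _) (ΣT.Σ-cong J (λ j →
          KT.solve 3 (λ x y z → x KT.:* (y KT.:* z) KT.:= y KT.:* (x KT.:* z)) T.refl X (κ (c i j)) (F i j)))))
        (T.sym (EX-T I J c (λ i j → X T.* F i j)))))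

      EX-cong : ∀ I J {c c′ F F′} → (∀ i j → c i j ≈ c′ i j) → (∀ i j → F i j T.≈ F′ i j) → EX I J c F T.≈ EX I J c′ F′
      EX-cong I J p q n k = Σ-cong I (λ i → Σ-cong J (λ j → *-cong (p i j) (q i j n k)))

      *-ev : ∀ X c {I J} n k → n ℕ.≤ I → n ℕ.≤ J → (X T.* ev c) n k ≈ EX I J c (λ i j → X T.* pw i j) n k
      *-ev X c {I} {J} n k p q = trans (Z.⊛-cong≤ n (λ _ _ _ → refl) (λ m h l → ev-rect c m l (ℕ.≤-trans h p) (ℕ.≤-trans h q)) k)
        (EX-* X I J c pw n k)

      shX shY : (ℕ → ℕ → Carrier) → ℕ → ℕ → Carrier
      shX c zero j = 0#
      shX c (suc i) j = c i j
      shY c i zero = 0#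
      shY c i (suc j) = c i j

      ev-cong : ∀ {c c′} → (∀ i j → c i j ≈ c′ i j) → ev c T.≈ ev c′
      ev-cong h n k = Σ-cong n (λ i → Σ-cong (n ℕ.∸ i) (λ j → *-congʳ (h i j)))

      ev-+ : ∀ c c′ → ev (λ i j → c i j + c′ i j) T.≈ ev c T.+ ev c′
      ev-+ c c′ n k = trans (Σ-cong n (λ i → trans (Σ-cong (n ℕ.∸ i) (λ j → distribʳ _ _ _)) (Σ-+ (n ℕ.∸ i) _ _))) (Σ-+ n _ _)

      ev-κ : ∀ x c → ev (λ i j → x * c i j) T.≈ κ x T.* ev c
      ev-κ x c n k = sym (trans (κ-* x (ev c) n k) (trans (Σ-* n x _) (Σ-cong n (λ i → trans (Σ-* (n ℕ.∸ i) x _)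
        (Σ-cong (n ℕ.∸ i) (λ j → sym (*-assoc _ _ _)))))))

      ev-R : ∀ c → R T.* ev c T.≈ ev (shX c)
      ev-R c n k = trans (*-ev R c n k (ℕ.≤-refl {n}) (ℕ.≤-refl {n})) (trans
        (EX-cong n n {F′ = λ i j → pw (suc i) j} (λ _ _ → refl) (λ i j → T.sym (T.*-assoc R (pow R i) (pow S j))) n k)
        (sym (trans (ev-rect (shX c) n k (ℕ.n≤1+n n) ℕ.≤-refl) (trans (Σ-suc n _) (trans (+-congʳ (Σ-0 n (λ _ _ → zeroˡ _))) (+-identityˡ _))))))

      ev-S : ∀ c → S T.* ev c T.≈ ev (shY c)
      ev-S c n k = trans (*-ev S c n k (ℕ.≤-refl {n}) (ℕ.≤-refl {n})) (trans
        (EX-cong n n {F′ = λ i j → pw i (suc j)} (λ _ _ → refl)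
          (λ i j → KT.solve 3 (λ x y z → x KT.:* (y KT.:* z) KT.:= y KT.:* (x KT.:* z)) T.refl S (pow R i) (pow S j)) n k)
        (sym (trans (ev-rect (shY c) n k ℕ.≤-refl (ℕ.n≤1+n n)) (Σ-cong n (λ i → trans (Σ-suc n _) (trans (+-congʳ (zeroˡ _)) (+-identityˡ _)))))))

      ev-1 : ∀ c → (∀ i j → (i ≡.≢ 0) ⊎ (j ≡.≢ 0) → c i j ≈ 0#) → c 0 0 ≈ 1# → ev c T.≈ T.1#
      ev-1 c h h0 n k = trans (trans (only n _ (λ i → Σ-0 (n ℕ.∸ suc i) (λ j _ → trans (*-congʳ (h (suc i) j (inj₁ λ ()))) (zeroˡ _))))
          (only n _ (λ j → trans (*-congʳ (h 0 (suc j) (inj₂ λ ()))) (zeroˡ _))))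
        (trans (*-congʳ h0) (trans (*-identityˡ _) (T.*-identityˡ T.1# n k)))
        where
        only : ∀ n (f : ℕ → Carrier) → (∀ i → f (suc i) ≈ 0#) → Σ≤ n f ≈ f 0
        only zero f h = refl
        only (suc n) f h = trans (Σ-suc n f) (trans (+-congˡ (Σ-0 n (λ i _ → h i))) (+-identityʳ _))

      ι-κ : ∀ n → KT.ι n T.≈ κ (ι n)
      ι-κ n i k = trans (trans (sym (T.*-identityʳ (KT.ι n) i k)) (trans (Z.ι-⊛ n T.1# i k) (U.ι-⊛ n (T.1# i) k))) (lem i k)
        where
        lem : ∀ i k → ι n * T.1# i k ≈ κ (ι n) i k
        lem zero zero = *-identityʳ _
        lem zero (suc k) = zeroʳ _
        lem (suc i) k = zeroʳ _

      ∂-pow : ∀ X i → ∂ (pow X (suc i)) T.≈ KT.ι (suc i) T.* (∂ X T.* pow X i)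
      ∂-pow X zero = T.trans (∂-cong (T.*-identityʳ X)) (T.sym (T.trans (T.*-congʳ (T.+-identityʳ T.1#)) (T.trans (T.*-identityˡ _) (T.*-identityʳ _))))
      ∂-pow X (suc i) = T.trans (Z.∂-⊛ X (pow X (suc i))) (T.trans (T.+-congˡ {∂ X T.* pow X (suc i)} (T.*-congˡ {X} (∂-pow X i)))
        (T.trans (KT.solve 4 (λ d x p n → d KT.:* (x KT.:* p) KT.:+ x KT.:* (n KT.:* (d KT.:* p)) KT.:= d KT.:* (x KT.:* p) KT.:+ n KT.:* (d KT.:* (x KT.:* p)))
          T.refl (∂ X) X (pow X i) (KT.ι (suc i)))
        (T.sym (T.trans (T.distribʳ _ T.1# (KT.ι (suc i))) (T.+-congʳ (T.*-identityˡ _))))))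

      ∂x ∂y : (ℕ → ℕ → Carrier) → ℕ → ℕ → Carrier
      ∂x c i j = ι (suc i) * c (suc i) j
      ∂y c i j = ι (suc j) * c i (suc j)

      KT-ι-* : ∀ m (Y : Ser) n k → (KT.ι m T.* Y) n k ≈ ι m * Y n k
      KT-ι-* m Y n k = trans (Z.ι-⊛ m Y n k) (U.ι-⊛ m (Y n) k)

      dR dS : ℕ → ℕ → Ser
      dR zero j = T.0#
      dR (suc i) j = KT.ι (suc i) T.* (∂ R T.* pw i j)
      dS i zero = T.0#
      dS i (suc j) = KT.ι (suc j) T.* (∂ S T.* pw i j)

      ∂-pow-0 : ∀ X → ∂ (pow X 0) T.≈ T.0#
      ∂-pow-0 X = ∂-const T.1# (λ _ _ → refl)

      ∂-pw : ∀ i j → ∂ (pw i j) T.≈ dR i j T.+ dS i j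
      ∂-pw i j = T.trans (Z.∂-⊛ (pow R i) (pow S j)) (T.+-cong (left i) (right j))
        where
        left : ∀ i → ∂ (pow R i) T.* pow S j T.≈ dR i j
        left zero = T.trans (T.*-congʳ {pow S j} (∂-pow-0 R)) (T.zeroˡ (pow S j))
        left (suc i) = T.trans (T.*-congʳ {pow S j} (∂-pow R i))
          (KT.solve 4 (λ n d x y → (n KT.:* (d KT.:* x)) KT.:* y KT.:= n KT.:* (d KT.:* (x KT.:* y))) T.refl (KT.ι (suc i)) (∂ R) (pow R i) (pow S j))
        right : ∀ j → pow R i T.* ∂ (pow S j) T.≈ dS i j
        right zero = T.trans (T.*-congˡ {pow R i} (∂-pow-0 S)) (T.zeroʳ (pow R i))
        right (suc j) = T.trans (T.*-congˡ {pow R i} (∂-pow S j))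
          (KT.solve 4 (λ n d x y → x KT.:* (n KT.:* (d KT.:* y)) KT.:= n KT.:* (d KT.:* (x KT.:* y))) T.refl (KT.ι (suc j)) (∂ S) (pow R i) (pow S j))

      -- The chain rule; ∂R and ∂S can be pulled out because each term of the finite sum satisfies
      -- the Leibniz rule `∂-pw`.
      ∂-ev : ∀ c → ∂ (ev c) T.≈ ∂ R T.* ev (∂x c) T.+ ∂ S T.* ev (∂y c)
      ∂-ev c n k = begin
        ∂ (ev c) n k ≈⟨ ∂-coeff (ev c) n k ⟩
        -- The coefficient of z^n of a derivative comes from z^(n+1), hence the rectangle of side n
        -- + 1; one index is lost again when the terms with i = 0 or j = 0 drop out.
        ι (suc n) * ev c (suc n) k ≈⟨ *-congˡ (ev-rect c (suc n) k ℕ.≤-refl ℕ.≤-refl) ⟩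
        ι (suc n) * EX (suc n) (suc n) c pw (suc n) k
          ≈⟨ trans (Σ-* (suc n) _ _) (Σ-cong (suc n) (λ i → trans (Σ-* (suc n) _ _) (Σ-cong (suc n) (λ j → term i j)))) ⟩
        Σ≤ (suc n) (λ i → Σ≤ (suc n) (λ j → c i j * dR i j n k + c i j * dS i j n k))
          ≈⟨ trans (Σ-cong (suc n) (λ i → Σ-+ (suc n) _ _)) (Σ-+ (suc n) _ _) ⟩
        EX (suc n) (suc n) c dR n k + EX (suc n) (suc n) c dS n k
          ≈⟨ +-cong partR partS ⟩
        (∂ R T.* ev (∂x c)) n k + (∂ S T.* ev (∂y c)) n k ∎
        where
        swap : ∀ x y z → x * (y * z) ≈ y * (x * z)
        swap = K.solve 3 (λ x y z → x K.:* (y K.:* z) K.:= y K.:* (x K.:* z)) refl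
        swap′ : ∀ x y z → x * (y * z) ≈ (y * x) * z
        swap′ = K.solve 3 (λ x y z → x K.:* (y K.:* z) K.:= (y K.:* x) K.:* z) refl
        term : ∀ i j → ι (suc n) * (c i j * pw i j (suc n) k) ≈ c i j * dR i j n k + c i j * dS i j n k
        term i j = trans (swap _ _ _) (trans (*-congˡ (trans (sym (∂-coeff (pw i j) n k)) (∂-pw i j n k))) (distribˡ _ _ _))
        partR : EX (suc n) (suc n) c dR n k ≈ (∂ R T.* ev (∂x c)) n k
        partR = trans (trans (Σ-suc n _) (trans (+-congʳ (Σ-0 (suc n) (λ j _ → zeroʳ _))) (+-identityˡ _)))
          (trans (Σ-cong n (λ i → Σ-cong (suc n) (λ j → trans (*-congˡ (KT-ι-* (suc i) (∂ R T.* pw i j) n k)) (swap′ _ _ _))))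
            (sym (*-ev (∂ R) (∂x c) n k (ℕ.≤-refl {n}) (ℕ.n≤1+n n))))
        partS : EX (suc n) (suc n) c dS n k ≈ (∂ S T.* ev (∂y c)) n k
        partS = trans (Σ-cong (suc n) (λ i → trans (Σ-suc n _) (trans (+-congʳ (zeroʳ _)) (+-identityˡ _))))
          (trans (Σ-cong (suc n) (λ i → Σ-cong n (λ j → trans (*-congˡ (KT-ι-* (suc j) (∂ S T.* pw i j) n k)) (swap′ _ _ _))))
            (sym (*-ev (∂ S) (∂y c) n k (ℕ.n≤1+n n) (ℕ.≤-refl {n}))))

-- The explicit solution of the equation for the M_k

module TutteEquation where

  open PowerSeriesRings
  open BivariateSeries
  open import Algebra.Bundles using (CommutativeRing)
  open import Level using (Level; _⊔_)
  open import Data.Nat.Base as ℕ using (ℕ; zero; suc)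
  import Data.Nat.Properties as ℕ
  open import Data.Nat.Tactic.RingSolver using (solve-∀)
  open import Data.Sum using (_⊎_; inj₁; inj₂)
  open import Data.Product using (_×_; _,_; proj₁; proj₂)
  open import Relation.Nullary using (contradiction)
  import Relation.Binary.PropositionalEquality as ≡
  import Relation.Binary.Reasoning.Setoid

  -- Trinomial coefficients, given by the ratios of neighbouring ones. Together with division by
  -- positive integers this is all that the identities below use; Pascal's rule follows from it.
  record Trinomials {c ℓ : Level} (A : CommutativeRing c ℓ) : Set (c ⊔ ℓ) where
    open CommutativeRing A
    open RingKit A using (ι)
    field
      inv : ℕ → Carrier
      ι-inv : ∀ n → ι (suc n) * inv n ≈ 1#
      m : ℕ → ℕ → ℕ → Carrier
      m-000 : m 0 0 0 ≈ 1#
      m-a : ∀ a b c → ι (suc a) * m (suc a) b c ≈ ι (suc (a ℕ.+ b ℕ.+ c)) * m a b c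
      m-b : ∀ a b c → ι (suc b) * m a (suc b) c ≈ ι (suc (a ℕ.+ b ℕ.+ c)) * m a b c
      m-c : ∀ a b c → ι (suc c) * m a b (suc c) ≈ ι (suc (a ℕ.+ b ℕ.+ c)) * m a b c

  module RingIdentities {c ℓ : Level} (A : CommutativeRing c ℓ) where
    open CommutativeRing A hiding (zero)
    open RingKit A
    open Relation.Binary.Reasoning.Setoid setoid

    -- The discriminant S² - 4R, which is the coefficient of y² in Δ.
    disc : Carrier → Carrier → Carrier
    disc R S = S * S + - ((R + R) + (R + R))

    -- Cayley-Hamilton for the matrix with rows (S, 2R) and (2, S), of trace 2S and determinant S² -
    -- 4R: it eliminates Y. In the application X and Y are `B` and `A₁` of the weight `ν τ`, X₂ and
    -- Y₂ those of `N₁ τ`, and b is `B τ`.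
    three-term : ∀ {R S X Y X₂ Y₂ b} → X₂ ≈ (S * X + (R * Y + R * Y)) + b → Y₂ ≈ (X + X) + S * Y →
      S * X₂ + (R * Y₂ + R * Y₂) ≈ S * (X₂ + X₂) + (- (S * b) + - (disc R S * X))
    three-term {R} {S} {X} {Y} {X₂} {Y₂} {b} p q = begin
      S * X₂ + (R * Y₂ + R * Y₂) ≈⟨ +-cong (*-congˡ p) (+-cong (*-congˡ q) (*-congˡ q)) ⟩
      _ ≈⟨ solve 5 (λ R S X Y b → S :* ((S :* X :+ (R :* Y :+ R :* Y)) :+ b) :+ (R :* ((X :+ X) :+ S :* Y) :+ R :* ((X :+ X) :+ S :* Y))
           := S :* (((S :* X :+ (R :* Y :+ R :* Y)) :+ b) :+ ((S :* X :+ (R :* Y :+ R :* Y)) :+ b)) :+ (:- (S :* b) :+ :- ((S :* S :+ :- ((R :+ R) :+ (R :+ R))) :* X))) refl R S X Y b ⟩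
      _ ≈⟨ +-congʳ (*-congˡ (+-cong (sym p) (sym p))) ⟩
      S * (X₂ + X₂) + (- (S * b) + - (disc R S * X)) ∎

    -- The same characteristic equation after one more shift, now for the combination R′ Y + S′ X,
    -- which by `∂-B` is the z-derivative of `B τ`. The coefficients found are those of Δ and Λ.
    ode : ∀ {R S R′ S′ X Y X₁ Y₁ X₂ Y₂ b b₁} → X₂ ≈ (S * X + (R * Y + R * Y)) + b → Y₂ ≈ (X + X) + S * Y →
      X₁ ≈ (S * X₂ + (R * Y₂ + R * Y₂)) + b₁ → Y₁ ≈ (X₂ + X₂) + S * Y₂ →
      ((R′ * Y₁ + S′ * X₁) + (- (S + S) * (R′ * Y₂ + S′ * X₂) + disc R S * (R′ * Y + S′ * X)))
        + (- S′ * b₁ + (S * S′ + - (R′ + R′)) * b) ≈ 0#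
    ode {R} {S} {R′} {S′} {X} {Y} {X₁} {Y₁} {X₂} {Y₂} {b} {b₁} p q r s = begin
      _ ≈⟨ +-congʳ (+-cong (+-cong (*-congˡ s) (*-congˡ r)) (+-congʳ refl)) ⟩
      _ ≈⟨ solve 10 (λ R S R′ S′ X Y X₂ Y₂ b b₁ →
             ((R′ :* ((X₂ :+ X₂) :+ S :* Y₂) :+ S′ :* ((S :* X₂ :+ (R :* Y₂ :+ R :* Y₂)) :+ b₁)) :+ ((:- (S :+ S)) :* (R′ :* Y₂ :+ S′ :* X₂) :+ (S :* S :+ :- ((R :+ R) :+ (R :+ R))) :* (R′ :* Y :+ S′ :* X)))
              :+ ((:- S′) :* b₁ :+ (S :* S′ :+ :- (R′ :+ R′)) :* b)
             := (R′ :* ((X₂ :+ X₂) :+ (:- (S :* Y₂))) :+ S′ :* ((:- (S :* X₂)) :+ (R :* Y₂ :+ R :* Y₂)))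
                :+ ((S :* S :+ :- ((R :+ R) :+ (R :+ R))) :* (R′ :* Y :+ S′ :* X) :+ (S :* S′ :+ :- (R′ :+ R′)) :* b)) refl R S R′ S′ X Y X₂ Y₂ b b₁ ⟩
      _ ≈⟨ +-congʳ (+-cong (*-congˡ (+-cong (+-cong p p) (-‿cong (*-congˡ q)))) (*-congˡ (+-cong (-‿cong (*-congˡ p)) (+-cong (*-congˡ q) (*-congˡ q))))) ⟩
      _ ≈⟨ solve 7 (λ R S R′ S′ X Y b →
             (R′ :* ((((S :* X :+ (R :* Y :+ R :* Y)) :+ b) :+ ((S :* X :+ (R :* Y :+ R :* Y)) :+ b)) :+ (:- (S :* ((X :+ X) :+ S :* Y))))
                :+ S′ :* ((:- (S :* ((S :* X :+ (R :* Y :+ R :* Y)) :+ b))) :+ (R :* ((X :+ X) :+ S :* Y) :+ R :* ((X :+ X) :+ S :* Y))))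
                :+ ((S :* S :+ :- ((R :+ R) :+ (R :+ R))) :* (R′ :* Y :+ S′ :* X) :+ (S :* S′ :+ :- (R′ :+ R′)) :* b)
             := con (0 , 0)) refl R S R′ S′ X Y b ⟩
      0# ∎

    -- With e = 𝔼 w, Δ e = Γ w is the three-term recurrence of w, and the conclusion says 𝔼 (Δ w²) = 0.
    square : ∀ {Δ Γ EΔ w e} → EΔ ≈ - (Γ + Γ) → Δ * e ≈ Γ * w → EΔ * (w * w) + Δ * (e * w + w * e) ≈ 0#
    square {Δ} {Γ} {EΔ} {w} {e} p q = begin
      EΔ * (w * w) + Δ * (e * w + w * e)
        ≈⟨ +-cong (*-congʳ p) (solve 3 (λ d e w → d :* (e :* w :+ w :* e) := (d :* e) :* w :+ (d :* e) :* w) refl Δ e w) ⟩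
      - (Γ + Γ) * (w * w) + ((Δ * e) * w + (Δ * e) * w) ≈⟨ +-congˡ (+-cong (*-congʳ q) (*-congʳ q)) ⟩
      - (Γ + Γ) * (w * w) + ((Γ * w) * w + (Γ * w) * w)
        ≈⟨ solve 2 (λ g w → (:- (g :+ g)) :* (w :* w) :+ ((g :* w) :* w :+ (g :* w) :* w) := con (0 , 0)) refl Γ w ⟩
      0# ∎

    -- Variation of constants: w solves the homogeneous equation Δ f′ + Λ f = 0, and a factor m with
    -- m′ = w contributes Δ w² = 1 on the right-hand side.
    transport : ∀ {Δ Λ y m w ∂m ∂w} → ∂m ≈ w → Δ * ∂w + Λ * w ≈ 0# → Δ * (w * w) ≈ 1# →
      Δ * (y * (∂m * w + m * ∂w)) + Λ * (y * (m * w)) ≈ y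
    transport {Δ} {Λ} {y} {m} {w} {∂m} {∂w} p q r = begin
      Δ * (y * (∂m * w + m * ∂w)) + Λ * (y * (m * w)) ≈⟨ +-congʳ (*-congˡ (*-congˡ (+-congʳ (*-congʳ p)))) ⟩
      Δ * (y * (w * w + m * ∂w)) + Λ * (y * (m * w))
        ≈⟨ solve 6 (λ d l y m w v → d :* (y :* (w :* w :+ m :* v)) :+ l :* (y :* (m :* w)) := y :* (d :* (w :* w)) :+ (y :* m) :* (d :* v :+ l :* w)) refl Δ Λ y m w ∂w ⟩
      y * (Δ * (w * w)) + (y * m) * (Δ * ∂w + Λ * w) ≈⟨ +-cong (*-congˡ r) (*-congˡ q) ⟩
      y * 1# + (y * m) * 0# ≈⟨ trans (+-cong (*-identityʳ y) (zeroʳ _)) (+-identityʳ y) ⟩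
      y ∎

  module Weighted {c ℓ : Level} (A : CommutativeRing c ℓ) (MM : Trinomials A)
    (R S : ℕ → ℕ → CommutativeRing.Carrier A)
    (R0 : ∀ k → CommutativeRing._≈_ A (R 0 k) (CommutativeRing.0# A))
    (S0 : ∀ k → CommutativeRing._≈_ A (S 0 k) (CommutativeRing.0# A)) where
    open CommutativeRing A hiding (zero)
    open Trinomials MM
    open Series A
    open K using (ι; ι-+)
    open Sums A using (Σ-0; Σ-cong; Σ-*)
    open Substitution R S R0 S0
    open Relation.Binary.Reasoning.Setoid setoid

    cancel : ∀ n {x y} → ι (suc n) * x ≈ ι (suc n) * y → x ≈ y
    cancel n {x} {y} e = trans (lem x) (trans (*-congˡ e) (sym (lem y)))
      where
      lem : ∀ z → z ≈ inv n * (ι (suc n) * z)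
      lem z = trans (sym (*-identityˡ z)) (trans (*-congʳ (trans (sym (ι-inv n)) (*-comm _ _))) (*-assoc _ _ _))

    pascal-j : ∀ j → m 0 0 (suc j) ≈ m 0 0 j
    pascal-j j = cancel j (m-c 0 0 j)

    pascal-i : ∀ i → m (suc i) (suc i) 0 ≈ m i (suc i) 0 + m i (suc i) 0
    pascal-i i = cancel i (begin
      ι (suc i) * m (suc i) (suc i) 0 ≈⟨ m-a i (suc i) 0 ⟩
      ι (suc (i ℕ.+ suc i ℕ.+ 0)) * m i (suc i) 0 ≈⟨ *-congʳ (trans (reflexive (≡.cong ι (ℕ.+-identityʳ (suc i ℕ.+ suc i)))) (ι-+ (suc i) (suc i))) ⟩
      (ι (suc i) + ι (suc i)) * m i (suc i) 0 ≈⟨ trans (distribʳ _ _ _) (sym (distribˡ _ _ _)) ⟩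
      ι (suc i) * (m i (suc i) 0 + m i (suc i) 0) ∎)

    pascal-ij : ∀ i j → m (suc i) (suc i) (suc j) ≈ m (suc i) (suc i) j + (m i (suc i) (suc j) + m i (suc i) (suc j))
    pascal-ij i j = cancel (suc i ℕ.+ suc i ℕ.+ j) (begin
      ι N * M ≈⟨ *-congʳ split-N ⟩
      (ι (suc i) + ι (suc i) + ι (suc j)) * M
        ≈⟨ K.solve 3 (λ x y z → (x K.:+ x K.:+ y) K.:* z K.:= y K.:* z K.:+ (x K.:* z K.:+ x K.:* z)) refl (ι (suc i)) (ι (suc j)) M ⟩
      ι (suc j) * M + (ι (suc i) * M + ι (suc i) * M)
        ≈⟨ +-cong (m-c (suc i) (suc i) j) (+-cong e e) ⟩
      ι N * m (suc i) (suc i) j + (ι N * m i (suc i) (suc j) + ι N * m i (suc i) (suc j))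
        ≈⟨ K.solve 3 (λ n x y → n K.:* x K.:+ (n K.:* y K.:+ n K.:* y) K.:= n K.:* (x K.:+ (y K.:+ y))) refl _ _ _ ⟩
      ι N * (m (suc i) (suc i) j + (m i (suc i) (suc j) + m i (suc i) (suc j))) ∎)
      where
      N = suc (suc i ℕ.+ suc i ℕ.+ j)
      M = m (suc i) (suc i) (suc j)
      split-N : ι N ≈ ι (suc i) + ι (suc i) + ι (suc j)
      split-N = trans (reflexive (≡.cong ι (≡.sym (ℕ.+-suc (suc i ℕ.+ suc i) j)))) (trans (ι-+ (suc i ℕ.+ suc i) (suc j)) (+-congʳ (ι-+ (suc i) (suc i))))
      e : ι (suc i) * M ≈ ι N * m i (suc i) (suc j)
      e = trans (m-a i (suc i) (suc j)) (*-congʳ (reflexive (≡.cong ι (≡.cong suc (ℕ.+-suc (i ℕ.+ suc i) j)))))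

    -- A weight τ stands for the series f = Σ τ_k x^k in x = t + S + R/t. Then `↑` is multiplication
    -- by x, `ν` is d/dx, and `N₁` sends f to the derivative of x f.
    Weight : Set c
    Weight = ℕ → Carrier

    ↑ : Weight → Weight
    ↑ τ zero = 0#
    ↑ τ (suc k) = τ k

    N₁ N₂ ν : Weight → Weight
    N₁ τ k = ι (suc k) * τ k
    N₂ τ k = ι (suc (suc k)) * τ k
    ν τ k = ι (suc k) * τ (suc k)

    b a : Weight → ℕ → ℕ → Carrier
    b τ i j = τ (2 ℕ.* i ℕ.+ j) * m i i j
    a τ i j = τ (suc (2 ℕ.* i ℕ.+ j)) * m i (suc i) j

    -- B τ = Σ τ_k [t⁰](t + S + R/t)^k and A τ = Σ τ_k [t¹](t + S + R/t)^k.
    B A₁ : Weight → Ser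
    B τ = ev (b τ)
    A₁ τ = ev (a τ)

    at : ∀ (τ : Weight) {k l} → k ≡.≡ l → τ k ≈ τ l
    at τ e = reflexive (≡.cong τ e)

    B-cong : ∀ {τ σ} → (∀ k → τ k ≈ σ k) → B τ T.≈ B σ
    B-cong h = ev-cong (λ i j → *-congʳ (h (2 ℕ.* i ℕ.+ j)))

    B-+ : ∀ τ σ → B (λ k → τ k + σ k) T.≈ B τ T.+ B σ
    B-+ τ σ = T.trans (ev-cong (λ i j → distribʳ _ _ _)) (ev-+ (b τ) (b σ))

    B-κ : ∀ x τ → B (λ k → x * τ k) T.≈ κ x T.* B τ
    B-κ x τ = T.trans (ev-cong (λ i j → *-assoc _ _ _)) (ev-κ x (b τ))

    -- [t⁰] x f = S [t⁰] f + [t⁻¹] f + R [t¹] f, and exchanging t with R/t shows [t⁻¹] f = R [t¹] f.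
    -- On coefficients this is Pascal's rule for trinomials.
    B-↑ : ∀ τ → B (↑ τ) T.≈ S T.* B τ T.+ (R T.* A₁ τ T.+ R T.* A₁ τ)
    B-↑ τ = T.trans (ev-cong coeff) (T.trans (ev-+ _ _) (T.+-cong (T.sym (ev-S (b τ)))
      (T.trans (ev-+ _ _) (T.+-cong (T.sym (ev-R (a τ))) (T.sym (ev-R (a τ)))))))
      where
      idx : ∀ i j → i ℕ.+ suc (i ℕ.+ 0) ℕ.+ j ≡.≡ suc (2 ℕ.* i ℕ.+ j)
      idx = solve-∀
      coeff : ∀ i j → b (↑ τ) i j ≈ shY (b τ) i j + (shX (a τ) i j + shX (a τ) i j)
      coeff zero zero = trans (zeroˡ _) (sym (trans (+-congˡ (+-identityˡ 0#)) (+-identityˡ 0#)))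
      coeff zero (suc j) = trans (*-congˡ (pascal-j j)) (sym (trans (+-congˡ (+-identityˡ 0#)) (+-identityʳ _)))
      coeff (suc i) zero = trans (*-cong (at τ (idx i 0)) (pascal-i i)) (trans (distribˡ _ _ _) (sym (+-identityˡ _)))
      coeff (suc i) (suc j) = trans (*-congˡ (pascal-ij i j)) (trans (distribˡ _ _ _)
        (+-cong (*-congʳ (at τ (idx′ i j))) (trans (distribˡ _ _ _) (+-cong (*-congʳ (at τ (idx i (suc j)))) (*-congʳ (at τ (idx i (suc j))))))))
        where
        idx′ : ∀ i j → i ℕ.+ suc (i ℕ.+ 0) ℕ.+ suc j ≡.≡ 2 ℕ.* suc i ℕ.+ j
        idx′ = solve-∀

    -- Behind the computation: the coefficient of t in t df/dt = (t - R/t) f′ expresses R [t²] f′ by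
    -- [t⁰] f′ and [t¹] f, and this removes [t²] f′ from [t¹] (x f)′.
    A-N₁ : ∀ τ → A₁ (N₁ τ) T.≈ (B (ν τ) T.+ B (ν τ)) T.+ S T.* A₁ (ν τ)
    A-N₁ τ = T.trans (ev-cong coeff) (T.trans (ev-+ _ _) (T.+-cong (ev-+ _ _) (T.sym (ev-S (a (ν τ))))))
      where
      ii : ∀ i j → ι (suc i) * m i (suc i) j ≈ ι (suc (2 ℕ.* i ℕ.+ j)) * m i i j
      ii i j = trans (m-b i i j) (*-congʳ (reflexive (≡.cong (λ x → ι (suc (x ℕ.+ j))) (≡.cong (i ℕ.+_) (≡.sym (ℕ.+-identityʳ i))))))
      coeff : ∀ i j → a (N₁ τ) i j ≈ (b (ν τ) i j + b (ν τ) i j) + shY (a (ν τ)) i j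
      coeff i zero = begin
        (ι (suc (suc (2 ℕ.* i ℕ.+ 0))) * t) * m i (suc i) 0 ≈⟨ *-congʳ (*-congʳ (trans (reflexive (≡.cong ι (idx i))) (ι-+ (suc i) (suc i)))) ⟩
        ((ι (suc i) + ι (suc i)) * t) * m i (suc i) 0
          ≈⟨ K.solve 3 (λ x t y → ((x K.:+ x) K.:* t) K.:* y K.:= t K.:* (x K.:* y) K.:+ t K.:* (x K.:* y)) refl _ _ _ ⟩
        t * (ι (suc i) * m i (suc i) 0) + t * (ι (suc i) * m i (suc i) 0) ≈⟨ +-cong e e ⟩
        b (ν τ) i 0 + b (ν τ) i 0 ≈⟨ sym (+-identityʳ _) ⟩
        (b (ν τ) i 0 + b (ν τ) i 0) + 0# ∎
        where
        t = τ (suc (2 ℕ.* i ℕ.+ 0))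
        idx : ∀ i → suc (suc (2 ℕ.* i ℕ.+ 0)) ≡.≡ suc i ℕ.+ suc i
        idx = solve-∀
        e : t * (ι (suc i) * m i (suc i) 0) ≈ b (ν τ) i 0
        e = trans (*-congˡ (ii i 0)) (K.solve 3 (λ t x y → t K.:* (x K.:* y) K.:= (x K.:* t) K.:* y) refl _ _ _)
      coeff i (suc j) = begin
        (ι (suc (suc (2 ℕ.* i ℕ.+ suc j))) * t) * M
          ≈⟨ *-congʳ (*-congʳ (trans (reflexive (≡.cong ι (idx i j))) (trans (ι-+ (suc i ℕ.+ suc i) (suc j)) (+-congʳ (ι-+ (suc i) (suc i)))))) ⟩
        ((ι (suc i) + ι (suc i) + ι (suc j)) * t) * M
          ≈⟨ K.solve 4 (λ x z t y → ((x K.:+ x K.:+ z) K.:* t) K.:* y K.:= (t K.:* (x K.:* y) K.:+ t K.:* (x K.:* y)) K.:+ t K.:* (z K.:* y)) refl _ _ _ _ ⟩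
        (t * (ι (suc i) * M) + t * (ι (suc i) * M)) + t * (ι (suc j) * M) ≈⟨ +-cong (+-cong e e) e′ ⟩
        (b (ν τ) i (suc j) + b (ν τ) i (suc j)) + a (ν τ) i j ∎
        where
        t = τ (suc (2 ℕ.* i ℕ.+ suc j))
        M = m i (suc i) (suc j)
        idx : ∀ i j → suc (suc (2 ℕ.* i ℕ.+ suc j)) ≡.≡ suc i ℕ.+ suc i ℕ.+ suc j
        idx = solve-∀
        e : t * (ι (suc i) * M) ≈ b (ν τ) i (suc j)
        e = trans (*-congˡ (ii i (suc j))) (K.solve 3 (λ t x y → t K.:* (x K.:* y) K.:= (x K.:* t) K.:* y) refl _ _ _)
        idx′ : ∀ i j → suc (i ℕ.+ suc i ℕ.+ j) ≡.≡ suc (suc (2 ℕ.* i ℕ.+ j))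
        idx′ = solve-∀
        e′ : t * (ι (suc j) * M) ≈ a (ν τ) i j
        e′ = trans (*-cong (at τ (≡.cong suc (ℕ.+-suc (2 ℕ.* i) j))) (trans (m-c i (suc i) j) (*-congʳ (reflexive (≡.cong ι (idx′ i j))))))
          (K.solve 3 (λ t x y → t K.:* (x K.:* y) K.:= (x K.:* t) K.:* y) refl _ _ _)

    -- Here dx/dS = 1 and dx/dR = 1/t, and [t⁰] of f′/t is [t¹] f′.
    ∂-B : ∀ τ → ∂ (B τ) T.≈ ∂ R T.* A₁ (ν τ) T.+ ∂ S T.* B (ν τ)
    ∂-B τ = T.trans (∂-ev (b τ)) (T.+-cong (T.*-congˡ {∂ R} (ev-cong cx)) (T.*-congˡ {∂ S} (ev-cong cy)))
      where
      swap : ∀ x y z → x * (y * z) ≈ y * (x * z)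
      swap = K.solve 3 (λ x y z → x K.:* (y K.:* z) K.:= y K.:* (x K.:* z)) refl
      swap′ : ∀ x y z → x * (y * z) ≈ (y * x) * z
      swap′ = K.solve 3 (λ x y z → x K.:* (y K.:* z) K.:= (y K.:* x) K.:* z) refl
      cx : ∀ i j → ∂x (b τ) i j ≈ a (ν τ) i j
      cx i j = trans (swap _ _ _) (trans (*-cong (at τ (idx i j)) (trans (m-a i (suc i) j) (*-congʳ (reflexive (≡.cong ι (idx′ i j)))))) (swap′ _ _ _))
        where
        idx : ∀ i j → 2 ℕ.* suc i ℕ.+ j ≡.≡ suc (suc (2 ℕ.* i ℕ.+ j))
        idx = solve-∀
        idx′ : ∀ i j → suc (i ℕ.+ suc i ℕ.+ j) ≡.≡ suc (suc (2 ℕ.* i ℕ.+ j))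
        idx′ = solve-∀
      cy : ∀ i j → ∂y (b τ) i j ≈ b (ν τ) i j
      cy i j = trans (swap _ _ _) (trans (*-cong (at τ (ℕ.+-suc (2 ℕ.* i) j)) (trans (m-c i i j) (*-congʳ (reflexive (≡.cong ι (idx′ i j)))))) (swap′ _ _ _))
        where
        idx′ : ∀ i j → suc (i ℕ.+ i ℕ.+ j) ≡.≡ suc (2 ℕ.* i ℕ.+ j)
        idx′ = solve-∀


    module RI = RingIdentities T

    D : Ser
    D = RI.disc R S

    -- This is (x f)′ = x f′ + f, followed by `B-↑`.
    B-N₁ : ∀ τ → B (N₁ τ) T.≈ (S T.* B (ν τ) T.+ (R T.* A₁ (ν τ) T.+ R T.* A₁ (ν τ))) T.+ B τ
    B-N₁ τ = T.trans (B-cong weights) (T.trans (B-+ (↑ (ν τ)) τ) (T.+-congʳ (B-↑ (ν τ))))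
      where
      weights : ∀ k → N₁ τ k ≈ ↑ (ν τ) k + τ k
      weights zero = trans (*-congʳ (+-identityʳ 1#)) (trans (*-identityˡ _) (sym (+-identityˡ _)))
      weights (suc k) = trans (distribʳ _ _ _) (trans (+-congʳ (*-identityˡ _)) (+-comm _ _))

    B-↑N₁ : ∀ τ → B (↑ (N₁ τ)) T.≈ S T.* (B (N₁ τ) T.+ B (N₁ τ)) T.+ (T.- (S T.* B τ) T.+ T.- (D T.* B (ν τ)))
    B-↑N₁ τ = T.trans (B-↑ (N₁ τ)) (RI.three-term {R} {S} (B-N₁ τ) (A-N₁ τ))

    ode-B : ∀ τ → (∂ (B (↑ (↑ τ))) T.+ (T.- (S T.+ S) T.* ∂ (B (↑ τ)) T.+ D T.* ∂ (B τ)))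
      T.+ (T.- ∂ S T.* B (↑ τ) T.+ (S T.* ∂ S T.+ T.- (∂ R T.+ ∂ R)) T.* B τ) T.≈ T.0#
    ode-B τ = T.trans (T.+-congʳ (T.+-cong (∂-B (↑ (↑ τ))) (T.+-cong (T.*-congˡ {T.- (S T.+ S)} (∂-B (↑ τ))) (T.*-congˡ {D} (∂-B τ)))))
      (RI.ode {R} {S} {∂ R} {∂ S} (B-N₁ τ) (A-N₁ τ) X₁ (A-N₁ (↑ τ)))
      where
      X₁ : B (ν (↑ (↑ τ))) T.≈ (S T.* B (ν (↑ τ)) T.+ (R T.* A₁ (ν (↑ τ)) T.+ R T.* A₁ (ν (↑ τ)))) T.+ B (↑ τ)
      X₁ = B-N₁ (↑ τ)

    shifted : Weight → ℕ → Weight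
    shifted τ zero = τ
    shifted τ (suc k) = ↑ (shifted τ k)

    δ₀ : Weight
    δ₀ zero = 1#
    δ₀ (suc _) = 0#

    δ : ℕ → Weight
    δ = shifted δ₀

    δ-at : ∀ (f : ℕ → Carrier) k l → f l * δ k l ≈ f k * δ k l
    δ-at f zero zero = refl
    δ-at f zero (suc l) = trans (zeroʳ _) (sym (zeroʳ _))
    δ-at f (suc k) zero = trans (zeroʳ _) (sym (zeroʳ _))
    δ-at f (suc k) (suc l) = δ-at (λ i → f (suc i)) k l

    ↑-cong : ∀ {τ σ} → (∀ k → τ k ≈ σ k) → ∀ k → ↑ τ k ≈ ↑ σ k
    ↑-cong h zero = refl
    ↑-cong h (suc k) = h k

    w : ℕ → Ser
    w k = B (δ k)

    B-scaled : ∀ n τ → B (λ k → ι n * τ k) T.≈ KT.ι n T.* B τ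
    B-scaled n τ = T.trans (B-κ (ι n) τ) (T.*-congʳ {B τ} (T.sym (ι-κ n)))

    N₁δ : ∀ k → B (N₁ (δ k)) T.≈ KT.ι (suc k) T.* w k
    N₁δ k = T.trans (B-cong (δ-at (λ i → ι (suc i)) k)) (B-scaled (suc k) (δ k))

    ↑N₁δ : ∀ k → B (↑ (N₁ (δ k))) T.≈ KT.ι (suc k) T.* w (suc k)
    ↑N₁δ k = T.trans (B-cong weights) (B-scaled (suc k) (δ (suc k)))
      where
      weights : ∀ l → ↑ (N₁ (δ k)) l ≈ ι (suc k) * δ (suc k) l
      weights zero = sym (zeroʳ _)
      weights (suc l) = δ-at (λ i → ι (suc i)) k l

    w0 : w 0 T.≈ T.1#
    w0 = ev-1 (b (δ 0)) off (trans (*-identityˡ _) m-000)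
      where
      off : ∀ i j → (i ≡.≢ 0) ⊎ (j ≡.≢ 0) → b (δ 0) i j ≈ 0#
      off zero zero (inj₁ h) = contradiction ≡.refl h
      off zero zero (inj₂ h) = contradiction ≡.refl h
      off zero (suc j) _ = zeroˡ _
      off (suc i) j _ = zeroˡ _

    B-0 : ∀ τ → (∀ k → τ k ≈ 0#) → B τ T.≈ T.0#
    B-0 τ h n k = Σ-0 n (λ i _ → Σ-0 (n ℕ.∸ i) (λ j _ → trans (*-congʳ (trans (*-congʳ (h _)) (zeroˡ _))) (zeroˡ _)))

    recurrence-1 : w 1 T.≈ S T.* w 0
    recurrence-1 = T.trans (T.trans (T.sym (T.*-identityˡ (w 1))) (T.trans (T.*-congʳ {w 1} (T.sym (T.+-identityʳ T.1#))) (T.sym (↑N₁δ 0))))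
      (T.trans (B-↑N₁ (δ 0)) (T.trans
        (T.+-cong (T.*-congˡ {S} (T.+-cong N₁δ0 N₁δ0)) (T.+-congˡ {T.- (S T.* w 0)} (T.-‿cong (T.*-congˡ {D} (B-0 (ν (δ 0)) (λ k → zeroʳ _))))))
        (RT.solve 3 (λ s d x → s RT.:* (x RT.:+ x) RT.:+ (RT.:- (s RT.:* x) RT.:+ RT.:- (d RT.:* RT.con (0 , 0))) RT.:= s RT.:* x) T.refl S D (w 0))))
      where
      module RT = RingKit T
      N₁δ0 : B (N₁ (δ 0)) T.≈ w 0
      N₁δ0 = T.trans (N₁δ 0) (T.trans (T.*-congʳ {w 0} (T.+-identityʳ T.1#)) (T.*-identityˡ (w 0)))

    -- Bonnet's recurrence (k+2) B_{k+2} = (2k+3) S B_{k+1} - (k+1) D B_k: up to scaling, the B_k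
    -- are Legendre polynomials in S/√D.
    recurrence : ∀ k → KT.ι (suc (suc k)) T.* w (suc (suc k)) T.≈
      S T.* (KT.ι (suc (suc k)) T.* w (suc k) T.+ KT.ι (suc (suc k)) T.* w (suc k)) T.+ (T.- (S T.* w (suc k)) T.+ T.- (D T.* (KT.ι (suc k) T.* w k)))
    recurrence k = T.trans (T.sym (↑N₁δ (suc k))) (T.trans (B-↑N₁ (δ (suc k)))
      (T.+-cong (T.*-congˡ {S} (T.+-cong (N₁δ (suc k)) (N₁δ (suc k)))) (T.+-congˡ {T.- (S T.* w (suc k))} (T.-‿cong (T.*-congˡ {D} (N₁δ k))))))

    module Y = PowerSeries T
    𝕊 : CommutativeRing c ℓ
    𝕊 = Y.ring′
    module 𝕊 = CommutativeRing 𝕊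
    module I𝕊 = RingIdentities 𝕊

    -- As polynomials in y, Γ is -½ y dΔ/dy and Λ is ½ dΔ/dz. Thus Δ · 𝔼 w = Γ w and Δ · ∂w + Λ w =
    -- 0 are the two differential equations of Δ^(-1/2).
    Δ Γ Λ : ℕ → Ser
    Δ 0 = T.1#
    Δ 1 = T.- (S T.+ S)
    Δ 2 = D
    Δ _ = T.0#
    Γ 1 = S
    Γ 2 = T.- D
    Γ _ = T.0#
    Λ 1 = T.- ∂ S
    Λ 2 = S T.* ∂ S T.+ T.- (∂ R T.+ ∂ R)
    Λ _ = T.0#

    torsion-free : ∀ n {X} → KT.ι (suc n) T.* X T.≈ T.0# → X T.≈ T.0#
    torsion-free n {X} h i k = cancel n (trans (sym (KT-ι-* (suc n) X i k)) (trans (h i k) (sym (zeroʳ _))))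

    Δ𝔼w : Δ 𝕊.* Y.𝔼 w 𝕊.≈ Γ 𝕊.* w
    Δ𝔼w 0 = T.trans (T.*-congˡ {T.1#} (T.zeroˡ (w 0))) (T.trans (T.zeroʳ T.1#) (T.sym (T.zeroˡ (w 0))))
    Δ𝔼w 1 = T.trans (T.+-congʳ (T.*-congˡ {T.1#} (T.*-congˡ {KT.ι 1} recurrence-1)))
      (KT.solve 2 (λ s x → KT.con (1 , 0) KT.:* ((KT.con (1 , 0) KT.:+ KT.con (0 , 0)) KT.:* (s KT.:* x)) KT.:+ (KT.:- (s KT.:+ s)) KT.:* (KT.con (0 , 0) KT.:* x)
        KT.:= KT.con (0 , 0) KT.:* (s KT.:* x) KT.:+ s KT.:* x) T.refl S (w 0) `then` T.+-congʳ (T.*-congˡ {T.0#} (T.sym recurrence-1)))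
      where _`then`_ = T.trans
    Δ𝔼w (suc (suc k)) = T.trans (Y.quadratic-⊛ Δ (Y.𝔼 w) (λ _ → T.refl) k) (T.trans
      (T.+-congʳ (T.*-congˡ {T.1#} (recurrence k)))
      (T.trans (KT.solve 6 (λ s d n x x₁ x₂ →
          KT.con (1 , 0) KT.:* (s KT.:* ((KT.con (1 , 0) KT.:+ (KT.con (1 , 0) KT.:+ n)) KT.:* x₁ KT.:+ (KT.con (1 , 0) KT.:+ (KT.con (1 , 0) KT.:+ n)) KT.:* x₁)
             KT.:+ (KT.:- (s KT.:* x₁) KT.:+ KT.:- (d KT.:* ((KT.con (1 , 0) KT.:+ n) KT.:* x))))
           KT.:+ ((KT.:- (s KT.:+ s)) KT.:* ((KT.con (1 , 0) KT.:+ n) KT.:* x₁) KT.:+ d KT.:* (n KT.:* x))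
          KT.:= KT.con (0 , 0) KT.:* x₂ KT.:+ (s KT.:* x₁ KT.:+ (KT.:- d) KT.:* x)) T.refl S D (KT.ι k) (w k) (w (suc k)) (w (suc (suc k))))
        (T.sym (Y.quadratic-⊛ Γ w (λ _ → T.refl) k))))

    𝔼Δ : Y.𝔼 Δ 𝕊.≈ 𝕊.- (Γ 𝕊.+ Γ)
    𝔼Δ 0 = KT.solve 0 (KT.con (0 , 0) KT.:* KT.con (1 , 0) KT.:= KT.:- (KT.con (0 , 0) KT.:+ KT.con (0 , 0))) T.refl
    𝔼Δ 1 = KT.solve 1 (λ s → (KT.con (1 , 0) KT.:+ KT.con (0 , 0)) KT.:* (KT.:- (s KT.:+ s)) KT.:= KT.:- (s KT.:+ s)) T.refl S
    𝔼Δ 2 = KT.solve 1 (λ d → (KT.con (1 , 0) KT.:+ (KT.con (1 , 0) KT.:+ KT.con (0 , 0))) KT.:* d KT.:= KT.:- ((KT.:- d) KT.:+ (KT.:- d))) T.refl D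
    𝔼Δ (suc (suc (suc n))) = KT.solve 1 (λ x → x KT.:* KT.con (0 , 0) KT.:= KT.:- (KT.con (0 , 0) KT.:+ KT.con (0 , 0))) T.refl (KT.ι (3 ℕ.+ n))

    -- The Euler operator multiplies the coefficient of y^n by n. Since it annihilates Δ w², only
    -- the constant term remains, and positive n can be cancelled.
    Δww : Δ 𝕊.* (w 𝕊.* w) 𝕊.≈ 𝕊.1#
    Δww zero = T.trans (T.*-identityˡ _) (T.trans (T.*-cong w0 w0) (T.*-identityˡ T.1#))
    Δww (suc n) = torsion-free n (euler (suc n))
      where
      euler : Y.𝔼 (Δ 𝕊.* (w 𝕊.* w)) 𝕊.≈ 𝕊.0#
      euler = 𝕊.trans (Y.𝔼-⊛ Δ (w 𝕊.* w)) (𝕊.trans (𝕊.+-congˡ {Y.𝔼 Δ 𝕊.* (w 𝕊.* w)} (𝕊.*-congˡ {Δ} (Y.𝔼-⊛ w w))) (I𝕊.square {Δ} {Γ} {Y.𝔼 Δ} {w} {Y.𝔼 w} 𝔼Δ Δ𝔼w))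

    module P = Y.Pointwise ∂ ∂-+ Z.∂-⊛
    open P using (D̂; D̂-⊛)

    -- Formally Δ^(1/2) ∂ Δ^(1/2), an operator that annihilates w = Δ^(-1/2).
    𝓛 : (ℕ → Ser) → ℕ → Ser
    𝓛 f = Δ 𝕊.* D̂ f 𝕊.+ Λ 𝕊.* f

    -- The relation `ode-B` involves three consecutive shifts of τ, so it says nothing in degrees 0
    -- and 1. This is why the defect has to be checked by hand at two indices.
    𝓛-shifted : ∀ τ k → 𝓛 (λ i → B (shifted τ i)) (suc (suc k)) T.≈ T.0#
    𝓛-shifted τ k = T.trans (T.+-cong (Y.quadratic-⊛ Δ (D̂ (λ i → B (shifted τ i))) (λ _ → T.refl) k) (Y.quadratic-⊛ Λ (λ i → B (shifted τ i)) (λ _ → T.refl) k))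
      (T.trans (T.+-cong (T.+-congʳ (T.*-identityˡ (∂ (B (shifted τ (suc (suc k))))))) (T.trans (T.+-congʳ (T.zeroˡ (B (shifted τ (suc (suc k)))))) (T.+-identityˡ _)))
        (ode-B (shifted τ k)))

    ∂w0 : ∂ (w 0) T.≈ T.0#
    ∂w0 = T.trans (∂-cong w0) (∂-const T.1# (λ _ _ → refl))

    𝓛w : 𝓛 w 𝕊.≈ 𝕊.0#
    𝓛w 0 = T.trans (T.+-cong (T.*-congˡ {T.1#} ∂w0) (T.zeroˡ (w 0))) (T.trans (T.+-identityʳ _) (T.zeroʳ T.1#))
    𝓛w 1 = T.trans (T.+-congʳ (T.+-cong (T.*-congˡ {T.1#} (T.trans (∂-cong recurrence-1) (T.trans (Z.∂-⊛ S (w 0)) (T.+-congˡ {∂ S T.* w 0} (T.*-congˡ {S} ∂w0)))))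
        (T.*-congˡ {T.- (S T.+ S)} ∂w0)))
      (KT.solve 4 (λ s s′ x y → (KT.con (1 , 0) KT.:* (s′ KT.:* x KT.:+ s KT.:* KT.con (0 , 0)) KT.:+ (KT.:- (s KT.:+ s)) KT.:* KT.con (0 , 0))
         KT.:+ (KT.con (0 , 0) KT.:* y KT.:+ (KT.:- s′) KT.:* x) KT.:= KT.con (0 , 0)) T.refl S (∂ S) (w 0) (w 1))
    𝓛w (suc (suc k)) = 𝓛-shifted δ₀ k

    ∫ : Ser → Ser
    ∫ X zero k = 0#
    ∫ X (suc n) k = inv n * X n k

    ∂∫ : ∀ X → ∂ (∫ X) T.≈ X
    ∂∫ X n k = trans (∂-coeff (∫ X) n k) (trans (sym (*-assoc _ _ _)) (trans (*-congʳ (ι-inv n)) (*-identityˡ _)))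

    ∂-injective : ∀ {X Y} → ∂ X T.≈ ∂ Y → (∀ k → X 0 k ≈ Y 0 k) → X T.≈ Y
    ∂-injective p q zero k = q k
    ∂-injective {X} {Y} p q (suc n) k = cancel n (trans (sym (∂-coeff X n k)) (trans (p n k) (∂-coeff Y n k)))

    ∂-neg : ∀ X → ∂ (T.- X) T.≈ T.- ∂ X
    ∂-neg X n k = trans (∂-coeff (T.- X) n k) (trans (sym (-‿distribʳ-* _ _)) (-‿cong (sym (∂-coeff X n k))))
      where open import Algebra.Properties.Ring ring using (-‿distribʳ-*)

    M : Weight → Ser
    M τ = ∫ (B τ)

    mm : ℕ → Ser
    mm k = M (δ k)

    M-0 : mm 0 T.≈ 𝕫
    M-0 zero k = refl
    M-0 (suc zero) zero = trans (*-cong (trans (sym (trans (*-congʳ (+-identityʳ 1#)) (*-identityˡ _))) (ι-inv 0)) (w0 0 0)) (*-identityˡ _)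
    M-0 (suc zero) (suc k) = trans (*-congˡ (w0 0 (suc k))) (zeroʳ _)
    M-0 (suc (suc n)) zero = trans (*-congˡ (w0 (suc n) 0)) (zeroʳ _)
    M-0 (suc (suc n)) (suc k) = trans (*-congˡ (w0 (suc n) (suc k))) (zeroʳ _)

    -- Twice this series is the z-derivative of y m², the convolution term of the equation.
    yy : ℕ → Ser
    yy = Y.𝕩 𝕊.* (mm 𝕊.* w)

    ∂𝕩 : D̂ Y.𝕩 𝕊.≈ 𝕊.0#
    ∂𝕩 0 = ∂-const T.0# (λ _ _ → refl)
    ∂𝕩 1 = ∂-const T.1# (λ _ _ → refl)
    ∂𝕩 (suc (suc n)) = ∂-const T.0# (λ _ _ → refl)

    ∂𝕩* : ∀ f g → D̂ (Y.𝕩 𝕊.* (f 𝕊.* g)) 𝕊.≈ Y.𝕩 𝕊.* (D̂ f 𝕊.* g 𝕊.+ f 𝕊.* D̂ g)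
    ∂𝕩* f g = 𝕊.trans (D̂-⊛ Y.𝕩 (f 𝕊.* g)) (𝕊.trans (𝕊.+-cong (𝕊.trans (𝕊.*-congʳ {f 𝕊.* g} ∂𝕩) (𝕊.zeroˡ (f 𝕊.* g))) (𝕊.*-congˡ {Y.𝕩} (D̂-⊛ f g))) (𝕊.+-identityˡ _))

    𝓛yy : 𝓛 yy 𝕊.≈ Y.𝕩
    𝓛yy = 𝕊.trans (𝕊.+-congʳ (𝕊.*-congˡ {Δ} (∂𝕩* mm w)))
      (I𝕊.transport {Δ} {Λ} {Y.𝕩} {mm} {w} {D̂ mm} {D̂ w} (λ k → ∂∫ (w k)) 𝓛w Δww)

    B-const : ∀ τ → τ 0 ≈ 0# → ∀ k → B τ 0 k ≈ 0#
    B-const τ h k = trans (*-congʳ (trans (*-congʳ h) (zeroˡ _))) (zeroˡ _)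

    *-const : ∀ X Y → (∀ k → X 0 k ≈ 0#) → ∀ k → (X T.* Y) 0 k ≈ 0#
    *-const X Y h k = vanish X Y 0 k λ { .0 j ℕ.z≤n q → inj₁ (h j) }

    *-constʳ : ∀ X Y → (∀ k → Y 0 k ≈ 0#) → ∀ k → (X T.* Y) 0 k ≈ 0#
    *-constʳ X Y h k = vanish X Y 0 k λ { .0 j ℕ.z≤n q → inj₂ (h _) }

    ⊛-const : ∀ f g → (∀ i k → f i 0 k ≈ 0#) → ∀ i k → (f 𝕊.* g) i 0 k ≈ 0#
    ⊛-const f g h zero k = *-const (f 0) (g 0) (h 0) k
    ⊛-const f g h (suc i) k = trans (+-cong (*-const (f 0) (g (suc i)) (h 0) k) (⊛-const (Y.tail f) g (λ i → h (suc i)) i k)) (+-identityˡ 0#)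

    ⊛-constʳ : ∀ f g → (∀ i k → g i 0 k ≈ 0#) → ∀ i k → (f 𝕊.* g) i 0 k ≈ 0#
    ⊛-constʳ f g h i k = trans (𝕊.*-comm f g i 0 k) (⊛-const g f h i k)

    module Solution (ω : Weight) (ω0 : ω 0 ≈ 0#)
      (R≈ : R T.≈ 𝕫 T.+ 𝕦 T.* (R T.* A₁ ω)) (S≈ : S T.≈ 𝕦 T.* B ω) where

      G : ℕ → Ser
      G k = B (shifted ω k)

      h : ℕ → Ser
      h k = w (suc k) T.+ (T.- (𝕦 T.* G k) T.+ T.- (yy k T.+ yy k))

      ∂𝕦* : ∀ X → ∂ (𝕦 T.* X) T.≈ 𝕦 T.* ∂ X
      ∂𝕦* X = T.trans (Z.∂-⊛ 𝕦 X) (T.trans (T.+-congʳ (T.trans (T.*-congʳ {X} (∂-const 𝕦 (λ _ _ → refl))) (T.zeroˡ X))) (T.+-identityˡ _))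

      D̂h : D̂ h 𝕊.≈ D̂ (λ k → w (suc k)) 𝕊.+ (𝕊.- (𝕦 Y.• D̂ G) 𝕊.+ 𝕊.- (D̂ yy 𝕊.+ D̂ yy))
      D̂h k = T.trans (∂-+ (w (suc k)) (T.- (𝕦 T.* G k) T.+ T.- (yy k T.+ yy k))) (T.+-congˡ {∂ (w (suc k))} (T.trans (∂-+ (T.- (𝕦 T.* G k)) (T.- (yy k T.+ yy k))) (T.+-cong (T.trans (∂-neg (𝕦 T.* G k)) (T.-‿cong (∂𝕦* (G k)))) (T.trans (∂-neg (yy k T.+ yy k)) (T.-‿cong (∂-+ (yy k) (yy k)))))))

      -- Every part of h is killed from degree 2 on: the B_{k+1} and the `G k` because they are
      -- families of shifts, and `yy` because its image is y itself.
      𝓛h : ∀ k → 𝓛 h (suc (suc k)) T.≈ T.0#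
      𝓛h k = T.trans (𝓛-linear (suc (suc k))) (T.trans
        (T.+-cong (𝓛-shifted-suc k) (T.+-cong (T.-‿cong (T.*-congˡ {𝕦} (𝓛-shifted ω k))) (T.-‿cong (T.+-cong (𝓛yy (suc (suc k))) (𝓛yy (suc (suc k)))))))
        (KT.solve 1 (λ x → KT.con (0 , 0) KT.:+ (KT.:- (x KT.:* KT.con (0 , 0)) KT.:+ KT.:- (KT.con (0 , 0) KT.:+ KT.con (0 , 0))) KT.:= KT.con (0 , 0)) T.refl 𝕦))
        where
        w⁺ : ℕ → Ser
        w⁺ k = w (suc k)
        𝓛-shifted-suc : ∀ k → 𝓛 w⁺ (suc (suc k)) T.≈ T.0#
        𝓛-shifted-suc k = T.trans (T.+-cong (Y.quadratic-⊛ Δ (D̂ w⁺) (λ _ → T.refl) k) (Y.quadratic-⊛ Λ w⁺ (λ _ → T.refl) k))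
          (T.trans (T.+-cong (T.+-congʳ (T.*-identityˡ (∂ (w⁺ (suc (suc k)))))) (T.trans (T.+-congʳ (T.zeroˡ (w⁺ (suc (suc k))))) (T.+-identityˡ _)))
            (ode-B (δ (suc k))))
        module R𝕊 = RingKit 𝕊
        𝓛-linear : 𝓛 h 𝕊.≈ 𝓛 w⁺ 𝕊.+ (𝕊.- (𝕦 Y.• 𝓛 G) 𝕊.+ 𝕊.- (𝓛 yy 𝕊.+ 𝓛 yy))
        𝓛-linear = 𝕊.trans (𝕊.+-congʳ (𝕊.*-congˡ {Δ} D̂h)) (𝕊.trans
          (R𝕊.solve 8 (λ d l a a′ b b′ c c′ → d R𝕊.:* (a′ R𝕊.:+ (R𝕊.:- b′ R𝕊.:+ R𝕊.:- (c′ R𝕊.:+ c′))) R𝕊.:+ l R𝕊.:* (a R𝕊.:+ (R𝕊.:- b R𝕊.:+ R𝕊.:- (c R𝕊.:+ c)))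
             R𝕊.:= (d R𝕊.:* a′ R𝕊.:+ l R𝕊.:* a) R𝕊.:+ (R𝕊.:- (d R𝕊.:* b′ R𝕊.:+ l R𝕊.:* b) R𝕊.:+ R𝕊.:- ((d R𝕊.:* c′ R𝕊.:+ l R𝕊.:* c) R𝕊.:+ (d R𝕊.:* c′ R𝕊.:+ l R𝕊.:* c))))
            𝕊.refl Δ Λ w⁺ (D̂ w⁺) (𝕦 Y.• G) (𝕦 Y.• D̂ G) yy (D̂ yy))
          (𝕊.+-congˡ {𝓛 w⁺} (𝕊.+-congʳ (𝕊.-‿cong (λ n → T.trans (T.+-cong (Y.⊛-• 𝕦 Δ (D̂ G) n) (Y.⊛-• 𝕦 Λ G n)) (T.sym (T.distribˡ 𝕦 ((Δ 𝕊.* D̂ G) n) ((Λ 𝕊.* G) n))))))))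

      h0 : h 0 T.≈ T.0#
      h0 = T.trans (T.+-cong (T.trans recurrence-1 (T.*-congˡ {S} w0)) (T.+-congʳ (T.-‿cong (T.sym S≈))))
        (KT.solve 2 (λ s x → s KT.:* KT.con (1 , 0) KT.:+ (KT.:- s KT.:+ KT.:- (KT.con (0 , 0) KT.:* x KT.:+ KT.con (0 , 0) KT.:* x)) KT.:= KT.con (0 , 0)) T.refl S ((mm 𝕊.* w) 0))

      w2 : w 2 T.≈ S T.* S T.+ (R T.+ R)
      w2 = KT.solve 2 (λ x y → x KT.:= (x KT.:+ KT.:- y) KT.:+ y) T.refl (w 2) (S T.* S T.+ (R T.+ R)) `then`
        T.trans (T.+-congʳ (torsion-free 1 (T.trans (T.distribˡ _ _ _) (T.trans (T.+-congʳ (T.trans (recurrence 0) rhs)) zero-sum)))) (T.+-identityˡ _)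
        where
        _`then`_ = T.trans
        w1 : w 1 T.≈ S
        w1 = T.trans recurrence-1 (T.trans (T.*-congˡ {S} w0) (T.*-identityʳ S))
        rhs = T.+-cong (T.*-congˡ {S} (T.+-cong (T.*-congˡ {KT.ι 2} w1) (T.*-congˡ {KT.ι 2} w1))) (T.+-cong (T.-‿cong (T.*-congˡ {S} w1)) (T.-‿cong (T.*-congˡ {D} (T.*-congˡ {KT.ι 1} w0))))
        zero-sum = KT.solve 2 (λ s r →
          (s KT.:* (two KT.:* s KT.:+ two KT.:* s) KT.:+ (KT.:- (s KT.:* s) KT.:+ KT.:- ((s KT.:* s KT.:+ KT.:- ((r KT.:+ r) KT.:+ (r KT.:+ r))) KT.:* ((KT.con (1 , 0) KT.:+ KT.con (0 , 0)) KT.:* KT.con (1 , 0)))))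
            KT.:+ two KT.:* (KT.:- (s KT.:* s KT.:+ (r KT.:+ r))) KT.:= KT.con (0 , 0)) T.refl S R
          where
          two : ∀ {n} → KT.Polynomial n
          two = KT.con (1 , 0) KT.:+ (KT.con (1 , 0) KT.:+ KT.con (0 , 0))

      -- Since B_2 = S² + 2R, this defect is S (S - u B ω) + 2 (R - z - u R A₁ ω), a combination of
      -- the two given equations.
      h1 : h 1 T.≈ T.0#
      h1 = T.trans (T.+-cong w2 (T.+-cong (T.-‿cong (T.*-congˡ {𝕦} (B-↑ ω))) (T.-‿cong (T.+-cong y1 y1))))
        (T.trans (KT.solve 6 (λ s r z u β α → (s KT.:* s KT.:+ (r KT.:+ r)) KT.:+ (KT.:- (u KT.:* (s KT.:* β KT.:+ (α KT.:+ α))) KT.:+ KT.:- (z KT.:+ z))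
            KT.:= s KT.:* (s KT.:+ KT.:- (u KT.:* β)) KT.:+ ((r KT.:+ KT.:- (z KT.:+ u KT.:* α)) KT.:+ (r KT.:+ KT.:- (z KT.:+ u KT.:* α)))) T.refl S R 𝕫 𝕦 (B ω) (R T.* A₁ ω))
        (T.trans (T.+-cong (T.*-congˡ {S} (minus S≈)) (T.+-cong (minus R≈) (minus R≈)))
          (KT.solve 1 (λ s → s KT.:* KT.con (0 , 0) KT.:+ (KT.con (0 , 0) KT.:+ KT.con (0 , 0)) KT.:= KT.con (0 , 0)) T.refl S)))
        where
        y1 : yy 1 T.≈ 𝕫
        y1 = T.trans (Y.𝕩-⊛-suc (mm 𝕊.* w) 0) (T.trans (T.*-cong M-0 w0) (T.*-identityʳ 𝕫))
        minus : ∀ {X Y} → X T.≈ Y → X T.+ T.- Y T.≈ T.0#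
        minus {X} {Y} e = T.trans (T.+-congʳ e) (T.-‿inverseʳ Y)

      mm-const : ∀ i k → mm i 0 k ≈ 0#
      mm-const i k = refl

      yy-const : ∀ i k → yy i 0 k ≈ 0#
      yy-const = ⊛-constʳ Y.𝕩 (mm 𝕊.* w) (⊛-const mm w mm-const)

      shifted-0 : ∀ k → shifted ω k 0 ≈ 0#
      shifted-0 zero = ω0
      shifted-0 (suc k) = refl

      h-const : ∀ i k → h i 0 k ≈ 0#
      h-const i k = trans (+-cong (B-const (δ (suc i)) refl k) (+-cong (-‿cong (*-constʳ 𝕦 (G i) (B-const (shifted ω i) (shifted-0 i)) k)) (-‿cong (+-cong (yy-const i k) (yy-const i k)))))
        (K.solve 0 (K.con (0 , 0) K.:+ (K.:- K.con (0 , 0) K.:+ K.:- (K.con (0 , 0) K.:+ K.con (0 , 0))) K.:= K.con (0 , 0)) refl)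

      -- When two consecutive defects vanish, 𝓛 h in the next degree reduces to the z-derivative of
      -- the next defect, which is therefore constant in z; and its constant term is zero.
      h≈0 : ∀ k → (h k T.≈ T.0#) × (h (suc k) T.≈ T.0#)
      h≈0 zero = h0 , h1
      h≈0 (suc k) = p₁ , ∂-injective {h (2 ℕ.+ k)} {T.0#} (T.trans ∂h (T.sym ∂0)) (h-const (2 ℕ.+ k))
        where
        p₀ = proj₁ (h≈0 k)
        p₁ = proj₂ (h≈0 k)
        ∂0 : ∂ T.0# T.≈ T.0#
        ∂0 = ∂-const T.0# (λ _ _ → refl)
        expand : 𝓛 h (2 ℕ.+ k) T.≈ ∂ (h (2 ℕ.+ k))
        expand = T.trans (T.+-cong (Y.quadratic-⊛ Δ (D̂ h) (λ _ → T.refl) k) (Y.quadratic-⊛ Λ h (λ _ → T.refl) k))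
          (T.trans (T.+-cong (T.+-congˡ {T.1# T.* ∂ (h (2 ℕ.+ k))} (T.+-cong (T.*-congˡ {Δ 1} (T.trans (∂-cong p₁) ∂0)) (T.*-congˡ {Δ 2} (T.trans (∂-cong p₀) ∂0))))
              (T.+-congˡ {T.0# T.* h (2 ℕ.+ k)} (T.+-cong (T.*-congˡ {Λ 1} p₁) (T.*-congˡ {Λ 2} p₀))))
            (KT.solve 6 (λ x y a b c d → (KT.con (1 , 0) KT.:* x KT.:+ (a KT.:* KT.con (0 , 0) KT.:+ b KT.:* KT.con (0 , 0)))
                KT.:+ (KT.con (0 , 0) KT.:* y KT.:+ (c KT.:* KT.con (0 , 0) KT.:+ d KT.:* KT.con (0 , 0))) KT.:= x) T.refl
              (∂ (h (2 ℕ.+ k))) (h (2 ℕ.+ k)) (Δ 1) (Δ 2) (Λ 1) (Λ 2)))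
        ∂h : ∂ (h (2 ℕ.+ k)) T.≈ T.0#
        ∂h = T.trans (T.sym expand) (𝓛h k)

      -- The z-derivative of this equation is the vanishing of the defect, and no term has a
      -- constant term in z.
      tutte : ∀ k → mm (suc k) T.≈ (Y.𝕩 𝕊.* (mm 𝕊.* mm)) k T.+ 𝕦 T.* M (shifted ω k)
      tutte k = ∂-injective (T.trans (∂∫ (w (suc k))) (T.trans from-h (T.sym (T.trans (∂-+ ((Y.𝕩 𝕊.* (mm 𝕊.* mm)) k) (𝕦 T.* M (shifted ω k))) (T.+-cong (∂yy k) (T.trans (∂𝕦* (M (shifted ω k))) (T.*-congˡ {𝕦} (∂∫ (G k)))))))))
        (λ j → sym (trans (+-cong (⊛-constʳ Y.𝕩 (mm 𝕊.* mm) (⊛-const mm mm mm-const) k j) (*-constʳ 𝕦 (M (shifted ω k)) (λ _ → refl) j)) (+-identityˡ 0#)))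
        where
        module R𝕊 = RingKit 𝕊
        ∂yy : D̂ (Y.𝕩 𝕊.* (mm 𝕊.* mm)) 𝕊.≈ yy 𝕊.+ yy
        ∂yy = 𝕊.trans (∂𝕩* mm mm) (𝕊.trans (𝕊.*-congˡ {Y.𝕩} (𝕊.+-cong (𝕊.*-congʳ {mm} (λ k → ∂∫ (w k))) (𝕊.*-congˡ {mm} (λ k → ∂∫ (w k)))))
          (R𝕊.solve 3 (λ y m w → y R𝕊.:* (w R𝕊.:* m R𝕊.:+ m R𝕊.:* w) R𝕊.:= y R𝕊.:* (m R𝕊.:* w) R𝕊.:+ y R𝕊.:* (m R𝕊.:* w)) 𝕊.refl Y.𝕩 mm w))
        from-h : w (suc k) T.≈ (yy k T.+ yy k) T.+ 𝕦 T.* G k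
        from-h = T.trans (KT.solve 3 (λ x g y → x KT.:= (x KT.:+ (KT.:- g KT.:+ KT.:- y)) KT.:+ (y KT.:+ g)) T.refl (w (suc k)) (𝕦 T.* G k) (yy k T.+ yy k))
          (T.trans (T.+-congʳ (proj₁ (h≈0 k))) (T.+-identityˡ _))

-- Existence, uniqueness and polynomiality of R and S

module ImplicitSeries where

  open PowerSeriesRings
  open BivariateSeries
  open import Algebra.Bundles using (CommutativeRing)
  open import Level using (Level)
  open import Data.Nat.Base as ℕ using (ℕ; zero; suc)
  import Data.Nat.Properties as ℕ
  open import Data.Nat.Tactic.RingSolver using (solve-∀)
  open import Data.Sum using (_⊎_; inj₁; inj₂)
  open import Data.Product using (_×_; _,_; proj₁; proj₂)
  open import Relation.Nullary using (yes; no; contradiction)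
  import Relation.Binary.PropositionalEquality as ≡

  module FixedPoint {c ℓ : Level} (A : CommutativeRing c ℓ) (φ₁ φ₂ : ℕ → ℕ → CommutativeRing.Carrier A) where
    open CommutativeRing A hiding (zero)
    open Series A
    open Sums A

    umul : Ser → Ser
    umul X n zero = 0#
    umul X n (suc k) = X n k

    eqR eqS : Ser → Ser → Ser
    eqR R S = 𝕫 T.+ umul (subst R S φ₁)
    eqS R S = umul (subst R S φ₂)

    -- Equality modulo u^k. In both equations R and S occur only behind a factor u, so the
    -- right-hand sides improve agreement by one power of u; this yields uniqueness and the
    -- convergence of the iterates.
    Agree : ℕ → Ser → Ser → Set ℓ
    Agree k X Y = ∀ n j → j ℕ.< k → X n j ≈ Y n j

    agree-* : ∀ k {X X′ Y Y′} → Agree k X X′ → Agree k Y Y′ → Agree k (X T.* Y) (X′ T.* Y′)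
    agree-* k {X} {X′} {Y} {Y′} p q n j h = trans (*-ΣΣ X Y n j) (trans
      (Σ-cong n (λ i → Σ-cong≤ j (λ l l≤j → *-cong (p i l (ℕ.≤-<-trans l≤j h)) (q (n ℕ.∸ i) (j ℕ.∸ l) (ℕ.≤-<-trans (ℕ.m∸n≤m j l) h)))))
      (sym (*-ΣΣ X′ Y′ n j)))

    agree-pow : ∀ k {X X′} → Agree k X X′ → ∀ i → Agree k (pow X i) (pow X′ i)
    agree-pow k p zero n j h = refl
    agree-pow k {X} {X′} p (suc i) = agree-* k {X} {X′} p (agree-pow k p i)

    agree-subst : ∀ k {R R′ S S′} → Agree k R R′ → Agree k S S′ → ∀ c → Agree k (subst R S c) (subst R′ S′ c)
    agree-subst k {R} {R′} {S} {S′} p q c n j h = Σ-cong n (λ i → Σ-cong (n ℕ.∸ i) (λ l → *-congˡ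
      (agree-* k {pow R i} {pow R′ i} (agree-pow k p i) (agree-pow k q l) n j h)))

    agree-eqR : ∀ k {R R′ S S′} → Agree k R R′ → Agree k S S′ → Agree (suc k) (eqR R S) (eqR R′ S′)
    agree-eqR k p q n zero h = refl
    agree-eqR k p q n (suc j) (ℕ.s≤s h) = +-congˡ (agree-subst k p q φ₁ n j h)

    agree-eqS : ∀ k {R R′ S S′} → Agree k R R′ → Agree k S S′ → Agree (suc k) (eqS R S) (eqS R′ S′)
    agree-eqS k p q n zero h = refl
    agree-eqS k p q n (suc j) (ℕ.s≤s h) = agree-subst k p q φ₂ n j h

    unique : ∀ {R R′ S S′} → R T.≈ eqR R S → S T.≈ eqS R S → R′ T.≈ eqR R′ S′ → S′ T.≈ eqS R′ S′ →
      ∀ k → Agree k R R′ × Agree k S S′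
    unique r s r′ s′ zero = (λ _ _ ()) , (λ _ _ ())
    unique r s r′ s′ (suc k) with unique r s r′ s′ k
    ... | p , q = (λ n j h → trans (r n j) (trans (agree-eqR k p q n j h) (sym (r′ n j))))
                , (λ n j h → trans (s n j) (trans (agree-eqS k p q n j h) (sym (s′ n j))))

    approxR approxS : ℕ → Ser
    approxR zero = T.0#
    approxR (suc i) = eqR (approxR i) (approxS i)
    approxS zero = T.0#
    approxS (suc i) = eqS (approxR i) (approxS i)

    -- The coefficient of u^k is stable from the iterate k + 1 on, so the limit can be read off
    -- diagonally.
    solR solS : Ser
    solR n k = approxR (suc k) n k
    solS n k = approxS (suc k) n k

    agree-step : ∀ i → Agree i (approxR i) (approxR (suc i)) × Agree i (approxS i) (approxS (suc i))
    agree-step zero = (λ _ _ ()) , (λ _ _ ())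
    agree-step (suc i) with agree-step i
    ... | p , q = agree-eqR i p q , agree-eqS i p q

    agree-later : ∀ {i j} → i ℕ.≤′ j → Agree i (approxR i) (approxR j) × Agree i (approxS i) (approxS j)
    agree-later (ℕ.≤′-reflexive ≡.refl) = (λ _ _ _ → refl) , (λ _ _ _ → refl)
    agree-later (ℕ.≤′-step {j} i≤j) with agree-later i≤j | agree-step j
    ... | p , q | p′ , q′ = (λ n l h → trans (p n l h) (p′ n l (ℕ.<-≤-trans h (ℕ.≤′⇒≤ i≤j))))
                          , (λ n l h → trans (q n l h) (q′ n l (ℕ.<-≤-trans h (ℕ.≤′⇒≤ i≤j))))

    sol-agree : ∀ k → Agree k (approxR k) solR × Agree k (approxS k) solS
    sol-agree k = (λ n j h → sym (proj₁ (agree-later (ℕ.≤⇒≤′ h)) n j ℕ.≤-refl)) , (λ n j h → sym (proj₂ (agree-later (ℕ.≤⇒≤′ h)) n j ℕ.≤-refl))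

    solR-eq : solR T.≈ eqR solR solS
    solR-eq n zero = refl
    solR-eq n (suc k) = +-congˡ (agree-subst (suc k) (proj₁ (sol-agree (suc k))) (proj₂ (sol-agree (suc k))) φ₁ n k ℕ.≤-refl)

    solS-eq : solS T.≈ eqS solR solS
    solS-eq n zero = refl
    solS-eq n (suc k) = agree-subst (suc k) (proj₁ (sol-agree (suc k))) (proj₂ (sol-agree (suc k))) φ₂ n k ℕ.≤-refl

    -- With z of weight 2 and u of weight -1, every monomial of X has weight at least w.
    Graded : ℕ → Ser → Set ℓ
    Graded w X = ∀ n k → 2 ℕ.* n ℕ.< k ℕ.+ w → X n k ≈ 0#

    graded-split : ∀ {n k i j w w′} → i ℕ.≤ n → j ℕ.≤ k → 2 ℕ.* n ℕ.< k ℕ.+ (w ℕ.+ w′) →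
      (2 ℕ.* i ℕ.< j ℕ.+ w) ⊎ (2 ℕ.* (n ℕ.∸ i) ℕ.< (k ℕ.∸ j) ℕ.+ w′)
    graded-split {n} {k} {i} {j} {w} {w′} i≤n j≤k h with 2 ℕ.* i ℕ.<? j ℕ.+ w | 2 ℕ.* (n ℕ.∸ i) ℕ.<? (k ℕ.∸ j) ℕ.+ w′
    ... | yes p | _ = inj₁ p
    ... | no _ | yes q = inj₂ q
    ... | no p | no q = contradiction h (ℕ.≤⇒≯ (≡.subst₂ ℕ._≤_
        (≡.trans (shuffle j w (k ℕ.∸ j) w′) (≡.cong (ℕ._+ (w ℕ.+ w′)) (ℕ.m+[n∸m]≡n j≤k)))
        (≡.trans (≡.sym (ℕ.*-distribˡ-+ 2 i (n ℕ.∸ i))) (≡.cong (2 ℕ.*_) (ℕ.m+[n∸m]≡n i≤n)))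
        (ℕ.+-mono-≤ (ℕ.≮⇒≥ p) (ℕ.≮⇒≥ q))))
      where
      shuffle : ∀ a b c d → (a ℕ.+ b) ℕ.+ (c ℕ.+ d) ≡.≡ (a ℕ.+ c) ℕ.+ (b ℕ.+ d)
      shuffle = solve-∀

    graded-* : ∀ {w w′ X Y} → Graded w X → Graded w′ Y → Graded (w ℕ.+ w′) (X T.* Y)
    graded-* {w} {w′} {X} {Y} p q n k h = vanish X Y n k λ i j i≤n j≤k → either (graded-split {w = w} {w′} i≤n j≤k h)
      where
      either : ∀ {i j i′ j′} → (2 ℕ.* i ℕ.< j ℕ.+ w) ⊎ (2 ℕ.* i′ ℕ.< j′ ℕ.+ w′) → X i j ≈ 0# ⊎ Y i′ j′ ≈ 0#
      either (inj₁ x) = inj₁ (p _ _ x)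
      either (inj₂ y) = inj₂ (q _ _ y)

    graded-pow : ∀ {w X} → Graded w X → ∀ i → Graded (i ℕ.* w) (pow X i)
    graded-pow p zero zero zero ()
    graded-pow p zero zero (suc k) h = refl
    graded-pow p zero (suc n) k h = refl
    graded-pow {w} p (suc i) = graded-* {w} {i ℕ.* w} p (graded-pow p i)

    -- The monomial R^i S^j has weight at least 2 i + j, so the least such index with a nonzero
    -- coefficient bounds the weight of the whole.
    graded-subst : ∀ {R S} → Graded 2 R → Graded 1 S → ∀ v c → (∀ i j → 2 ℕ.* i ℕ.+ j ℕ.< v → c i j ≈ 0#) → Graded v (subst R S c)
    graded-subst {R} {S} p q v c h n k l = Σ-0 n (λ i _ → Σ-0 (n ℕ.∸ i) (λ j _ → term i j))
      where
      term : ∀ i j → c i j * monomial R S i j n k ≈ 0#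
      term i j with 2 ℕ.* i ℕ.+ j ℕ.<? v
      ... | yes a = trans (*-congʳ (h i j a)) (zeroˡ _)
      ... | no a = trans (*-congˡ (graded-* {i ℕ.* 2} {j ℕ.* 1} (graded-pow p i) (graded-pow q j) n k
        (ℕ.<-≤-trans l (ℕ.+-monoʳ-≤ k (≡.subst (v ℕ.≤_) (≡.cong₂ ℕ._+_ (ℕ.*-comm 2 i) (≡.sym (ℕ.*-identityʳ j))) (ℕ.≮⇒≥ a)))))) (zeroʳ _)

    graded-umul : ∀ {w X} → Graded (suc w) X → Graded w (umul X)
    graded-umul p n zero h = refl
    graded-umul {w} p n (suc k) h = p n k (≡.subst (2 ℕ.* n ℕ.<_) (≡.sym (ℕ.+-suc k w)) h)

    -- The thresholds 3 and 2 express that there are no trees with fewer than three leaves. The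
    -- factor u then lowers the weights 3 and 2 to 2 and 1, which are the weights assumed for R and
    -- S; z itself has weight 2. A bound on the weight bounds the degree in u of each coefficient of
    -- z^n.
    module Polynomial (φ₁-0 : ∀ i j → 2 ℕ.* i ℕ.+ j ℕ.< 3 → φ₁ i j ≈ 0#) (φ₂-0 : ∀ i j → 2 ℕ.* i ℕ.+ j ℕ.< 2 → φ₂ i j ≈ 0#) where

      graded-approx : ∀ i → Graded 2 (approxR i) × Graded 1 (approxS i)
      graded-approx zero = (λ _ _ _ → refl) , (λ _ _ _ → refl)
      graded-approx (suc i) with graded-approx i
      ... | p , q = (λ n k h → trans (+-cong (graded-𝕫 n k h) (graded-umul {2} (graded-subst p q 3 φ₁ φ₁-0) n k h)) (+-identityˡ 0#))
                  , graded-umul {1} (graded-subst p q 2 φ₂ φ₂-0)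
        where
        graded-𝕫 : Graded 2 𝕫
        graded-𝕫 0 k h = refl
        graded-𝕫 1 zero (ℕ.s≤s (ℕ.s≤s ()))
        graded-𝕫 1 (suc k) h = refl
        graded-𝕫 (suc (suc n)) k h = refl

      solR-graded : Graded 2 solR
      solR-graded n k = proj₁ (graded-approx (suc k)) n k

      solS-graded : Graded 1 solS
      solS-graded n k = proj₂ (graded-approx (suc k)) n k

-- Counting plane forests by their leaves

module ForestNumbers where

  open PowerSeriesRings
  open import Algebra.Bundles using (CommutativeRing)
  open import Level using (Level)
  open import Data.Bool using (Bool; true; false; if_then_else_)
  open import Data.Nat.Base as ℕ using (ℕ; zero; suc; _+_; _*_; _≡ᵇ_; _!)
  import Data.Nat.Properties as ℕ
  open import Data.Nat.Tactic.RingSolver using (solve-∀)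
  open import Relation.Binary.PropositionalEquality
  open import Relation.Nullary using (contradiction)

  module Forests (r : ℕ) where
    s q p : ℕ
    s = suc r
    q = suc s
    p = suc q

    -- P b l counts the plane forests of b (p-1)-ary trees with l inner nodes; such a forest has s l + b leaves.
    P : ℕ → ℕ → ℕ
    P b zero = 1
    P zero (suc l) = 0
    P (suc b) (suc l) = P b (suc l) + P (b + q) l

    private
      step : ∀ b l → P b (suc l) * (suc l ! * (s * suc l + b) !) ≡ b * (q * l + (b + s)) ! →
        P (b + q) l * (l ! * (s * l + (b + q)) !) ≡ (b + q) * (q * l + (b + s)) ! →
        P (suc b) (suc l) * (suc l ! * (s * suc l + suc b) !) ≡ suc b * (q * suc l + b) !
      step b l first second = begin
        (P b (suc l) + P (b + q) l) * (suc l ! * (s * suc l + suc b) !)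
          ≡⟨ cong (λ x → (P b (suc l) + P (b + q) l) * (suc l ! * x)) (cong _! (ℕ.+-suc (s * suc l) b)) ⟩
        (P b (suc l) + P (b + q) l) * ((suc l * l !) * (suc E * E !))
          ≡⟨ rearrange (P b (suc l)) (P (b + q) l) (suc l) (l !) (suc E) (E !) ⟩
        (P b (suc l) * ((suc l * l !) * E !)) * suc E + (P (b + q) l * (l ! * (suc E * E !))) * suc l
          ≡⟨ cong₂ (λ x y → x * suc E + y * suc l) first (trans (cong (λ x → P (b + q) l * (l ! * x !)) (sym (idx b r l))) second) ⟩
        (b * A) * suc E + ((b + q) * A) * suc l
          ≡⟨ final b r l A ⟩
        suc b * ((suc (q * l + (b + s))) * A)
          ≡⟨ cong (suc b *_) (cong _! (top b r l)) ⟩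
        suc b * (q * suc l + b) ! ∎
        where
        open ≡-Reasoning
        E = s * suc l + b
        A = (q * l + (b + s)) !
        rearrange : ∀ x y a f e g → (x + y) * ((a * f) * (e * g)) ≡ (x * ((a * f) * g)) * e + (y * (f * (e * g))) * a
        rearrange = solve-∀
        idx : ∀ b r l → suc r * l + (b + suc (suc r)) ≡ suc (suc r * suc l + b)
        idx = solve-∀
        final : ∀ b r l A → (b * A) * suc (suc r * suc l + b) + ((b + suc (suc r)) * A) * suc l ≡ suc b * ((suc (suc (suc r) * l + (b + suc r))) * A)
        final = solve-∀
        top : ∀ b r l → suc (suc (suc r) * l + (b + suc r)) ≡ suc (suc r) * suc l + b
        top = solve-∀

    -- The Raney numbers b/(q l + b) · binomial(q l + b, l), with denominators cleared and b
    -- replaced by b + 1. The formula satisfies the defining recurrence of `P`, which is checked by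
    -- `step`.
    P-closed : ∀ b l → P (suc b) l * (l ! * (s * l + suc b) !) ≡ suc b * (q * l + b) !
    P-closed b zero rewrite ℕ.*-zeroʳ r = trans (ℕ.*-identityˡ _) (ℕ.*-identityˡ _)
    P-closed zero (suc l) = step 0 l refl (P-closed s l)
    P-closed (suc b) (suc l) = step (suc b) l (trans (P-closed b (suc l)) (cong (λ x → suc b * x !) (idx b r l)))
      (subst (λ x → P x l * (l ! * (s * l + x) !) ≡ x * (q * l + (suc b + s)) !) (sym (ℕ.+-suc (suc b) s)) (P-closed (suc b + s) l))
      where
      idx : ∀ b r l → suc (suc r) * suc l + b ≡ suc (suc r) * l + (suc b + suc r)
      idx = solve-∀

    module Over {c ℓ : Level} (R : CommutativeRing c ℓ) where
      open CommutativeRing R using (Carrier; _≈_; 0#; +-cong; +-congʳ; +-congˡ; +-identityʳ; +-identityˡ)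
        renaming (_+_ to _⊞_; refl to ≈-refl; sym to ≈-sym; trans to ≈-trans; reflexive to ≈-reflexive)
      open RingKit R using (ι; ι-+)
      open Sums R

      sel : Bool → Carrier → Carrier
      sel x v = if x then v else 0#

      -- The number of plane forests of b trees with k leaves. It specialises to t_{k+1} for b = q,
      -- a leaf-rooted tree without its root leaf, and to t^c_k for b = p. Summing over l ≤ k
      -- suffices since s ≥ 1.
      ω : ℕ → ℕ → Carrier
      ω b k = Σ≤ k (λ l → sel ((s * l + b) ≡ᵇ k) (ι (P b l)))

      ≡ᵇ-no : ∀ {m n} → m ≢ n → (m ≡ᵇ n) ≡ false
      ≡ᵇ-no {zero} {zero} h = contradiction refl h
      ≡ᵇ-no {zero} {suc n} h = refl
      ≡ᵇ-no {suc m} {zero} h = refl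
      ≡ᵇ-no {suc m} {suc n} h = ≡ᵇ-no {m} {n} (λ e → h (cong suc e))

      big : ∀ {k l} b → k ℕ.< l → (s * l + b) ≢ k
      big {k} {l} b h e = ℕ.<⇒≢ (ℕ.<-≤-trans h (ℕ.≤-trans (ℕ.m≤m+n l (r * l)) (ℕ.m≤m+n (s * l) b))) (sym e)

      ω-extend : ∀ b k → Σ≤ (suc k) (λ l → sel ((s * l + b) ≡ᵇ k) (ι (P b l))) ≈ ω b k
      ω-extend b k = Σ-extend (ℕ.n≤1+n k) _ (λ l h → ≈-reflexive (cong (λ x → sel x (ι (P b l))) (≡ᵇ-no (big b h))))

      ω-zero : ∀ k → k ≢ 0 → ω 0 k ≈ 0#
      ω-zero zero h = contradiction refl h
      ω-zero (suc k) h = Σ-0 (suc k) term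
        where
        term : ∀ l → l ℕ.≤ suc k → sel ((s * l + 0) ≡ᵇ suc k) (ι (P 0 l)) ≈ 0#
        term zero _ rewrite ℕ.*-zeroʳ r = ≈-refl
        term (suc l) _ with (s * suc l + 0) ≡ᵇ suc k
        ... | true = ≈-refl
        ... | false = ≈-refl

      ω-low : ∀ b k → k ℕ.< b → ω b k ≈ 0#
      ω-low b k h = Σ-0 k (λ l _ → ≈-reflexive (cong (λ x → sel x (ι (P b l))) (≡ᵇ-no (λ e → ℕ.<⇒≢ (ℕ.<-≤-trans h (ℕ.m≤n+m b (s * l))) (sym e)))))

      -- Either the first tree is a leaf, or its root has q children.
      ω-suc : ∀ b k → ω (suc b) (suc k) ≈ ω b k ⊞ ω (b + q) (suc k)
      ω-suc b k = ≈-trans (Σ-suc k _) (≈-trans (+-cong (≈-reflexive (head b k)) (≈-trans (Σ-cong k term) (Σ-+ k _ _)))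
        (≈-trans assoc (+-cong (≈-trans (≈-sym (Σ-suc k _)) (ω-extend b k)) (≈-sym tail-part))))
        where
        f g : ℕ → Carrier
        f l = sel ((s * suc l + b) ≡ᵇ k) (ι (P b (suc l)))
        g l = sel ((s * l + (b + q)) ≡ᵇ suc k) (ι (P (b + q) l))
        head : ∀ b k → sel ((s * 0 + suc b) ≡ᵇ suc k) (ι (P (suc b) 0)) ≡ sel ((s * 0 + b) ≡ᵇ k) (ι (P b 0))
        head b k = cong (λ x → sel (x ≡ᵇ suc k) (ι 1)) (ℕ.+-suc (s * 0) b)
        idx : ∀ l b r → suc r * suc l + suc b ≡ suc r * l + (b + suc (suc r))
        idx = solve-∀
        idx′ : ∀ l → (s * l + (b + q)) ≡ suc (s * suc l + b)
        idx′ l = trans (sym (idx l b r)) (ℕ.+-suc (s * suc l) b)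
        sel-+ : ∀ x m n → sel x (ι (m + n)) ≈ sel x (ι m) ⊞ sel x (ι n)
        sel-+ true m n = ι-+ m n
        sel-+ false m n = ≈-sym (+-identityʳ 0#)
        term : ∀ l → sel ((s * suc l + suc b) ≡ᵇ suc k) (ι (P (suc b) (suc l))) ≈ f l ⊞ g l
        term l = ≈-trans (≈-reflexive (cong (λ x → sel (x ≡ᵇ suc k) (ι (P (suc b) (suc l)))) (ℕ.+-suc (s * suc l) b)))
          (≈-trans (sel-+ ((s * suc l + b) ≡ᵇ k) (P b (suc l)) (P (b + q) l))
            (+-congˡ (≈-reflexive (cong (λ x → sel (x ≡ᵇ suc k) (ι (P (b + q) l))) (sym (idx′ l))))))
        assoc = ≈-sym (CommutativeRing.+-assoc R _ _ _)
        tail-part : ω (b + q) (suc k) ≈ Σ≤ k g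
        tail-part = Σ-extend (ℕ.n≤1+n k) g (λ l h → ≈-reflexive (cong (λ x → sel x (ι (P (b + q) l))) (≡ᵇ-no λ e → big b (ℕ.m≤n⇒m≤1+n h) (ℕ.suc-injective (trans (sym (idx′ l)) e)))))

-- Words that encode explorations without handles

module ExplorationWords where

  open import Data.Nat.Base using (ℕ; zero; suc; _+_; _*_; _∸_; _≤_; _<_; z≤n; s≤s)
  import Data.Nat.Properties as ℕ
  open import Data.Nat.Tactic.RingSolver using (solve-∀)
  open import Data.Nat.ListAction using (sum)
  open import Data.List.Base using (List; []; _∷_; _++_; map; length)
  open import Relation.Binary.PropositionalEquality

  data Step : Set where
    nil mark fnew unew bad : Step
    loop : ℕ → Step

  Word : Set
  Word = List Step

  cat : ℕ → (ℕ → List Word) → List Word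
  cat zero g = []
  cat (suc a) g = cat a g ++ g a

  module Enumerate (q′ : ℕ) where
    q : ℕ
    q = suc q′

    -- The words of at most n steps that explore a planar configuration with b darts of undetermined status and
    -- a non-forest darts on the current contour and pending contours of lengths L, find f faces and open k trees.
    words : ℕ → ℕ → ℕ → List ℕ → ℕ → ℕ → List Word
    loops : ℕ → ℕ → List ℕ → ℕ → ℕ → ℕ → List Word
    words zero b a L f k = []
    words (suc n) (suc b) a L f k = map (mark ∷_) (words n b (suc a) L f k) ++ map (fnew ∷_) (words n (b + q) a L f k)
    words (suc n) zero zero L zero k = []
    -- The last empty contour closes the last face, so exactly one face and no further tree must
    -- remain to be counted.
    words (suc n) zero zero [] (suc zero) zero = (nil ∷ []) ∷ []
    words (suc n) zero zero [] (suc zero) (suc k) = []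
    words (suc n) zero zero [] (suc (suc f)) k = []
    words (suc n) zero zero (l ∷ L) (suc f) k = map (nil ∷_) (words n 0 l L f k)
    words (suc n) zero (suc a) L f zero = cat a (loops n a L f 0)
    words (suc n) zero (suc a) L f (suc k) = cat a (loops n a L f (suc k)) ++ map (unew ∷_) (words n q a L f k)
    -- The first dart of the contour is joined to the one at position i among the a others, which
    -- cuts the contour into pieces of i and a - 1 - i darts.
    loops n a L f k i = map (loop i ∷_) (words n 0 i (a ∸ suc i ∷ L) f k)

    -- Each face not yet found needs two units: this is twice the least number of faces of a configuration.
    need : ℕ → ℕ → List ℕ → ℕ
    need b a L = b + a + sum L + 2 * suc (length L)

    need-loop : ∀ a i L → i < a → need 0 i (a ∸ suc i ∷ L) ≡ need 0 (suc a) L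
    need-loop a i L h = trans (lem i (a ∸ suc i) (sum L) (length L)) (cong (λ x → suc x + sum L + 2 * suc (length L)) (ℕ.m+[n∸m]≡n h))
      where
      lem : ∀ i j s l → 0 + i + (j + s) + 2 * suc (suc l) ≡ suc (suc i + j) + s + 2 * suc l
      lem = solve-∀

    need-nil : ∀ l s m → l + s + 2 * suc (suc m) ≡ 2 + (l + s + 2 * suc m)
    need-nil = solve-∀

    cat-[] : ∀ a {g} → (∀ i → i < a → g i ≡ []) → cat a g ≡ []
    cat-[] zero h = refl
    cat-[] (suc a) h rewrite cat-[] a (λ i p → h i (ℕ.m<n⇒m<1+n p)) = h a ℕ.≤-refl

    -- No step increases 2 f minus `need`: closing a face lowers both terms by 2, a loop trades two
    -- darts for a contour, marking changes nothing and a new vertex only adds darts.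
    words-[] : ∀ n b a L f k → 2 * f < need b a L → words n b a L f k ≡ []
    words-[] zero b a L f k h = refl
    words-[] (suc n) (suc b) a L f k h
      rewrite words-[] n b (suc a) L f k (subst (λ x → 2 * f < x + sum L + 2 * suc (length L)) (sym (ℕ.+-suc b a)) h)
            | words-[] n (b + q) a L f k (ℕ.≤-trans h (ℕ.+-monoˡ-≤ (2 * suc (length L)) (ℕ.+-monoˡ-≤ (sum L) (ℕ.+-monoˡ-≤ a
                (subst (suc b ≤_) (sym (ℕ.+-suc b q′)) (s≤s (ℕ.m≤m+n b q′))))))) = refl
    words-[] (suc n) zero zero L zero k h = refl
    words-[] (suc n) zero zero [] (suc zero) zero (s≤s (s≤s ()))
    words-[] (suc n) zero zero [] (suc zero) (suc k) h = refl
    words-[] (suc n) zero zero [] (suc (suc f)) k h = refl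
    words-[] (suc n) zero zero (l ∷ L) (suc f) k h
      rewrite words-[] n 0 l L f k (ℕ.+-cancelˡ-< 2 (2 * f) (need 0 l L) (subst₂ _<_ (ℕ.*-suc 2 f) (need-nil l (sum L) (length L)) h)) = refl
    words-[] (suc n) zero (suc a) L f zero h = cat-[] a (λ i p → cong (map (loop i ∷_)) (words-[] n 0 i (a ∸ suc i ∷ L) f 0 (subst (2 * f <_) (sym (need-loop a i L p)) h)))
    words-[] (suc n) zero (suc a) L f (suc k) h
      rewrite cat-[] a {loops n a L f (suc k)} (λ i p → cong (map (loop i ∷_)) (words-[] n 0 i (a ∸ suc i ∷ L) f (suc k) (subst (2 * f <_) (sym (need-loop a i L p)) h)))
            | words-[] n q a L f k (ℕ.≤-trans h (ℕ.+-monoˡ-≤ (2 * suc (length L)) (ℕ.+-monoˡ-≤ (sum L) (s≤s (ℕ.m≤n+m a q′))))) = refl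

    -- Abstract because its unfolding is very large.
    abstract
      codes : ℕ → ℕ → ℕ → List Word
      codes b f k = words (8 * f + (2 * b + 1)) b 0 [] f k

      codes-words : ∀ b f k → codes b f k ≡ words (8 * f + (2 * b + 1)) b 0 [] f k
      codes-words b f k = refl

    codes-[] : ∀ b k → codes b 0 k ≡ []
    codes-[] b k = trans (codes-words b 0 k) (words-[] (8 * 0 + (2 * b + 1)) b 0 [] 0 k (ℕ.<-≤-trans (s≤s z≤n) (ℕ.m≤n+m 2 (b + 0 + 0))))

-- The generating function of the words

module WordCount where

  open PowerSeriesRings
  open BivariateSeries
  open TutteEquation
  open ForestNumbers
  open ExplorationWords
  open import Algebra.Bundles using (CommutativeRing)
  open import Level using (Level)
  open import Data.Nat.Base as ℕ using (ℕ; zero; suc)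
  import Data.Nat.Properties as ℕ
  open import Data.Nat.Tactic.RingSolver using (solve-∀)
  open import Data.Nat.ListAction using (sum)
  open import Data.List.Base using (List; []; _∷_; _++_; map; length)
  import Data.List.Properties as List
  open import Data.Sum using (_⊎_; inj₁; inj₂)
  open import Relation.Nullary using (yes; no; contradiction)
  import Relation.Binary.PropositionalEquality as ≡
  open ≡ using (_≡_)
  import Relation.Binary.Reasoning.Setoid

  module Counting {c ℓ : Level} (A : CommutativeRing c ℓ) (MM : Trinomials A) (r : ℕ)
    (R S : ℕ → ℕ → CommutativeRing.Carrier A)
    (R0 : ∀ k → CommutativeRing._≈_ A (R 0 k) (CommutativeRing.0# A))
    (S0 : ∀ k → CommutativeRing._≈_ A (S 0 k) (CommutativeRing.0# A)) where
    open CommutativeRing A hiding (zero)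
    open Trinomials MM using (inv)
    open Series A
    open K using (ι; ι-+)
    open Sums A
    open Weighted A MM R S R0 S0
    open Forests r using (s; q; p; P)
    open Forests.Over r A
    open Enumerate s using (words; loops; need; need-loop; words-[]; codes; codes-words)

    ∫-cong : ∀ {X Y} → X T.≈ Y → ∫ X T.≈ ∫ Y
    ∫-cong h zero k = refl
    ∫-cong h (suc n) k = *-congˡ (h n k)

    M-cong : ∀ {τ σ} → (∀ k → τ k ≈ σ k) → M τ T.≈ M σ
    M-cong h = ∫-cong (B-cong h)

    M-+ : ∀ τ σ → M (λ k → τ k + σ k) T.≈ M τ T.+ M σ
    M-+ τ σ zero k = sym (+-identityˡ 0#)
    M-+ τ σ (suc n) k = trans (*-congˡ (B-+ τ σ n k)) (distribˡ _ _ _)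

    -- The b undetermined darts grow into a forest of b trees; if it has k leaves, the contour ends
    -- up with k + a marked darts.
    contour : ℕ → ℕ → Ser
    contour b a = M (shifted (ω b) a)

    contour-zero : ∀ a → contour 0 a T.≈ mm a
    contour-zero a = M-cong (shifted-cong a ω0)
      where
      ω0 : ∀ k → ω 0 k ≈ δ₀ k
      ω0 zero rewrite ℕ.*-zeroʳ r = +-identityʳ 1#
      ω0 (suc k) = ω-zero (suc k) (λ ())
      shifted-cong : ∀ a {τ σ} → (∀ k → τ k ≈ σ k) → ∀ k → shifted τ a k ≈ shifted σ a k
      shifted-cong zero h = h
      shifted-cong (suc a) h = ↑-cong (shifted-cong a h)

    -- The alternative in `ω-suc` for the first tree, a leaf or a node, is the choice between the
    -- steps `mark` and `fnew`.
    contour-suc : ∀ b a → contour (suc b) a T.≈ contour b (suc a) T.+ contour (b ℕ.+ q) a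
    contour-suc b a = T.trans (M-cong (weights a)) (M-+ (shifted (ω b) (suc a)) (shifted (ω (b ℕ.+ q)) a))
      where
      weights : ∀ a k → shifted (ω (suc b)) a k ≈ shifted (ω b) (suc a) k + shifted (ω (b ℕ.+ q)) a k
      weights zero zero = trans (ω-low (suc b) 0 (ℕ.s≤s ℕ.z≤n))
        (sym (trans (+-congˡ (ω-low (b ℕ.+ q) 0 (≡.subst (0 ℕ.<_) (≡.sym (ℕ.+-suc b s)) (ℕ.s≤s ℕ.z≤n)))) (+-identityˡ 0#)))
      weights zero (suc k) = ω-suc b k
      weights (suc a) zero = sym (+-identityˡ 0#)
      weights (suc a) (suc k) = weights a k

    shifted-low : ∀ b a k → k ℕ.< b ℕ.+ a → shifted (ω b) a k ≈ 0#
    shifted-low b zero k h = ω-low b k (≡.subst (k ℕ.<_) (ℕ.+-identityʳ b) h)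
    shifted-low b (suc a) zero h = refl
    shifted-low b (suc a) (suc k) h = shifted-low b a k (ℕ.s≤s⁻¹ (≡.subst (suc k ℕ.<_) (ℕ.+-suc b a) h))

    -- Order in z at least v/2: in `need` a face counts two units, while a dart counts one.
    Valuation : ℕ → Ser → Set ℓ
    Valuation v X = ∀ n k → 2 ℕ.* n ℕ.< v → X n k ≈ 0#

    -- A term R^i S^j has z-order at least i + j and zero weight when 2 i + j < b + a; the extra 2
    -- comes from the integration.
    contour-val : ∀ b a → Valuation (b ℕ.+ a ℕ.+ 2) (contour b a)
    contour-val b a zero k h = refl
    contour-val b a (suc n) k h = trans (*-congˡ (Σ-0 n λ i i≤n → Σ-0 (n ℕ.∸ i) λ j j≤ → trans (*-congʳ (trans (*-congʳ
        (shifted-low b a (2 ℕ.* i ℕ.+ j) (ℕ.≤-<-trans (bound i j i≤n j≤) small))) (zeroˡ _))) (zeroˡ _))) (zeroʳ _)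
      where
      small : 2 ℕ.* n ℕ.< b ℕ.+ a
      small = ℕ.+-cancelˡ-< 2 (2 ℕ.* n) (b ℕ.+ a) (≡.subst₂ ℕ._<_ (ℕ.*-suc 2 n) (ℕ.+-comm (b ℕ.+ a) 2) h)
      bound : ∀ i j → i ℕ.≤ n → j ℕ.≤ n ℕ.∸ i → 2 ℕ.* i ℕ.+ j ℕ.≤ 2 ℕ.* n
      bound i j p q′ = ℕ.≤-trans (ℕ.+-mono-≤ (ℕ.≤-refl {2 ℕ.* i}) (ℕ.≤-trans q′ (ℕ.m≤n*m (n ℕ.∸ i) 2)))
        (ℕ.≤-reflexive (≡.trans (≡.sym (ℕ.*-distribˡ-+ 2 i (n ℕ.∸ i))) (≡.cong (2 ℕ.*_) (ℕ.m+[n∸m]≡n p))))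

    *-val : ∀ {v w X Y} → Valuation v X → Valuation w Y → Valuation (v ℕ.+ w) (X T.* Y)
    *-val {v} {w} {X} {Y} p p′ n k h = vanish X Y n k λ i j i≤n _ → case i i≤n (2 ℕ.* i ℕ.<? v)
      where
      case : ∀ i {j} → i ℕ.≤ n → _ → X i j ≈ 0# ⊎ Y (n ℕ.∸ i) (k ℕ.∸ j) ≈ 0#
      case i {j} _ (yes a) = inj₁ (p i j a)
      case i {j} i≤n (no a) = inj₂ (p′ (n ℕ.∸ i) (k ℕ.∸ j) (ℕ.+-cancelˡ-< v (2 ℕ.* (n ℕ.∸ i)) w (ℕ.≤-<-trans (ℕ.+-monoˡ-≤ (2 ℕ.* (n ℕ.∸ i)) (ℕ.≮⇒≥ a))
        (≡.subst (ℕ._< v ℕ.+ w) (≡.trans (≡.cong (2 ℕ.*_) (≡.sym (ℕ.m+[n∸m]≡n i≤n))) (ℕ.*-distribˡ-+ 2 i (n ℕ.∸ i))) h))))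

    pending : List ℕ → Ser
    pending [] = T.1#
    pending (l ∷ L) = mm l T.* pending L

    -- Without handles the contours never interact, so a configuration is counted by the product
    -- over its contours.
    config : ℕ → ℕ → List ℕ → Ser
    config b a L = contour b a T.* pending L

    mm-val : ∀ a → Valuation (a ℕ.+ 2) (mm a)
    mm-val a n k h = trans (sym (contour-zero a n k)) (contour-val 0 a n k h)

    pending-val : ∀ L → Valuation (sum L ℕ.+ 2 ℕ.* length L) (pending L)
    pending-val [] n k ()
    pending-val (l ∷ L) n k h = *-val {l ℕ.+ 2} {sum L ℕ.+ 2 ℕ.* length L} (mm-val l) (pending-val L) n k (≡.subst (2 ℕ.* n ℕ.<_) (lem l (sum L) (length L)) h)
      where
      lem : ∀ l s m → l ℕ.+ s ℕ.+ 2 ℕ.* suc m ≡ l ℕ.+ 2 ℕ.+ (s ℕ.+ 2 ℕ.* m)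
      lem = solve-∀

    config-val : ∀ b a L → Valuation (need b a L) (config b a L)
    config-val b a L n k h = *-val {b ℕ.+ a ℕ.+ 2} {sum L ℕ.+ 2 ℕ.* length L} (contour-val b a) (pending-val L) n k (≡.subst (2 ℕ.* n ℕ.<_) (lem b a (sum L) (length L)) h)
      where
      lem : ∀ b a s m → b ℕ.+ a ℕ.+ s ℕ.+ 2 ℕ.* suc m ≡ b ℕ.+ a ℕ.+ 2 ℕ.+ (s ℕ.+ 2 ℕ.* m)
      lem = solve-∀

    config-suc : ∀ b a L → config (suc b) a L T.≈ config b (suc a) L T.+ config (b ℕ.+ q) a L
    config-suc b a L = T.trans (T.*-congʳ {pending L} (contour-suc b a)) (T.distribʳ (pending L) (contour b (suc a)) (contour (b ℕ.+ q) a))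

    𝕫≈𝕩 : 𝕫 T.≈ Z.𝕩
    𝕫≈𝕩 0 k = refl
    𝕫≈𝕩 1 zero = refl
    𝕫≈𝕩 1 (suc k) = refl
    𝕫≈𝕩 (suc (suc n)) k = refl

    config-00 : ∀ L → config 0 0 L T.≈ 𝕫 T.* pending L
    config-00 L = T.*-congʳ {pending L} (T.trans (contour-zero 0) M-0)

    𝕫*-zero : ∀ X k → (𝕫 T.* X) 0 k ≈ 0#
    𝕫*-zero X k = *-const 𝕫 X (λ _ → refl) k

    𝕫*-suc : ∀ X n k → (𝕫 T.* X) (suc n) k ≈ X n k
    𝕫*-suc X n k = trans (T.*-congʳ {X} 𝕫≈𝕩 (suc n) k) (Z.𝕩-⊛-suc X n k)

    ι-cat : ∀ a g (F : ℕ → Ser) f k → (∀ i → i ℕ.≤ a → ι (length (g i)) ≈ F i f k) → ι (length (cat (suc a) g)) ≈ ΣT.Σ≤ a F f k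
    ι-cat zero g F f k h = h 0 ℕ.z≤n
    ι-cat (suc a) g F f k h = trans (reflexive (≡.cong ι (List.length-++ (cat (suc a) g)))) (trans (ι-+ (length (cat (suc a) g)) (length (g (suc a))))
      (+-cong (ι-cat a g F f k (λ i p → h i (ℕ.m≤n⇒m≤1+n p))) (h (suc a) ℕ.≤-refl)))

    ι-map : ∀ (x : Step) ws → ι (length (map (x ∷_) ws)) ≈ ι (length ws)
    ι-map x ws = reflexive (≡.cong ι (List.length-map (x ∷_) ws))

    ι-++ : ∀ (xs ys : List Word) → ι (length (xs ++ ys)) ≈ ι (length xs) + ι (length ys)
    ι-++ xs ys = trans (reflexive (≡.cong ι (List.length-++ xs))) (ι-+ (length xs) (length ys))

    module Solved
      (R≈ : R T.≈ 𝕫 T.+ 𝕦 T.* (R T.* A₁ (ω q))) (S≈ : S T.≈ 𝕦 T.* B (ω q)) where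
      open Solution (ω q) (ω-low q 0 (ℕ.s≤s ℕ.z≤n)) R≈ S≈ using (tutte)

      config-loops : ∀ a L → config 0 (suc (suc a)) L T.≈ ΣT.Σ≤ a (λ i → config 0 i (a ℕ.∸ i ∷ L)) T.+ 𝕦 T.* config q (suc a) L
      config-loops a L = T.trans (T.*-congʳ {pending L} (T.trans (contour-zero (suc (suc a))) (tutte (suc a))))
        (T.trans (T.distribʳ (pending L) _ _) (T.+-cong loops-part (T.*-assoc 𝕦 (contour q (suc a)) (pending L))))
        where
        loops-part : (Y.𝕩 𝕊.* (mm 𝕊.* mm)) (suc a) T.* pending L T.≈ ΣT.Σ≤ a (λ i → config 0 i (a ℕ.∸ i ∷ L))
        loops-part = T.trans (T.*-congʳ {pending L} (T.trans (Y.𝕩-⊛-suc (mm 𝕊.* mm) a) (Y.⊛-Σ a mm mm)))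
          (T.trans (T.*-comm (ΣT.Σ≤ a (λ i → mm i T.* mm (a ℕ.∸ i))) (pending L)) (T.trans (ΣT.Σ-* a (pending L) (λ i → mm i T.* mm (a ℕ.∸ i)))
            (ΣT.Σ-cong a (λ i → T.trans (T.*-comm (pending L) (mm i T.* mm (a ℕ.∸ i))) (T.trans (T.*-assoc (mm i) (mm (a ℕ.∸ i)) (pending L))
              (T.*-congʳ {mm (a ℕ.∸ i) T.* pending L} (T.sym (contour-zero i))))))))

      config-1 : ∀ L → config 0 1 L T.≈ 𝕦 T.* config q 0 L
      config-1 L = T.trans (T.*-congʳ {pending L} (T.trans (contour-zero 1) (T.trans (tutte 0) (T.trans (T.+-congʳ (T.zeroˡ ((mm 𝕊.* mm) 0))) (T.+-identityˡ _)))))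
        (T.*-assoc 𝕦 (contour q 0) (pending L))

      size : ℕ → ℕ → List ℕ → ℕ
      size b a L = 2 ℕ.* b ℕ.+ a ℕ.+ sum L ℕ.+ suc (length L)

      -- Φ is the surplus of 2 f over `need`. A new vertex lowers Φ by s and raises `size` by 2 s or
      -- 2 s + 1, which is less than 4 s; any other step keeps Φ and lowers `size` by one. Hence 4 Φ
      -- + `size` strictly decreases and bounds the fuel required.
      count : ∀ n Φ b a L f k → need b a L ℕ.+ Φ ≡ 2 ℕ.* f → 4 ℕ.* Φ ℕ.+ size b a L ℕ.≤ n → ι (length (words n b a L f k)) ≈ config b a L f k

      -- A step discovering a vertex adds s = p − 2 darts to the contours.
      count-new : ∀ n Φ b a b′ a′ L f k → need b′ a′ L ≡ need b a L ℕ.+ s → need b a L ℕ.+ Φ ≡ 2 ℕ.* f →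
        (∀ Φ′ → Φ ≡ s ℕ.+ Φ′ → 4 ℕ.* Φ′ ℕ.+ size b′ a′ L ℕ.≤ n) → ι (length (words n b′ a′ L f k)) ≈ config b′ a′ L f k
      count-new n Φ b a b′ a′ L f k e h le with s ℕ.≤? Φ
      ... | yes s≤Φ = count n (Φ ℕ.∸ s) b′ a′ L f k
              (≡.trans (≡.cong (ℕ._+ (Φ ℕ.∸ s)) e) (≡.trans (ℕ.+-assoc (need b a L) s (Φ ℕ.∸ s)) (≡.trans (≡.cong (need b a L ℕ.+_) (ℕ.m+[n∸m]≡n s≤Φ)) h)))
              (le (Φ ℕ.∸ s) (≡.sym (ℕ.m+[n∸m]≡n s≤Φ)))
      -- There is no room for another vertex: the list of words is empty, and the series vanishes at
      -- this order by its valuation.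
      ... | no s≰Φ = trans (reflexive (≡.cong (λ x → ι (length x)) (words-[] n b′ a′ L f k small))) (sym (config-val b′ a′ L f k small))
        where
        small : 2 ℕ.* f ℕ.< need b′ a′ L
        small = ≡.subst₂ ℕ._<_ h (≡.sym e) (ℕ.+-monoʳ-< (need b a L) (ℕ.≰⇒> s≰Φ))

      count zero Φ b a L f k h le = contradiction (ℕ.≤-trans (ℕ.m≤n+m (size b a L) (4 ℕ.* Φ)) le) (≡.subst (ℕ._≰ 0) (≡.sym (ℕ.+-suc (2 ℕ.* b ℕ.+ a ℕ.+ sum L) (length L))) λ ())
      count (suc n) Φ (suc b) a L f k h le = trans (ι-++ (map (mark ∷_) (words n b (suc a) L f k)) (map (fnew ∷_) (words n (b ℕ.+ q) a L f k)))
        (trans (+-cong (trans (ι-map mark (words n b (suc a) L f k)) marked) (trans (ι-map fnew (words n (b ℕ.+ q) a L f k)) new)) (sym (config-suc b a L f k)))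
        where
        marked : ι (length (words n b (suc a) L f k)) ≈ config b (suc a) L f k
        marked = count n Φ b (suc a) L f k (≡.trans (≡.cong (λ x → x ℕ.+ sum L ℕ.+ 2 ℕ.* suc (length L) ℕ.+ Φ) (ℕ.+-suc b a)) h)
          (ℕ.s≤s⁻¹ (≡.subst (ℕ._≤ suc n) (lem Φ b a (sum L) (length L)) le))
          where
          lem : ∀ Φ b a s l → 4 ℕ.* Φ ℕ.+ (2 ℕ.* suc b ℕ.+ a ℕ.+ s ℕ.+ suc l) ≡ suc (4 ℕ.* Φ ℕ.+ (2 ℕ.* b ℕ.+ suc a ℕ.+ s ℕ.+ suc l))
          lem = solve-∀
        new : ι (length (words n (b ℕ.+ q) a L f k)) ≈ config (b ℕ.+ q) a L f k
        new = count-new n Φ (suc b) a (b ℕ.+ q) a L f k (lem b a r (sum L) (length L)) h le′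
          where
          lem : ∀ b a r s l → b ℕ.+ suc (suc r) ℕ.+ a ℕ.+ s ℕ.+ 2 ℕ.* suc l ≡ suc b ℕ.+ a ℕ.+ s ℕ.+ 2 ℕ.* suc l ℕ.+ suc r
          lem = solve-∀
          lem′ : ∀ Φ b a r s l → 4 ℕ.* (suc r ℕ.+ Φ) ℕ.+ (2 ℕ.* suc b ℕ.+ a ℕ.+ s ℕ.+ suc l) ≡ suc (4 ℕ.* Φ ℕ.+ (2 ℕ.* (b ℕ.+ suc (suc r)) ℕ.+ a ℕ.+ s ℕ.+ suc l) ℕ.+ suc (r ℕ.+ r))
          lem′ = solve-∀
          le′ : ∀ Φ′ → Φ ≡ s ℕ.+ Φ′ → 4 ℕ.* Φ′ ℕ.+ size (b ℕ.+ q) a L ℕ.≤ n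
          le′ Φ′ ≡.refl = ℕ.m+n≤o⇒m≤o _ (ℕ.s≤s⁻¹ (≡.subst (ℕ._≤ suc n) (lem′ Φ′ b a r (sum L) (length L)) le))
      count (suc n) Φ zero zero L zero k h le = sym (trans (config-00 L 0 k) (𝕫*-zero (pending L) k))
      count (suc n) Φ zero zero [] (suc zero) zero h le = trans (+-identityʳ 1#) (sym (trans (config-00 [] 1 0) (𝕫*-suc T.1# 0 0)))
      count (suc n) Φ zero zero [] (suc zero) (suc k) h le = sym (trans (config-00 [] 1 (suc k)) (𝕫*-suc T.1# 0 (suc k)))
      count (suc n) Φ zero zero [] (suc (suc f)) k h le = sym (trans (config-00 [] (suc (suc f)) k) (𝕫*-suc T.1# (suc f) k))
      count (suc n) Φ zero zero (l ∷ L) (suc f) k h le = trans (ι-map nil (words n 0 l L f k)) (trans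
        (count n Φ 0 l L f k (ℕ.+-cancelˡ-≡ 2 _ _ (≡.trans (≡.trans (≡.sym (lem l (sum L) (length L) Φ)) h) (ℕ.*-suc 2 f)))
          (ℕ.s≤s⁻¹ (≡.subst (ℕ._≤ suc n) (lem′ Φ l (sum L) (length L)) le)))
        (sym (trans (config-00 (l ∷ L) (suc f) k) (trans (𝕫*-suc (pending (l ∷ L)) f k) (T.*-congʳ {pending L} (T.sym (contour-zero l)) f k)))))
        where
        lem : ∀ l s m Φ → (l ℕ.+ s) ℕ.+ 2 ℕ.* suc (suc m) ℕ.+ Φ ≡ 2 ℕ.+ (l ℕ.+ s ℕ.+ 2 ℕ.* suc m ℕ.+ Φ)
        lem = solve-∀
        lem′ : ∀ Φ l s m → 4 ℕ.* Φ ℕ.+ ((l ℕ.+ s) ℕ.+ suc (suc m)) ≡ suc (4 ℕ.* Φ ℕ.+ (l ℕ.+ s ℕ.+ suc m))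
        lem′ = solve-∀
      count (suc n) Φ zero (suc a) L f k h le = trans (split k) (trans (+-cong (loops-part a h le) (unew-part k)) (whole a))
        where
        unews : ℕ → List Word
        unews zero = []
        unews (suc k) = map (unew ∷_) (words n q a L f k)
        split : ∀ k → ι (length (words (suc n) zero (suc a) L f k)) ≈ ι (length (cat a (loops n a L f k))) + ι (length (unews k))
        split zero = sym (+-identityʳ _)
        split (suc k) = ι-++ (cat a (loops n a L f (suc k))) (unews (suc k))
        unew-part : ∀ k → ι (length (unews k)) ≈ (𝕦 T.* config q a L) f k
        unew-part zero = sym (𝕦-* (config q a L) f)
        unew-part (suc k) = trans (ι-map unew (words n q a L f k)) (trans (count-new n Φ 0 (suc a) q a L f k (lem a r (sum L) (length L)) h le′) (sym (𝕦-*-suc (config q a L) f k)))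
          where
          lem : ∀ a r s l → suc (suc r) ℕ.+ a ℕ.+ s ℕ.+ 2 ℕ.* suc l ≡ suc a ℕ.+ s ℕ.+ 2 ℕ.* suc l ℕ.+ suc r
          lem = solve-∀
          lem′ : ∀ Φ a r s l → 4 ℕ.* (suc r ℕ.+ Φ) ℕ.+ (suc a ℕ.+ s ℕ.+ suc l) ≡ suc (4 ℕ.* Φ ℕ.+ (2 ℕ.* suc (suc r) ℕ.+ a ℕ.+ s ℕ.+ suc l) ℕ.+ (r ℕ.+ r))
          lem′ = solve-∀
          le′ : ∀ Φ′ → Φ ≡ s ℕ.+ Φ′ → 4 ℕ.* Φ′ ℕ.+ size q a L ℕ.≤ n
          le′ Φ′ ≡.refl = ℕ.m+n≤o⇒m≤o _ (ℕ.s≤s⁻¹ (≡.subst (ℕ._≤ suc n) (lem′ Φ′ a r (sum L) (length L)) le))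
        LoopSum : ℕ → Ser
        LoopSum zero = T.0#
        LoopSum (suc a) = ΣT.Σ≤ a (λ i → config 0 i (a ℕ.∸ i ∷ L))
        loops-part : ∀ a → need 0 (suc a) L ℕ.+ Φ ≡ 2 ℕ.* f → 4 ℕ.* Φ ℕ.+ size 0 (suc a) L ℕ.≤ suc n →
          ι (length (cat a (loops n a L f k))) ≈ LoopSum a f k
        loops-part zero h le = refl
        loops-part (suc a) h le = ι-cat a (loops n (suc a) L f k) (λ i → config 0 i (a ℕ.∸ i ∷ L)) f k λ i i≤a →
          trans (ι-map (loop i) (words n 0 i (a ℕ.∸ i ∷ L) f k)) (count n Φ 0 i (a ℕ.∸ i ∷ L) f k
            (≡.trans (≡.cong (ℕ._+ Φ) (need-loop (suc a) i L (ℕ.s≤s i≤a))) h)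
            (ℕ.s≤s⁻¹ (≡.subst (ℕ._≤ suc n) (≡.trans (≡.cong (λ x → 4 ℕ.* Φ ℕ.+ (2 ℕ.+ x ℕ.+ sum L ℕ.+ suc (length L))) (≡.sym (ℕ.m+[n∸m]≡n i≤a))) (lem Φ i (a ℕ.∸ i) (sum L) (length L))) le)))
          where
          lem : ∀ Φ i j s l → 4 ℕ.* Φ ℕ.+ (2 ℕ.+ (i ℕ.+ j) ℕ.+ s ℕ.+ suc l) ≡ suc (4 ℕ.* Φ ℕ.+ (i ℕ.+ (j ℕ.+ s) ℕ.+ suc (suc l)))
          lem = solve-∀
        whole : ∀ a → LoopSum a f k + (𝕦 T.* config q a L) f k ≈ config 0 (suc a) L f k
        whole zero = trans (+-identityˡ _) (sym (config-1 L f k))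
        whole (suc a) = sym (config-loops a L f k)

      -- The fuel is 4 Φ + `size` with Φ bounded by 2 f and `size` equal to 2 b + 1.
      count-all : ∀ b f k → ι (length (words (8 ℕ.* f ℕ.+ (2 ℕ.* b ℕ.+ 1)) b 0 [] f k)) ≈ config b 0 [] f k
      count-all b f k with need b 0 [] ℕ.≤? 2 ℕ.* f
      ... | yes h = count (8 ℕ.* f ℕ.+ (2 ℕ.* b ℕ.+ 1)) (2 ℕ.* f ℕ.∸ need b 0 []) b 0 [] f k (ℕ.m+[n∸m]≡n h)
        (ℕ.+-mono-≤ (ℕ.≤-trans (ℕ.*-monoʳ-≤ 4 (ℕ.m∸n≤m (2 ℕ.* f) (need b 0 []))) (ℕ.≤-reflexive (≡.sym (ℕ.*-assoc 4 2 f)))) (ℕ.≤-reflexive (lem (2 ℕ.* b))))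
        where
        lem : ∀ x → x ℕ.+ 0 ℕ.+ 0 ℕ.+ 1 ≡ x ℕ.+ 1
        lem = solve-∀
      ... | no h = trans (reflexive (≡.cong (λ x → ι (length x)) (words-[] (8 ℕ.* f ℕ.+ (2 ℕ.* b ℕ.+ 1)) b 0 [] f k (ℕ.≰⇒> h)))) (sym (config-val b 0 [] f k (ℕ.≰⇒> h)))

      count-codes : ∀ b f k → ι (length (codes b f k)) ≈ config b 0 [] f k
      count-codes b f k = trans (reflexive (≡.cong (λ ws → ι (length ws)) (codes-words b f k))) (count-all b f k)

-- The given series expressed through forest numbers

module SolutionCoefficients where

  open import Defs
  open PowerSeriesRings
  open RationalNumbers
  open BivariateSeries
  open TutteEquation
  open ForestNumbers
  open ExplorationWords
  open ImplicitSeries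
  open WordCount
  open import Data.Nat.Base as ℕ using (ℕ; zero; suc; _!)
  import Data.Nat.Properties as ℕ
  open import Data.Nat.Tactic.RingSolver using (solve-∀)
  open import Data.Rational as ℚ using (ℚ; 0ℚ; 1ℚ)
  import Data.Rational.Properties as ℚ
  open import Data.List.Base using ([]; length)
  open import Data.Product using (_,_)
  open import Algebra.Bundles using (CommutativeRing)
  open import Level using (0ℓ)
  open import Relation.Binary.PropositionalEquality hiding (subst₂)
  open import Relation.Nullary using (contradiction)

  ℚring : CommutativeRing 0ℓ 0ℓ
  ℚring = ℚ.+-*-commutativeRing

  module Fractions where
    open Q using (solve; _:*_; _:=_)

    ι-cancel′ : ∀ d {x y} → d ≢ 0 → ι d ℚ.* x ≡ ι d ℚ.* y → x ≡ y
    ι-cancel′ zero h _ = contradiction refl h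
    ι-cancel′ (suc d) h e = ι-cancel d e

    shuffle : ∀ a b c d → (a ℚ.* b) ℚ.* (c ℚ.* d) ≡ (c ℚ.* b) ℚ.* (a ℚ.* d)
    shuffle = solve 4 (λ a b c d → (a :* b) :* (c :* d) := (c :* b) :* (a :* d)) refl

    -- Cross-multiplication turns identities between multinomial coefficients into identities
    -- between natural numbers.
    frac-eq : ∀ x n d x′ n′ d′ → d ≢ 0 → d′ ≢ 0 → x ℕ.* n ℕ.* d′ ≡ x′ ℕ.* n′ ℕ.* d →
      ι x ℚ.* (n ÷ d) ≡ ι x′ ℚ.* (n′ ÷ d′)
    frac-eq x n d x′ n′ d′ h h′ e = ι-cancel′ (d ℕ.* d′) {ι x ℚ.* (n ÷ d)} {ι x′ ℚ.* (n′ ÷ d′)} dd′ (begin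
      ι (d ℕ.* d′) ℚ.* (ι x ℚ.* (n ÷ d)) ≡⟨ cong (ℚ._* (ι x ℚ.* (n ÷ d))) (trans (cong ι (ℕ.*-comm d d′)) (ι-* d′ d)) ⟩
      (ι d′ ℚ.* ι d) ℚ.* (ι x ℚ.* (n ÷ d)) ≡⟨ shuffle (ι d′) (ι d) (ι x) (n ÷ d) ⟩
      (ι x ℚ.* ι d) ℚ.* (ι d′ ℚ.* (n ÷ d)) ≡⟨ solve′ (ι x) (ι d) (ι d′) (n ÷ d) ⟩
      (ι x ℚ.* (ι d ℚ.* (n ÷ d))) ℚ.* ι d′ ≡⟨ cong (λ z → (ι x ℚ.* z) ℚ.* ι d′) (*-÷ n d h) ⟩
      (ι x ℚ.* ι n) ℚ.* ι d′ ≡⟨ trans (cong (ℚ._* ι d′) (sym (ι-* x n))) (sym (ι-* (x ℕ.* n) d′)) ⟩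
      ι (x ℕ.* n ℕ.* d′) ≡⟨ cong ι e ⟩
      ι (x′ ℕ.* n′ ℕ.* d) ≡⟨ trans (ι-* (x′ ℕ.* n′) d) (cong (ℚ._* ι d) (ι-* x′ n′)) ⟩
      (ι x′ ℚ.* ι n′) ℚ.* ι d ≡⟨ cong (λ z → (ι x′ ℚ.* z) ℚ.* ι d) (sym (*-÷ n′ d′ h′)) ⟩
      (ι x′ ℚ.* (ι d′ ℚ.* (n′ ÷ d′))) ℚ.* ι d ≡⟨ sym (solve′ (ι x′) (ι d′) (ι d) (n′ ÷ d′)) ⟩
      (ι x′ ℚ.* ι d′) ℚ.* (ι d ℚ.* (n′ ÷ d′)) ≡⟨ sym (shuffle (ι d) (ι d′) (ι x′) (n′ ÷ d′)) ⟩
      (ι d ℚ.* ι d′) ℚ.* (ι x′ ℚ.* (n′ ÷ d′)) ≡⟨ cong (ℚ._* (ι x′ ℚ.* (n′ ÷ d′))) (sym (ι-* d d′)) ⟩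
      ι (d ℕ.* d′) ℚ.* (ι x′ ℚ.* (n′ ÷ d′)) ∎)
      where
      open ≡-Reasoning
      dd′ : d ℕ.* d′ ≢ 0
      dd′ = ℕ.≢-nonZero⁻¹ (d ℕ.* d′) {{ℕ.m*n≢0 d d′ {{ℕ.≢-nonZero h}} {{ℕ.≢-nonZero h′}}}}
      solve′ : ∀ a b c f → (a ℚ.* b) ℚ.* (c ℚ.* f) ≡ (a ℚ.* (b ℚ.* f)) ℚ.* c
      solve′ = solve 4 (λ a b c f → (a :* b) :* (c :* f) := (a :* (b :* f)) :* c) refl

    !≢0 : ∀ n → n ! ≢ 0
    !≢0 n = ℕ.≢-nonZero⁻¹ (n !) {{n ℕ.!≢0}}

    *≢0 : ∀ {m n} → m ≢ 0 → n ≢ 0 → m ℕ.* n ≢ 0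
    *≢0 {m} {n} h h′ = ℕ.≢-nonZero⁻¹ (m ℕ.* n) {{ℕ.m*n≢0 m n {{ℕ.≢-nonZero h}} {{ℕ.≢-nonZero h′}}}}

    den≢0 : ∀ a b c → (a !) ℕ.* (b !) ℕ.* (c !) ≢ 0
    den≢0 a b c = *≢0 (*≢0 (!≢0 a) (!≢0 b)) (!≢0 c)

    multinom-a : ∀ a b c → ι (suc a) ℚ.* multinom (suc a) b c ≡ ι (suc (a ℕ.+ b ℕ.+ c)) ℚ.* multinom a b c
    multinom-a a b c = frac-eq (suc a) _ ((suc a !) ℕ.* (b !) ℕ.* (c !)) (suc (a ℕ.+ b ℕ.+ c)) _ ((a !) ℕ.* (b !) ℕ.* (c !)) (den≢0 (suc a) b c) (den≢0 a b c)
      (lem (suc a) (suc (a ℕ.+ b ℕ.+ c)) ((a ℕ.+ b ℕ.+ c) !) (a !) (b !) (c !))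
      where
      lem : ∀ x n f u v w → x ℕ.* (n ℕ.* f) ℕ.* (u ℕ.* v ℕ.* w) ≡ n ℕ.* f ℕ.* ((x ℕ.* u) ℕ.* v ℕ.* w)
      lem = solve-∀

    multinom-b : ∀ a b c → ι (suc b) ℚ.* multinom a (suc b) c ≡ ι (suc (a ℕ.+ b ℕ.+ c)) ℚ.* multinom a b c
    multinom-b a b c = frac-eq (suc b) _ ((a !) ℕ.* (suc b !) ℕ.* (c !)) (suc (a ℕ.+ b ℕ.+ c)) _ ((a !) ℕ.* (b !) ℕ.* (c !)) (den≢0 a (suc b) c) (den≢0 a b c)
      (trans (cong (λ z → suc b ℕ.* (z ℕ.+ c) ! ℕ.* ((a !) ℕ.* (b !) ℕ.* (c !))) (ℕ.+-suc a b))
        (lem (suc b) (suc (a ℕ.+ b ℕ.+ c)) ((a ℕ.+ b ℕ.+ c) !) (a !) (b !) (c !)))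
      where
      lem : ∀ x n f u v w → x ℕ.* (n ℕ.* f) ℕ.* (u ℕ.* v ℕ.* w) ≡ n ℕ.* f ℕ.* (u ℕ.* (x ℕ.* v) ℕ.* w)
      lem = solve-∀

    multinom-c : ∀ a b c → ι (suc c) ℚ.* multinom a b (suc c) ≡ ι (suc (a ℕ.+ b ℕ.+ c)) ℚ.* multinom a b c
    multinom-c a b c = frac-eq (suc c) _ ((a !) ℕ.* (b !) ℕ.* (suc c !)) (suc (a ℕ.+ b ℕ.+ c)) _ ((a !) ℕ.* (b !) ℕ.* (c !)) (den≢0 a b (suc c)) (den≢0 a b c)
      (trans (cong (λ z → suc c ℕ.* z ! ℕ.* ((a !) ℕ.* (b !) ℕ.* (c !))) (ℕ.+-suc (a ℕ.+ b) c))
        (lem (suc c) (suc (a ℕ.+ b ℕ.+ c)) ((a ℕ.+ b ℕ.+ c) !) (a !) (b !) (c !)))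
      where
      lem : ∀ x n f u v w → x ℕ.* (n ℕ.* f) ℕ.* (u ℕ.* v ℕ.* w) ≡ n ℕ.* f ℕ.* (u ℕ.* v ℕ.* (x ℕ.* w))
      lem = solve-∀

    trinomials : Trinomials ℚring
    trinomials = record
      { inv = λ n → 1 ÷ suc n
      ; ι-inv = λ n → trans (*-÷ 1 (suc n) (λ ())) (ℚ.+-identityʳ 1ℚ)
      ; m = multinom
      ; m-000 = refl
      ; m-a = multinom-a
      ; m-b = multinom-b
      ; m-c = multinom-c
      }

  open Fractions

  module TreeNumbers (r : ℕ) where
    open Forests r
    open Over ℚring
    open Sums ℚring

    sumTo≡ : ∀ n (f : ℕ → ℚ) → sumTo n f ≡ Σ≤ n f
    sumTo≡ zero f = refl
    sumTo≡ (suc n) f = cong (ℚ._+ f (suc n)) (sumTo≡ n f)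

    -- The vertex next to the root leaf carries q = p - 1 subtrees with l further nodes in all.
    tval-P : ∀ l → tval p (suc l) ≡ ι (P q l)
    tval-P l = ÷-unique _ ((suc l) ! ℕ.* (s ℕ.* suc l ℕ.+ 1) !) (*≢0 (!≢0 (suc l)) (!≢0 (s ℕ.* suc l ℕ.+ 1))) (trans (sym (ι-* ((suc l) ! ℕ.* (s ℕ.* suc l ℕ.+ 1) !) (P q l))) (cong ι (begin
      ((suc l ℕ.* l !) ℕ.* (s ℕ.* suc l ℕ.+ 1) !) ℕ.* P q l ≡⟨ cong (λ z → ((suc l ℕ.* l !) ℕ.* z !) ℕ.* P q l) (idx r l) ⟩
      ((suc l ℕ.* l !) ℕ.* (s ℕ.* l ℕ.+ q) !) ℕ.* P q l ≡⟨ lem (suc l) (l !) ((s ℕ.* l ℕ.+ q) !) (P q l) ⟩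
      suc l ℕ.* (P q l ℕ.* (l ! ℕ.* (s ℕ.* l ℕ.+ q) !)) ≡⟨ cong (suc l ℕ.*_) (P-closed s l) ⟩
      suc l ℕ.* (q ℕ.* (q ℕ.* l ℕ.+ s) !) ≡⟨ lem′ (suc l) q ((q ℕ.* l ℕ.+ s) !) ⟩
      (q ℕ.* suc l) ℕ.* (q ℕ.* l ℕ.+ s) ! ≡⟨ cong (ℕ._* ((q ℕ.* l ℕ.+ s) !)) (idx′ r l) ⟩
      (suc (q ℕ.* l ℕ.+ s)) ! ≡⟨ cong _! (sym (idx′ r l)) ⟩
      (q ℕ.* suc l) ! ∎)))
      where
      open ≡-Reasoning
      idx : ∀ r l → suc r ℕ.* suc l ℕ.+ 1 ≡ suc r ℕ.* l ℕ.+ suc (suc r)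
      idx = solve-∀
      idx′ : ∀ r l → suc (suc r) ℕ.* suc l ≡ suc (suc (suc r) ℕ.* l ℕ.+ suc r)
      idx′ = solve-∀
      lem : ∀ a f g x → ((a ℕ.* f) ℕ.* g) ℕ.* x ≡ a ℕ.* (x ℕ.* (f ℕ.* g))
      lem = solve-∀
      lem′ : ∀ a x f → a ℕ.* (x ℕ.* f) ≡ (x ℕ.* a) ℕ.* f
      lem′ = solve-∀

    -- A root corner singles out a vertex and an order of its p subtrees, which have l further nodes
    -- in all.
    tcval-P : ∀ l → tcval p (suc l) ≡ ι (P p l)
    tcval-P l = ÷-unique _ (l ! ℕ.* (s ℕ.* suc l ℕ.+ 2) !) (*≢0 (!≢0 l) (!≢0 (s ℕ.* suc l ℕ.+ 2))) (trans (sym (ι-* (l ! ℕ.* (s ℕ.* suc l ℕ.+ 2) !) (P p l))) (cong ι (begin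
      (l ! ℕ.* (s ℕ.* suc l ℕ.+ 2) !) ℕ.* P p l ≡⟨ trans (ℕ.*-comm _ (P p l)) (cong (λ z → P p l ℕ.* (l ! ℕ.* z !)) (idx r l)) ⟩
      P p l ℕ.* (l ! ℕ.* (s ℕ.* l ℕ.+ p) !) ≡⟨ P-closed q l ⟩
      p ℕ.* (q ℕ.* l ℕ.+ q) ! ≡⟨ cong (λ z → p ℕ.* z !) (idx′ r l) ⟩
      p ℕ.* (q ℕ.* suc l) ! ∎)))
      where
      open ≡-Reasoning
      idx : ∀ r l → suc r ℕ.* suc l ℕ.+ 2 ≡ suc r ℕ.* l ℕ.+ suc (suc (suc r))
      idx = solve-∀
      idx′ : ∀ r l → suc (suc r) ℕ.* l ℕ.+ suc (suc r) ≡ suc (suc r) ℕ.* suc l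
      idx′ = solve-∀

    t-ω : ∀ k → t p (suc k) ≡ ω q k
    t-ω k = trans (sumTo≡ (suc k) _) (trans (Σ-suc k _) (trans (ℚ.+-identityˡ _) (Σ-cong k λ l →
      cong₂ sel (cong (ℕ._≡ᵇ suc k) (idx r l)) (tval-P l))))
      where
      idx : ∀ r l → suc r ℕ.* suc l ℕ.+ 2 ≡ suc (suc r ℕ.* l ℕ.+ suc (suc r))
      idx = solve-∀

    tc-ω : ∀ k → tc p k ≡ ω p k
    tc-ω zero = sym (ω-low p 0 (ℕ.s≤s ℕ.z≤n))
    tc-ω (suc k) = trans (sumTo≡ (suc k) _) (trans (Σ-suc k _) (trans (ℚ.+-identityˡ _) (trans
      (Σ-cong k λ l → cong₂ sel (cong (ℕ._≡ᵇ suc k) (idx r l)) (tcval-P l))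
      (sym (Σ-extend (ℕ.n≤1+n k) _ λ l h → cong (λ x → sel x (ι (P p l))) (≡ᵇ-no λ e → big q h (ℕ.suc-injective (trans (sym (ℕ.+-suc (s ℕ.* l) q)) e))))))))
      where
      idx : ∀ r l → suc r ℕ.* suc l ℕ.+ 2 ≡ suc r ℕ.* l ℕ.+ suc (suc (suc r))
      idx = solve-∀

    module Ser = Series ℚring
    module FP = FixedPoint ℚring (Φ₁c p) (Φ₂c p)

    mul≡ : ∀ X Y n k → (X ⊛ Y) n k ≡ (X Ser.T.* Y) n k
    mul≡ X Y n k = trans (trans (sumTo≡ n _) (Σ-cong n (λ i → sumTo≡ k _))) (sym (Ser.*-ΣΣ X Y n k))

    pow≡ : ∀ X i n k → powS X i n k ≡ Ser.pow X i n k
    pow≡ X zero zero zero = refl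
    pow≡ X zero zero (suc k) = refl
    pow≡ X zero (suc n) k = refl
    pow≡ X (suc i) n k = trans (mul≡ X (powS X i) n k) (Ser.T.*-congˡ {X} (pow≡ X i) n k)

    subst≡ : ∀ c R S n k → subst₂ c R S n k ≡ Ser.subst R S c n k
    subst≡ c R S n k = trans (trans (sumTo≡ n _) (Σ-cong n λ i → sumTo≡ (n ℕ.∸ i) _))
      (Σ-cong n λ i → Σ-cong (n ℕ.∸ i) λ j → cong (c i j ℚ.*_) (trans (mul≡ (powS R i) (powS S j) n k) (Ser.T.*-cong (pow≡ R i) (pow≡ S j) n k)))

    zS≡ : ∀ n k → zS n k ≡ Ser.𝕫 n k
    zS≡ 0 k = refl
    zS≡ 1 zero = refl
    zS≡ 1 (suc k) = refl
    zS≡ (suc (suc n)) k = refl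

    eqR≡ : ∀ R S n k → (zS ⊕ uMul (subst₂ (Φ₁c p) R S)) n k ≡ FP.eqR R S n k
    eqR≡ R S n zero = cong (ℚ._+ 0ℚ) (zS≡ n zero)
    eqR≡ R S n (suc k) = cong₂ ℚ._+_ (zS≡ n (suc k)) (subst≡ (Φ₁c p) R S n k)

    eqS≡ : ∀ R S n k → uMul (subst₂ (Φ₂c p) R S) n k ≡ FP.eqS R S n k
    eqS≡ R S n zero = refl
    eqS≡ R S n (suc k) = subst≡ (Φ₂c p) R S n k

    Φ₁-ω : ∀ i j → Φ₁c p (suc i) j ≡ ω q (suc (2 ℕ.* i ℕ.+ j)) ℚ.* multinom i (suc i) j
    Φ₁-ω i j = cong (ℚ._* multinom i (suc i) j) (trans (cong (t p) (idx i j)) (t-ω (suc (2 ℕ.* i ℕ.+ j))))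
      where
      idx : ∀ i j → 2 ℕ.* suc i ℕ.+ j ≡ suc (suc (2 ℕ.* i ℕ.+ j))
      idx = solve-∀

    Φ₂-ω : ∀ i j → Φ₂c p i j ≡ ω q (2 ℕ.* i ℕ.+ j) ℚ.* multinom i i j
    Φ₂-ω i j = cong (ℚ._* multinom i i j) (trans (cong (t p) (ℕ.+-comm (2 ℕ.* i ℕ.+ j) 1)) (t-ω (2 ℕ.* i ℕ.+ j)))

    Φ₁-0 : ∀ i j → 2 ℕ.* i ℕ.+ j ℕ.< 3 → Φ₁c p i j ≡ 0ℚ
    Φ₁-0 zero j h = refl
    Φ₁-0 (suc i) j h = trans (Φ₁-ω i j) (trans (cong (ℚ._* multinom i (suc i) j) (ω-low q (suc (2 ℕ.* i ℕ.+ j))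
        (ℕ.≤-trans (ℕ.s≤s⁻¹ (subst (ℕ._< 3) (idx i j) h)) (ℕ.s≤s (ℕ.s≤s ℕ.z≤n))))) (ℚ.*-zeroˡ (multinom i (suc i) j)))
      where
      idx : ∀ i j → 2 ℕ.* suc i ℕ.+ j ≡ suc (suc (2 ℕ.* i ℕ.+ j))
      idx = solve-∀

    Φ₂-0 : ∀ i j → 2 ℕ.* i ℕ.+ j ℕ.< 2 → Φ₂c p i j ≡ 0ℚ
    Φ₂-0 i j h = trans (Φ₂-ω i j) (trans (cong (ℚ._* multinom i i j) (ω-low q (2 ℕ.* i ℕ.+ j) (ℕ.≤-trans h (ℕ.s≤s (ℕ.s≤s ℕ.z≤n))))) (ℚ.*-zeroˡ (multinom i i j)))

    open FP using (solR; solS; solR-eq; solS-eq; Graded) public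
    module Poly = FP.Polynomial Φ₁-0 Φ₂-0

    graded-polynomial : ∀ {w X} → Graded w X → PolyCoeffs X
    graded-polynomial {w} h n = 2 ℕ.* n , λ k l → h n k (ℕ.<-≤-trans l (ℕ.m≤m+n k w))

    graded-const : ∀ {w X} → Graded (suc w) X → ZeroConst X
    graded-const {w} h k = h 0 k (subst (0 ℕ.<_) (sym (ℕ.+-suc k w)) (ℕ.s≤s ℕ.z≤n))

    R0 : ZeroConst solR
    R0 = graded-const {1} Poly.solR-graded

    S0 : ZeroConst solS
    S0 = graded-const {0} Poly.solS-graded

    umul≡ : ∀ {X Y} → X Ser.T.≈ Y → FP.umul X Ser.T.≈ Ser.𝕦 Ser.T.* Y
    umul≡ {X} {Y} h n zero = sym (Ser.𝕦-* Y n)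
    umul≡ {X} {Y} h n (suc k) = trans (h n k) (sym (Ser.𝕦-*-suc Y n k))

    open Weighted ℚring trinomials solR solS R0 S0 using (A₁; B; a; b)
    open Counting ℚring trinomials r solR solS R0 S0 using (module Solved; config; contour)
    open Ser.Substitution solR solS R0 S0 using (ev-R; ev-cong; shX)

    -- Φ₁ has no term without x, so a factor R can be taken out; the remaining coefficients are
    -- those of `A₁`.
    R≈ : solR Ser.T.≈ Ser.𝕫 Ser.T.+ Ser.𝕦 Ser.T.* (solR Ser.T.* A₁ (ω q))
    R≈ n k = trans (solR-eq n k) (cong (Ser.𝕫 n k ℚ.+_) (umul≡ (Ser.T.sym (Ser.T.trans (ev-R (a (ω q))) (ev-cong coeff))) n k))
      where
      coeff : ∀ i j → shX (a (ω q)) i j ≡ Φ₁c p i j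
      coeff zero j = refl
      coeff (suc i) j = sym (Φ₁-ω i j)

    S≈ : solS Ser.T.≈ Ser.𝕦 Ser.T.* B (ω q)
    S≈ n k = trans (solS-eq n k) (umul≡ (ev-cong Φ₂-ω) n k)

    open Solved R≈ S≈ using (count-codes)
    open Enumerate s using (codes)

    -- The factor n + 1 undoes the integration in M, and the initial contour, p undetermined darts,
    -- carries the weights t^c_k of θ.
    θ-count : ∀ n k → ℕtoℚ (suc n) ℚ.* ℕtoℚ (length (codes p (suc n) k)) ≡ subst₂ (θc p) solR solS n k
    θ-count n k = begin
      ℕtoℚ (suc n) ℚ.* ℕtoℚ N ≡⟨ cong₂ ℚ._*_ (ℕtoℚ≡ι (suc n)) (trans (ℕtoℚ≡ι N) (count-codes p (suc n) k)) ⟩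
      ι (suc n) ℚ.* config p 0 [] (suc n) k ≡⟨ cong (ι (suc n) ℚ.*_) (Ser.T.*-identityʳ (contour p 0) (suc n) k) ⟩
      ι (suc n) ℚ.* ((1 ÷ suc n) ℚ.* B (ω p) n k) ≡⟨ sym (ℚ.*-assoc (ι (suc n)) (1 ÷ suc n) (B (ω p) n k)) ⟩
      (ι (suc n) ℚ.* (1 ÷ suc n)) ℚ.* B (ω p) n k ≡⟨ cong (ℚ._* B (ω p) n k) (trans (*-÷ 1 (suc n) (λ ())) (ℚ.+-identityʳ 1ℚ)) ⟩
      1ℚ ℚ.* B (ω p) n k ≡⟨ ℚ.*-identityˡ (B (ω p) n k) ⟩
      B (ω p) n k ≡⟨ ev-cong (λ i j → cong (ℚ._* multinom i i j) (sym (tc-ω (2 ℕ.* i ℕ.+ j)))) n k ⟩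
      Ser.subst solR solS (θc p) n k ≡⟨ sym (subst≡ (θc p) solR solS n k) ⟩
      subst₂ (θc p) solR solS n k ∎
      where
      open ≡-Reasoning
      N = length (codes p (suc n) k)

-- Explorations with named darts, and the faces they trace

module Traces where

  open ExplorationWords using (nil; mark; fnew; unew; bad; loop; Word)
  open import Data.Bool using (Bool; true; false)
  open import Data.Nat.Base using (ℕ; zero; suc; _+_; _*_)
  import Data.Nat.Properties as ℕ
  open import Data.Nat.DivMod using (_%_; _mod_; m<n⇒m%n≡m; n%n≡0; %-distribˡ-+; m%n%n≡m%n; m%n<n)
  open import Data.Nat.Tactic.RingSolver using (solve-∀)
  open import Data.Fin.Base as Fin using (Fin; zero; suc; toℕ)
  import Data.Fin.Properties as Fin
  open import Data.List.Base using (List; []; _∷_; _++_; length; concat; tabulate; [_])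
  import Data.List.Properties as List
  open import Data.List.Membership.Propositional using (_∈_)
  open import Data.List.Membership.Propositional.Properties using (∈-++⁺ˡ; ∈-++⁺ʳ; ∈-++⁻)
  open import Data.List.Relation.Unary.All as All using (All; []; _∷_)
  import Data.List.Relation.Unary.All.Properties as All
  open import Data.List.Relation.Unary.Any as Any using (Any; here; there)
  open import Data.List.Relation.Binary.Permutation.Propositional using (_↭_; ↭-refl; ↭-sym; ↭-trans; prep)
  open import Data.List.Relation.Binary.Permutation.Propositional.Properties using (∈-resp-↭; ++-commutativeMonoid)
  open import Data.Product using (∃; _×_; _,_)
  open import Data.Sum using (_⊎_; inj₁; inj₂)
  open import Relation.Binary.PropositionalEquality hiding ([_])
  import Algebra.Solver.CommutativeMonoid

  private variable
    A : Set

  module Run (s : ℕ) where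
    q p : ℕ
    q = suc s
    p = suc q

    -- The dart (v , i) is the i-th dart, in counterclockwise order, of the v-th discovered vertex.
    Name : Set
    Name = ℕ × Fin p

    next : Fin p → Fin p
    next i = suc (toℕ i) mod p

    σ : Name → Name
    σ (v , i) = v , next i

    base : ℕ → Name
    base v = v , zero

    others vertex : ℕ → List Name
    others v = tabulate (λ i → v , suc i)
    vertex v = base v ∷ others v

    fresh : ℕ → ℕ → List Name
    fresh n zero = []
    fresh n (suc k) = vertex n ++ fresh (suc n) k

    Edge : Set
    Edge = Name × Name × Bool

    private variable
      n k : ℕ
      U K l₁ l₂ l : List Name
      L L₁ L₂ : List (List Name)
      w : Word
      P : List Edge
      d e : Name

    -- Exploration of a map.  The current contour is U ++ K, where the darts of U are not yet known to be forest darts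
    -- or not and those of K are not forest darts; L lists the other contours and n is the next vertex to be discovered.
    -- Forest edges are followed first (fnew), then an edge of K either closes the contour (loop) or discovers the root
    -- of a new tree (unew); joining two contours (bad) creates a handle.
    data Tr : ℕ → List Name → List Name → List (List Name) → Word → List Edge → ℕ → Set where
      stop : Tr n [] [] [] (nil ∷ []) [] 0
      nil : Tr n [] l L w P k → Tr n [] [] (l ∷ L) (nil ∷ w) P k
      mark : Tr n U (K ++ [ d ]) L w P k → Tr n (d ∷ U) K L (mark ∷ w) P k
      fnew : Tr (suc n) (others n ++ U) K L w P k → Tr n (d ∷ U) K L (fnew ∷ w) ((d , base n , true) ∷ P) (suc k)
      unew : Tr (suc n) (others n) K L w P k → Tr n [] (d ∷ K) L (unew ∷ w) ((d , base n , false) ∷ P) (suc k)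
      loop : K ≡ l₁ ++ e ∷ l₂ → Tr n [] l₁ (l₂ ∷ L) w P k → Tr n [] (d ∷ K) L (loop (length l₁) ∷ w) ((d , e , false) ∷ P) k
      bad : L ≡ L₁ ++ (l₁ ++ e ∷ l₂) ∷ L₂ → Tr n [] (l₂ ++ l₁ ++ K) (L₁ ++ L₂) w P k →
        Tr n [] (d ∷ K) L (bad ∷ w) ((d , e , false) ∷ P) k

    ends : List Edge → List Name
    ends [] = []
    ends ((d , e , _) ∷ P) = d ∷ e ∷ ends P

    module CM = Algebra.Solver.CommutativeMonoid (++-commutativeMonoid {A = Name})
    open CM using (_⊕_; _⊜_)

    -- Each dart is an end of exactly one edge, which makes the edge list a fixed-point-free
    -- involution on the darts.
    ends-↭ : Tr n U K L w P k → ends P ↭ U ++ (K ++ concat L) ++ fresh n k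
    ends-↭ stop = ↭-refl
    ends-↭ (nil t) = ends-↭ t
    ends-↭ {n = n} {k = k} (mark {U = U} {K = K} {d = d} {L = L} t) = ↭-trans (ends-↭ t)
      (CM.solve 5 (λ d U K L F → U ⊕ ((K ⊕ d) ⊕ L) ⊕ F ⊜ (d ⊕ U) ⊕ (K ⊕ L) ⊕ F) ↭-refl [ d ] U K (concat L) (fresh n k))
    ends-↭ {n = n} (fnew {U = U} {K = K} {L = L} {k = k} {d = d} t) = ↭-trans (prep d (prep (base n) (ends-↭ t)))
      (CM.solve 7 (λ d b o U K L F → d ⊕ b ⊕ ((o ⊕ U) ⊕ (K ⊕ L) ⊕ F) ⊜ (d ⊕ U) ⊕ (K ⊕ L) ⊕ ((b ⊕ o) ⊕ F)) ↭-refl [ d ] [ base n ] (others n) U K (concat L) (fresh (suc n) k))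
    ends-↭ {n = n} (unew {K = K} {L = L} {k = k} {d = d} t) = ↭-trans (prep d (prep (base n) (ends-↭ t)))
      (CM.solve 6 (λ d b o K L F → d ⊕ b ⊕ (o ⊕ (K ⊕ L) ⊕ F) ⊜ (d ⊕ K ⊕ L) ⊕ ((b ⊕ o) ⊕ F)) ↭-refl [ d ] [ base n ] (others n) K (concat L) (fresh (suc n) k))
    ends-↭ {n = n} {k = k} (loop {l₁ = l₁} {e = e} {l₂ = l₂} {L = L} {d = d} refl t) = ↭-trans (prep d (prep e (ends-↭ t)))
      (CM.solve 6 (λ d e a b L F → d ⊕ e ⊕ ((a ⊕ (b ⊕ L)) ⊕ F) ⊜ (d ⊕ (a ⊕ (e ⊕ b)) ⊕ L) ⊕ F) ↭-refl [ d ] [ e ] l₁ l₂ (concat L) (fresh n k))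
    ends-↭ {n = n} {k = k} (bad {L₁ = L₁} {l₁ = l₁} {e = e} {l₂ = l₂} {L₂ = L₂} {K = K} {d = d} refl t) = ↭-trans (prep d (prep e (ends-↭ t)))
      (subst₂ (λ x y → d ∷ e ∷ ((l₂ ++ l₁ ++ K) ++ x) ++ fresh n k ↭ (d ∷ K ++ y) ++ fresh n k) (List.concat-++ L₁ L₂) (List.concat-++ L₁ _)
        (CM.solve 8 (λ d e a b K A B F → d ⊕ e ⊕ (((b ⊕ a ⊕ K) ⊕ (A ⊕ B)) ⊕ F) ⊜ (d ⊕ K ⊕ (A ⊕ ((a ⊕ (e ⊕ b)) ⊕ B))) ⊕ F) ↭-refl [ d ] [ e ] l₁ l₂ K (concat L₁) (concat L₂) (fresh n k)))

    nils unews bads : Word → ℕ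
    nils [] = 0
    nils (nil ∷ w) = suc (nils w)
    nils (_ ∷ w) = nils w
    unews [] = 0
    unews (unew ∷ w) = suc (unews w)
    unews (_ ∷ w) = unews w
    bads [] = 0
    bads (bad ∷ w) = suc (bads w)
    bads (_ ∷ w) = bads w

    -- A `loop` adds a contour, `bad` and `nil` each remove one, and the steps that discover a
    -- vertex keep the number; every edge is of one of the kinds loop, bad or discovery.
    euler : Tr n U K L w P k → suc (length L) + length P ≡ nils w + k + 2 * bads w
    euler stop = refl
    euler (nil t) = cong suc (euler t)
    euler (mark t) = euler t
    euler {w = _ ∷ w} (fnew {L = L} {P = P} {k = k} t) = trans (ℕ.+-suc (suc (length L)) (length P)) (trans (cong suc (euler t)) (cong (_+ 2 * bads w) (sym (ℕ.+-suc (nils w) k))))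
    euler {w = _ ∷ w} (unew {L = L} {P = P} {k = k} t) = trans (ℕ.+-suc (suc (length L)) (length P)) (trans (cong suc (euler t)) (cong (_+ 2 * bads w) (sym (ℕ.+-suc (nils w) k))))
    euler (loop {L = L} {P = P} refl t) = trans (ℕ.+-suc (suc (length L)) (length P)) (euler t)
    euler {w = _ ∷ w} {k = k} (bad {L₁ = L₁} {l₁ = l₁} {e = e} {l₂ = l₂} {L₂ = L₂} {P = P} refl t) =
      trans (cong suc (cong₂ _+_ (trans (List.length-++ L₁) (trans (ℕ.+-suc (length L₁) (length L₂)) (cong suc (sym (List.length-++ L₁))))) refl))
        (trans (lem (length (L₁ ++ L₂)) (length P)) (trans (cong (2 +_) (euler t)) (lem′ (nils w) k (bads w))))
      where
      lem : ∀ a b → suc (suc a + suc b) ≡ 2 + (suc a + b)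
      lem = solve-∀
      lem′ : ∀ a b c → 2 + (a + b + 2 * c) ≡ a + b + 2 * suc c
      lem′ = solve-∀

    next-mod : ∀ i → next (i mod p) ≡ suc i mod p
    next-mod i = Fin.toℕ-injective (begin
      toℕ (next (i mod p)) ≡⟨ Fin.toℕ-fromℕ< _ ⟩
      suc (toℕ (i mod p)) % p ≡⟨ cong (λ x → suc x % p) (Fin.toℕ-fromℕ< (m%n<n i p)) ⟩
      (1 + i % p) % p ≡⟨ %-distribˡ-+ 1 (i % p) p ⟩
      (1 % p + i % p % p) % p ≡⟨ cong (λ x → (1 % p + x) % p) (m%n%n≡m%n i p) ⟩
      (1 % p + i % p) % p ≡⟨ sym (%-distribˡ-+ 1 i p) ⟩
      suc i % p ≡⟨ sym (Fin.toℕ-fromℕ< (m%n<n (suc i) p)) ⟩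
      toℕ (suc i mod p) ∎)
      where open ≡-Reasoning

    mod-< : ∀ (i : Fin p) → toℕ i mod p ≡ i
    mod-< i = Fin.toℕ-injective (trans (Fin.toℕ-fromℕ< _) (m<n⇒m%n≡m (Fin.toℕ<n i)))

    p-mod : p mod p ≡ zero
    p-mod = Fin.toℕ-injective (trans (Fin.toℕ-fromℕ< _) (n%n≡0 p))

    others-∈ : ∀ v i → (v , suc i) ∈ others v
    others-∈ v i = ∈-tab i
      where
      open import Data.List.Membership.Propositional.Properties using (∈-tabulate⁺)
      ∈-tab : ∀ i → (v , suc i) ∈ others v
      ∈-tab = ∈-tabulate⁺ {f = λ i → v , suc i}

    vertex-∈ : ∀ v i → (v , i) ∈ vertex v
    vertex-∈ v zero = here refl
    vertex-∈ v (suc i) = there (others-∈ v i)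

    -- Corner relations: the dart x stands for the corner before it, so that following the boundary of a face
    -- identifies a dart d with σ (α d).
    module Corners (E : Name → Name → Set) (E-refl : ∀ {x} → E x x) (E-sym : ∀ {x y} → E x y → E y x)
      (E-trans : ∀ {x y z} → E x y → E y z → E x z) where

      -- Chain r l r′: the corners r, …, r′ left by the successive darts of l are equivalent two by two.
      Chain : Name → List Name → Name → Set
      Chain r [] r′ = E r r′
      Chain r (x ∷ l) r′ = E r x × Chain (σ x) l r′

      chain-head : ∀ {a b c} l → E a b → Chain b l c → Chain a l c
      chain-head [] h c = E-trans h c
      chain-head (x ∷ l) h (c , cs) = E-trans h c , cs

      chain-last : ∀ {a b c} l → Chain a l b → E b c → Chain a l c
      chain-last [] c h = E-trans c h
      chain-last (x ∷ l) (c , cs) h = c , chain-last l cs h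

      chain-++ : ∀ {a b c} l {l′} → Chain a l b → Chain b l′ c → Chain a (l ++ l′) c
      chain-++ [] {l′} h c = chain-head l′ h c
      chain-++ (x ∷ l) (c , cs) c′ = c , chain-++ l cs c′

      chain-split : ∀ {a c} l {l′} → Chain a (l ++ l′) c → ∃ λ b → Chain a l b × Chain b l′ c
      chain-split [] h = _ , E-refl , h
      chain-split (x ∷ l) (c , cs) with chain-split l cs
      ... | b , c₁ , c₂ = b , (c , c₁) , c₂

      chain-others : ∀ v → Chain (σ (base v)) (others v) (base v)
      chain-others v = subst₂ (λ x y → Chain x (others v) y) refl (cong (v ,_) p-mod)
        -- The darts 1, ..., q of the vertex, each the σ-image of the one before, so all links are
        -- reflexive; the index p = q + 1 wraps around to the base.
        (run 1 q (λ i → v , suc i) (λ i → cong (v ,_) (sym (mod-< (suc i)))))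
        where
        run : ∀ i k (f : Fin k → Name) → (∀ j → f j ≡ (v , (i + toℕ j) mod p)) → Chain (v , i mod p) (tabulate f) (v , (i + k) mod p)
        run i zero f h = subst (λ x → E (v , i mod p) (v , x mod p)) (sym (ℕ.+-identityʳ i)) E-refl
        run i (suc k) f h = subst (E (v , i mod p)) (sym (trans (h zero) (cong (λ x → v , x mod p) (ℕ.+-identityʳ i)))) E-refl
          , subst₂ (λ x y → Chain x (tabulate (λ j → f (suc j))) y)
              (trans (cong (v ,_) (sym (next-mod i))) (cong σ (sym (trans (h zero) (cong (λ x → v , x mod p) (ℕ.+-identityʳ i))))))
              (cong (λ x → v , x mod p) (sym (ℕ.+-suc i k)))
              (run (suc i) k (λ j → f (suc j)) (λ j → trans (h (suc j)) (cong (λ x → v , x mod p) (ℕ.+-suc i (toℕ j)))))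

      data Pending : List Name → List (List Name) → Set where
        [] : Pending [] []
        _∷_ : ∀ {r rs l L} → Chain r l r → Pending rs L → Pending (r ∷ rs) (l ∷ L)

      pending-split : ∀ {rs} L₁ {l L₂} → Pending rs (L₁ ++ l ∷ L₂) →
        ∃ λ r → ∃ λ rs′ → Chain r l r × Pending rs′ (L₁ ++ L₂) × (∀ {x} → x ∈ rs → x ≡ r ⊎ x ∈ rs′)
      pending-split [] (c ∷ cs) = _ , _ , c , cs , λ { (here e) → inj₁ e ; (there h) → inj₂ h }
      pending-split (l ∷ L₁) (c ∷ cs) with pending-split L₁ cs
      ... | r , rs′ , c′ , cs′ , f = r , _ , c′ , c ∷ cs′ , λ
        { (here e) → inj₂ (here e)
        ; (there h) → Data.Sum.map₂ there (f h) }
        where import Data.Sum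

      Cov : List Name → Name → Set
      Cov reps x = Any (E x) reps

      cov-E : ∀ {reps x y} → E x y → Cov reps y → Cov reps x
      cov-E h = Any.map (E-trans h)

      cov-chain : ∀ {reps a c} l → Chain a l c → (∀ {x} → x ∈ l → Cov reps x) → Cov reps c → Cov reps a
      cov-chain [] h f g = cov-E h g
      cov-chain (x ∷ l) (h , _) f g = cov-E h (f (here refl))

      FacePair : List Name → Edge → Set
      FacePair reps (d , e , _) = (E d (σ e) × E e (σ d)) × Cov reps d × Cov reps e

      ends-cov : ∀ {reps} P → All (FacePair reps) P → ∀ {x} → x ∈ ends P → Cov reps x
      ends-cov (_ ∷ P) ((_ , h , _) ∷ _) (here refl) = h
      ends-cov (_ ∷ P) ((_ , _ , h) ∷ _) (there (here refl)) = h
      ends-cov (_ ∷ P) (_ ∷ hs) (there (there m)) = ends-cov P hs m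

      in-ends : Tr n U K L w P k → ∀ {x} → x ∈ U ++ (K ++ concat L) → x ∈ ends P
      in-ends {n} {U} {K} {L} {k = k} t h = ∈-resp-↭ (↭-sym (ends-↭ t)) (subst (_ ∈_) (List.++-assoc U (K ++ concat L) (fresh n k)) (∈-++⁺ˡ h))

    when-[] : List A → Name × Name → List (Name × Name)
    when-[] [] x = []
    when-[] (_ ∷ _) x = x ∷ []

    -- The identifications of corners that suffice: when l₁ (or l₂) is empty, the other one follows from the chain.
    glue : Tr n U K L w P k → List (Name × Name)
    glue stop = []
    glue (nil t) = glue t
    glue (mark t) = glue t
    glue {n} (fnew {d = d} t) = (d , σ (base n)) ∷ (base n , σ d) ∷ glue t
    glue {n} (unew {d = d} t) = (d , σ (base n)) ∷ (base n , σ d) ∷ glue t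
    glue (loop {l₁ = l₁} {e = e} {l₂ = l₂} {d = d} _ t) = when-[] l₁ (e , σ d) ++ when-[] l₂ (d , σ e) ++ glue t
    glue (bad {e = e} {d = d} _ t) = (d , σ e) ∷ (e , σ d) ∷ glue t

    empty : List A → ℕ
    empty [] = 1
    empty (_ ∷ _) = 0

    empties : List (List A) → ℕ
    empties [] = 0
    empties (l ∷ L) = empty l + empties L

    empty-snoc : ∀ U K (d : Name) → empty (U ++ K ++ [ d ]) ≡ 0
    empty-snoc [] [] d = refl
    empty-snoc [] (_ ∷ K) d = refl
    empty-snoc (_ ∷ U) K d = refl

    when-length : ∀ (l : List A) x → length (when-[] l x) + empty l ≡ 1
    when-length [] x = refl
    when-length (_ ∷ _) x = refl

    -- Each edge costs two identifications, less one for every empty contour that a loop creates.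
    -- From a single nonempty contour this leaves 2 |P| minus `nils` identifications, so at least
    -- `nils` classes survive among the 2 |P| corners.
    glue-length : (t : Tr n U K L w P k) → bads w ≡ 0 → length (glue t) + nils w ≡ 2 * length P + (empty (U ++ K) + empties L)
    glue-length stop h = refl
    glue-length {P = P} (nil t) h = trans (ℕ.+-suc (length (glue t)) _) (trans (cong suc (glue-length t h)) (sym (ℕ.+-suc (2 * length P) _)))
    glue-length (mark {U = U} {K = K} {d = d} {L = L} {P = P} t) h = trans (glue-length t h) (cong (λ x → 2 * length P + (x + empties L)) (empty-snoc U K d))
    glue-length {L = L} (fnew {P = P} t) h = trans (cong (2 +_) (glue-length t h)) (lem (length P) (empties L))
      where
      lem : ∀ a b → 2 + (2 * a + b) ≡ 2 * suc a + b
      lem = solve-∀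
    glue-length {L = L} (unew {P = P} t) h = trans (cong (2 +_) (glue-length t h)) (lem (length P) (empties L))
      where
      lem : ∀ a b → 2 + (2 * a + b) ≡ 2 * suc a + b
      lem = solve-∀
    glue-length {w = _ ∷ w} (loop {l₁ = l₁} {e = e} {l₂ = l₂} {L = L} {P = P} {d = d} refl t) h = begin
      length (when-[] l₁ (e , σ d) ++ when-[] l₂ (d , σ e) ++ glue t) + nils w
        ≡⟨ cong (_+ nils w) (trans (List.length-++ (when-[] l₁ _)) (cong (length (when-[] l₁ _) +_) (List.length-++ (when-[] l₂ _)))) ⟩
      a₁ + (a₂ + length (glue t)) + nils w ≡⟨ lem₁ a₁ a₂ (length (glue t)) (nils w) ⟩
      a₁ + (a₂ + (length (glue t) + nils w)) ≡⟨ cong (λ x → a₁ + (a₂ + x)) (glue-length t h) ⟩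
      a₁ + (a₂ + (2 * length P + (empty l₁ + (empty l₂ + empties L)))) ≡⟨ lem₂ a₁ a₂ (length P) (empty l₁) (empty l₂) (empties L) ⟩
      (a₁ + empty l₁) + (a₂ + empty l₂) + (2 * length P + empties L) ≡⟨ cong₂ (λ x y → x + y + (2 * length P + empties L)) (when-length l₁ (e , σ d)) (when-length l₂ (d , σ e)) ⟩
      2 + (2 * length P + empties L) ≡⟨ lem₃ (length P) (empties L) ⟩
      2 * suc (length P) + (0 + empties L) ∎
      where
      open ≡-Reasoning
      a₁ = length (when-[] l₁ (e , σ d))
      a₂ = length (when-[] l₂ (d , σ e))
      lem₁ : ∀ a b c d → a + (b + c) + d ≡ a + (b + (c + d))
      lem₁ = solve-∀
      lem₂ : ∀ a b p x y z → a + (b + (2 * p + (x + (y + z)))) ≡ (a + x) + (b + y) + (2 * p + z)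
      lem₂ = solve-∀
      lem₃ : ∀ a b → 2 + (2 * a + b) ≡ 2 * suc a + (0 + b)
      lem₃ = solve-∀

    module Faces (E : Name → Name → Set) (E-refl : ∀ {x} → E x x) (E-sym : ∀ {x y} → E x y → E y x)
      (E-trans : ∀ {x y z} → E x y → E y z → E x z) where
      open Corners E E-refl E-sym E-trans public

      Glued : List (Name × Name) → Set
      Glued g = ∀ {a b} → (a , b) ∈ g → E a b

      new-chain : ∀ {r d l v} → E d (σ (base v)) → E (base v) (σ d) → Chain r (d ∷ l) r → Chain r (others v ++ l) r
      new-chain {l = l} {v = v} h h′ (c , cs) = chain-head (others v ++ l) (E-trans c h) (chain-++ (others v) (chain-others v) (chain-head l h′ cs))

      closing : ∀ l {x a b} → Chain a l b → E b x → Glued (when-[] l (x , a)) → E x a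
      closing [] c h _ = E-sym (E-trans c h)
      closing (_ ∷ _) _ _ g = g (here refl)

      -- Every face contains the corner r of a contour that became empty.
      faces-traced : (t : Tr n U K L w P k) → Glued (glue t) → ∀ {r rs} → Chain r (U ++ K) r → Pending rs L →
        ∃ λ reps → length reps ≡ nils w × All (FacePair reps) P × Cov reps r × (∀ {x} → x ∈ rs → Cov reps x)
      faces-traced stop g {r} c [] = (r ∷ []) , refl , [] , here E-refl , λ ()
      faces-traced (nil t) g {r} c (_∷_ {r = r′} c′ cs) with faces-traced t g c′ cs
      ... | reps , e , h , hr , hrs = r ∷ reps , cong suc e , All.map (λ (x , y , z) → x , there y , there z) h , here E-refl , λ
        { (here refl) → there hr ; (there m) → there (hrs m) }
      faces-traced (mark {U = U} {K = K} {d = d} {P = P} t) g {r} (c , cs) pend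
        with faces-traced t g {σ d} (subst (λ x → Chain (σ d) x (σ d)) (List.++-assoc U K [ d ]) (chain-++ (U ++ K) cs (c , E-refl))) pend
      ... | reps , e , h , hr , hrs = reps , e , h , cov-E c (ends-cov P h (in-ends t (∈-++⁺ʳ U (∈-++⁺ˡ (∈-++⁺ʳ K (here refl)))))) , hrs
      faces-traced {n} (fnew {U = U} {K = K} {L = L} {P = P} {d = d} t) g {r} C@(c , cs) pend
        with faces-traced t (λ m → g (there (there m))) {r} (subst (λ x → Chain r x r) (sym (List.++-assoc (others n) U K)) (new-chain (g (here refl)) (g (there (here refl))) C)) pend
      ... | reps , e , h , hr , hrs = reps , e , ((g (here refl) , g (there (here refl))) , cov-E (E-sym c) hr ,
            cov-E (g (there (here refl))) (cov-chain (U ++ K) cs (λ m → ends-cov P h (in-ends t (sub m))) hr)) ∷ h , hr , hrs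
        where
        sub : ∀ {x} → x ∈ U ++ K → x ∈ (others n ++ U) ++ (K ++ concat L)
        sub m with ∈-++⁻ U m
        ... | inj₁ a = ∈-++⁺ˡ (∈-++⁺ʳ (others n) a)
        ... | inj₂ b = ∈-++⁺ʳ (others n ++ U) (∈-++⁺ˡ b)
      faces-traced {n} (unew {K = K} {L = L} {P = P} {d = d} t) g {r} C@(c , cs) pend
        with faces-traced t (λ m → g (there (there m))) {r} (new-chain (g (here refl)) (g (there (here refl))) C) pend
      ... | reps , e , h , hr , hrs = reps , e , ((g (here refl) , g (there (here refl))) , cov-E (E-sym c) hr ,
            cov-E (g (there (here refl))) (cov-chain K cs (λ m → ends-cov P h (in-ends t (∈-++⁺ʳ (others n) (∈-++⁺ˡ m)))) hr)) ∷ h , hr , hrs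
      -- The contour based at r splits in two: l₁ closes up at σ d, because e and σ d are the same
      -- corner, and l₂ at r, because d and σ e are.
      faces-traced (loop {l₁ = l₁} {e = e} {l₂ = l₂} {L = L} {P = P} {d = d} refl t) g {r} (c , cs) pend with chain-split l₁ cs
      ... | b , c₁ , (ce , c₂) with closing l₁ {e} c₁ ce (λ m → g (∈-++⁺ˡ m)) | closing l₂ {d} c₂ c (λ m → g (∈-++⁺ʳ (when-[] l₁ (e , σ d)) (∈-++⁺ˡ m)))
      ... | ed | de
        with faces-traced t (λ m → g (∈-++⁺ʳ (when-[] l₁ (e , σ d)) (∈-++⁺ʳ (when-[] l₂ (d , σ e)) m))) {σ d} (chain-last l₁ c₁ (E-trans ce ed)) (chain-head l₂ (E-trans c de) c₂ ∷ pend)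
      ... | reps , eq , h , hr , hrs = reps , eq , ((de , ed) , cov-E (E-sym c) (hrs (here refl)) , cov-E ed hr) ∷ h , hrs (here refl) , λ m → hrs (there m)
      -- The other contour is cut open at e and inserted in place of d, so the joined contour keeps
      -- the base r. The corner r′ of the other one is found on it.
      faces-traced (bad {L₁ = L₁} {l₁ = l₁} {e = e} {l₂ = l₂} {L₂ = L₂} {K = K} {P = P} {d = d} refl t) g {r} (c , cs) pend with pending-split L₁ pend
      ... | r′ , rs′ , c′ , pend′ , f with chain-split l₁ c′
      ... | b , c₁ , (ce , c₂)
        with faces-traced t (λ m → g (there (there m))) {r} (chain-head (l₂ ++ l₁ ++ K) (E-trans c (g (here refl)))
               (chain-++ l₂ c₂ (chain-++ l₁ c₁ (chain-head K (E-trans ce (g (there (here refl)))) cs)))) pend′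
      ... | reps , eq , h , hr , hrs = reps , eq , ((g (here refl) , g (there (here refl))) , cov-E (E-sym c) hr , cov-e) ∷ h , hr , λ m → from (f m)
        where
        memb : ∀ {x} → x ∈ l₁ ++ K → Cov reps x
        memb m = ends-cov P h (in-ends t (∈-++⁺ˡ (∈-++⁺ʳ l₂ m)))
        cov-e : Cov reps e
        cov-e = cov-E (g (there (here refl))) (cov-chain K cs (λ m → memb (∈-++⁺ʳ l₁ m)) hr)
        from : ∀ {x} → x ≡ r′ ⊎ x ∈ rs′ → Cov reps x
        from (inj₁ refl) = cov-chain l₁ c₁ (λ m → memb (∈-++⁺ˡ m)) (cov-E ce cov-e)
        from (inj₂ m) = hrs m

-- Counting orbits and connected components

module EquivalenceClasses where

  open import Defs using (iter; countB; reach)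
  open import Data.Bool using (Bool; true; false; not; _∨_; T; if_then_else_)
  import Data.Bool.Properties as Bool
  open import Data.Bool.ListAction using () renaming (all to allB; any to anyB)
  open import Data.Nat.Base as ℕ using (ℕ; zero; suc; _+_; _*_; _∸_; _≤_; _<_; z≤n; s≤s; _≡ᵇ_; _≤ᵇ_)
  import Data.Nat.Properties as ℕ
  open import Data.Nat.ListAction using (sum)
  open import Data.Nat.DivMod using (_%_; _/_; m≡m%n+[m/n]*n; m%n<n)
  open import Data.Nat.Induction using (<-rec)
  open import Data.Fin.Base as Fin using (Fin; zero; suc; toℕ)
  import Data.Fin.Properties as Fin
  open import Data.List.Base using (List; []; _∷_; length; map; allFin; upTo; filterᵇ)
  open import Data.List.Membership.Propositional using (_∈_)
  open import Data.List.Membership.Propositional.Properties using (∈-allFin; ∈-upTo⁺)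
  open import Data.List.Relation.Unary.All as All using (All; []; _∷_)
  open import Data.List.Relation.Unary.Any as Any using (Any; here; there)
  open import Data.List.Relation.Unary.AllPairs using (AllPairs; []; _∷_)
  import Data.List.Relation.Unary.Unique.Propositional.Properties as Unique
  open import Data.Product using (∃; _×_; _,_; proj₁; proj₂)
  open import Data.Unit using (tt)
  open import Relation.Nullary using (¬_; yes; no; contradiction)
  open import Relation.Binary.PropositionalEquality

  module _ {A : Set} (R : A → A → Set) (R-sym : ∀ {x y} → R x y → R y x) (R-trans : ∀ {x y z} → R x y → R y z → R x z) where

    remove : ∀ {x ys} → Any (R x) ys → List A
    remove {ys = y ∷ ys} (here _) = ys
    remove {ys = y ∷ ys} (there h) = y ∷ remove h

    length-remove : ∀ {x ys} (h : Any (R x) ys) → length ys ≡ suc (length (remove h))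
    length-remove (here _) = refl
    length-remove (there h) = cong suc (length-remove h)

    any-remove : ∀ {x x′ ys} (h : Any (R x) ys) → ¬ R x x′ → Any (R x′) ys → Any (R x′) (remove h)
    any-remove (here r) h′ (here r′) = contradiction (R-trans r (R-sym r′)) h′
    any-remove (here r) h′ (there a) = a
    any-remove (there h) h′ (here r) = here r
    any-remove (there h) h′ (there a) = there (any-remove h h′ a)

    -- Each element of xs uses up its representative in ys; by transitivity an inequivalent element
    -- cannot rely on the same one.
    inequivalent-≤ : ∀ {xs} ys → AllPairs (λ x y → ¬ R x y) xs → All (λ x → Any (R x) ys) xs → length xs ≤ length ys
    inequivalent-≤ ys [] [] = z≤n
    inequivalent-≤ ys (p ∷ ps) (h ∷ hs) = subst (_ ≤_) (sym (length-remove h))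
      (s≤s (inequivalent-≤ (remove h) ps (All.zipWith (λ (n , a) → any-remove h n a) (p , hs))))

  module _ {A : Set} where

    all-true : ∀ (p : A → Bool) xs → allB p xs ≡ true → ∀ {x} → x ∈ xs → p x ≡ true
    all-true p (x ∷ xs) h m with p x in e
    all-true p (x ∷ xs) h (here refl) | true = e
    all-true p (x ∷ xs) h (there m) | true = all-true p xs h m

    all-false : ∀ (p : A → Bool) xs → allB p xs ≡ false → ∃ λ x → x ∈ xs × p x ≡ false
    all-false p (x ∷ xs) h with p x in e
    ... | false = x , here refl , e
    ... | true with all-false p xs h
    ...   | y , m , e′ = y , there m , e′

    any-true : ∀ (p : A → Bool) xs → anyB p xs ≡ true → ∃ λ x → x ∈ xs × p x ≡ true
    any-true p (x ∷ xs) h with p x in e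
    ... | true = x , here refl , e
    ... | false with any-true p xs h
    ...   | y , m , e′ = y , there m , e′

    any-intro : ∀ (p : A → Bool) xs {x} → x ∈ xs → p x ≡ true → anyB p xs ≡ true
    any-intro p (x ∷ xs) (here refl) e rewrite e = refl
    any-intro p (x ∷ xs) (there m) e with p x
    ... | true = refl
    ... | false = any-intro p xs m e

  ≤ᵇ-true : ∀ {m n} → (m ≤ᵇ n) ≡ true → m ≤ n
  ≤ᵇ-true {m} {n} e = ℕ.≤ᵇ⇒≤ m n (subst T (sym e) tt)

  ≤ᵇ-false : ∀ {m n} → (m ≤ᵇ n) ≡ false → n < m
  ≤ᵇ-false {m} {n} e = ℕ.≰⇒> λ h → subst T e (ℕ.≤⇒≤ᵇ h)

  countB-filter : ∀ {m} (b : Fin m → Bool) → countB b ≡ length (filterᵇ b (allFin m))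
  countB-filter {m} b = go (allFin m)
    where
    go : ∀ xs → sum (map (λ d → if b d then 1 else 0) xs) ≡ length (filterᵇ b xs)
    go [] = refl
    go (x ∷ xs) with b x
    ... | true = cong suc (go xs)
    ... | false = go xs

  -- `cycles` and `components` count the least elements of classes. Any list meeting every class
  -- bounds such a count from above, and any pairwise inequivalent list from below, without
  -- reference to the order.
  module Minima {m : ℕ} (R : Fin m → Fin m → Set) (R-refl : ∀ {x} → R x x) (R-sym : ∀ {x y} → R x y → R y x)
    (R-trans : ∀ {x y z} → R x y → R y z → R x z) (b : Fin m → Bool)
    (b-true : ∀ d → b d ≡ true → ∀ e → R d e → toℕ d ≤ toℕ e)
    (b-false : ∀ d → b d ≡ false → ∃ λ e → R d e × toℕ e < toℕ d) where

    mins : List (Fin m)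
    mins = filterᵇ b (allFin m)

    count-mins : length mins ≡ countB b
    count-mins = sym (countB-filter b)

    filter-∈ : ∀ xs {x} → x ∈ xs → b x ≡ true → x ∈ filterᵇ b xs
    filter-∈ (x ∷ xs) (here refl) e rewrite e = here refl
    filter-∈ (x ∷ xs) (there m) e with b x
    ... | true = there (filter-∈ xs m e)
    ... | false = filter-∈ xs m e

    filter-All : ∀ {P : Fin m → Set} xs → All P xs → All P (filterᵇ b xs)
    filter-All [] [] = []
    filter-All (x ∷ xs) (h ∷ hs) with b x
    ... | true = h ∷ filter-All xs hs
    ... | false = filter-All xs hs

    filter-distinct : ∀ xs → AllPairs _≢_ xs → AllPairs (λ x y → ¬ R x y) (filterᵇ b xs)
    filter-distinct [] [] = []
    filter-distinct (x ∷ xs) (p ∷ ps) with b x in e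
    ... | false = filter-distinct xs ps
    ... | true = apart xs p ∷ filter-distinct xs ps
      where
      apart : ∀ xs → All (x ≢_) xs → All (λ y → ¬ R x y) (filterᵇ b xs)
      apart [] [] = []
      apart (y ∷ ys) (n ∷ ns) with b y in e′
      ... | false = apart ys ns
      ... | true = (λ r → n (Fin.toℕ-injective (ℕ.≤-antisym (b-true x e y r) (b-true y e′ x (R-sym r))))) ∷ apart ys ns

    minimum : ∀ n x → toℕ x ≡ n → Any (R x) mins
    minimum = <-rec (λ n → ∀ x → toℕ x ≡ n → Any (R x) mins) step
      where
      step : ∀ n → (∀ {k} → k < n → ∀ x → toℕ x ≡ k → Any (R x) mins) → ∀ x → toℕ x ≡ n → Any (R x) mins
      step n rec x refl with b x in e
      ... | true = Any.map (λ { refl → R-refl }) (filter-∈ (allFin m) (∈-allFin x) e)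
      ... | false with b-false x e
      ...   | y , r , y<x = Any.map (R-trans r) (rec y<x y refl)

    count-≤ : ∀ ys → (∀ x → Any (R x) ys) → countB b ≤ length ys
    count-≤ ys h = subst (_≤ length ys) (sym (countB-filter b))
      (inequivalent-≤ R R-sym R-trans ys (filter-distinct (allFin m) (Unique.allFin⁺ m)) (All.tabulate (λ {x} _ → h x)))

    count-≥ : ∀ xs → AllPairs (λ x y → ¬ R x y) xs → length xs ≤ countB b
    count-≥ xs h = subst (length xs ≤_) (sym (countB-filter b)) (inequivalent-≤ R R-sym R-trans mins h (All.tabulate (λ {x} _ → minimum (toℕ x) x refl)))

  module Orbits {m : ℕ} (f : Fin m → Fin m) (f-injective : ∀ {x y} → f x ≡ f y → x ≡ y) where

    Orb : Fin m → Fin m → Set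
    Orb d e = ∃ λ i → iter f i d ≡ e

    iter-+ : ∀ i k d → iter f (i + k) d ≡ iter f i (iter f k d)
    iter-+ zero k d = refl
    iter-+ (suc i) k d = cong f (iter-+ i k d)

    iter-injective : ∀ i {x y} → iter f i x ≡ iter f i y → x ≡ y
    iter-injective zero h = h
    iter-injective (suc i) h = iter-injective i (f-injective h)

    -- Pigeonhole on the first m + 1 iterates; injectivity cancels the part before the repetition.
    period : ∀ d → ∃ λ k → suc k ≤ m × iter f (suc k) d ≡ d
    period d with Fin.pigeonhole (ℕ.n<1+n m) (λ i → iter f (toℕ i) d)
    ... | i , j , i<j , e with ℕ.m≤n⇒∃[o]m+o≡n i<j
    ...   | k , e′ = k , ℕ.+-cancelˡ-≤ (toℕ i) (suc k) m (ℕ.≤-trans (ℕ.≤-reflexive (trans (ℕ.+-suc (toℕ i) k) e′)) (ℕ.≤-trans (ℕ.s≤s⁻¹ (Fin.toℕ<n j)) (ℕ.m≤n+m m (toℕ i))))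
        , sym (iter-injective (toℕ i) (trans e (trans (cong (λ x → iter f x d) (trans (sym e′) (sym (ℕ.+-suc (toℕ i) k)))) (iter-+ (toℕ i) (suc k) d))))

    iter-periods : ∀ k d → iter f k d ≡ d → ∀ j → iter f (j * k) d ≡ d
    iter-periods k d h zero = refl
    iter-periods k d h (suc j) = trans (iter-+ k (j * k) d) (trans (cong (iter f k) (iter-periods k d h j)) h)

    -- Reducing the exponent modulo the period justifies that `cycles` inspects m iterates only.
    orb-short : ∀ {d e} → Orb d e → ∃ λ i → i < m × iter f i d ≡ e
    orb-short {d} (j , refl) with period d
    ... | k , k<m , h = j % suc k , ℕ.<-≤-trans (m%n<n j (suc k)) k<m ,
      trans (cong (iter f (j % suc k)) (sym (iter-periods (suc k) d h (j / suc k))))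
        (trans (sym (iter-+ (j % suc k) _ d)) (cong (λ x → iter f x d) (sym (m≡m%n+[m/n]*n j (suc k)))))

    orb-refl : ∀ {d} → Orb d d
    orb-refl = 0 , refl

    orb-trans : ∀ {x y z} → Orb x y → Orb y z → Orb x z
    orb-trans {x} (i , refl) (j , refl) = j + i , iter-+ j i x

    orb-sym : ∀ {x y} → Orb x y → Orb y x
    orb-sym {x} o with orb-short o | period x
    -- After i steps, another (k + 1) i - i steps complete a multiple of the period k + 1.
    ... | i , i<m , refl | k , _ , h = suc k * i ∸ i , trans (sym (iter-+ (suc k * i ∸ i) i x))
      (trans (cong (λ j → iter f j x) (trans (ℕ.m∸n+n≡m {suc k * i} {i} (ℕ.m≤m+n i (k * i))) (ℕ.*-comm (suc k) i))) (iter-periods (suc k) x h i))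

    least : Fin m → Bool
    least d = allB (λ i → toℕ d ≤ᵇ toℕ (iter f i d)) (upTo m)

    least-true : ∀ d → least d ≡ true → ∀ e → Orb d e → toℕ d ≤ toℕ e
    least-true d h e o with orb-short o
    ... | i , i<m , refl = ≤ᵇ-true (all-true _ (upTo m) h (∈-upTo⁺ i<m))

    least-false : ∀ d → least d ≡ false → ∃ λ e → Orb d e × toℕ e < toℕ d
    least-false d h with all-false _ (upTo m) h
    ... | i , _ , h′ = iter f i d , (i , refl) , ≤ᵇ-false h′

    open Minima Orb orb-refl orb-sym orb-trans least least-true least-false public
      renaming (count-≤ to cycles-≤; count-≥ to cycles-≥)
      using (mins; minimum; count-mins)

  module Walks {m : ℕ} (nb : Fin m → List (Fin m)) (nb-sym : ∀ {x y} → y ∈ nb x → x ∈ nb y) where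

    data Walk : ℕ → Fin m → Fin m → Set where
      done : ∀ {d} → Walk 0 d d
      step : ∀ {d x e k} → x ∈ nb d → Walk k x e → Walk (suc k) d e

    ≡ᵇ-true : ∀ {a b : ℕ} → (a ≡ᵇ b) ≡ true → a ≡ b
    ≡ᵇ-true {a} {b} e = ℕ.≡ᵇ⇒≡ a b (subst T (sym e) tt)

    reach⇒walk : ∀ k d e → reach k nb d e ≡ true → ∃ λ j → Walk j d e
    reach⇒walk zero d e h = 0 , subst (Walk 0 d) (Fin.toℕ-injective (≡ᵇ-true h)) done
    reach⇒walk (suc k) d e h with reach k nb d e in r
    ... | true = reach⇒walk k d e r
    ... | false with any-true (λ x → reach k nb x e) (nb d) h
    ...   | x , x∈ , r′ with reach⇒walk k x e r′
    ...     | j , w = suc j , step x∈ w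

    walk⇒reach : ∀ {j} k {d e} → j ≤ k → Walk j d e → reach k nb d e ≡ true
    walk⇒reach zero {d} z≤n done with toℕ d ≡ᵇ toℕ d | ℕ.≡⇒≡ᵇ (toℕ d) (toℕ d) refl
    ... | true | _ = refl
    walk⇒reach (suc k) {d} z≤n done rewrite walk⇒reach k {d} z≤n (done {d}) = refl
    walk⇒reach (suc k) {d} {e} (s≤s h) (step x∈ w) rewrite any-intro (λ x → reach k nb x e) (nb d) x∈ (walk⇒reach k h w) = Bool.∨-zeroʳ _

    walk-++ : ∀ {i j d x e} → Walk i d x → Walk j x e → Walk (i + j) d e
    walk-++ done w = w
    walk-++ (step h v) w = step h (walk-++ v w)

    site : ∀ {k d e} → Walk k d e → Fin (suc k) → Fin m
    site {d = d} w zero = d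
    site (step _ w) (suc i) = site w i

    upto : ∀ {k d e} (w : Walk k d e) (i : Fin (suc k)) → Walk (toℕ i) d (site w i)
    upto w zero = done
    upto (step h w) (suc i) = step h (upto w i)

    from : ∀ {k d e} (w : Walk k d e) (i : Fin (suc k)) → Walk (k ∸ toℕ i) (site w i) e
    from w zero = w
    from (step h w) (suc i) = from w i

    -- A walk longer than m visits some dart twice and can be cut there; this is why `reach` with m
    -- steps sees a whole component.
    shorten : ∀ k {d e} → Walk k d e → ∃ λ j → j ≤ m × Walk j d e
    shorten = <-rec (λ k → ∀ {d e} → Walk k d e → ∃ λ j → j ≤ m × Walk j d e) go
      where
      go : ∀ k → (∀ {j} → j < k → ∀ {d e} → Walk j d e → ∃ λ i → i ≤ m × Walk i d e) → ∀ {d e} → Walk k d e → ∃ λ j → j ≤ m × Walk j d e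
      go k rec w with k ℕ.≤? m
      ... | yes k≤m = k , k≤m , w
      ... | no k≰m with Fin.pigeonhole (ℕ.m<n⇒m<1+n (ℕ.≰⇒> k≰m)) (site w)
      ...   | i , j , i<j , e = rec shorter (walk-++ (upto w i) (subst (λ x → Walk (k ∸ toℕ j) x _) (sym e) (from w j)))
        where
        shorter : toℕ i + (k ∸ toℕ j) < k
        shorter = ℕ.<-≤-trans (ℕ.+-monoˡ-< (k ∸ toℕ j) i<j) (ℕ.≤-reflexive (ℕ.m+[n∸m]≡n (ℕ.s≤s⁻¹ (Fin.toℕ<n j))))

    Connected : Fin m → Fin m → Set
    Connected d e = ∃ λ k → Walk k d e

    connected-refl : ∀ {d} → Connected d d
    connected-refl = 0 , done

    connected-trans : ∀ {x y z} → Connected x y → Connected y z → Connected x z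
    connected-trans (_ , v) (_ , w) = _ , walk-++ v w

    connected-step : ∀ {x y} → y ∈ nb x → Connected x y
    connected-step h = 1 , step h done

    connected-sym : ∀ {x y} → Connected x y → Connected y x
    connected-sym (_ , done) = connected-refl
    connected-sym (_ , step h w) = connected-trans (connected-sym (_ , w)) (connected-step (nb-sym h))

    least : Fin m → Bool
    least d = allB (λ e → not (reach m nb d e) ∨ (toℕ d ≤ᵇ toℕ e)) (allFin m)

    least-true : ∀ d → least d ≡ true → ∀ e → Connected d e → toℕ d ≤ toℕ e
    least-true d h e (k , w) with shorten k w
    ... | j , j≤m , w′ with all-true (λ e → not (reach m nb d e) ∨ (toℕ d ≤ᵇ toℕ e)) (allFin m) h (∈-allFin e)
    ...   | h′ rewrite walk⇒reach m j≤m w′ = ≤ᵇ-true h′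

    least-false : ∀ d → least d ≡ false → ∃ λ e → Connected d e × toℕ e < toℕ d
    least-false d h with all-false _ (allFin m) h
    ... | e , _ , h′ with reach m nb d e in r
    ...   | true = e , reach⇒walk m d e r , ≤ᵇ-false h′

    open Minima Connected connected-refl connected-sym connected-trans least least-true least-false public
      renaming (count-≤ to components-≤; count-≥ to components-≥; mins to roots; minimum to root-of; count-mins to count-roots)
      using ()

-- Consequences of a trace: edges, reachability, trees

module TraceProperties where

  open ExplorationWords using (nil; mark; fnew; unew; bad; loop; Word)
  open Traces
  open EquivalenceClasses
  open import Data.Bool using (Bool; true; false)
  open import Data.Nat.Base as ℕ using (ℕ; zero; suc; _+_; _*_; _≤_; _<_; z≤n; s≤s)
  import Data.Nat.Properties as ℕ
  open import Data.Nat.DivMod using (_mod_)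
  open import Data.Fin.Base as Fin using (Fin; zero; suc; toℕ)
  import Data.Fin.Properties as Fin
  open import Data.List.Base using (List; []; _∷_; _++_; length; concat)
  import Data.List.Properties as List
  open import Data.List.Membership.Propositional using (_∈_)
  open import Data.List.Membership.Propositional.Properties using (∈-++⁺ˡ; ∈-++⁺ʳ; ∈-++⁻; ∈-tabulate⁻)
  open import Data.List.Relation.Unary.All as All using (All; []; _∷_)
  import Data.List.Relation.Unary.All.Properties as All
  open import Data.List.Relation.Unary.Any using (Any; here; there)
  open import Data.List.Relation.Unary.AllPairs as AllPairs using (AllPairs; []; _∷_)
  import Data.List.Relation.Unary.AllPairs.Properties as AllPairs
  open import Data.List.Relation.Binary.Permutation.Propositional using (_↭_; refl; prep; swap; trans)
  open import Data.List.Relation.Binary.Permutation.Propositional.Properties using (All-resp-↭)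
  open import Data.Product using (Σ; ∃; _×_; _,_; proj₁; proj₂)
  open import Data.Product.Properties using (≡-dec)
  open import Data.Sum using (_⊎_; inj₁; inj₂; [_,_]′)
  open import Function using (_∘_)
  open import Relation.Nullary using (yes; no; contradiction)
  open import Relation.Binary.Definitions using (DecidableEquality)
  open import Relation.Binary.PropositionalEquality hiding ([_]; trans)
  import Relation.Binary.PropositionalEquality as ≡

  AllPairs-↭ : ∀ {A : Set} {R : A → A → Set} → (∀ {x y} → R x y → R y x) → ∀ {xs ys} → xs ↭ ys → AllPairs R xs → AllPairs R ys
  AllPairs-↭ sym refl ps = ps
  AllPairs-↭ sym (prep x r) (p ∷ ps) = All-resp-↭ r p ∷ AllPairs-↭ sym r ps
  AllPairs-↭ sym (swap x y r) ((a ∷ p) ∷ p′ ∷ ps) = (sym a ∷ All-resp-↭ r p′) ∷ All-resp-↭ r p ∷ AllPairs-↭ sym r ps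
  AllPairs-↭ sym (trans r r′) ps = AllPairs-↭ sym r′ (AllPairs-↭ sym r ps)

  -- Each identification merges at most two classes.
  module Merging {A : Set} (_≟_ : DecidableEquality A) where

    Labelling : List (A × A) → List A → Set
    Labelling G X = Σ (A → A) λ lab → (∀ {a b} → (a , b) ∈ G → lab a ≡ lab b) ×
      Σ (List A) λ xs → (∀ {x} → x ∈ xs → x ∈ X) × AllPairs (λ x y → lab x ≢ lab y) xs × length X ≤ length xs + length G

    drop-label : ∀ (lab : A → A) a xs → AllPairs (λ x y → lab x ≢ lab y) xs →
      Σ (List A) λ ys → (∀ {x} → x ∈ ys → x ∈ xs × lab x ≢ a) × AllPairs (λ x y → lab x ≢ lab y) ys × length xs ≤ suc (length ys)
    drop-label lab a [] [] = [] , (λ ()) , [] , z≤n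
    drop-label lab a (x ∷ xs) (p ∷ ps) with lab x ≟ a
    ... | yes refl = xs , (λ m → there m , λ e → All.lookup p m (sym e)) , ps , ℕ.≤-refl
    ... | no h with drop-label lab a xs ps
    ...   | ys , f , qs , le = x ∷ ys , (λ { (here refl) → here refl , h ; (there m) → there (proj₁ (f m)) , proj₂ (f m) })
                               , All.tabulate (λ m → All.lookup p (proj₁ (f m))) ∷ qs , s≤s le

    relabel : A → A → A → A
    relabel a b x with x ≟ a
    ... | yes _ = b
    ... | no _ = x

    relabel-hit : ∀ a b → relabel a b a ≡ b
    relabel-hit a b with a ≟ a
    ... | yes _ = refl
    ... | no h = contradiction refl h

    relabel-new : ∀ a b → relabel a b b ≡ b
    relabel-new a b with b ≟ a
    ... | yes _ = refl
    ... | no h = refl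

    relabel-miss : ∀ {a b x} → x ≢ a → relabel a b x ≡ x
    relabel-miss {a} {b} {x} h with x ≟ a
    ... | yes e = contradiction e h
    ... | no _ = refl

    -- For a pair (a, b) the label of a is renamed to that of b. Dropping the one representative
    -- that carried the old label keeps the others distinct.
    labelling : ∀ G X → AllPairs _≢_ X → Labelling G X
    labelling [] X u = (λ x → x) , (λ ()) , X , (λ m → m) , u , ℕ.m≤m+n (length X) 0
    labelling ((a , b) ∷ G) X u with labelling G X u
    ... | lab , resp , xs , sub , dist , le with drop-label lab (lab a) xs dist
    ...   | ys , f , dist′ , le′ = lab′ , resp′ , ys , (λ m → sub (proj₁ (f m))) , distinct ys (λ m → proj₂ (f m)) dist′ ,
            ℕ.≤-trans le (ℕ.≤-trans (ℕ.+-monoˡ-≤ (length G) le′) (ℕ.≤-reflexive (sym (ℕ.+-suc (length ys) (length G)))))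
      where
      lab′ : A → A
      lab′ x = relabel (lab a) (lab b) (lab x)
      resp′ : ∀ {x y} → (x , y) ∈ (a , b) ∷ G → lab′ x ≡ lab′ y
      resp′ (here refl) = ≡.trans (relabel-hit (lab a) (lab b)) (sym (relabel-new (lab a) (lab b)))
      resp′ (there m) = cong (relabel (lab a) (lab b)) (resp m)
      other : ∀ {x} → lab x ≢ lab a → lab′ x ≡ lab x
      other h = relabel-miss h
      distinct : ∀ ys → (∀ {x} → x ∈ ys → lab x ≢ lab a) → AllPairs (λ x y → lab x ≢ lab y) ys → AllPairs (λ x y → lab′ x ≢ lab′ y) ys
      distinct [] h [] = []
      distinct (y ∷ ys) h (p ∷ ps) = All.tabulate (λ m e → All.lookup p m (≡.trans (sym (other (h (here refl)))) (≡.trans e (other (h (there m))))))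
        ∷ distinct ys (h ∘ there) ps

  argmax : ∀ {k} (f : Fin (suc k) → ℕ) → ∃ λ i → ∀ j → f j ≤ f i
  argmax {zero} f = zero , λ { zero → ℕ.≤-refl }
  argmax {suc k} f with argmax (λ i → f (suc i))
  ... | i , h with f zero ℕ.≤? f (suc i)
  ...   | yes le = suc i , λ { zero → le ; (suc j) → h j }
  ...   | no gt = zero , λ { zero → ℕ.≤-refl ; (suc j) → ℕ.≤-trans (h j) (ℕ.<⇒≤ (ℕ.≰⇒> gt)) }

  module TraceFacts (s : ℕ) where
    open Run s

    private variable
      n k : ℕ
      U K : List Name
      L : List (List Name)
      w : Word
      P : List Edge

    _≟N_ : DecidableEquality Name
    _≟N_ = ≡-dec ℕ._≟_ Fin._≟_

    ∈-fresh⁻ : ∀ n k {v i} → (v , i) ∈ fresh n k → n ≤ v × v < n + k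
    ∈-fresh⁻ n (suc k) m with ∈-++⁻ (vertex n) m
    ... | inj₁ (here refl) = ℕ.≤-refl , ℕ.m<m+n n (s≤s z≤n)
    ... | inj₁ (there m′) with ∈-tabulate⁻ {f = λ i → n , suc i} m′
    ...   | _ , refl = ℕ.≤-refl , ℕ.m<m+n n (s≤s z≤n)
    ∈-fresh⁻ n (suc k) m | inj₂ m′ with ∈-fresh⁻ (suc n) k m′
    ... | a , b = ℕ.<⇒≤ a , ℕ.<-≤-trans b (ℕ.≤-reflexive (sym (ℕ.+-suc n k)))

    ∈-fresh⁺ : ∀ n k {v i} → n ≤ v → v < n + k → (v , i) ∈ fresh n k
    ∈-fresh⁺ n zero {v} a b = contradiction (ℕ.<-≤-trans (subst (v <_) (ℕ.+-identityʳ n) b) a) (ℕ.<-irrefl refl)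
    ∈-fresh⁺ n (suc k) {v} {i} a b with v ℕ.≟ n
    ... | yes refl = ∈-++⁺ˡ (vertex-∈ n i)
    ... | no h = ∈-++⁺ʳ (vertex n) (∈-fresh⁺ (suc n) k (ℕ.≤∧≢⇒< a (h ∘ sym)) (subst (v <_) (ℕ.+-suc n k) b))

    ∈-vertex⁻ : ∀ n {x} → x ∈ vertex n → proj₁ x ≡ n
    ∈-vertex⁻ n (here refl) = refl
    ∈-vertex⁻ n (there m) with ∈-tabulate⁻ {f = λ i → n , suc i} m
    ... | _ , refl = refl

    unique-vertex : ∀ n → AllPairs _≢_ (vertex n)
    unique-vertex n = AllPairs.tabulate⁺ {f = λ i → n , i} (λ h e → h (cong proj₂ e))

    unique-fresh : ∀ n k → AllPairs _≢_ (fresh n k)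
    unique-fresh n zero = []
    unique-fresh n (suc k) = AllPairs.++⁺ (unique-vertex n) (unique-fresh (suc n) k)
      (All.tabulate λ m → All.tabulate λ m′ e → ℕ.<-irrefl (sym (∈-vertex⁻ n (subst (_∈ vertex n) e m))) (proj₁ (∈-fresh⁻ (suc n) k m′)))

    length-fresh : ∀ n k → length (fresh n k) ≡ k * p
    length-fresh n zero = refl
    length-fresh n (suc k) = ≡.trans (List.length-++ (vertex n)) (cong₂ _+_ (cong suc (List.length-tabulate (λ i → n , suc i))) (length-fresh (suc n) k))

    length-ends : ∀ P → length (ends P) ≡ 2 * length P
    length-ends [] = refl
    length-ends (_ ∷ P) = ≡.trans (cong (2 +_) (length-ends P)) (sym (ℕ.*-suc 2 (length P)))

    look : List Edge → Name → Name × Bool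
    -- A default value; darts of the rebuilt map are all ends of edges and never get here.
    look [] x = x , false
    look ((d , e , b) ∷ P) x with x ≟N d | x ≟N e
    ... | yes _ | _ = e , b
    ... | no _ | yes _ = d , b
    ... | no _ | no _ = look P x

    look-out : ∀ {d e b P x} → x ≢ d → x ≢ e → look ((d , e , b) ∷ P) x ≡ look P x
    look-out {d} {e} {x = x} h h′ with x ≟N d | x ≟N e
    ... | yes p | _ = contradiction p h
    ... | no _ | yes p = contradiction p h′
    ... | no _ | no _ = refl

    look-edge : AllPairs _≢_ (ends P) → ∀ {d e b} → (d , e , b) ∈ P → look P d ≡ (e , b) × look P e ≡ (d , b)
    look-edge {(d , e , b) ∷ P} ((h ∷ _) ∷ _) (here refl) = first , second
      where
      first : look ((d , e , b) ∷ P) d ≡ (e , b)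
      first with d ≟N d | d ≟N e
      ... | yes _ | _ = refl
      ... | no p | _ = contradiction refl p
      second : look ((d , e , b) ∷ P) e ≡ (d , b)
      second with e ≟N d | e ≟N e
      ... | yes p | _ = contradiction (sym p) h
      ... | no _ | yes _ = refl
      ... | no _ | no p = contradiction refl p
    look-edge {(d , e , b) ∷ P} ((_ ∷ hd) ∷ he ∷ u) (there m) =
      let (f , g) = look-edge u m ; (i , j) = in-ends′ m in
      ≡.trans (look-out (λ x → All.lookup hd i (sym x)) (λ x → All.lookup he i (sym x))) f ,
      ≡.trans (look-out (λ x → All.lookup hd j (sym x)) (λ x → All.lookup he j (sym x))) g
      where
      in-ends′ : ∀ {P d e b} → (d , e , b) ∈ P → d ∈ ends P × e ∈ ends P
      in-ends′ (here refl) = here refl , there (here refl)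
      in-ends′ (there m) = there (there (proj₁ (in-ends′ m))) , there (there (proj₂ (in-ends′ m)))

    ends-edge : ∀ P {x} → x ∈ ends P → ∃ λ y → ∃ λ b → ((x , y , b) ∈ P ⊎ (y , x , b) ∈ P)
    ends-edge ((d , e , b) ∷ P) (here refl) = e , b , inj₁ (here refl)
    ends-edge ((d , e , b) ∷ P) (there (here refl)) = d , b , inj₂ (here refl)
    ends-edge (_ ∷ P) (there (there m)) with ends-edge P m
    ... | y , b , inj₁ h = y , b , inj₁ (there h)
    ... | y , b , inj₂ h = y , b , inj₂ (there h)

    closed-vertex : ∀ (C : Name → Set) → (∀ {x} → C x → C (σ x)) → ∀ v → C (base v) → ∀ i → C (v , i)
    closed-vertex C σ-closed v c i = subst (λ j → C (v , j)) (mod-< i) (go (toℕ i))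
      where
      go : ∀ j → C (v , j mod p)
      go zero = subst (λ i → C (v , i)) (sym (mod-< zero)) c
      go (suc j) = subst (λ i → C (v , i)) (next-mod j) (σ-closed (go j))

    glue-edges : (t : Tr n U K L w P k) → ∀ {x y} → (x , y) ∈ glue t →
      ∃ λ d → ∃ λ e → ∃ λ b → (d , e , b) ∈ P × ((x ≡ d × y ≡ σ e) ⊎ (x ≡ e × y ≡ σ d))
    glue-edges (nil t) m = glue-edges t m
    glue-edges (mark t) m = glue-edges t m
    glue-edges (fnew t) (here refl) = _ , _ , _ , here refl , inj₁ (refl , refl)
    glue-edges (fnew t) (there (here refl)) = _ , _ , _ , here refl , inj₂ (refl , refl)
    glue-edges (fnew t) (there (there m)) with glue-edges t m
    ... | d , e , b , m′ , h = d , e , b , there m′ , h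
    glue-edges (unew t) (here refl) = _ , _ , _ , here refl , inj₁ (refl , refl)
    glue-edges (unew t) (there (here refl)) = _ , _ , _ , here refl , inj₂ (refl , refl)
    glue-edges (unew t) (there (there m)) with glue-edges t m
    ... | d , e , b , m′ , h = d , e , b , there m′ , h
    glue-edges (loop {l₁ = l₁} {e = e} {l₂ = l₂} {d = d} _ t) m with ∈-++⁻ (when-[] l₁ (e , σ d)) m
    ... | inj₁ m₁ with l₁ | m₁
    ...   | _ ∷ _ | here refl = _ , _ , _ , here refl , inj₂ (refl , refl)
    glue-edges (loop {l₁ = l₁} {e = e} {l₂ = l₂} {d = d} _ t) m | inj₂ m₂ with ∈-++⁻ (when-[] l₂ (d , σ e)) m₂
    ... | inj₁ m₃ with l₂ | m₃
    ...   | _ ∷ _ | here refl = _ , _ , _ , here refl , inj₁ (refl , refl)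
    glue-edges (loop {l₁ = l₁} {e = e} {l₂ = l₂} {d = d} _ t) m | inj₂ m₂ | inj₂ m₃ with glue-edges t m₃
    ... | d , e , b , m′ , h = d , e , b , there m′ , h
    glue-edges (bad _ t) (here refl) = _ , _ , _ , here refl , inj₁ (refl , refl)
    glue-edges (bad _ t) (there (here refl)) = _ , _ , _ , here refl , inj₂ (refl , refl)
    glue-edges (bad _ t) (there (there m)) with glue-edges t m
    ... | d , e , b , m′ , h = d , e , b , there m′ , h

    module _ {C : Name → Set} where

      -- Here and in the next four lemmas: darts on the contours after a step were there before it
      -- or belong to the new vertex, so a property of all of them persists.
      keep-mark : ∀ U K {d} (S : List Name) → (∀ {x} → x ∈ d ∷ U ++ K ++ S → C x) → ∀ {x} → x ∈ U ++ (K ++ d ∷ []) ++ S → C x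
      keep-mark U K {d} S h m = h (shuffle m)
        where
        shuffle : ∀ {x} → x ∈ U ++ (K ++ d ∷ []) ++ S → x ∈ d ∷ U ++ K ++ S
        shuffle m with ∈-++⁻ U m
        ... | inj₁ a = there (∈-++⁺ˡ a)
        ... | inj₂ b with ∈-++⁻ (K ++ d ∷ []) b
        ...   | inj₂ c = there (∈-++⁺ʳ U (∈-++⁺ʳ K c))
        ...   | inj₁ c with ∈-++⁻ K c
        ...     | inj₁ c′ = there (∈-++⁺ʳ U (∈-++⁺ˡ c′))
        ...     | inj₂ (here refl) = here refl

      keep-new : ∀ U {V} (S : List Name) {d} → (∀ {x} → x ∈ V → C x) → (∀ {x} → x ∈ d ∷ U ++ S → C x) → ∀ {x} → x ∈ (V ++ U) ++ S → C x
      keep-new U {V} S g h m with ∈-++⁻ (V ++ U) m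
      ... | inj₂ c = h (there (∈-++⁺ʳ U c))
      ... | inj₁ c with ∈-++⁻ V c
      ...   | inj₁ c′ = g c′
      ...   | inj₂ c′ = h (there (∈-++⁺ˡ c′))

      keep-root : ∀ {V} (S : List Name) {d} → (∀ {x} → x ∈ V → C x) → (∀ {x} → x ∈ d ∷ S → C x) → ∀ {x} → x ∈ V ++ S → C x
      keep-root {V} S g h m with ∈-++⁻ V m
      ... | inj₁ c′ = g c′
      ... | inj₂ c′ = h (there c′)

      keep-loop : ∀ l₁ {l₂ e d} (S : List Name) → (∀ {x} → x ∈ d ∷ (l₁ ++ e ∷ l₂) ++ S → C x) → ∀ {x} → x ∈ l₁ ++ l₂ ++ S → C x
      keep-loop l₁ {l₂} {e} S h m = h (there (subst (_ ∈_) (sym (List.++-assoc l₁ (e ∷ l₂) S)) (weaken m)))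
        where
        weaken : ∀ {x} → x ∈ l₁ ++ l₂ ++ S → x ∈ l₁ ++ e ∷ l₂ ++ S
        weaken m with ∈-++⁻ l₁ m
        ... | inj₁ a = ∈-++⁺ˡ a
        ... | inj₂ b = ∈-++⁺ʳ l₁ (there b)

      keep-bad : ∀ L₁ l₁ {l₂ e d} K L₂ → (∀ {x} → x ∈ d ∷ K ++ concat (L₁ ++ (l₁ ++ e ∷ l₂) ∷ L₂) → C x) →
        ∀ {x} → x ∈ (l₂ ++ l₁ ++ K) ++ concat (L₁ ++ L₂) → C x
      keep-bad L₁ l₁ {l₂} {e} {d} K L₂ h m with ∈-++⁻ (l₂ ++ l₁ ++ K) m
      ... | inj₁ a with ∈-++⁻ l₂ a
      ...   | inj₁ b = h (there (∈-++⁺ʳ K (subst (_ ∈_) (List.concat-++ L₁ _) (∈-++⁺ʳ (concat L₁) (∈-++⁺ˡ (∈-++⁺ʳ l₁ (there b)))))))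
      ...   | inj₂ b with ∈-++⁻ l₁ b
      ...     | inj₁ c = h (there (∈-++⁺ʳ K (subst (_ ∈_) (List.concat-++ L₁ _) (∈-++⁺ʳ (concat L₁) (∈-++⁺ˡ (∈-++⁺ˡ c))))))
      ...     | inj₂ c = h (there (∈-++⁺ˡ c))
      keep-bad L₁ l₁ {l₂} {e} K L₂ h m | inj₂ a with ∈-++⁻ (concat L₁) (subst (_ ∈_) (sym (List.concat-++ L₁ L₂)) a)
      ... | inj₁ b = h (there (∈-++⁺ʳ K (subst (_ ∈_) (List.concat-++ L₁ _) (∈-++⁺ˡ b))))
      ... | inj₂ b = h (there (∈-++⁺ʳ K (subst (_ ∈_) (List.concat-++ L₁ _) (∈-++⁺ʳ (concat L₁) (∈-++⁺ʳ (l₁ ++ e ∷ l₂) b)))))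

    -- A vertex is discovered along an edge from a contour, so C passes to its base and then, by σ,
    -- to all its darts, which join the contours in turn.
    reached : ∀ (C : Name → Set) → (∀ {x} → C x → C (σ x)) → Tr n U K L w P k →
      (∀ {d e b} → (d , e , b) ∈ P → C d → C e) → (∀ {x} → x ∈ U ++ K ++ concat L → C x) → ∀ {x} → x ∈ fresh n k → C x
    reached C σ-closed (nil t) ce h m = reached C σ-closed t ce h m
    reached C σ-closed (mark {U = U} {K = K} {L = L} t) ce h m = reached C σ-closed t ce (keep-mark U K (concat L) h) m
    reached {n = n} C σ-closed (fnew {U = U} {K = K} {L = L} t) ce h m = [ new , reached C σ-closed t (ce ∘ there) (keep-new U (K ++ concat L) (new ∘ there) h) ]′ (∈-++⁻ (vertex n) m)
      where
      new : ∀ {x} → x ∈ vertex n → C x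
      new a = subst C (cong (_, _) (sym (∈-vertex⁻ n a))) (closed-vertex C σ-closed n (ce (here refl) (h (here refl))) _)
    reached {n = n} C σ-closed (unew {K = K} {L = L} t) ce h m = [ new , reached C σ-closed t (ce ∘ there) (keep-root (K ++ concat L) (new ∘ there) h) ]′ (∈-++⁻ (vertex n) m)
      where
      new : ∀ {x} → x ∈ vertex n → C x
      new a = subst C (cong (_, _) (sym (∈-vertex⁻ n a))) (closed-vertex C σ-closed n (ce (here refl) (h (here refl))) _)
    reached C σ-closed (loop {l₁ = l₁} {L = L} refl t) ce h m = reached C σ-closed t (ce ∘ there) (keep-loop l₁ (concat L) h) m
    reached C σ-closed (bad {L₁ = L₁} {l₁ = l₁} {L₂ = L₂} {K = K} refl t) ce h m = reached C σ-closed t (ce ∘ there) (keep-bad L₁ l₁ K L₂ h) m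

    module Trees (E : Name → Name → Set) (E-refl : ∀ {x} → E x x) (E-sym : ∀ {x y} → E x y → E y x)
      (E-trans : ∀ {x y z} → E x y → E y z → E x z) (E-σ : ∀ x → E x (σ x)) where

      E-vertex : ∀ n {x} → x ∈ vertex n → E x (base n)
      E-vertex n {x} m = subst (λ v → E (v , proj₂ x) (base n)) (sym (∈-vertex⁻ n m))
        (closed-vertex (λ y → E y (base n)) (λ {y} h → E-trans (E-sym (E-σ y)) h) n E-refl (proj₂ x))

      -- All of U belongs to the tree rooted at r that is being grown. Once U is empty this tree is
      -- complete, so the condition on r holds for any r.
      tree-roots : Tr n U K L w P k → (∀ {d e} → (d , e , true) ∈ P → E e d) → ∀ r → (∀ {x} → x ∈ U → E x r) →
        ∃ λ reps → length reps ≡ unews w × (∀ {x} → x ∈ fresh n k → Any (E x) (r ∷ reps))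
      tree-roots stop f r h = [] , refl , λ ()
      tree-roots (nil t) f r h = tree-roots t f r λ ()
      tree-roots (mark t) f r h = tree-roots t f r (h ∘ there)
      tree-roots {n = n} (fnew {U = U} {d = d} t) f r h with tree-roots t (f ∘ there) r h′
        where
        h′ : ∀ {x} → x ∈ others n ++ U → E x r
        h′ m with ∈-++⁻ (others n) m
        ... | inj₁ a = E-trans (E-vertex n (there a)) (E-trans (f (here refl)) (h (here refl)))
        ... | inj₂ a = h (there a)
      ... | reps , e , c = reps , e , λ m → cover (∈-++⁻ (vertex n) m)
        where
        cover : ∀ {x} → x ∈ vertex n ⊎ _ → Any (E x) (r ∷ reps)
        cover (inj₁ a) = here (E-trans (E-vertex n a) (E-trans (f (here refl)) (h (here refl))))
        cover (inj₂ a) = c a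
      tree-roots {n = n} (unew {d = d} t) f r h with tree-roots t (f ∘ there) (base n) (λ m → E-vertex n (there m))
      ... | reps , e , c = base n ∷ reps , cong suc e , λ m → cover (∈-++⁻ (vertex n) m)
        where
        cover : ∀ {x} → x ∈ vertex n ⊎ _ → Any (E x) (r ∷ base n ∷ reps)
        cover (inj₁ a) = there (here (E-vertex n a))
        cover (inj₂ a) = there (c a)
      tree-roots (loop _ t) f r h = tree-roots t (f ∘ there) r λ ()
      tree-roots (bad _ t) f r h = tree-roots t (f ∘ there) r λ ()

    parents : List Edge → List (ℕ × ℕ)
    parents [] = []
    parents ((d , e , true) ∷ P) = (proj₁ d , proj₁ e) ∷ parents P
    parents ((d , e , false) ∷ P) = parents P

    parents-∈ : ∀ P {d e} → (d , e , true) ∈ P → (proj₁ d , proj₁ e) ∈ parents P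
    parents-∈ ((d , e , true) ∷ P) (here refl) = here refl
    parents-∈ ((d , e , true) ∷ P) (there m) = there (parents-∈ P m)
    parents-∈ ((d , e , false) ∷ P) (there m) = parents-∈ P m

    parents-length : Tr n U K L w P k → length (parents P) + unews w ≡ k
    parents-length stop = refl
    parents-length (nil t) = parents-length t
    parents-length (mark t) = parents-length t
    parents-length (fnew t) = cong suc (parents-length t)
    parents-length (unew {P = P} t) = ≡.trans (ℕ.+-suc (length (parents P)) _) (cong suc (parents-length t))
    parents-length (loop _ t) = parents-length t
    parents-length (bad _ t) = parents-length t

    -- Forest edges arise by discovery only, so vertex numbers increase away from the root of a
    -- tree, and a tree is entered at base darts. This drives the proof of `acyclic`.
    parent-< : Tr n U K L w P k → (∀ {x} → x ∈ U → proj₁ x < n) →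
      ∀ {d e} → (d , e , true) ∈ P → e ≡ base (proj₁ e) × proj₁ d < proj₁ e
    parent-< (nil t) h m = parent-< t (λ ()) m
    parent-< (mark t) h m = parent-< t (h ∘ there) m
    parent-< (fnew t) h (here refl) = refl , h (here refl)
    parent-< {n = n} (fnew {U = U} t) h (there m) = parent-< t h′ m
      where
      h′ : ∀ {x} → x ∈ others n ++ U → proj₁ x < suc n
      h′ m with ∈-++⁻ (others n) m
      ... | inj₁ a = s≤s (ℕ.≤-reflexive (∈-vertex⁻ n (there a)))
      ... | inj₂ a = ℕ.m<n⇒m<1+n (h (there a))
    parent-< {n = n} (unew t) h (there m) = parent-< t (λ a → s≤s (ℕ.≤-reflexive (∈-vertex⁻ n (there a)))) m
    parent-< (loop _ t) h (there m) = parent-< t (λ ()) m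
    parent-< (bad _ t) h (there m) = parent-< t (λ ()) m

-- The map rebuilt from a trace

module RebuiltMap where

  open import Defs using (FMap; iter; Conn; cRoot; cσ; cα; Valid; ForestCycle; SameV; forestNb; components; vertices; faces)
  open ExplorationWords using (Word)
  open Traces
  open EquivalenceClasses
  open TraceProperties
  open import Data.Bool using (Bool; true)
  open import Data.Nat.Base as ℕ using (ℕ; zero; suc; _+_; _*_; _≤_; _<_; z≤n; s≤s)
  import Data.Nat.Properties as ℕ
  open import Data.Nat.DivMod using (_%_; _/_; _mod_; m≡m%n+[m/n]*n; m<n⇒m%n≡m; m%n<n; [m+n]%n≡m%n)
  open import Data.Nat.Tactic.RingSolver using (solve-∀)
  open import Data.Fin.Base as Fin using (Fin; zero; suc; toℕ; fromℕ; inject₁; lower₁; combine; remQuot)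
  import Data.Fin.Properties as Fin
  open import Data.List.Base using (List; []; _∷_; _++_; length; map; upTo)
  import Data.List.Properties as List
  open import Data.List.Membership.Propositional using (_∈_)
  open import Data.List.Membership.Propositional.Properties using (∈-++⁻; ∈-upTo⁺; ∈-upTo⁻)
  open import Data.List.Relation.Unary.All as All using (All; []; _∷_)
  open import Data.List.Relation.Unary.Any as Any using (Any; here; there)
  import Data.List.Relation.Unary.Any.Properties as Any
  open import Data.List.Relation.Unary.AllPairs as AllPairs using (AllPairs; []; _∷_)
  import Data.List.Relation.Unary.AllPairs.Properties as AllPairs
  import Data.List.Relation.Unary.Unique.Propositional.Properties as Unique
  open import Data.List.Relation.Binary.Permutation.Propositional using (_↭_; ↭-sym)
  open import Data.List.Relation.Binary.Permutation.Propositional.Properties using (∈-resp-↭; ↭-length)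
  open import Data.Product using (∃; _×_; _,_; proj₁; proj₂)
  open import Data.Sum using (_⊎_; inj₁; inj₂)
  open import Data.Empty using (⊥; ⊥-elim)
  open import Function using (_∘_)
  open import Relation.Nullary using (¬_; yes; no)
  open import Relation.Binary.PropositionalEquality

  module Rotation (s : ℕ) where
    open Run s

    prev : Fin p → Fin p
    prev i = (toℕ i + q) mod p

    toℕ-mod : ∀ i → toℕ (i mod p) ≡ i % p
    toℕ-mod i = Fin.toℕ-fromℕ< (m%n<n i p)

    mod-cong : ∀ {i j} → i % p ≡ j % p → i mod p ≡ j mod p
    mod-cong {i} {j} h = Fin.toℕ-injective (trans (toℕ-mod i) (trans h (sym (toℕ-mod j))))

    next-prev : ∀ i → next (prev i) ≡ i
    next-prev i = trans (next-mod (toℕ i + q)) (trans (cong (_mod p) (sym (ℕ.+-suc (toℕ i) q))) (trans (mod-cong {toℕ i + p} {toℕ i} ([m+n]%n≡m%n (toℕ i) p)) (mod-< i)))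

    iter-next : ∀ k i → iter {p} next k i ≡ (k + toℕ i) mod p
    iter-next zero i = sym (mod-< i)
    iter-next (suc k) i = trans (cong next (iter-next k i)) (next-mod (k + toℕ i))

    prev-iter : ∀ i → prev i ≡ iter {p} next q i
    prev-iter i = trans (cong (_mod p) (ℕ.+-comm (toℕ i) q)) (sym (iter-next q i))

    iter-p : ∀ i → iter {p} next p i ≡ i
    iter-p i = trans (iter-next p i) (trans (cong (_mod p) (ℕ.+-comm p (toℕ i))) (trans (mod-cong {toℕ i + p} {toℕ i} ([m+n]%n≡m%n (toℕ i) p)) (mod-< i)))

    iter-comm : ∀ {m} (f : Fin m → Fin m) k i → iter f k (f i) ≡ f (iter f k i)
    iter-comm f zero i = refl
    iter-comm f (suc k) i = cong f (iter-comm f k i)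

    prev-next : ∀ i → prev (next i) ≡ i
    prev-next i = trans (prev-iter (next i)) (trans (iter-comm next q i) (iter-p i))

    iter-least : ∀ k → 0 < k → k < p → ∀ i → iter {p} next k i ≢ i
    iter-least k 0<k k<p i h = absurd ((k + toℕ i) / p) (ℕ.+-cancelʳ-≡ (toℕ i) k _ (trans (m≡m%n+[m/n]*n (k + toℕ i) p)
        (trans (cong (_+ (k + toℕ i) / p * p) (trans (sym (toℕ-mod (k + toℕ i))) (cong toℕ (trans (sym (iter-next k i)) h)))) (ℕ.+-comm (toℕ i) _))))
      where
      absurd : ∀ c → k ≡ c * p → ⊥
      absurd zero refl = ℕ.<-irrefl refl 0<k
      absurd (suc c) e = ℕ.<-irrefl refl (ℕ.<-≤-trans k<p (ℕ.≤-trans (ℕ.m≤m+n p (c * p)) (ℕ.≤-reflexive (sym e))))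

  module Map (s : ℕ) {w : Word} {P : List (Run.Edge s)} {k : ℕ} (t : Run.Tr s 1 (Run.vertex s 0) [] [] w P k) where
    open Run s
    open TraceFacts s
    open Rotation s

    N m : ℕ
    N = suc k
    m = N * p

    ends-all : ends P ↭ fresh 0 N
    ends-all = ends-↭ t

    unique-ends : AllPairs _≢_ (ends P)
    unique-ends = AllPairs-↭ (λ h e → h (sym e)) (↭-sym ends-all) (unique-fresh 0 N)

    ∈-ends⁺ : ∀ {x} → proj₁ x < N → x ∈ ends P
    ∈-ends⁺ h = ∈-resp-↭ (↭-sym ends-all) (∈-fresh⁺ 0 N z≤n h)

    ∈-ends⁻ : ∀ {x} → x ∈ ends P → proj₁ x < N
    ∈-ends⁻ h = proj₂ (∈-fresh⁻ 0 N (∈-resp-↭ ends-all h))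

    partner : Name → Name
    partner x = proj₁ (look P x)

    flag : Name → Bool
    flag x = proj₂ (look P x)

    record Info (x : Name) : Set where
      field
        y : Name
        b : Bool
        edge : (x , y , b) ∈ P ⊎ (y , x , b) ∈ P
        partner-x : partner x ≡ y
        partner-y : partner y ≡ x
        flag-x : flag x ≡ b
        flag-y : flag y ≡ b
        y<N : proj₁ y < N
        distinct : y ≢ x

    edge-ends : ∀ {P d e b} → (d , e , b) ∈ P → d ∈ ends P × e ∈ ends P
    edge-ends (here refl) = here refl , there (here refl)
    edge-ends (there m) = there (there (proj₁ (edge-ends m))) , there (there (proj₂ (edge-ends m)))

    edge-distinct : ∀ {P} → AllPairs _≢_ (ends P) → ∀ {d e b} → (d , e , b) ∈ P → d ≢ e
    edge-distinct {_ ∷ P} ((h ∷ _) ∷ _) (here refl) = h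
    edge-distinct {_ ∷ P} (_ ∷ _ ∷ u) (there m) = edge-distinct u m

    info : ∀ x → proj₁ x < N → Info x
    info x h with ends-edge P (∈-ends⁺ h)
    ... | y , b , inj₁ m = record { y = y ; b = b ; edge = inj₁ m ; partner-x = cong proj₁ lx ; partner-y = cong proj₁ ly
      ; flag-x = cong proj₂ lx ; flag-y = cong proj₂ ly ; y<N = ∈-ends⁻ (proj₂ (edge-ends m)) ; distinct = λ e → edge-distinct unique-ends m (sym e) }
      where
      lx = proj₁ (look-edge unique-ends m)
      ly = proj₂ (look-edge unique-ends m)
    ... | y , b , inj₂ m = record { y = y ; b = b ; edge = inj₂ m ; partner-x = cong proj₁ lx ; partner-y = cong proj₁ ly
      ; flag-x = cong proj₂ lx ; flag-y = cong proj₂ ly ; y<N = ∈-ends⁻ (proj₁ (edge-ends m)) ; distinct = edge-distinct unique-ends m }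
      where
      lx = proj₂ (look-edge unique-ends m)
      ly = proj₁ (look-edge unique-ends m)

    abstract
      name : Fin m → Name
      name x = toℕ (proj₁ (remQuot {N} p x)) , proj₂ (remQuot {N} p x)

      -- Reduction modulo N makes this total; it inverts `name` on the vertices below N, and
      -- compatibility with σ holds without any bound.
      dart : Name → Fin m
      dart (v , i) = combine (v mod N) i

      name<N : ∀ x → proj₁ (name x) < N
      name<N x = Fin.toℕ<n (proj₁ (remQuot {N} p x))

      dart-name : ∀ x → dart (name x) ≡ x
      dart-name x = trans (cong (λ v → combine {N} {p} v (proj₂ (remQuot {N} p x)))
        (Fin.toℕ-injective (trans (Fin.toℕ-fromℕ< _) (m<n⇒m%n≡m (name<N x))))) (Fin.combine-remQuot {N} p x)

      name-dart-mod : ∀ v i → name (dart (v , i)) ≡ (toℕ (v mod N) , i)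
      name-dart-mod v i = cong (λ z → toℕ (proj₁ z) , proj₂ z) (Fin.remQuot-combine {N} {p} (v mod N) i)

      dart-mod : ∀ v i → dart (toℕ (v mod N) , i) ≡ dart (v , i)
      dart-mod v i = cong (λ u → combine {N} {p} u i) (Fin.toℕ-injective (trans (Fin.toℕ-fromℕ< _) (m<n⇒m%n≡m (Fin.toℕ<n (v mod N)))))

    name-dart : ∀ {x} → proj₁ x < N → name (dart x) ≡ x
    name-dart {v , i} h = trans (name-dart-mod v i) (cong (_, i) (trans (Fin.toℕ-fromℕ< _) (m<n⇒m%n≡m h)))

    name-injective : ∀ {x y} → name x ≡ name y → x ≡ y
    name-injective {x} {y} e = trans (sym (dart-name x)) (trans (cong dart e) (dart-name y))

    M : FMap m
    M = record
      { σ = λ x → dart (σ (name x))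
      ; σ⁻ = λ x → dart (proj₁ (name x) , prev (proj₂ (name x)))
      ; α = λ x → dart (partner (name x))
      ; root = dart (base 0)
      ; forest = λ x → flag (name x)
      }

    σM αM φM : Fin m → Fin m
    σM = FMap.σ M
    αM = FMap.α M
    φM x = σM (αM x)

    name-σ : ∀ x → name (σM x) ≡ σ (name x)
    name-σ x = name-dart (name<N x)

    name-α : ∀ x → name (αM x) ≡ partner (name x)
    name-α x = name-dart (subst (λ y → proj₁ y < N) (sym (Info.partner-x i)) (Info.y<N i))
      where i = info (name x) (name<N x)

    name-iter : ∀ i x → name (iter σM i x) ≡ (proj₁ (name x) , iter {p} next i (proj₂ (name x)))
    name-iter zero x = refl
    name-iter (suc i) x = trans (name-σ (iter σM i x)) (cong σ (name-iter i x))

    σ-left : ∀ x → FMap.σ⁻ M (σM x) ≡ x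
    σ-left x = trans (cong dart (trans (cong (λ y → proj₁ y , prev (proj₂ y)) (name-σ x)) (cong (proj₁ (name x) ,_) (prev-next (proj₂ (name x)))))) (dart-name x)

    σ-right : ∀ x → σM (FMap.σ⁻ M x) ≡ x
    σ-right x = trans (cong dart (trans (cong σ (name-dart {proj₁ (name x) , prev (proj₂ (name x))} (name<N x))) (cong (proj₁ (name x) ,_) (next-prev (proj₂ (name x)))))) (dart-name x)

    α-invol : ∀ x → αM (αM x) ≡ x
    α-invol x = trans (cong dart (trans (cong partner (trans (name-α x) (Info.partner-x i))) (Info.partner-y i))) (dart-name x)
      where i = info (name x) (name<N x)

    α-nofix : ∀ x → αM x ≢ x
    α-nofix x h = Info.distinct i (trans (sym (Info.partner-x i)) (trans (sym (name-α x)) (cong name h)))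
      where i = info (name x) (name<N x)

    forest-α : ∀ x → FMap.forest M (αM x) ≡ FMap.forest M x
    forest-α x = trans (cong flag (trans (name-α x) (Info.partner-x i))) (trans (Info.flag-y i) (sym (Info.flag-x i)))
      where i = info (name x) (name<N x)

    valent : ∀ x → iter σM p x ≡ x
    valent x = name-injective (trans (name-iter p x) (cong (proj₁ (name x) ,_) (iter-p (proj₂ (name x)))))

    valent-min : ∀ i → 0 < i → i < p → ∀ x → iter σM i x ≢ x
    valent-min i h h′ x e = iter-least i h h′ (proj₂ (name x)) (cong proj₂ (trans (sym (name-iter i x)) (cong name e)))

    σM-injective : ∀ {x y} → σM x ≡ σM y → x ≡ y
    σM-injective {x} {y} h = trans (sym (σ-left x)) (trans (cong (FMap.σ⁻ M) h) (σ-left y))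

    φM-injective : ∀ {x y} → φM x ≡ φM y → x ≡ y
    φM-injective {x} {y} h = trans (sym (α-invol x)) (trans (cong αM (σM-injective h)) (α-invol y))

    dart-σ : ∀ x → dart (σ x) ≡ σM (dart x)
    dart-σ (v , i) = sym (trans (cong (dart ∘ σ) (name-dart-mod v i)) (dart-mod v (next i)))

    dart-α : ∀ {d e b} → (d , e , b) ∈ P → αM (dart d) ≡ dart e × αM (dart e) ≡ dart d
    dart-α h = cong dart (trans (cong partner (name-dart (∈-ends⁻ (proj₁ (edge-ends h))))) (cong proj₁ (proj₁ (look-edge unique-ends h))))
             , cong dart (trans (cong partner (name-dart (∈-ends⁻ (proj₂ (edge-ends h))))) (cong proj₁ (proj₂ (look-edge unique-ends h))))

    flag′ : Fin m → Bool
    flag′ = FMap.forest M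

    dart-flag : ∀ {d e b} → (d , e , b) ∈ P → flag′ (dart d) ≡ b × flag′ (dart e) ≡ b
    dart-flag h = trans (cong flag (name-dart (∈-ends⁻ (proj₁ (edge-ends h))))) (cong proj₂ (proj₁ (look-edge unique-ends h)))
                , trans (cong flag (name-dart (∈-ends⁻ (proj₂ (edge-ends h))))) (cong proj₂ (proj₂ (look-edge unique-ends h)))

    dart-injective : ∀ {x y} → proj₁ x < N → proj₁ y < N → dart x ≡ dart y → x ≡ y
    dart-injective hx hy e = trans (sym (name-dart hx)) (trans (cong name e) (name-dart hy))

    every : ∀ (C : Fin m → Set) → (∀ {x} → x ∈ fresh 0 N → C (dart x)) → ∀ x → C x
    every C h x = subst C {dart (name x)} {x} (dart-name x) (h (∈-fresh⁺ 0 N z≤n (name<N x)))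

    connected : ∀ x → Conn M x
    connected = every (Conn M) λ {x} h → from h (∈-fresh⁻ 0 N h)
      where
      C : Name → Set
      C x = proj₁ x < N → Conn M (dart x)
      C-σ : ∀ {x} → C x → C (σ x)
      C-σ {x} c h = subst (Conn M) (sym (dart-σ x)) (cσ (c h))
      C-α : ∀ {d e b} → (d , e , b) ∈ P → C d → C e
      C-α h c _ = subst (Conn M) (proj₁ (dart-α h)) (cα (c (∈-ends⁻ (proj₁ (edge-ends h)))))
      C-0 : ∀ {x} → x ∈ vertex 0 → C x
      C-0 {x} h = subst (λ v → C (v , proj₂ x)) (sym (∈-vertex⁻ 0 h)) (closed-vertex C C-σ 0 (λ _ → cRoot) (proj₂ x))
      from : ∀ {x} → x ∈ fresh 0 N → _ → Conn M (dart x)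
      from {x} h (_ , v<N) with ∈-++⁻ (vertex 0) h
      ... | inj₁ a = C-0 a v<N
      ... | inj₂ a = reached C C-σ t C-α (λ {y} b → C-0 (subst (y ∈_) (List.++-identityʳ (vertex 0)) b)) a v<N

    module Oσ = Orbits σM σM-injective
    module Oφ = Orbits φM φM-injective

    length-2P : 2 * length P ≡ m
    length-2P = trans (sym (length-ends P)) (trans (↭-length ends-all) (length-fresh 0 N))

    same-vertex : ∀ {x y} → Oσ.Orb x y → proj₁ (name x) ≡ proj₁ (name y)
    same-vertex {x} (i , refl) = sym (cong proj₁ (name-iter i x))

    vertices-M : vertices M ≡ N
    vertices-M = ℕ.≤-antisym
      (subst (vertices M ≤_) len (Oσ.cycles-≤ bases (every (λ x → Any (Oσ.Orb x) bases) λ {x} h → Any.map⁺ (Any.map (λ { refl → Oσ.orb-sym (to-base h) }) (∈-upTo⁺ (proj₂ (∈-fresh⁻ 0 N h)))))))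
      (subst (_≤ vertices M) len (Oσ.cycles-≥ bases (AllPairs.map⁺ (AllPairs.applyUpTo⁺₁ (λ v → v) N λ {i} {j} i<j j<N o →
        ℕ.<⇒≢ i<j (trans (sym (cong proj₁ (name-dart {base i} (ℕ.<-trans i<j j<N)))) (trans (same-vertex o) (cong proj₁ (name-dart {base j} j<N))))))))
      where
      bases : List (Fin m)
      bases = map (λ v → dart (base v)) (upTo N)
      len : length bases ≡ N
      len = trans (List.length-map _ (upTo N)) (List.length-upTo N)
      to-base : ∀ {x} → x ∈ fresh 0 N → Oσ.Orb (dart (base (proj₁ x))) (dart x)
      to-base {x} h = toℕ (proj₂ x) , name-injective (trans (name-iter (toℕ (proj₂ x)) (dart (base (proj₁ x))))
          (trans (cong (λ y → proj₁ y , iter {p} next (toℕ (proj₂ x)) (proj₂ y)) (name-dart {base (proj₁ x)} v<N))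
            (trans (cong (proj₁ x ,_) (trans (iter-next (toℕ (proj₂ x)) zero) (trans (cong (_mod p) (ℕ.+-identityʳ (toℕ (proj₂ x)))) (mod-< (proj₂ x))))) (sym (name-dart v<N)))))
        where v<N = proj₂ (∈-fresh⁻ 0 N h)

    glue-orbits : ∀ {x y} → (x , y) ∈ glue t → Oφ.Orb (dart x) (dart y)
    glue-orbits h with glue-edges t h
    ... | d , e , b , m , inj₁ (refl , refl) = 1 , trans (cong σM (proj₁ (dart-α m))) (sym (dart-σ e))
    ... | d , e , b , m , inj₂ (refl , refl) = 1 , trans (cong σM (proj₂ (dart-α m))) (sym (dart-σ d))

    initial-chain : ∀ (E : Name → Name → Set) (E-refl : ∀ {x} → E x x) (E-sym : ∀ {x y} → E x y → E y x) (E-trans : ∀ {x y z} → E x y → E y z → E x z) →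
      Faces.Chain E E-refl E-sym E-trans (base 0) (vertex 0 ++ []) (base 0)
    initial-chain E E-refl E-sym E-trans = subst (λ l → Chain (base 0) l (base 0)) (sym (List.++-identityʳ (vertex 0))) (E-refl , chain-others 0)
      where open Faces E E-refl E-sym E-trans

    -- Corners are related when their darts lie on the same face orbit; `faces-traced` then supplies
    -- `nils w` representatives. Words with `bad` are included.
    faces-≤ : faces M ≤ nils w
    faces-≤ = subst (faces M ≤_) len (Oφ.cycles-≤ (map dart reps) (every (λ x → Any (Oφ.Orb x) (map dart reps)) λ h → Any.map⁺ (ends-cov P ok (∈-resp-↭ (↭-sym ends-all) h))))
      where
      E : Name → Name → Set
      E x y = Oφ.Orb (dart x) (dart y)
      open Faces E Oφ.orb-refl Oφ.orb-sym Oφ.orb-trans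
      result = faces-traced t glue-orbits (initial-chain E Oφ.orb-refl Oφ.orb-sym Oφ.orb-trans) []
      reps = proj₁ result
      ok = proj₁ (proj₂ (proj₂ result))
      len : length (map dart reps) ≡ nils w
      len = trans (List.length-map dart reps) (proj₁ (proj₂ result))

    -- Corners are related when they have equal labels, for a labelling that respects `glue` only.
    -- By `faces-traced` it is then constant along faces, so there are at least as many faces as
    -- labels, and `glue-length` gives `nils w` of them.
    faces-≥ : bads w ≡ 0 → nils w ≤ faces M
    faces-≥ nb = bound (Merging.labelling _≟N_ (glue t) (ends P) unique-ends)
     where
     bound : Merging.Labelling _≟N_ (glue t) (ends P) → nils w ≤ faces M
     bound (lab , resp , xs , sub , apart , le) = ℕ.≤-trans enough (subst (_≤ faces M) (List.length-map dart xs) (Oφ.cycles-≥ (map dart xs) (AllPairs.map⁺ (distinct xs sub apart))))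
      where
      E : Name → Name → Set
      E x y = lab x ≡ lab y
      open Faces E refl sym trans
      ok = proj₁ (proj₂ (proj₂ (faces-traced t resp (initial-chain E refl sym trans) [])))
      E-φ : ∀ x → E (name x) (name (φM x))
      E-φ x = trans (edge-E (Info.edge i)) (cong lab (sym (trans (name-σ (αM x)) (cong σ (trans (name-α x) (Info.partner-x i))))))
        where
        i = info (name x) (name<N x)
        edge-E : ∀ {d e b} → (d , e , b) ∈ P ⊎ (e , d , b) ∈ P → E d (σ e)
        edge-E (inj₁ m) = proj₁ (proj₁ (All.lookup ok m))
        edge-E (inj₂ m) = proj₂ (proj₁ (All.lookup ok m))
      E-orb : ∀ i x → E (name x) (name (iter φM i x))
      E-orb zero x = refl
      E-orb (suc i) x = trans (E-orb i x) (E-φ (iter φM i x))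
      separated : ∀ {x y} → proj₁ x < N → proj₁ y < N → Oφ.Orb (dart x) (dart y) → lab x ≡ lab y
      separated {x} {y} hx hy (i , e) = trans (cong lab (sym (name-dart hx))) (trans (E-orb i (dart x)) (cong lab (trans (cong name e) (name-dart hy))))
      distinct : ∀ xs → (∀ {x} → x ∈ xs → x ∈ ends P) → AllPairs (λ x y → lab x ≢ lab y) xs → AllPairs (λ x y → ¬ Oφ.Orb (dart x) (dart y)) xs
      distinct [] h [] = []
      distinct (x ∷ xs) h (a ∷ as) = All.tabulate (λ m o → All.lookup a m (separated (∈-ends⁻ (h (here refl))) (∈-ends⁻ (h (there m))) o)) ∷ distinct xs (h ∘ there) as
      enough : nils w ≤ length xs
      enough = ℕ.+-cancelˡ-≤ (length (glue t)) (nils w) (length xs) (ℕ.≤-trans (ℕ.≤-reflexive (trans (glue-length t nb) (trans (ℕ.+-identityʳ _) (sym (length-ends P)))))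
        (ℕ.≤-trans le (ℕ.≤-reflexive (ℕ.+-comm (length xs) (length (glue t))))))

    nb-sym : ∀ {x y} → y ∈ forestNb M x → x ∈ forestNb M y
    nb-sym {x} (here refl) = there (here (sym (σ-left x)))
    nb-sym {x} (there (here refl)) = here (sym (σ-right x))
    nb-sym {x} (there (there h)) with flag (name x) in e
    nb-sym {x} (there (there (here refl))) | true rewrite trans (forest-α x) e = there (there (here (sym (α-invol x))))

    module W = Walks (forestNb M) nb-sym

    nb-cases : ∀ x {y} → y ∈ forestNb M x → y ≡ σM x ⊎ y ≡ FMap.σ⁻ M x ⊎ (flag (name x) ≡ true × y ≡ αM x)
    nb-cases x (here e) = inj₁ e
    nb-cases x (there (here e)) = inj₂ (inj₁ e)
    nb-cases x (there (there h)) with flag (name x) in f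
    nb-cases x (there (there (here e))) | true = inj₂ (inj₂ (refl , e))

    forest-pair : ∀ x → flag (name x) ≡ true → (name x , name (αM x) , true) ∈ P ⊎ (name (αM x) , name x , true) ∈ P
    forest-pair x f = go (Info.edge i)
      where
      i = info (name x) (name<N x)
      e : Info.y i ≡ name (αM x)
      e = sym (trans (name-α x) (Info.partner-x i))
      b : Info.b i ≡ true
      b = trans (sym (Info.flag-x i)) f
      go : (name x , Info.y i , Info.b i) ∈ P ⊎ (Info.y i , name x , Info.b i) ∈ P → (name x , name (αM x) , true) ∈ P ⊎ (name (αM x) , name x , true) ∈ P
      go (inj₁ m) = inj₁ (subst₂ (λ y b → (name x , y , b) ∈ P) e b m)
      go (inj₂ m) = inj₂ (subst₂ (λ y b → (y , name x , b) ∈ P) e b m)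

    -- Above: every dart is connected to the base of the root vertex or of a vertex opened by
    -- `unew`. Below: the forest edges number k minus `unews w` and merge at most that many of the k
    -- + 1 vertices.
    components-M : components M ≡ suc (unews w)
    components-M = ℕ.≤-antisym upper lower
      where
      E : Name → Name → Set
      E x y = proj₁ x < N → proj₁ y < N → W.Connected (dart x) (dart y)
      upper : components M ≤ suc (unews w)
      upper = subst (components M ≤_) (cong suc (trans (List.length-map dart reps) (proj₁ (proj₂ result))))
        (W.components-≤ (map dart (base 0 ∷ reps)) (every (λ x → Any (W.Connected x) (map dart (base 0 ∷ reps))) cover))
        where
        T : Name → Name → Set
        T x y = W.Connected (dart x) (dart y)
        T-σ : ∀ x → T x (σ x)
        T-σ (v , i) = subst (W.Connected (dart (v , i))) (sym (dart-σ (v , i))) (W.connected-step (here refl))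
        open Trees T W.connected-refl W.connected-sym W.connected-trans T-σ
        forest-edge : ∀ {d e} → (d , e , true) ∈ P → T e d
        forest-edge {d} {e} h = W.connected-step (edge-nb (trans (cong flag (name-dart (∈-ends⁻ (proj₂ (edge-ends h))))) (cong proj₂ (proj₂ (look-edge unique-ends h)))))
          where
          edge-nb : flag (name (dart e)) ≡ true → dart d ∈ forestNb M (dart e)
          edge-nb f rewrite f = there (there (here (sym (proj₂ (dart-α h)))))
        result = tree-roots t forest-edge (base 0) (λ m → E-vertex 0 m)
        reps = proj₁ result
        cover : ∀ {x} → x ∈ fresh 0 N → Any (W.Connected (dart x)) (map dart (base 0 ∷ reps))
        cover h with ∈-++⁻ (vertex 0) h
        ... | inj₁ a = here (E-vertex 0 a)
        ... | inj₂ a = Any.map⁺ (proj₂ (proj₂ result) a)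
      lower : suc (unews w) ≤ components M
      lower = bound (Merging.labelling ℕ._≟_ (parents P) (upTo N) (Unique.upTo⁺ N))
        where
        bound : Merging.Labelling ℕ._≟_ (parents P) (upTo N) → suc (unews w) ≤ components M
        bound (lab , resp , xs , sub , apart , le) = ℕ.≤-trans enough (subst (_≤ components M) (List.length-map (dart ∘ base) xs) (W.components-≥ (map (dart ∘ base) xs) (AllPairs.map⁺ (distinct xs sub apart))))
          where
          tree : Fin m → ℕ
          tree x = lab (proj₁ (name x))
          tree-pair : ∀ {d e} → (d , e , true) ∈ P ⊎ (e , d , true) ∈ P → lab (proj₁ d) ≡ lab (proj₁ e)
          tree-pair (inj₁ m) = resp (parents-∈ P m)
          tree-pair (inj₂ m) = sym (resp (parents-∈ P m))
          tree-nb : ∀ x {y} → y ≡ σM x ⊎ y ≡ FMap.σ⁻ M x ⊎ (flag (name x) ≡ true × y ≡ αM x) → tree x ≡ tree y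
          tree-nb x (inj₁ refl) = cong lab (sym (cong proj₁ (name-σ x)))
          tree-nb x (inj₂ (inj₁ refl)) = cong lab (sym (cong proj₁ (name-dart {proj₁ (name x) , prev (proj₂ (name x))} (name<N x))))
          tree-nb x (inj₂ (inj₂ (f , refl))) = tree-pair (forest-pair x f)
          tree-walk : ∀ {k x y} → W.Walk k x y → tree x ≡ tree y
          tree-walk W.done = refl
          tree-walk (W.step h v) = trans (tree-nb _ (nb-cases _ h)) (tree-walk v)
          separated : ∀ {v u} → v < N → u < N → W.Connected (dart (base v)) (dart (base u)) → lab v ≡ lab u
          separated {v} {u} hv hu (_ , wk) = trans (cong (lab ∘ proj₁) (sym (name-dart {base v} hv))) (trans (tree-walk wk) (cong (lab ∘ proj₁) (name-dart {base u} hu)))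
          distinct : ∀ xs → (∀ {x} → x ∈ xs → x ∈ upTo N) → AllPairs (λ x y → lab x ≢ lab y) xs → AllPairs (λ x y → ¬ W.Connected (dart (base x)) (dart (base y))) xs
          distinct [] h [] = []
          distinct (x ∷ xs) h (a ∷ as) = All.tabulate (λ m o → All.lookup a m (separated (∈-upTo⁻ (h (here refl))) (∈-upTo⁻ (h (there m))) o)) ∷ distinct xs (h ∘ there) as
          enough : suc (unews w) ≤ length xs
          enough = ℕ.+-cancelˡ-≤ (length (parents P)) _ _ (ℕ.≤-trans (ℕ.≤-reflexive (trans (ℕ.+-suc (length (parents P)) (unews w)) (trans (cong suc (parents-length t)) (sym (List.length-upTo N)))))
            (ℕ.≤-trans le (ℕ.≤-reflexive (ℕ.+-comm (length xs) (length (parents P))))))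

    -- At the vertex of a forest cycle discovered last, both cycle edges would lead to its parent.
    acyclic : ¬ ForestCycle M
    acyclic c = impossible
      where
      open ForestCycle c renaming (k to len)
      v : Fin (suc len) → ℕ
      v i = proj₁ (name (ds i))
      top = proj₁ (argmax v)
      top-max = proj₂ (argmax v)
      Up : Fin m → Set
      Up x = name (αM x) ≡ base (proj₁ (name (αM x))) × proj₁ (name x) < proj₁ (name (αM x))
      Down : Fin m → Set
      Down x = name x ≡ base (proj₁ (name x)) × proj₁ (name (αM x)) < proj₁ (name x)
      direction : ∀ x → FMap.forest M x ≡ true → Up x ⊎ Down x
      direction x f = go (forest-pair x f)
        where
        go : (name x , name (αM x) , true) ∈ P ⊎ (name (αM x) , name x , true) ∈ P → Up x ⊎ Down x
        go (inj₁ m) = inj₁ (parent-< t (λ h → s≤s (ℕ.≤-reflexive (∈-vertex⁻ 0 h))) m)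
        go (inj₂ m) = inj₂ (parent-< t (λ h → s≤s (ℕ.≤-reflexive (∈-vertex⁻ 0 h))) m)
      before : ∀ i → ∃ λ j → SameV M (αM (ds j)) (ds i)
      before zero = fromℕ len , close
      before (suc i) = inject₁ i , consec i
      after : ∀ i → ∃ λ j → SameV M (αM (ds i)) (ds j)
      after i with len ℕ.≟ toℕ i
      ... | yes e = zero , subst (λ j → SameV M (αM (ds j)) (ds zero)) (Fin.toℕ-injective (trans (Fin.toℕ-fromℕ len) e)) close
      ... | no h = suc (lower₁ i h) , subst (λ j → SameV M (αM (ds j)) (ds (suc (lower₁ i h)))) (Fin.inject₁-lower₁ i h) (consec (lower₁ i h))
      leaving : Down (ds top)
      leaving with direction (ds top) (inF top)
      ... | inj₂ d = d
      ... | inj₁ (_ , lt) with after top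
      ...   | j , o = ⊥-elim (ℕ.<-irrefl refl (ℕ.<-≤-trans lt (ℕ.≤-trans (ℕ.≤-reflexive (same-vertex o)) (top-max j))))
      prior = proj₁ (before top)
      entering-vertex : proj₁ (name (αM (ds prior))) ≡ v top
      entering-vertex = same-vertex (proj₂ (before top))
      entering : Up (ds prior)
      entering with direction (ds prior) (inF prior)
      ... | inj₁ u = u
      ... | inj₂ (_ , lt) = ⊥-elim (ℕ.<-irrefl refl (ℕ.<-≤-trans (subst (_< v prior) entering-vertex lt) (top-max prior)))
      meet : ds top ≡ αM (ds prior)
      meet = name-injective (trans (proj₁ leaving) (sym (trans (proj₁ entering) (cong base entering-vertex))))
      impossible : ⊥
      impossible with top Fin.≟ prior
      ... | no h = proj₂ (edgesDistinct top prior h) meet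
      -- Both edges coincide only if the cycle is a loop, yet a forest edge leads to a later vertex.
      ... | yes e = ℕ.<-irrefl (cong v (sym e)) (subst (v prior <_) entering-vertex (proj₂ entering))

    nils-euler : nils w + k + 2 * bads w ≡ suc (length P)
    nils-euler = sym (euler t)

    valid : bads w ≡ 0 → Valid p M
    valid nb = record
      { σ-left = σ-left ; σ-right = σ-right ; α-invol = α-invol ; α-nofix = α-nofix ; connected = connected
      ; planar = begin
          2 * (vertices M + faces M) ≡⟨ cong (2 *_) (cong₂ _+_ vertices-M (ℕ.≤-antisym faces-≤ (faces-≥ nb))) ⟩
          2 * (suc k + nils w) ≡⟨ cong (λ x → 2 * suc x) (trans (ℕ.+-comm k (nils w)) (trans (sym (ℕ.+-identityʳ _)) (trans (cong (λ x → nils w + k + 2 * x) (sym nb)) nils-euler))) ⟩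
          2 * suc (suc (length P)) ≡⟨ lem (length P) ⟩
          2 * length P + 4 ≡⟨ cong (_+ 4) length-2P ⟩
          m + 4 ∎
      ; valent = valent ; valent-min = valent-min ; forest-α = forest-α ; acyclic = acyclic }
      where
      open ≡-Reasoning
      lem : ∀ x → 2 * suc (suc x) ≡ 2 * x + 4
      lem = solve-∀

-- Words, their traces, and uniqueness of the word of a map

module WordTraces where

  open ExplorationWords
  open Traces
  open TraceProperties
  open import Data.Bool using (Bool; false)
  open import Data.Nat.Base as ℕ using (ℕ; zero; suc; _+_; _*_; _∸_; _≤_; _<_; z≤n; s≤s)
  import Data.Nat.Properties as ℕ
  open import Data.Nat.ListAction using (sum)
  open import Data.Nat.Tactic.RingSolver using (solve-∀)
  open import Data.Fin.Base using (zero; suc)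
  open import Data.List.Base using (List; []; _∷_; _++_; length; concat; map)
  import Data.List.Properties as List
  open import Data.List.Membership.Propositional using (_∈_)
  open import Data.List.Membership.Propositional.Properties using (∈-++⁺ˡ; ∈-++⁺ʳ; ∈-++⁻; ∈-map⁺; ∈-map⁻)
  open import Data.List.Relation.Unary.All as All using (All; []; _∷_)
  import Data.List.Relation.Unary.All.Properties as All
  open import Data.List.Relation.Unary.Any using (here; there)
  open import Data.List.Relation.Unary.AllPairs as AllPairs using (AllPairs; []; _∷_)
  import Data.List.Relation.Unary.AllPairs.Properties as AllPairs
  open import Data.Product using (Σ; ∃; _×_; _,_; proj₁; proj₂)
  open import Data.Sum using (_⊎_; inj₁; inj₂)
  open import Function using (_∘_)
  open import Relation.Nullary using (¬_; yes; no; contradiction)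
  open import Relation.Binary.PropositionalEquality

  ∈-cat⁻ : ∀ a {g : ℕ → List Word} {w} → w ∈ cat a g → ∃ λ i → i < a × w ∈ g i
  ∈-cat⁻ (suc a) {g} m with ∈-++⁻ (cat a g) m
  ... | inj₂ h = a , ℕ.≤-refl , h
  ... | inj₁ h with ∈-cat⁻ a h
  ...   | i , i<a , h′ = i , ℕ.m<n⇒m<1+n i<a , h′

  ∈-cat⁺ : ∀ a {g : ℕ → List Word} {w i} → i < a → w ∈ g i → w ∈ cat a g
  ∈-cat⁺ (suc a) {g} {i = i} i<a m with i ℕ.≟ a
  ... | yes refl = ∈-++⁺ʳ (cat a g) m
  ... | no h = ∈-++⁺ˡ (∈-cat⁺ a (ℕ.≤∧≢⇒< (ℕ.s≤s⁻¹ i<a) h) m)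

  split-at : ∀ {A : Set} i (K : List A) → i < length K → ∃ λ l₁ → ∃ λ e → ∃ λ l₂ → K ≡ l₁ ++ e ∷ l₂ × length l₁ ≡ i × length l₂ ≡ length K ∸ suc i
  split-at zero (e ∷ l₂) h = [] , e , l₂ , refl , refl , refl
  split-at (suc i) (x ∷ K) (s≤s h) with split-at i K h
  ... | l₁ , e , l₂ , refl , refl , e′ = x ∷ l₁ , e , l₂ , refl , refl , e′

  module Enumeration (r : ℕ) where
    s : ℕ
    s = suc r
    open Run s
    open TraceFacts s
    open Enumerate s using (words; loops; codes; codes-words)

    private variable
      n k : ℕ
      U K : List Name
      L : List (List Name)
      w : Word
      P : List Edge

    length-others : ∀ n → length (others n) ≡ q
    length-others n = List.length-tabulate {n = q} (λ i → n , suc i)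

    Traced : ℕ → List Name → List Name → List (List Name) → Word → ℕ → ℕ → Set
    Traced n U K L w f u = Σ (List Edge) λ P → Σ ℕ λ k → Tr n U K L w P k × nils w ≡ f × unews w ≡ u × bads w ≡ 0

    traced : ∀ g n U K L f u → w ∈ words g (length U) (length K) (map length L) f u → Traced n U K L w f u
    traced-loops : ∀ g n d K L f u → w ∈ cat (length K) (loops g (length K) (map length L) f u) → Traced n [] (d ∷ K) L w f u
    traced (suc g) n (d ∷ U) K L f u m with ∈-++⁻ (map (mark ∷_) (words g (length U) (suc (length K)) (map length L) f u)) m
    ... | inj₁ a with ∈-map⁻ (mark ∷_) a
    ...   | w′ , m′ , refl with traced g n U (K ++ d ∷ []) L f u (subst (λ a → w′ ∈ words g (length U) a (map length L) f u) (sym (trans (List.length-++ K) (ℕ.+-comm (length K) 1))) m′)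
    ...     | P , k , t , x = P , k , mark t , x
    traced (suc g) n (d ∷ U) K L f u m | inj₂ a with ∈-map⁻ (fnew ∷_) a
    ...   | w′ , m′ , refl with traced g (suc n) (others n ++ U) K L f u (subst (λ b → w′ ∈ words g b (length K) (map length L) f u)
                               (sym (trans (List.length-++ (others n)) (trans (cong (_+ length U) (length-others n)) (ℕ.+-comm q (length U))))) m′)
    ...     | P , k , t , x = _ , suc k , fnew t , x
    traced (suc g) n [] [] L zero u ()
    traced (suc g) n [] [] [] (suc zero) zero (here refl) = [] , 0 , stop , refl , refl , refl
    traced (suc g) n [] [] [] (suc zero) (suc u) ()
    traced (suc g) n [] [] [] (suc (suc f)) u ()
    traced (suc g) n [] [] (l ∷ L) (suc f) u m with ∈-map⁻ (nil ∷_) m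
    ... | w′ , m′ , refl with traced g n [] l L f u m′
    ...   | P , k , t , x , y = P , k , nil t , cong suc x , y
    traced (suc g) n [] (d ∷ K) L f zero m = traced-loops g n d K L f zero m
    traced (suc g) n [] (d ∷ K) L f (suc u) m with ∈-++⁻ (cat (length K) (loops g (length K) (map length L) f (suc u))) m
    ... | inj₁ a = traced-loops g n d K L f (suc u) a
    ... | inj₂ a with ∈-map⁻ (unew ∷_) a
    ...   | w′ , m′ , refl with traced g (suc n) (others n) K L f u (subst (λ b → w′ ∈ words g b (length K) (map length L) f u) (sym (length-others n)) m′)
    ...     | P , k , t , x , y , z = _ , suc k , unew t , x , cong suc y , z
    traced-loops g n d K L f u m with ∈-cat⁻ (length K) m
    ... | i , i<a , m′ with split-at i K i<a | ∈-map⁻ (loop i ∷_) m′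
    ...   | l₁ , e , l₂ , refl , refl , e₂ | w′ , m″ , refl with traced g n [] l₁ (l₂ ∷ L) f u (subst (λ j → w′ ∈ words g 0 (length l₁) (j ∷ map length L) f u) (sym e₂) m″)
    ...     | P , k , t , x = _ , k , loop refl t , x

    -- Each step consumes one unit of fuel, so any g not smaller than the length of the word will
    -- do.
    enumerated : Tr n U K L w P k → bads w ≡ 0 → ∀ g → length w ≤ g → w ∈ words g (length U) (length K) (map length L) (nils w) (unews w)
    enumerated stop h (suc g) le = here refl
    enumerated (nil t) h (suc g) (s≤s le) = ∈-map⁺ (nil ∷_) (enumerated t h g le)
    enumerated {w = _ ∷ w} (mark {U = U} {K = K} {L = L} t) h (suc g) (s≤s le) = ∈-++⁺ˡ (∈-map⁺ (mark ∷_)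
      (subst (λ a → w ∈ words g (length U) a (map length L) (nils w) (unews w)) (trans (List.length-++ K) (ℕ.+-comm (length K) 1)) (enumerated t h g le)))
    enumerated {n} {w = _ ∷ w} (fnew {U = U} {K = K} {L = L} t) h (suc g) (s≤s le) =
      ∈-++⁺ʳ (map (mark ∷_) (words g (length U) (suc (length K)) (map length L) (nils w) (unews w))) (∈-map⁺ (fnew ∷_)
      (subst (λ b → w ∈ words g b (length K) (map length L) (nils w) (unews w))
        (trans (List.length-++ (others n)) (trans (cong (_+ length U) (length-others n)) (ℕ.+-comm q (length U)))) (enumerated t h g le)))
    enumerated {n} {w = _ ∷ w} (unew {K = K} {L = L} t) h (suc g) (s≤s le) =
      ∈-++⁺ʳ (cat (length K) (loops g (length K) (map length L) (nils w) (suc (unews w)))) (∈-map⁺ (unew ∷_)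
      (subst (λ b → w ∈ words g b (length K) (map length L) (nils w) (unews w)) (length-others n) (enumerated t h g le)))
    enumerated {w = _ ∷ w} (loop {l₁ = l₁} {e = e} {l₂ = l₂} {L = L} refl t) h (suc g) (s≤s le) = place (nils w) (unews w)
        (∈-cat⁺ (length (l₁ ++ e ∷ l₂)) shorter (∈-map⁺ (loop (length l₁) ∷_)
          (subst (λ j → w ∈ words g 0 (length l₁) (j ∷ map length L) (nils w) (unews w)) rest (enumerated t h g le))))
      where
      len : length (l₁ ++ e ∷ l₂) ≡ suc (length l₁ + length l₂)
      len = trans (List.length-++ l₁) (ℕ.+-suc (length l₁) (length l₂))
      shorter : length l₁ < length (l₁ ++ e ∷ l₂)
      shorter = subst (length l₁ <_) (sym len) (s≤s (ℕ.m≤m+n (length l₁) (length l₂)))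
      rest : length l₂ ≡ length (l₁ ++ e ∷ l₂) ∸ suc (length l₁)
      rest = sym (trans (cong (_∸ suc (length l₁)) len) (ℕ.m+n∸m≡n (length l₁) (length l₂)))
      place : ∀ f u {w′} → w′ ∈ cat (length (l₁ ++ e ∷ l₂)) (loops g (length (l₁ ++ e ∷ l₂)) (map length L) f u) →
        w′ ∈ words (suc g) 0 (suc (length (l₁ ++ e ∷ l₂))) (map length L) f u
      place f zero m = m
      place f (suc u) m = ∈-++⁺ˡ m

    total : List Name → List Name → List (List Name) → ℕ
    total U K L = length U + length K + sum (map length L)

    sum-join : ∀ L₁ (l₁ l₂ K : List Name) e L₂ → sum (map length (L₁ ++ (l₁ ++ e ∷ l₂) ∷ L₂)) ≡ suc (length l₁ + length l₂ + sum (map length (L₁ ++ L₂)))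
    sum-join [] l₁ l₂ K e L₂ = cong (_+ sum (map length L₂)) (trans (List.length-++ l₁) (ℕ.+-suc (length l₁) (length l₂)))
    sum-join (l ∷ L₁) l₁ l₂ K e L₂ = trans (cong (length l +_) (sum-join L₁ l₁ l₂ K e L₂)) (lem (length l) (length l₁ + length l₂) (sum (map length (L₁ ++ L₂))))
      where
      lem : ∀ a b c → a + suc (b + c) ≡ suc (b + (a + c))
      lem = solve-∀

    -- The surplus of 2 f over the need, bounded in the count of words, is here known exactly: s
    -- units for each vertex still to come.
    faces-needed : Tr n U K L w P k → bads w ≡ 0 → total U K L + 2 * suc (length L) + s * k ≡ 2 * nils w
    faces-needed stop h = lem r
      where
      lem : ∀ r → 2 + suc r * 0 ≡ 2
      lem = solve-∀
    faces-needed {w = _ ∷ w} {k = k} (nil {l = l} {L = L} t) h = trans (lem (length l) (sum (map length L)) (length L) (s * k)) (trans (cong (2 +_) (faces-needed t h)) (sym (ℕ.*-suc 2 (nils w))))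
      where
      lem : ∀ a b c x → a + b + 2 * suc (suc c) + x ≡ 2 + (a + b + 2 * suc c + x)
      lem = solve-∀
    faces-needed {k = k} (mark {U = U} {K = K} {d = d} {L = L} t) h = trans
      (trans (lem (length U) (length K) (sum (map length L)) (length L) (s * k)) (cong (λ x → length U + x + sum (map length L) + 2 * suc (length L) + s * k) (sym (List.length-++ K {d ∷ []}))))
      (faces-needed t h)
      where
      lem : ∀ u a b c x → suc u + a + b + 2 * suc c + x ≡ u + (a + 1) + b + 2 * suc c + x
      lem = solve-∀
    faces-needed {n} (fnew {U = U} {K = K} {L = L} {k = k} t) h = trans
      (trans (lem r (length U) (length K) (sum (map length L)) (length L) k) (cong (λ x → x + length K + sum (map length L) + 2 * suc (length L) + s * k)
        (sym (trans (List.length-++ (others n)) (cong (_+ length U) (length-others n))))))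
      (faces-needed t h)
      where
      lem : ∀ r u a b c k → suc u + a + b + 2 * suc c + suc r * suc k ≡ suc (suc r) + u + a + b + 2 * suc c + suc r * k
      lem = solve-∀
    faces-needed {n} (unew {K = K} {L = L} {k = k} t) h = trans
      (trans (lem r (length K) (sum (map length L)) (length L) k) (cong (λ x → x + length K + sum (map length L) + 2 * suc (length L) + s * k)
        (sym (length-others n))))
      (faces-needed t h)
      where
      lem : ∀ r a b c k → suc a + b + 2 * suc c + suc r * suc k ≡ suc (suc r) + a + b + 2 * suc c + suc r * k
      lem = solve-∀
    faces-needed {k = k} (loop {l₁ = l₁} {e = e} {l₂ = l₂} {L = L} refl t) h = trans
      (trans (cong (λ x → suc x + sum (map length L) + 2 * suc (length L) + s * k) (List.length-++ l₁)) (lem (length l₁) (length l₂) (sum (map length L)) (length L) (s * k)))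
      (faces-needed t h)
      where
      lem : ∀ a b c d x → suc (a + suc b) + c + 2 * suc d + x ≡ a + (b + c) + 2 * suc (suc d) + x
      lem = solve-∀

    -- The same potential as in the count of words, 4 times the surplus s k plus a size in which the
    -- darts of U count twice.
    length-bound : Tr n U K L w P k → bads w ≡ 0 → length w ≤ 4 * (s * k) + (length U + total U K L + suc (length L))
    length-bound stop h = ℕ.m≤n+m 1 (4 * (s * 0))
    length-bound {k = k} (nil {l = l} {L = L} t) h = ℕ.≤-trans (s≤s (length-bound t h)) (ℕ.≤-reflexive (lem (4 * (s * k)) (length l) (sum (map length L)) (length L)))
      where
      lem : ∀ x a b c → suc (x + (a + b + suc c)) ≡ x + (a + b + suc (suc c))
      lem = solve-∀
    length-bound {k = k} (mark {U = U} {K = K} {d = d} {L = L} t) h = ℕ.≤-trans (s≤s (length-bound t h)) (ℕ.≤-reflexive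
      (trans (cong (λ y → suc (4 * (s * k) + (length U + (length U + y + sum (map length L)) + suc (length L)))) (List.length-++ K {d ∷ []}))
        (lem (4 * (s * k)) (length U) (length K) (sum (map length L)) (length L))))
      where
      lem : ∀ x u a b c → suc (x + (u + (u + (a + 1) + b) + suc c)) ≡ x + (suc u + (suc u + a + b) + suc c)
      lem = solve-∀
    length-bound {n} (fnew {U = U} {K = K} {L = L} {k = k} t) h = ℕ.≤-trans (s≤s (length-bound t h)) (ℕ.≤-trans (ℕ.≤-reflexive
      (cong (λ y → suc (4 * (s * k) + (y + (y + length K + sum (map length L)) + suc (length L)))) (trans (List.length-++ (others n)) (cong (_+ length U) (length-others n)))))
        (ℕ.≤-trans (ℕ.m≤m+n _ (suc (r + r))) (ℕ.≤-reflexive (lem r k (length U) (length K) (sum (map length L)) (length L)))))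
      where
      lem : ∀ r k u a b c → suc (4 * (suc r * k) + (suc (suc r) + u + (suc (suc r) + u + a + b) + suc c)) + suc (r + r) ≡ 4 * (suc r * suc k) + (suc u + (suc u + a + b) + suc c)
      lem = solve-∀
    length-bound {n} (unew {K = K} {L = L} {k = k} t) h = ℕ.≤-trans (s≤s (length-bound t h)) (ℕ.≤-trans (ℕ.≤-reflexive
      (cong (λ y → suc (4 * (s * k) + (y + (y + length K + sum (map length L)) + suc (length L)))) (length-others n)))
        (ℕ.≤-trans (ℕ.m≤m+n _ (r + r)) (ℕ.≤-reflexive (lem r k (length K) (sum (map length L)) (length L)))))
      where
      lem : ∀ r k a b c → suc (4 * (suc r * k) + (suc (suc r) + (suc (suc r) + a + b) + suc c)) + (r + r) ≡ 4 * (suc r * suc k) + (suc a + b + suc c)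
      lem = solve-∀
    length-bound {k = k} (loop {l₁ = l₁} {e = e} {l₂ = l₂} {L = L} refl t) h = ℕ.≤-trans (s≤s (length-bound t h)) (ℕ.≤-reflexive
      (trans (lem (4 * (s * k)) (length l₁) (length l₂) (sum (map length L)) (length L)) (cong (λ y → 4 * (s * k) + (suc y + sum (map length L) + suc (length L))) (sym (List.length-++ l₁ {e ∷ l₂})))))
      where
      lem : ∀ x a b c d → suc (x + (a + (b + c) + suc (suc d))) ≡ x + (suc (a + suc b) + c + suc d)
      lem = solve-∀

    enumerated-all : ∀ {w P k} → Tr 1 (vertex 0) [] [] w P k → bads w ≡ 0 → w ∈ codes p (nils w) (unews w)
    enumerated-all {w} {P} {k} t h = subst (w ∈_) (sym (codes-words p (nils w) (unews w))) (subst (λ b → w ∈ words (8 * nils w + (2 * p + 1)) b 0 [] (nils w) (unews w)) (cong suc (length-others 0))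
      (enumerated t h _ (ℕ.≤-trans (length-bound t h) (ℕ.+-mono-≤ (ℕ.≤-trans (ℕ.*-monoʳ-≤ 4 few) (ℕ.≤-reflexive (sym (ℕ.*-assoc 4 2 (nils w)))))
        (ℕ.≤-reflexive (trans (cong (λ b → b + (b + 0 + 0) + 1) (cong suc (length-others 0))) (lem p)))))))
      where
      few : s * k ≤ 2 * nils w
      few = ℕ.≤-trans (ℕ.m≤n+m (s * k) (total (vertex 0) [] [] + 2)) (ℕ.≤-reflexive (faces-needed t h))
      lem : ∀ b → b + (b + 0 + 0) + 1 ≡ 2 * b + 1
      lem = solve-∀

    traced-all : ∀ f u {w} → w ∈ codes p f u → Traced 1 (vertex 0) [] [] w f u
    traced-all f u {w} m = traced (8 * f + (2 * p + 1)) 1 (vertex 0) [] [] f u (subst (λ b → w ∈ words (8 * f + (2 * p + 1)) b 0 [] f u) (sym (cong suc (length-others 0))) (subst (w ∈_) (codes-words p f u) m))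

    Unique : List Word → Set
    Unique = AllPairs _≢_

    unique-map : ∀ (x : Step) {ws} → Unique ws → Unique (map (x ∷_) ws)
    unique-map x u = AllPairs.map⁺ (AllPairs.map (λ h e → h (List.∷-injectiveʳ e)) u)

    disjoint-++ : ∀ {xs ys : List Word} → Unique xs → Unique ys → (∀ {w} → w ∈ xs → ¬ (w ∈ ys)) → Unique (xs ++ ys)
    disjoint-++ u v h = AllPairs.++⁺ u v (All.tabulate λ m → All.tabulate λ m′ e → h m (subst (_∈ _) (sym e) m′))

    heads : ∀ {x y : Step} {xs ys : List Word} {w} → x ≢ y → w ∈ map (x ∷_) xs → ¬ (w ∈ map (y ∷_) ys)
    heads {x} {y} h m m′ with ∈-map⁻ (x ∷_) m | ∈-map⁻ (y ∷_) m′
    ... | _ , _ , refl | _ , _ , e = h (List.∷-injectiveˡ e)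

    loop-injective : ∀ {i j : ℕ} → _≡_ {A = Step} (loop i) (loop j) → i ≡ j
    loop-injective refl = refl

    unique-cat : ∀ a {ws : ℕ → List Word} → (∀ i → Unique (ws i)) → Unique (cat a (λ i → map (loop i ∷_) (ws i)))
    unique-cat zero h = []
    unique-cat (suc a) h = disjoint-++ (unique-cat a h) (unique-map (loop a) (h a)) λ m m′ →
      let (i , i<a , m″) = ∈-cat⁻ a m in heads (λ e → ℕ.<-irrefl (loop-injective e) i<a) m″ m′

    unique-words : ∀ g b a L f u → Unique (words g b a L f u)
    unique-words zero b a L f u = []
    unique-words (suc g) (suc b) a L f u = disjoint-++ (unique-map mark (unique-words g b (suc a) L f u)) (unique-map fnew (unique-words g (b + q) a L f u)) (heads λ ())
    unique-words (suc g) zero zero L zero u = []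
    unique-words (suc g) zero zero [] (suc zero) zero = [] ∷ []
    unique-words (suc g) zero zero [] (suc zero) (suc u) = []
    unique-words (suc g) zero zero [] (suc (suc f)) u = []
    unique-words (suc g) zero zero (l ∷ L) (suc f) u = unique-map nil (unique-words g 0 l L f u)
    unique-words (suc g) zero (suc a) L f zero = unique-cat a (λ i → unique-words g 0 i (a ∸ suc i ∷ L) f 0)
    unique-words (suc g) zero (suc a) L f (suc u) = disjoint-++ (unique-cat a (λ i → unique-words g 0 i (a ∸ suc i ∷ L) f (suc u))) (unique-map unew (unique-words g q a L f u))
      λ m m′ → let (i , _ , m″) = ∈-cat⁻ a m in heads (λ ()) m″ m′

    later : ∀ {x : Name} {a P} → (∃ λ y → (x , y , false) ∈ P ⊎ (y , x , false) ∈ P) → ∃ λ y → (x , y , false) ∈ a ∷ P ⊎ (y , x , false) ∈ a ∷ P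
    later (y , inj₁ m) = y , inj₁ (there m)
    later (y , inj₂ m) = y , inj₂ (there m)

    -- A marked dart is used up by `loop` or `unew` only, and both record the flag false. This tells
    -- `mark` from `fnew` by looking at the map.
    unflagged : Tr n U K L w P k → bads w ≡ 0 → ∀ {x} → x ∈ K ++ concat L → ∃ λ y → (x , y , false) ∈ P ⊎ (y , x , false) ∈ P
    unflagged (nil t) h m = unflagged t h m
    unflagged (mark {K = K} {d = d} {L = L} t) h m with ∈-++⁻ K m
    ... | inj₁ a = unflagged t h (∈-++⁺ˡ (∈-++⁺ˡ a))
    ... | inj₂ a = unflagged t h (∈-++⁺ʳ (K ++ d ∷ []) a)
    unflagged (fnew t) h m = later (unflagged t h m)
    unflagged (unew t) h (here refl) = _ , inj₁ (here refl)
    unflagged (unew t) h (there m) = later (unflagged t h m)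
    unflagged (loop refl t) h (here refl) = _ , inj₁ (here refl)
    unflagged (loop {l₁ = l₁} {e = e} {l₂ = l₂} {L = L} refl t) h (there m) with ∈-++⁻ l₁ (subst (_ ∈_) (List.++-assoc l₁ (e ∷ l₂) (concat L)) m)
    ... | inj₁ a = later (unflagged t h (∈-++⁺ˡ a))
    ... | inj₂ (here refl) = _ , inj₂ (here refl)
    ... | inj₂ (there a) = later (unflagged t h (∈-++⁺ʳ l₁ a))

    unique-prefix : ∀ (xs : List Name) {ys} → AllPairs _≢_ (xs ++ ys) → AllPairs _≢_ xs
    unique-prefix [] u = []
    unique-prefix (x ∷ xs) (h ∷ u) = All.++⁻ˡ xs h ∷ unique-prefix xs u

    unique-tail : ∀ {x : Name} {xs} → AllPairs _≢_ (x ∷ xs) → AllPairs _≢_ xs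
    unique-tail (_ ∷ u) = u

    same-split : ∀ l₁ {l₁′ : List Name} {e l₂ l₂′} → AllPairs _≢_ (l₁ ++ e ∷ l₂) → l₁ ++ e ∷ l₂ ≡ l₁′ ++ e ∷ l₂′ → l₁ ≡ l₁′ × l₂ ≡ l₂′
    same-split [] {[]} u refl = refl , refl
    same-split [] {x ∷ l₁′} (h ∷ _) refl = contradiction refl (All.lookup h (∈-++⁺ʳ l₁′ (here refl)))
    same-split (x ∷ l₁) {[]} (h ∷ _) refl = contradiction refl (All.lookup h (∈-++⁺ʳ l₁ (here refl)))
    same-split (x ∷ l₁) {y ∷ l₁′} (_ ∷ u) e with List.∷-injective e
    ... | refl , e′ with same-split l₁ u e′
    ...   | refl , refl = refl , refl

    -- ψ and ψ′ name the darts of the same map.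
    module Lockstep {D : Set} (σD α : D → D) (fo : D → Bool) (ψ ψ′ : Name → D)
      (ψ-σ : ∀ x → ψ (σ x) ≡ σD (ψ x)) (ψ′-σ : ∀ x → ψ′ (σ x) ≡ σD (ψ′ x)) where

      Respects : (Name → D) → List Edge → Set
      Respects ψ P = ∀ {d e b} → (d , e , b) ∈ P → α (ψ d) ≡ ψ e × fo (ψ d) ≡ b × fo (ψ e) ≡ b

      Injective : (Name → D) → ℕ → Set
      Injective ψ n = ∀ {x y} → proj₁ x < n → proj₁ y < n → ψ x ≡ ψ y → x ≡ y

      Fine : ℕ → Name → Set
      Fine n x = proj₁ x < n × ψ x ≡ ψ′ x

      fine-vertex : ∀ n → ψ (base n) ≡ ψ′ (base n) → ∀ {x} → x ∈ others n → Fine (suc n) x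
      fine-vertex n h {x} m = s≤s (ℕ.≤-reflexive v) , subst (λ u → ψ (u , proj₂ x) ≡ ψ′ (u , proj₂ x)) (sym v)
        (closed-vertex (λ y → ψ y ≡ ψ′ y) (λ {y} e → trans (ψ-σ y) (trans (cong σD e) (sym (ψ′-σ y)))) n h (proj₂ x))
        where v = ∈-vertex⁻ n (there m)

      widen : ∀ {n x} → Fine n x → Fine (suc n) x
      widen (h , e) = ℕ.m<n⇒m<1+n h , e

      flag-false : ∀ {P x} → Respects ψ P → (∃ λ y → (x , y , false) ∈ P ⊎ (y , x , false) ∈ P) → fo (ψ x) ≡ false
      flag-false r (y , inj₁ m) = proj₁ (proj₂ (r m))
      flag-false r (y , inj₂ m) = proj₂ (proj₂ (r m))

      flag-false′ : ∀ {P x} → Respects ψ′ P → (∃ λ y → (x , y , false) ∈ P ⊎ (y , x , false) ∈ P) → fo (ψ′ x) ≡ false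
      flag-false′ r (y , inj₁ m) = proj₁ (proj₂ (r m))
      flag-false′ r (y , inj₂ m) = proj₂ (proj₂ (r m))

      -- The map dictates each step: the flag of the first dart decides between `mark` and `fnew`,
      -- whether its partner has been discovered decides between `loop` and `unew`, and the position
      -- of the partner gives the index of the loop. All of this is seen alike through ψ and ψ′,
      -- which agree on the contours.
      lockstep : ∀ {n U K L w P k w′ P′ k′} → Tr n U K L w P k → Tr n U K L w′ P′ k′ → bads w ≡ 0 → bads w′ ≡ 0 →
        Respects ψ P → Respects ψ′ P′ → Injective ψ (n + k) → Injective ψ′ (n + k′) → AllPairs _≢_ (ends P) →
        (∀ {x} → x ∈ U ++ K ++ concat L → Fine n x) → w ≡ w′
      lockstep stop stop h h′ r r′ i i′ u f = refl
      lockstep (nil t) (nil t′) h h′ r r′ i i′ u f = cong (nil ∷_) (lockstep t t′ h h′ r r′ i i′ u f)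
      lockstep (mark {U = U} {K = K} {L = L} t) (mark t′) h h′ r r′ i i′ u f = cong (mark ∷_) (lockstep t t′ h h′ r r′ i i′ u (keep-mark U K (concat L) f))
      lockstep (mark {K = K} t) (fnew t′) h h′ r r′ i i′ u f with trans (sym (flag-false r (unflagged t h (∈-++⁺ˡ (∈-++⁺ʳ K (here refl)))))) (trans (cong fo (proj₂ (f (here refl)))) (proj₁ (proj₂ (r′ (here refl)))))
      ... | ()
      lockstep (fnew t) (mark {K = K} t′) h h′ r r′ i i′ u f with trans (sym (flag-false′ r′ (unflagged t′ h′ (∈-++⁺ˡ (∈-++⁺ʳ K (here refl)))))) (trans (cong fo (sym (proj₂ (f (here refl))))) (proj₁ (proj₂ (r (here refl)))))
      ... | ()
      lockstep {n} (fnew {U = U} {K = K} {L = L} {k = k} t) (fnew {k = k′} t′) h h′ r r′ i i′ (_ ∷ _ ∷ u) f = cong (fnew ∷_)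
        (lockstep t t′ h h′ (r ∘ there) (r′ ∘ there) (subst (Injective ψ) (ℕ.+-suc n k) i) (subst (Injective ψ′) (ℕ.+-suc n k′) i′) u
          (keep-new U (K ++ concat L) (fine-vertex n same) (widen ∘ f)))
        where
        same : ψ (base n) ≡ ψ′ (base n)
        same = trans (sym (proj₁ (r (here refl)))) (trans (cong α (proj₂ (f (here refl)))) (proj₁ (r′ (here refl))))
      lockstep {n} (unew {K = K} {L = L} {k = k} t) (unew {k = k′} t′) h h′ r r′ i i′ (_ ∷ _ ∷ u) f = cong (unew ∷_)
        (lockstep t t′ h h′ (r ∘ there) (r′ ∘ there) (subst (Injective ψ) (ℕ.+-suc n k) i) (subst (Injective ψ′) (ℕ.+-suc n k′) i′) u
          (keep-root (K ++ concat L) (fine-vertex n same) (widen ∘ f)))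
        where
        same : ψ (base n) ≡ ψ′ (base n)
        same = trans (sym (proj₁ (r (here refl)))) (trans (cong α (proj₂ (f (here refl)))) (proj₁ (r′ (here refl))))
      -- One dart would have as partner both the base of the new vertex n and a dart of an earlier
      -- vertex.
      lockstep {n} (unew {k = k} t) (loop {l₁ = l₁} {e = e} refl t′) h h′ r r′ i i′ u f =
        contradiction (i (ℕ.m<m+n n (s≤s z≤n)) (ℕ.m≤n⇒m≤n+o _ (proj₁ fe)) (trans (sym (proj₁ (r (here refl)))) (trans (cong α (proj₂ (f (here refl)))) (trans (proj₁ (r′ (here refl))) (sym (proj₂ fe))))))
          (λ eq → ℕ.<-irrefl (cong proj₁ (sym eq)) (proj₁ fe))
        where fe = f (there (∈-++⁺ˡ (∈-++⁺ʳ l₁ (here refl))))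
      lockstep {n} (loop {l₁ = l₁} {e = e} refl t) (unew {k = k′} t′) h h′ r r′ i i′ u f =
        contradiction (i′ (ℕ.m<m+n n (s≤s z≤n)) (ℕ.m≤n⇒m≤n+o _ (proj₁ fe)) (trans (sym (proj₁ (r′ (here refl)))) (trans (cong α (sym (proj₂ (f (here refl))))) (trans (proj₁ (r (here refl))) (proj₂ fe)))))
          (λ eq → ℕ.<-irrefl (cong proj₁ (sym eq)) (proj₁ fe))
        where fe = f (there (∈-++⁺ˡ (∈-++⁺ʳ l₁ (here refl))))
      lockstep {n} (loop {l₁ = l₁} {e = e} {l₂ = l₂} {L = L} {k = k} refl t) (loop {l₁ = l₁′} {e = e′} eq t′) h h′ r r′ i i′ u@(_ ∷ _ ∷ u₀) f
        with i {e} {e′} (ℕ.m≤n⇒m≤n+o k (proj₁ (f (there (∈-++⁺ˡ (∈-++⁺ʳ l₁ (here refl))))))) (ℕ.m≤n⇒m≤n+o k (proj₁ fe′))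
               (trans (sym (proj₁ (r (here refl)))) (trans (cong α (proj₂ (f (here refl)))) (trans (proj₁ (r′ (here refl))) (sym (proj₂ fe′)))))
        where fe′ = f {e′} (there (∈-++⁺ˡ (subst (e′ ∈_) (sym eq) (∈-++⁺ʳ l₁′ (here refl)))))
      ... | refl with same-split l₁ contour-unique eq
        where
        contour-unique : AllPairs _≢_ (l₁ ++ e ∷ l₂)
        contour-unique = unique-prefix (l₁ ++ e ∷ l₂) (unique-prefix ((l₁ ++ e ∷ l₂) ++ concat L) (unique-tail (AllPairs-↭ (λ h e → h (sym e)) (ends-↭ (loop refl t)) u)))
      ...   | refl , refl = cong (loop (length l₁) ∷_) (lockstep t t′ h h′ (r ∘ there) (r′ ∘ there) i i′ u₀ (keep-loop l₁ (concat L) f))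

-- Exploring a given map

module MapExploration where

  open import Defs using (FMap; iter; Valid; SameV)
  open ExplorationWords using (Word; nil; mark; fnew; unew; bad; loop)
  open Traces
  open EquivalenceClasses
  open TraceProperties
  open import Data.Bool using (Bool; true; false)
  open import Data.Empty using (⊥; ⊥-elim)
  open import Data.Nat.Base as ℕ using (ℕ; zero; suc; _+_; _≤_; _<_; z≤n; s≤s)
  import Data.Nat.Properties as ℕ
  open import Data.Nat.DivMod using (_%_; _/_; m≡m%n+[m/n]*n; m%n<n)
  open import Data.Nat.ListAction using (sum)
  open import Data.Nat.Tactic.RingSolver using (solve-∀)
  open import Data.Fin.Base as Fin using (Fin; zero; suc; toℕ; fromℕ; fromℕ<; inject₁)
  import Data.Fin.Properties as Fin
  open import Data.List.Base using (List; []; _∷_; _++_; length; concat; map)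
  import Data.List.Properties as List
  open import Data.List.Membership.Propositional using (_∈_; _∉_)
  open import Data.List.Membership.Propositional.Properties using (∈-++⁺ˡ; ∈-++⁺ʳ; ∈-++⁻; ∈-∃++; ∈-concat⁻′; ∈-tabulate⁻)
  open import Data.List.Relation.Unary.All as All using (All; []; _∷_)
  import Data.List.Relation.Unary.All.Properties as All
  open import Data.List.Relation.Unary.Any using (here; there)
  open import Data.List.Relation.Unary.AllPairs as AllPairs using (AllPairs; []; _∷_)
  import Data.List.Relation.Unary.AllPairs.Properties as AllPairs
  open import Data.List.Relation.Binary.Permutation.Propositional using (_↭_; ↭-refl; ↭-sym)
  open import Data.List.Relation.Binary.Permutation.Propositional.Properties using (∈-resp-↭)
  open import Data.Product using (Σ; ∃; _×_; _,_; proj₁; proj₂)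
  open import Data.Sum using (_⊎_; inj₁; inj₂)
  open import Function using (_∘_)
  open import Relation.Binary.Definitions using (tri<; tri≈; tri>)
  open import Relation.Nullary using (¬_; Dec; yes; no; contradiction)
  open import Relation.Binary.PropositionalEquality hiding ([_])

  module Exploration (s : ℕ) {m : ℕ} (M : FMap m) (V : Valid (suc (suc s)) M) where
    open Run s
    open TraceFacts s
    open Valid V

    σM αM : Fin m → Fin m
    σM = FMap.σ M
    αM = FMap.α M
    fo : Fin m → Bool
    fo = FMap.forest M

    module O = Orbits σM (λ {x} {y} h → trans (sym (σ-left x)) (trans (cong (FMap.σ⁻ M) h) (σ-left y)))

    Bases : Set
    Bases = ℕ → Fin m

    ψ : Bases → Name → Fin m
    ψ bs (v , i) = iter σM (toℕ i) (bs v)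

    ψ-σ : ∀ bs x → ψ bs (σ x) ≡ σM (ψ bs x)
    ψ-σ bs (v , i) = trans (cong (λ j → iter σM j (bs v)) (Fin.toℕ-fromℕ< (m%n<n (suc (toℕ i)) p)))
      (trans (cong (iter σM (suc (toℕ i) % p)) (sym (O.iter-periods p (bs v) (valent (bs v)) (suc (toℕ i) / p))))
        (trans (sym (O.iter-+ (suc (toℕ i) % p) _ (bs v))) (cong (λ j → iter σM j (bs v)) (sym (m≡m%n+[m/n]*n (suc (toℕ i)) p)))))

    ψ-iter : ∀ bs k x → ∃ λ j → iter σM k (ψ bs x) ≡ ψ bs (proj₁ x , j)
    ψ-iter bs zero x = proj₂ x , refl
    ψ-iter bs (suc k) x with ψ-iter bs k x
    ... | j , e = next j , trans (cong σM e) (sym (ψ-σ bs (proj₁ x , j)))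

    same-vertex : ∀ bs v i j → SameV M (ψ bs (v , i)) (ψ bs (v , j))
    same-vertex bs v i j = O.orb-trans (O.orb-sym (toℕ i , refl)) (toℕ j , refl)

    Injective : Bases → ℕ → Set
    Injective bs n = ∀ x y → proj₁ x < n → proj₁ y < n → ψ bs x ≡ ψ bs y → x ≡ y

    -- St lists the darts on the contours. By `processed`, any other dart of a discovered vertex is
    -- matched with a discovered dart off the contours. By `nonbase`, a base other than the root is
    -- off the contours, having been used up by the discovery of its vertex.
    record Core (bs : Bases) (n : ℕ) (St : List Name) : Set where
      field
        old : ∀ {x} → x ∈ St → proj₁ x < n
        unique : AllPairs _≢_ St
        injective : Injective bs n
        processed : ∀ x → proj₁ x < n → x ∈ St ⊎ ∃ λ y → proj₁ y < n × y ∉ St × αM (ψ bs x) ≡ ψ bs y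
        nonbase : ∀ {x} → x ∈ St → proj₂ x ≡ zero → proj₁ x ≡ 0
    open Core

    core-↭ : ∀ {bs n St St′} → St ↭ St′ → Core bs n St → Core bs n St′
    core-↭ {bs} {n} {St} {St′} r c = record
      { old = old c ∘ ∈-resp-↭ (↭-sym r)
      ; unique = AllPairs-↭ (λ h e → h (sym e)) r (unique c)
      ; injective = injective c
      ; processed = λ x h → move (processed c x h)
      ; nonbase = nonbase c ∘ ∈-resp-↭ (↭-sym r) }
      where
      move : ∀ {x} → (x ∈ St ⊎ ∃ λ y → proj₁ y < n × y ∉ St × αM (ψ bs x) ≡ ψ bs y) → x ∈ St′ ⊎ ∃ λ y → proj₁ y < n × y ∉ St′ × αM (ψ bs x) ≡ ψ bs y
      move (inj₁ a) = inj₁ (∈-resp-↭ r a)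
      move (inj₂ (y , h , n , e)) = inj₂ (y , h , n ∘ ∈-resp-↭ (↭-sym r) , e)

    core-loop : ∀ {bs n d e St} → Core bs n (d ∷ e ∷ St) → αM (ψ bs d) ≡ ψ bs e → Core bs n St
    core-loop {bs} {n} {d} {e} {St} c h with unique c
    ... | (d≢e ∷ d∉) ∷ e∉ ∷ u = record
      { old = old c ∘ there ∘ there
      ; unique = u
      ; injective = injective c
      ; processed = λ x h′ → move x (processed c x h′)
      ; nonbase = nonbase c ∘ there ∘ there }
      where
      move : ∀ x → x ∈ d ∷ e ∷ St ⊎ (∃ λ y → proj₁ y < n × y ∉ d ∷ e ∷ St × αM (ψ bs x) ≡ ψ bs y) → x ∈ St ⊎ ∃ λ y → proj₁ y < n × y ∉ St × αM (ψ bs x) ≡ ψ bs y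
      move x (inj₁ (here refl)) = inj₂ (e , old c (there (here refl)) , (λ m → All.lookup e∉ m refl) , h)
      move x (inj₁ (there (here refl))) = inj₂ (d , old c (here refl) , (λ m → All.lookup d∉ m refl) , trans (cong αM (sym h)) (α-invol _))
      move x (inj₁ (there (there m))) = inj₁ m
      move x (inj₂ (y , hy , n , q)) = inj₂ (y , hy , n ∘ there ∘ there , q)

    extend : Bases → ℕ → Fin m → Bases
    extend bs n x v with v ℕ.≟ n
    ... | yes _ = x
    ... | no _ = bs v

    extend-new : ∀ bs n x → extend bs n x n ≡ x
    extend-new bs n x with n ℕ.≟ n
    ... | yes _ = refl
    ... | no h = contradiction refl h

    extend-old : ∀ bs n x {v} → v < n → extend bs n x v ≡ bs v
    extend-old bs n x {v} h with v ℕ.≟ n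
    ... | yes refl = contradiction h (ℕ.<-irrefl refl)
    ... | no _ = refl

    ψ-old : ∀ bs n x y → proj₁ y < n → ψ (extend bs n x) y ≡ ψ bs y
    ψ-old bs n x (v , i) h = cong (iter σM (toℕ i)) (extend-old bs n x h)

    iter-distinct : ∀ e (i j : Fin p) → toℕ i < toℕ j → iter σM (toℕ i) e ≢ iter σM (toℕ j) e
    iter-distinct e i j lt h with ℕ.m≤n⇒∃[o]m+o≡n lt
    ... | k , eq = valent-min (suc k) (s≤s z≤n) (ℕ.≤-<-trans (ℕ.≤-trans (ℕ.m≤n+m (suc k) (toℕ i)) (ℕ.≤-reflexive (trans (ℕ.+-suc (toℕ i) k) eq))) (Fin.toℕ<n j)) (iter σM (toℕ i) e)
      (trans (sym (O.iter-+ (suc k) (toℕ i) e)) (trans (cong (λ l → iter σM l e) (trans (ℕ.+-comm (suc k) (toℕ i)) (trans (ℕ.+-suc (toℕ i) k) eq))) (sym h)))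

    iter-positions : ∀ e {i j : Fin p} → iter σM (toℕ i) e ≡ iter σM (toℕ j) e → i ≡ j
    iter-positions e {i} {j} h with ℕ.<-cmp (toℕ i) (toℕ j)
    ... | tri< lt _ _ = contradiction h (iter-distinct e i j lt)
    ... | tri≈ _ eq _ = Fin.toℕ-injective eq
    ... | tri> _ _ gt = contradiction (sym h) (iter-distinct e j i gt)

    -- The base of the new vertex is matched with d at once, so both stay off the contours and only
    -- the p - 1 other darts join.
    core-new : ∀ {bs n d St} → Core bs n (d ∷ St) → (∀ x → proj₁ x < n → ψ bs x ≢ αM (ψ bs d)) → Core (extend bs n (αM (ψ bs d))) (suc n) (others n ++ St)
    core-new {bs} {n} {d} {St} c fr with unique c
    ... | d∉ ∷ u = record
      { old = λ m → old′ (∈-++⁻ (others n) m)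
      ; unique = AllPairs.++⁺ (others-unique n) u (All.tabulate λ m → All.tabulate λ m′ e →
          ℕ.<-irrefl (∈-vertex⁻ n (there (subst (_∈ others n) e m))) (old c (there m′)))
      ; injective = inj
      ; processed = λ x h → proc x (split h)
      ; nonbase = λ m → base′ (∈-++⁻ (others n) m) }
      where
      e₀ = αM (ψ bs d)
      bs′ = extend bs n e₀
      others-unique : ∀ n → AllPairs _≢_ (others n)
      others-unique n with unique-vertex n
      ... | _ ∷ u = u
      old′ : ∀ {x} → x ∈ others n ⊎ x ∈ St → proj₁ x < suc n
      old′ (inj₁ a) = s≤s (ℕ.≤-reflexive (∈-vertex⁻ n (there a)))
      old′ (inj₂ a) = ℕ.m<n⇒m<1+n (old c (there a))
      base′ : ∀ {x} → x ∈ others n ⊎ x ∈ St → proj₂ x ≡ zero → proj₁ x ≡ 0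
      base′ (inj₁ a) e with ∈-tabulate⁻ {f = λ i → n , suc i} a
      base′ (inj₁ a) () | _ , refl
      base′ (inj₂ a) e = nonbase c (there a) e
      split : ∀ {v} → v < suc n → v < n ⊎ v ≡ n
      split h = ℕ.m≤n⇒m<n∨m≡n (ℕ.s≤s⁻¹ h)
      ψ-new : ∀ i → ψ bs′ (n , i) ≡ iter σM (toℕ i) e₀
      ψ-new i = cong (iter σM (toℕ i)) (extend-new bs n e₀)
      -- A visited dart at the new vertex would make the new base visited.
      separate : ∀ {x} i → proj₁ x < n → ψ bs x ≢ iter σM (toℕ i) e₀
      separate {x} i h e with O.orb-sym {e₀} {ψ bs x} (toℕ i , sym e)
      ... | k , e′ with ψ-iter bs k x
      ...   | j , e″ = fr (proj₁ x , j) h (trans (sym e″) e′)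
      inj′ : ∀ {x y} → proj₁ x < n ⊎ proj₁ x ≡ n → proj₁ y < n ⊎ proj₁ y ≡ n → ψ bs′ x ≡ ψ bs′ y → x ≡ y
      inj′ {x} {y} (inj₁ a) (inj₁ b) e = injective c x y a b (trans (sym (ψ-old bs n e₀ x a)) (trans e (ψ-old bs n e₀ y b)))
      inj′ {x} {_ , j} (inj₁ a) (inj₂ refl) e = contradiction (trans (sym (ψ-old bs n e₀ x a)) (trans e (ψ-new j))) (separate {x} j a)
      inj′ {_ , i} {y} (inj₂ refl) (inj₁ b) e = contradiction (trans (sym (ψ-old bs n e₀ y b)) (trans (sym e) (ψ-new i))) (separate {y} i b)
      inj′ {_ , i} {_ , j} (inj₂ refl) (inj₂ refl) e = cong (n ,_) (iter-positions e₀ (trans (sym (ψ-new i)) (trans e (ψ-new j))))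
      inj : Injective bs′ (suc n)
      inj x y hx hy e = inj′ {x} {y} (split hx) (split hy) e
      proc : ∀ x → proj₁ x < n ⊎ proj₁ x ≡ n → x ∈ others n ++ St ⊎ ∃ λ y → proj₁ y < suc n × y ∉ others n ++ St × αM (ψ bs′ x) ≡ ψ bs′ y
      proc (_ , suc i) (inj₂ refl) = inj₁ (∈-++⁺ˡ (others-∈ n i))
      proc (_ , zero) (inj₂ refl) = inj₂ (d , ℕ.m<n⇒m<1+n (old c (here refl)) , d-done , trans (cong αM (ψ-new zero)) (trans (α-invol (ψ bs d)) (sym (ψ-old bs n e₀ d (old c (here refl))))))
        where
        d-done : d ∉ others n ++ St
        d-done m with ∈-++⁻ (others n) m
        ... | inj₁ a = ℕ.<-irrefl (∈-vertex⁻ n (there a)) (old c (here refl))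
        ... | inj₂ a = All.lookup d∉ a refl
      proc x (inj₁ a) with processed c x a
      ... | inj₁ (here refl) = inj₂ (base n , ℕ.≤-refl , new-done , trans (cong αM (ψ-old bs n e₀ x a)) (sym (ψ-new zero)))
        where
        new-done : base n ∉ others n ++ St
        new-done m with ∈-++⁻ (others n) m
        ... | inj₂ b = ℕ.<-irrefl refl (old c (there b))
        ... | inj₁ b with ∈-tabulate⁻ {f = λ i → n , suc i} b
        ...   | _ , ()
      ... | inj₁ (there b) = inj₁ (∈-++⁺ʳ (others n) b)
      ... | inj₂ (y , hy , y∉ , e) = inj₂ (y , ℕ.m<n⇒m<1+n hy , still , trans (cong αM (ψ-old bs n e₀ x a)) (trans e (sym (ψ-old bs n e₀ y hy))))
        where
        still : y ∉ others n ++ St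
        still m with ∈-++⁻ (others n) m
        ... | inj₁ b = ℕ.<-irrefl (∈-vertex⁻ n (there b)) hy
        ... | inj₂ b = y∉ (there b)

    -- The vertex v of the darts at the head of U, and below them the remaining darts of its ancestors.
    data Spine (bs : Bases) : ℕ → List Name → Set where
      [] : ∀ {v} → Spine bs v []
      here : ∀ {v x U} → proj₁ x ≡ v → Spine bs v U → Spine bs v (x ∷ U)
      up : ∀ {v U} d → proj₁ d < v → αM (ψ bs (base v)) ≡ ψ bs d → fo (ψ bs d) ≡ true → Spine bs (proj₁ d) U → Spine bs v U

    spine-head : ∀ {bs v d U} → Spine bs v (d ∷ U) → Spine bs (proj₁ d) U
    spine-head (here refl sp) = sp
    spine-head (up _ _ _ _ sp) = spine-head sp

    spine-old : ∀ {bs n x v U} → v < n → Spine bs v U → Spine (extend bs n x) v U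
    spine-old h [] = []
    spine-old h (here e sp) = here e (spine-old h sp)
    spine-old {bs} {n} {x} {v} h (up d lt e f sp) = up d lt
      (trans (cong αM (ψ-old bs n x (base v) h)) (trans e (sym (ψ-old bs n x d (ℕ.<-trans lt h))))) (trans (cong fo (ψ-old bs n x d (ℕ.<-trans lt h))) f) (spine-old (ℕ.<-trans lt h) sp)

    spine-others : ∀ {bs n} xs {U} → (∀ {x} → x ∈ xs → proj₁ x ≡ n) → Spine bs n U → Spine bs n (xs ++ U)
    spine-others [] h sp = sp
    spine-others (x ∷ xs) h sp = here (h (here refl)) (spine-others xs (h ∘ there) sp)

    data Descent (bs : Bases) : ℕ → ℕ → ℕ → Set where
      [] : ∀ {v} → Descent bs v v 0
      down : ∀ {v v₀ k} d → proj₁ d < v → αM (ψ bs (base v)) ≡ ψ bs d → fo (ψ bs d) ≡ true → Descent bs (proj₁ d) v₀ k → Descent bs v v₀ (suc k)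

    descent : ∀ {bs v U x} → Spine bs v U → x ∈ U → ∃ λ k → Descent bs v (proj₁ x) k
    descent (here refl sp) (here refl) = 0 , []
    descent (here refl sp) (there m) = descent sp m
    descent (up d lt e f sp) m with descent sp m
    ... | k , ds = suc k , down d lt e f ds

    stage : ∀ {bs v v₀ k} → Descent bs v v₀ k → Fin k → ℕ
    stage {v = v} (down _ _ _ _ ds) zero = v
    stage (down _ _ _ _ ds) (suc i) = stage ds i

    parent : ∀ {bs v v₀ k} → Descent bs v v₀ k → Fin k → Name
    parent (down d _ _ _ _) zero = d
    parent (down _ _ _ _ ds) (suc i) = parent ds i

    stage-parent : ∀ {bs v v₀ k} (ds : Descent bs v v₀ k) i → αM (ψ bs (base (stage ds i))) ≡ ψ bs (parent ds i)
    stage-parent (down _ _ e _ _) zero = e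
    stage-parent (down _ _ _ _ ds) (suc i) = stage-parent ds i

    stage-forest : ∀ {bs v v₀ k} (ds : Descent bs v v₀ k) i → fo (ψ bs (base (stage ds i))) ≡ true
    stage-forest (down _ _ e f _) zero = trans (sym (forest-α _)) (trans (cong fo e) f)
    stage-forest (down _ _ _ _ ds) (suc i) = stage-forest ds i

    parent-below : ∀ {bs v v₀ k} (ds : Descent bs v v₀ k) i → proj₁ (parent ds i) < stage ds i
    parent-below (down _ lt _ _ _) zero = lt
    parent-below (down _ _ _ _ ds) (suc i) = parent-below ds i

    stage-≤ : ∀ {bs v v₀ k} (ds : Descent bs v v₀ k) i → stage ds i ≤ v
    stage-≤ (down _ _ _ _ _) zero = ℕ.≤-refl
    stage-≤ (down _ lt _ _ ds) (suc i) = ℕ.≤-trans (stage-≤ ds i) (ℕ.<⇒≤ lt)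

    end-≤ : ∀ {bs v v₀ k} → Descent bs v v₀ k → v₀ ≤ v
    end-≤ [] = ℕ.≤-refl
    end-≤ (down _ lt _ _ ds) = ℕ.≤-trans (end-≤ ds) (ℕ.<⇒≤ lt)

    stage-> : ∀ {bs v v₀ k} (ds : Descent bs v v₀ k) i → v₀ < stage ds i
    stage-> (down _ lt _ _ ds) zero = ℕ.≤-<-trans (end-≤ ds) lt
    stage-> (down _ _ _ _ ds) (suc i) = stage-> ds i

    stage-injective : ∀ {bs v v₀ k} (ds : Descent bs v v₀ k) i j → stage ds i ≡ stage ds j → i ≡ j
    stage-injective (down _ _ _ _ _) zero zero e = refl
    stage-injective (down _ lt _ _ ds) zero (suc j) e = contradiction (ℕ.≤-trans (ℕ.≤-reflexive e) (stage-≤ ds j)) (ℕ.<⇒≱ lt)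
    stage-injective (down _ lt _ _ ds) (suc i) zero e = contradiction (ℕ.≤-trans (ℕ.≤-reflexive (sym e)) (stage-≤ ds i)) (ℕ.<⇒≱ lt)
    stage-injective (down _ _ _ _ ds) (suc i) (suc j) e = cong suc (stage-injective ds i j e)

    parent-next : ∀ {bs v v₀ k} (ds : Descent bs v v₀ (suc k)) (i : Fin k) → proj₁ (parent ds (inject₁ i)) ≡ stage ds (suc i)
    parent-next (down d _ _ _ (down _ _ _ _ _)) zero = refl
    parent-next (down _ _ _ _ (down d lt e f ds)) (suc i) = parent-next (down d lt e f ds) i

    parent-last : ∀ {bs v v₀ k} (ds : Descent bs v v₀ (suc k)) → proj₁ (parent ds (fromℕ k)) ≡ v₀
    parent-last (down d _ _ _ []) = refl
    parent-last (down _ _ _ _ (down d lt e f ds)) = parent-last (down d lt e f ds)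

    -- The darts of a would-be forest cycle: x, whose edge leads to the vertex v, then the base of
    -- every vertex met on the way from v back to the vertex of x.
    cycle : ∀ {bs v v₀ k} → Name → Descent bs v v₀ k → Fin (suc k) → Name
    cycle x des zero = x
    cycle x des (suc i) = base (stage des i)

    meet : ∀ bs y z {a} → a ≡ ψ bs y → proj₁ y ≡ proj₁ z → SameV M a (ψ bs z)
    meet bs (v , i) (_ , j) refl refl = same-vertex bs v i j

    consec : ∀ {bs v v₀ k} x d → αM (ψ bs x) ≡ ψ bs d → proj₁ d ≡ v → (des : Descent bs v v₀ k) (i : Fin k) →
      SameV M (αM (ψ bs (cycle x des (inject₁ i)))) (ψ bs (cycle x des (suc i)))
    consec {bs} {v} x d e h des@(down _ _ _ _ _) zero = meet bs d (base v) e h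
    consec {bs} {k = suc k} x d e h des (suc i) = meet bs (parent des (inject₁ i)) (base (stage des (suc i))) (stage-parent des (inject₁ i)) (parent-next des i)

    close : ∀ {bs v k} x d → αM (ψ bs x) ≡ ψ bs d → proj₁ d ≡ v → (des : Descent bs v (proj₁ x) k) →
      SameV M (αM (ψ bs (cycle x des (fromℕ k)))) (ψ bs x)
    close {bs} {k = zero} x d e h [] = meet bs d x e h
    close {bs} {k = suc k} x d e h des = meet bs (parent des (fromℕ k)) x (stage-parent des (fromℕ k)) (parent-last des)

    -- A forest edge from d to a dart x on a contour at the same vertex or at an ancestor closes the
    -- descent between their vertices to a cycle. Its vertices are distinct since the stages
    -- strictly decrease.
    spine-acyclic : ∀ {bs n St d x k} → Core bs n St → d ∈ St → x ∈ St → αM (ψ bs d) ≡ ψ bs x → fo (ψ bs d) ≡ true → Descent bs (proj₁ d) (proj₁ x) k → ⊥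
    spine-acyclic {bs} {n} {St} {d} {x} {k} c d∈ x∈ e f des = acyclic (record
      { k = k ; ds = darts ; inF = inF ; edgesDistinct = λ i j h → distinct i j h , crossing i j h
      ; consec = consec x d e′ refl des ; close = close x d e′ refl des ; vertsDistinct = λ i j h o → h (names-vertex i j (vertex-eq i j o)) })
      where
      nm : Fin (suc k) → Name
      nm = cycle x des
      e′ : αM (ψ bs x) ≡ ψ bs d
      e′ = trans (cong αM (sym e)) (α-invol _)
      darts : Fin (suc k) → Fin m
      darts i = ψ bs (nm i)
      nm-old : ∀ i → proj₁ (nm i) < n
      nm-old zero = old c x∈
      nm-old (suc i) = ℕ.≤-<-trans (stage-≤ des i) (old c d∈)
      inF : ∀ i → fo (darts i) ≡ true
      inF zero = trans (cong fo (sym e)) (trans (forest-α _) f)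
      inF (suc i) = stage-forest des i
      names-vertex : ∀ i j → proj₁ (nm i) ≡ proj₁ (nm j) → i ≡ j
      names-vertex zero zero _ = refl
      names-vertex zero (suc j) q = contradiction q (ℕ.<⇒≢ (stage-> des j))
      names-vertex (suc i) zero q = contradiction (sym q) (ℕ.<⇒≢ (stage-> des i))
      names-vertex (suc i) (suc j) q = cong suc (stage-injective des i j q)
      vertex-eq : ∀ i j → SameV M (darts i) (darts j) → proj₁ (nm i) ≡ proj₁ (nm j)
      vertex-eq i j (l , q) with ψ-iter bs l (nm i)
      ... | j′ , q′ = cong proj₁ (injective c (proj₁ (nm i) , j′) (nm j) (nm-old i) (nm-old j) (trans (sym q′) q))
      distinct : ∀ i j → i ≢ j → darts i ≢ darts j
      distinct i j h q = h (names-vertex i j (cong proj₁ (injective c (nm i) (nm j) (nm-old i) (nm-old j) q)))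
      parent-old : ∀ i → proj₁ (parent des i) < n
      parent-old i = ℕ.<-trans (parent-below des i) (nm-old (suc i))
      -- A base on a contour belongs to vertex 0 by `nonbase`, while every stage exceeds the vertex
      -- of x.
      d-not-base : ∀ i → d ≢ base (stage des i)
      d-not-base i eq = ℕ.n≮0 (subst (proj₁ x <_) (trans (sym (cong proj₁ eq)) (nonbase c d∈ (cong proj₂ eq))) (stage-> des i))
      crossing : ∀ i j → i ≢ j → darts i ≢ αM (darts j)
      crossing zero zero h q = h refl
      crossing zero (suc j) h q = d-not-base j (injective c d (nm (suc j)) (old c d∈) (nm-old (suc j)) (trans (sym e′) (trans (cong αM q) (α-invol _))))
      crossing (suc i) zero h q = d-not-base i (sym (injective c (nm (suc i)) d (nm-old (suc i)) (old c d∈) (trans q e′)))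
      -- If one tree edge were another one reversed, each of its two vertices would be earlier than
      -- the other.
      crossing (suc i) (suc j) h q = ℕ.<-asym
        (subst (_< stage des j) (cong proj₁ (sym (injective c (nm (suc i)) (parent des j) (nm-old (suc i)) (parent-old j) (trans q (stage-parent des j))))) (parent-below des j))
        (subst (_< stage des i) (cong proj₁ (sym (injective c (nm (suc j)) (parent des i) (nm-old (suc j)) (parent-old i) (trans (trans (sym (α-invol _)) (cong αM (sym q))) (stage-parent des i))))) (parent-below des i))

    Respects : Bases → List Edge → Set
    Respects bs P = ∀ {d e b} → (d , e , b) ∈ P → αM (ψ bs d) ≡ ψ bs e × fo (ψ bs d) ≡ b

    -- Agreement of bs′ and bs below n says that later discoveries leave the names of the earlier
    -- darts unchanged.
    Explored : Bases → ℕ → List Name → List Name → List (List Name) → Set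
    Explored bs n U K L = Σ Word λ w → Σ (List Edge) λ P → Σ ℕ λ k → Σ Bases λ bs′ →
      Tr n U K L w P k × (∀ {v} → v < n → bs′ v ≡ bs v) × Respects bs′ P × Injective bs′ (n + k)

    size : List Name → List Name → List (List Name) → ℕ
    size U K L = length U + length U + length K + sum (map length L) + length L

    Flagless : Bases → List Name → Set
    Flagless bs xs = ∀ {x} → x ∈ xs → fo (ψ bs x) ≡ false

    visited? : ∀ bs n e → Dec (∃ λ x → proj₁ x < n × ψ bs x ≡ e)
    visited? bs n e with Fin.any? (λ (v : Fin n) → Fin.any? (λ i → ψ bs (toℕ v , i) Fin.≟ e))
    ... | yes (v , i , h) = yes ((toℕ v , i) , Fin.toℕ<n v , h)
    ... | no h = no λ { ((v , i) , lt , e′) → h (fromℕ< lt , i , trans (cong (λ u → ψ bs (u , i)) (Fin.toℕ-fromℕ< lt)) e′) }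

    -- Were x off the contours, so would be its partner, which is d by injectivity of the names.
    partner-∈ : ∀ {bs n St d} x → Core bs n St → d ∈ St → proj₁ x < n → ψ bs x ≡ αM (ψ bs d) → x ∈ St
    partner-∈ {d = d} x c d∈ lt e with processed c x lt
    ... | inj₁ h = h
    ... | inj₂ (y , hy , y∉ , e′) = contradiction (subst (_∈ _) (injective c d y (old c d∈) hy (trans (sym (α-invol _)) (trans (cong αM (sym e)) e′))) d∈) y∉

    not-self : ∀ bs d x → ψ bs x ≡ αM (ψ bs d) → x ≢ d
    not-self bs d .d e refl = α-nofix (ψ bs d) (sym e)

    -- Distinct vertices have distinct bases, so at most m vertices can be discovered.
    too-many : ∀ bs → ¬ Injective bs (suc m)
    too-many bs inj with Fin.pigeonhole (ℕ.n<1+n m) (λ v → bs (toℕ v))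
    ... | i , j , i<j , e = ℕ.<⇒≢ i<j (cong proj₁ (inj (base (toℕ i)) (base (toℕ j)) (Fin.toℕ<n i) (Fin.toℕ<n j) e))

    -- Lexicographic recursion on r and g: a discovery lowers r and resets g, any other step lowers
    -- g. The spine and `Flagless` are there to exclude a forest edge that leads to a discovered
    -- dart.
    explore : ∀ r g {bs n v U K L} → n + r ≡ m → size U K L ≤ g → Core bs n (U ++ K ++ concat L) → Flagless bs (K ++ concat L) → Spine bs v U → v < n →
      Explored bs n U K L

    -- r bounds the number of vertices still to be discovered.
    discover : ∀ r {bs n d v U K L} → n + r ≡ m → Core (extend bs n (αM (ψ bs d))) (suc n) ((others n ++ U) ++ K ++ concat L) →
      Flagless (extend bs n (αM (ψ bs d))) (K ++ concat L) → Spine (extend bs n (αM (ψ bs d))) v (others n ++ U) → v < suc n →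
      Explored (extend bs n (αM (ψ bs d))) (suc n) (others n ++ U) K L
    discover zero {bs} {n} {d} e c f sp h = contradiction (injective c) (subst (λ l → ¬ Injective (extend bs n (αM (ψ bs d))) (suc l)) (trans (sym e) (ℕ.+-identityʳ n)) (too-many (extend bs n (αM (ψ bs d)))))
    discover (suc r) {n = n} e c f sp h = explore r _ (trans (sym (ℕ.+-suc n r)) e) ℕ.≤-refl c f sp h

    new-edge : ∀ {bs n k b P} d (bs′ : Bases) → proj₁ d < n → fo (ψ bs d) ≡ b → (∀ {v} → v < suc n → bs′ v ≡ extend bs n (αM (ψ bs d)) v) →
      Respects bs′ P → Injective bs′ (suc n + k) →
      (∀ {v} → v < n → bs′ v ≡ bs v) × Respects bs′ ((d , base n , b) ∷ P) × Injective bs′ (n + suc k)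
    new-edge {bs} {n} {k} {b} {P} d bs′ d<n fd agree resp inj = (λ h → trans (agree (ℕ.m<n⇒m<1+n h)) (extend-old bs n _ h)) , resp′ , subst (Injective bs′) (sym (ℕ.+-suc n k)) inj
      where
      at-d : ψ bs′ d ≡ ψ bs d
      at-d = cong (iter σM (toℕ (proj₂ d))) (trans (agree (ℕ.m<n⇒m<1+n d<n)) (extend-old bs n _ d<n))
      resp′ : Respects bs′ ((d , base n , b) ∷ P)
      resp′ (here refl) = trans (cong αM at-d) (sym (trans (agree ℕ.≤-refl) (extend-new bs n _))) , trans (cong fo at-d) fd
      resp′ (there m) = resp m

    old-edge : ∀ {bs bs′ n b P} d e → proj₁ d < n → proj₁ e < n → αM (ψ bs d) ≡ ψ bs e → fo (ψ bs d) ≡ b → (∀ {v} → v < n → bs′ v ≡ bs v) →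
      Respects bs′ P → Respects bs′ ((d , e , b) ∷ P)
    old-edge {bs} {bs′} {n} d e hd he q f agree resp (here refl) = trans (cong αM at-d) (trans q (sym at-e)) , trans (cong fo at-d) f
      where
      at-d : ψ bs′ d ≡ ψ bs d
      at-d = cong (iter σM (toℕ (proj₂ d))) (agree hd)
      at-e : ψ bs′ e ≡ ψ bs e
      at-e = cong (iter σM (toℕ (proj₂ e))) (agree he)
    old-edge d e hd he q f agree resp (there m) = resp m

    flagless-old : ∀ {bs n x xs} → Flagless bs xs → (∀ {y} → y ∈ xs → proj₁ y < n) → Flagless (extend bs n x) xs
    flagless-old {bs} {n} {x} f h {y} m = trans (cong fo (ψ-old bs n x y (h m))) (f m)

    new-↭ : ∀ n U K (S : List Name) → others n ++ U ++ K ++ S ↭ (others n ++ U) ++ K ++ S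
    new-↭ n U K S = CM.solve 4 (λ o u k s → o ⊕ u ⊕ k ⊕ s ⊜ (o ⊕ u) ⊕ k ⊕ s) ↭-refl (others n) U K S
      where open CM using (_⊕_; _⊜_)

    mark-↭ : ∀ d U K (S : List Name) → d ∷ U ++ K ++ S ↭ U ++ (K ++ d ∷ []) ++ S
    mark-↭ d U K S = CM.solve 4 (λ d u k s → d ⊕ u ⊕ k ⊕ s ⊜ u ⊕ (k ⊕ d) ⊕ s) ↭-refl (d ∷ []) U K S
      where open CM using (_⊕_; _⊜_)

    loop-↭ : ∀ d l₁ e l₂ (S : List Name) → d ∷ (l₁ ++ e ∷ l₂) ++ S ↭ d ∷ e ∷ l₁ ++ l₂ ++ S
    loop-↭ d l₁ e l₂ S = CM.solve 5 (λ d a e b s → d ⊕ (a ⊕ e ⊕ b) ⊕ s ⊜ d ⊕ e ⊕ a ⊕ b ⊕ s) ↭-refl (d ∷ []) l₁ (e ∷ []) l₂ S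
      where open CM using (_⊕_; _⊜_)

    bad-↭ : ∀ d K L₁ l₁ e l₂ L₂ → d ∷ K ++ concat (L₁ ++ (l₁ ++ e ∷ l₂) ∷ L₂) ↭ d ∷ e ∷ (l₂ ++ l₁ ++ K) ++ concat (L₁ ++ L₂)
    bad-↭ d K L₁ l₁ e l₂ L₂ = subst₂ (λ x y → d ∷ K ++ x ↭ d ∷ e ∷ (l₂ ++ l₁ ++ K) ++ y) (List.concat-++ L₁ _) (List.concat-++ L₁ L₂)
      (CM.solve 7 (λ d k A a e b B → d ⊕ k ⊕ A ⊕ (a ⊕ e ⊕ b) ⊕ B ⊜ d ⊕ e ⊕ (b ⊕ a ⊕ k) ⊕ A ⊕ B) ↭-refl (d ∷ []) K (concat L₁) l₁ (e ∷ []) l₂ (concat L₂))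
      where open CM using (_⊕_; _⊜_)

    size-bad : ∀ (d : Name) K L₁ l₁ e l₂ L₂ → size [] (d ∷ K) (L₁ ++ (l₁ ++ e ∷ l₂) ∷ L₂) ≡ 3 + size [] (l₂ ++ l₁ ++ K) (L₁ ++ L₂)
    size-bad d K [] l₁ e l₂ L₂ = trans (cong (λ x → suc (length K) + (x + sum (map length L₂)) + suc (length L₂)) (trans (List.length-++ l₁) (ℕ.+-suc (length l₁) (length l₂))))
      (trans (lem (length K) (length l₁) (length l₂) (sum (map length L₂)) (length L₂)) (cong (λ x → 3 + (x + sum (map length L₂) + length L₂)) (sym (trans (List.length-++ l₂) (cong (length l₂ +_) (List.length-++ l₁))))))
      where
      lem : ∀ k a b c l → suc k + (suc (a + b) + c) + suc l ≡ 3 + (b + (a + k) + c + l)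
      lem = solve-∀
    size-bad d K (l ∷ L₁) l₁ e l₂ L₂ = trans (lem (length K) (length l) _ _) (trans (cong (λ x → suc (length l + x)) (size-bad d K L₁ l₁ e l₂ L₂)) (sym (lem′ (length (l₂ ++ l₁ ++ K)) (length l) _ _)))
      where
      lem : ∀ k a b c → suc k + (a + b) + suc c ≡ suc (a + (suc k + b + c))
      lem = solve-∀
      lem′ : ∀ k a b c → 3 + (k + (a + b) + suc c) ≡ suc (a + (3 + (k + b + c)))
      lem′ = solve-∀

    explore r g {bs} {n} {v} {d ∷ U} {K} {L} e le c f sp h with fo (ψ bs d) in fd
    explore r zero {U = d ∷ U} e () c f sp h | _
    explore r (suc g) {bs} {n} {v} {d ∷ U} {K} {L} e le c f sp h | false with explore r g {U = U} {K ++ d ∷ []} {L} e smaller (core-↭ (mark-↭ d U K (concat L)) c) f′ (spine-head sp) (old c (here refl))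
      where
      smaller : size U (K ++ d ∷ []) L ≤ g
      smaller = ℕ.≤-trans (ℕ.≤-reflexive (trans (cong (λ x → length U + length U + x + sum (map length L) + length L) (List.length-++ K)) (lem (length U) (length K) (sum (map length L)) (length L)))) (ℕ.s≤s⁻¹ le)
        where
        lem : ∀ u k a b → u + u + (k + 1) + a + b ≡ u + suc u + k + a + b
        lem = solve-∀
      f′ : Flagless bs ((K ++ d ∷ []) ++ concat L)
      f′ m with ∈-++⁻ (K ++ d ∷ []) m
      ... | inj₂ b = f (∈-++⁺ʳ K b)
      ... | inj₁ a with ∈-++⁻ K a
      ...   | inj₁ b = f (∈-++⁺ˡ b)
      ...   | inj₂ (here refl) = fd
    ... | w , P , k , bs′ , t , agree , resp , inj = mark ∷ w , P , k , bs′ , mark t , agree , resp , inj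
    explore r g {bs} {n} {v} {d ∷ U} {K} {L} e le c f sp h | true with visited? bs n (αM (ψ bs d))
    -- In K or L the discovered partner would be known not to be a forest dart; in U it sits on the
    -- spine, and the edge would close a forest cycle.
    ... | yes (x , x<n , ex) = ⊥-elim (closing (partner-∈ x c (here refl) x<n ex))
      where
      closing : x ∈ d ∷ U ++ K ++ concat L → ⊥
      closing (here refl) = not-self bs d x ex refl
      closing (there m) with ∈-++⁻ U m
      ... | inj₂ b with trans (sym (f b)) (trans (cong fo ex) (trans (forest-α (ψ bs d)) fd))
      ...   | ()
      closing (there m) | inj₁ a = spine-acyclic c (here refl) (there (∈-++⁺ˡ a)) (sym ex) fd (proj₂ (descent (spine-head sp) a))
    ... | no fresh′ with discover r {bs} {n} {d} {n} {U} {K} {L} e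
           (core-↭ (new-↭ n U K (concat L)) (core-new c (λ x lt ex → fresh′ (x , lt , ex)))) (flagless-old f (λ m → old c (there (∈-++⁺ʳ U m))))
           (spine-others (others n) (λ m → ∈-vertex⁻ n (there m)) (up d (old c (here refl))
              (trans (cong αM (extend-new bs n _)) (trans (α-invol _) (sym (ψ-old bs n _ d (old c (here refl))))))
              (trans (cong fo (ψ-old bs n _ d (old c (here refl)))) fd) (spine-old (old c (here refl)) (spine-head sp)))) ℕ.≤-refl
    ...   | w , P , k , bs′ , t , agree , resp , inj with new-edge {bs} d bs′ (old c (here refl)) fd agree resp inj
    ...     | agree′ , resp′ , inj′ = fnew ∷ w , _ , suc k , bs′ , fnew t , agree′ , resp′ , inj′
    explore r g {bs} {n} {v} {[]} {[]} {[]} e le c f sp h = nil ∷ [] , [] , 0 , bs , stop , (λ _ → refl) , (λ ()) , subst (Injective bs) (sym (ℕ.+-identityʳ n)) (injective c)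
    explore r zero {bs} {n} {v} {[]} {[]} {l ∷ L} e le c f sp h = contradiction le (λ le → ℕ.n≮0 (subst (_≤ 0) (ℕ.+-suc (length l + sum (map length L)) (length L)) le))
    explore r (suc g) {bs} {n} {v} {[]} {[]} {l ∷ L} e le c f sp h with explore r g {U = []} {l} {L} e (ℕ.s≤s⁻¹ (subst (_≤ suc g) (ℕ.+-suc (length l + sum (map length L)) (length L)) le)) c f [] h
    ... | w , P , k , bs′ , t , agree , resp , inj = nil ∷ w , P , k , bs′ , nil t , agree , resp , inj
    explore r g {bs} {n} {v} {[]} {d ∷ K} {L} e le c f sp h with visited? bs n (αM (ψ bs d))
    ... | no fresh′ with discover r {bs} {n} {d} {n} {[]} {K} {L} e
           (core-↭ (new-↭ n [] K (concat L)) (core-new c (λ x lt ex → fresh′ (x , lt , ex)))) (flagless-old (f ∘ there) (λ m → old c (there m)))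
           (spine-others (others n) (λ m → ∈-vertex⁻ n (there m)) []) ℕ.≤-refl
    ...   | w , P , k , bs′ , t , agree , resp , inj with new-edge {bs} d bs′ (old c (here refl)) (f (here refl)) agree resp inj
    ...     | agree′ , resp′ , inj′ = unew ∷ w , _ , suc k , bs′ , unew (subst (λ U → Tr (suc n) U K L w P k) (List.++-identityʳ (others n)) t) , agree′ , resp′ , inj′
    explore r zero {bs} {n} {v} {[]} {d ∷ K} {L} e () c f sp h | yes _
    explore r (suc g) {bs} {n} {v} {[]} {d ∷ K} {L} e le c f sp h | yes (x , x<n , ex) with partner-∈ x c (here refl) x<n ex
    ... | here refl = contradiction refl (not-self bs d x ex)
    ... | there m with ∈-++⁻ K m
    ...   | inj₁ a with ∈-∃++ a
    ...     | l₁ , l₂ , refl with explore r g {U = []} {l₁} {l₂ ∷ L} e smaller (core-loop (core-↭ (loop-↭ d l₁ x l₂ (concat L)) c) (sym ex)) (keep-loop l₁ (concat L) f) [] h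
      where
      smaller : size [] l₁ (l₂ ∷ L) ≤ g
      smaller = ℕ.s≤s⁻¹ (ℕ.≤-trans (ℕ.≤-reflexive (trans (lem (length l₁) (length l₂) (sum (map length L)) (length L)) (cong (λ y → suc y + sum (map length L) + length L) (sym (List.length-++ l₁ {x ∷ l₂}))))) le)
        where
        lem : ∀ a b c l → suc (a + (b + c) + suc l) ≡ suc (a + suc b) + c + l
        lem = solve-∀
    ...       | w , P , k , bs′ , t , agree , resp , inj = loop (length l₁) ∷ w , _ , k , bs′ , loop refl t , agree , old-edge {bs} d x (old c (here refl)) x<n (sym ex) (f (here refl)) agree resp , inj
    -- The partner lies on another contour. This handle step has to be traced too: that a planar map
    -- has none is known only once faces are counted.
    explore r (suc g) {bs} {n} {v} {[]} {d ∷ K} {L} e le c f sp h | yes (x , x<n , ex) | there m | inj₂ b with ∈-concat⁻′ L b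
    ... | l , x∈l , l∈L with ∈-∃++ l∈L | ∈-∃++ x∈l
    ...   | L₁ , L₂ , refl | l₁ , l₂ , refl with explore r g {U = []} {l₂ ++ l₁ ++ K} {L₁ ++ L₂} e smaller (core-loop (core-↭ (bad-↭ d K L₁ l₁ x l₂ L₂) c) (sym ex)) (keep-bad L₁ l₁ K L₂ f) [] h
      where
      smaller : size [] (l₂ ++ l₁ ++ K) (L₁ ++ L₂) ≤ g
      smaller = ℕ.≤-trans (ℕ.m≤n+m _ 2) (ℕ.s≤s⁻¹ (ℕ.≤-trans (ℕ.≤-reflexive (sym (size-bad d K L₁ l₁ x l₂ L₂))) le))
    ...     | w , P , k , bs′ , t , agree , resp , inj = bad ∷ w , _ , k , bs′ , bad refl t , agree , old-edge {bs} d x (old c (here refl)) x<n (sym ex) (f (here refl)) agree resp , inj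

    start : Bases
    start _ = FMap.root M

    core-start : Core start 1 (vertex 0 ++ [])
    core-start = record
      { old = λ m → s≤s (ℕ.≤-reflexive (in-0 m))
      ; unique = subst (AllPairs _≢_) (sym (List.++-identityʳ (vertex 0))) (unique-vertex 0)
      ; injective = λ { (zero , i) (zero , j) _ _ e → cong (0 ,_) (iter-positions (FMap.root M) e)
                      ; (suc _ , _) _ (s≤s ()) _ _
                      ; _ (suc _ , _) _ (s≤s ()) _ }
      ; processed = λ { (zero , i) _ → inj₁ (∈-++⁺ˡ (vertex-∈ 0 i)) ; (suc _ , _) (s≤s ()) }
      ; nonbase = λ m _ → in-0 m }
      where
      in-0 : ∀ {x} → x ∈ vertex 0 ++ [] → proj₁ x ≡ 0
      in-0 {x} m = ∈-vertex⁻ 0 (subst (x ∈_) (List.++-identityʳ (vertex 0)) m)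

    explored : Explored start 1 (vertex 0) [] []
    explored = explore _ _ (proj₂ (nonempty (FMap.root M))) ℕ.≤-refl core-start (λ ())
      (subst (Spine start 0) (List.++-identityʳ (vertex 0)) (spine-others (vertex 0) (∈-vertex⁻ 0) [])) (s≤s z≤n)
      where
      nonempty : ∀ {m} → Fin m → ∃ λ r → 1 + r ≡ m
      nonempty {suc r} _ = r , refl

-- Isomorphism classes of forested maps and words

open import Defs hiding (σ; α)
open ExplorationWords using (Word; nil; mark; fnew; unew; bad; loop)
open Traces
open EquivalenceClasses
open TraceProperties
open RebuiltMap
open WordTraces
open MapExploration
open SolutionCoefficients
open import Data.Bool using (true)
open import Data.Nat.Base as ℕ using (ℕ; zero; suc; _+_; _*_; _≤_; z≤n; s≤s)
import Data.Nat.Properties as ℕ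
open import Data.Nat.Tactic.RingSolver using (solve-∀)
open import Data.Fin.Base as Fin using (Fin; zero; suc)
import Data.Fin.Properties as Fin
open import Data.List.Base using (List; []; _∷_; _++_; length; map)
import Data.List.Properties as List
open import Data.List.Membership.Propositional using (_∈_)
open import Data.List.Relation.Unary.All as All using (All; []; _∷_)
open import Data.List.Relation.Unary.Any as Any using (Any; here; there)
import Data.List.Relation.Unary.Any.Properties as Any
open import Data.List.Relation.Unary.AllPairs using (AllPairs; []; _∷_)
open import Data.Rational using () renaming (_*_ to _ℚ*_)
open import Data.Product using (Σ; ∃; _×_; _,_; proj₁; proj₂)
open import Data.Sum using (_⊎_; inj₁; inj₂)
open import Function using (_∘_)
open import Relation.Nullary using (¬_)
open import Relation.Binary.PropositionalEquality hiding (subst₂)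
import Relation.Binary.PropositionalEquality as ≡

iso-sym : ∀ {m m′} {M : FMap m} {M′ : FMap m′} → Iso M M′ → Iso M′ M
iso-sym {M = M} {M′} I = record
  { ψ = ψ⁻ ; ψ⁻ = ψ ; ψ-left = ψ-right ; ψ-right = ψ-left
  ; ψ-σ = λ d → trans (cong (ψ⁻ ∘ FMap.σ M′) (sym (ψ-right d))) (trans (cong ψ⁻ (sym (ψ-σ (ψ⁻ d)))) (ψ-left _))
  ; ψ-α = λ d → trans (cong (ψ⁻ ∘ FMap.α M′) (sym (ψ-right d))) (trans (cong ψ⁻ (sym (ψ-α (ψ⁻ d)))) (ψ-left _))
  ; ψ-root = trans (cong ψ⁻ (sym ψ-root)) (ψ-left _)
  ; ψ-forest = λ d → trans (sym (ψ-forest (ψ⁻ d))) (cong (FMap.forest M′) (ψ-right d)) }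
  where open Iso I

iso-trans : ∀ {m m′ m″} {M : FMap m} {M′ : FMap m′} {M″ : FMap m″} → Iso M M′ → Iso M′ M″ → Iso M M″
iso-trans I J = record
  { ψ = J.ψ ∘ I.ψ ; ψ⁻ = I.ψ⁻ ∘ J.ψ⁻
  ; ψ-left = λ d → trans (cong I.ψ⁻ (J.ψ-left _)) (I.ψ-left d)
  ; ψ-right = λ d → trans (cong J.ψ (I.ψ-right _)) (J.ψ-right d)
  ; ψ-σ = λ d → trans (cong J.ψ (I.ψ-σ d)) (J.ψ-σ _)
  ; ψ-α = λ d → trans (cong J.ψ (I.ψ-α d)) (J.ψ-α _)
  ; ψ-root = trans (cong J.ψ I.ψ-root) J.ψ-root
  ; ψ-forest = λ d → trans (J.ψ-forest _) (I.ψ-forest d) }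
  where
  module I = Iso I
  module J = Iso J

module _ {m : ℕ} {M : FMap m}
  (σ-left : ∀ d → FMap.σ⁻ M (FMap.σ M d) ≡ d) (σ-right : ∀ d → FMap.σ M (FMap.σ⁻ M d) ≡ d)
  (α-invol : ∀ d → FMap.α M (FMap.α M d) ≡ d) (forest-α : ∀ d → FMap.forest M (FMap.α M d) ≡ FMap.forest M d) where

  σ-injective : ∀ {x y} → FMap.σ M x ≡ FMap.σ M y → x ≡ y
  σ-injective {x} {y} h = trans (sym (σ-left x)) (trans (cong (FMap.σ⁻ M) h) (σ-left y))

  φ-injective : ∀ {x y} → FMap.σ M (FMap.α M x) ≡ FMap.σ M (FMap.α M y) → x ≡ y
  φ-injective {x} {y} h = trans (sym (α-invol x)) (trans (cong (FMap.α M) (σ-injective h)) (α-invol y))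

  neighbour-sym : ∀ {x y} → y ∈ forestNb M x → x ∈ forestNb M y
  neighbour-sym {x} (here refl) = there (here (sym (σ-left x)))
  neighbour-sym {x} (there (here refl)) = here (sym (σ-right x))
  neighbour-sym {x} (there (there h)) with FMap.forest M x in e
  neighbour-sym {x} (there (there (here refl))) | true rewrite trans (forest-α x) e = there (there (here (sym (α-invol x))))

-- Pulling back the least darts of the g-orbits along h⁻ gives a dart in every f-orbit.
cycles-mono : ∀ {m m′} (f : Fin m → Fin m) (g : Fin m′ → Fin m′) → (∀ {x y} → f x ≡ f y → x ≡ y) → (∀ {x y} → g x ≡ g y → x ≡ y) →
  (h : Fin m → Fin m′) (h⁻ : Fin m′ → Fin m) → (∀ x → h⁻ (h x) ≡ x) → (∀ x → h (f x) ≡ g (h x)) → cycles f ≤ cycles g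
cycles-mono f g fi gi h h⁻ inv comm = subst (cycles f ≤_) (trans (List.length-map h⁻ Og.mins) Og.count-mins)
  (Of.cycles-≤ (map h⁻ Og.mins) λ x → Any.map⁺ (Any.map (λ { (i , refl) → i , trans (sym (inv _)) (cong h⁻ (commutes i x)) }) (Og.minimum _ (h x) refl)))
  where
  module Of = Orbits f fi
  module Og = Orbits g gi
  commutes : ∀ i x → h (iter f i x) ≡ iter g i (h x)
  commutes zero x = refl
  commutes (suc i) x = trans (comm _) (cong g (commutes i x))

module Invariance {p m m′ : ℕ} {M : FMap m} {M′ : FMap m′} (V : Valid p M) (V′ : Valid p M′) where
  module V = Valid V
  module V′ = Valid V′
  module W = Walks (forestNb M) (neighbour-sym {M = M} V.σ-left V.σ-right V.α-invol V.forest-α)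
  module W′ = Walks (forestNb M′) (neighbour-sym {M = M′} V′.σ-left V′.σ-right V′.α-invol V′.forest-α)

  faces-mono : Iso M M′ → faces M ≤ faces M′
  faces-mono I = cycles-mono _ _ (φ-injective {M = M} V.σ-left V.σ-right V.α-invol V.forest-α) (φ-injective {M = M′} V′.σ-left V′.σ-right V′.α-invol V′.forest-α)
    (Iso.ψ I) (Iso.ψ⁻ I) (Iso.ψ-left I) (λ x → trans (Iso.ψ-σ I _) (cong (FMap.σ M′) (Iso.ψ-α I x)))

  module _ (I : Iso M′ M) where
    open Iso I
    σ⁻-iso : ∀ x → ψ (FMap.σ⁻ M′ x) ≡ FMap.σ⁻ M (ψ x)
    σ⁻-iso x = trans (sym (V.σ-left _)) (cong (FMap.σ⁻ M) (trans (sym (ψ-σ _)) (cong ψ (V′.σ-right x))))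
    neighbour-iso : ∀ {x y} → y ∈ forestNb M′ x → ψ y ∈ forestNb M (ψ x)
    neighbour-iso {x} (here refl) = here (ψ-σ x)
    neighbour-iso {x} (there (here refl)) = there (here (σ⁻-iso x))
    neighbour-iso {x} (there (there h)) with FMap.forest M′ x in e
    neighbour-iso {x} (there (there (here refl))) | true rewrite trans (ψ-forest x) e = there (there (here (ψ-α x)))
    walk-iso : ∀ {k x y} → W′.Walk k x y → W.Walk k (ψ x) (ψ y)
    walk-iso W′.done = W.done
    walk-iso (W′.step h w) = W.step (neighbour-iso h) (walk-iso w)

  components-mono : Iso M M′ → components M ≤ components M′
  components-mono I = subst (components M ≤_) (trans (List.length-map (Iso.ψ⁻ I) W′.roots) W′.count-roots)
    (W.components-≤ (map (Iso.ψ⁻ I) W′.roots) λ x → Any.map⁺ (Any.map (λ { (k , w) → k , subst (λ z → W.Walk k z _) (Iso.ψ-left I x) (walk-iso (iso-sym I) w) }) (W′.root-of _ (Iso.ψ I x) refl)))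

components-iso : ∀ {p m m′} {M : FMap m} {M′ : FMap m′} → Valid p M → Valid p M′ → Iso M M′ → components M ≡ components M′
components-iso V V′ I = ℕ.≤-antisym (Invariance.components-mono V V′ I) (Invariance.components-mono V′ V (iso-sym I))

module Reconstruction (r : ℕ) where
  open Enumeration r
  open Run s
  open TraceFacts s

  module Encoded {m : ℕ} (M : FMap m) (V : Valid p M) where
    open Exploration s M V using (ψ; ψ-σ; Respects; Injective; Bases; explored)
    open Valid V

    -- The naming is onto because M is connected: its image contains the root and is closed under σ
    -- and α. The inverse map is read off from this argument.
    rebuilt-iso : ∀ {w P k} (t : Tr 1 (vertex 0) [] [] w P k) (bs : Bases) → bs 0 ≡ FMap.root M → Respects bs P → Injective bs (suc k) → Iso (Map.M s t) M
    rebuilt-iso {w} {P} {k} t bs bs0 resp inj = record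
      { ψ = f ; ψ⁻ = λ y → proj₁ (onto (connected y))
      ; ψ-left = λ x → f-injective (proj₂ (onto (connected (f x))))
      ; ψ-right = λ y → proj₂ (onto (connected y))
      ; ψ-σ = f-σ ; ψ-α = f-α ; ψ-root = f-root ; ψ-forest = f-forest }
      where
      open Map s t hiding (M; m; connected; α-invol; forest-α)
      f : Fin (N * p) → Fin _
      f x = ψ bs (name x)
      f-σ : ∀ x → f (σM x) ≡ FMap.σ M (f x)
      f-σ x = trans (cong (ψ bs) (name-σ x)) (ψ-σ bs (name x))
      edge-α : ∀ {x y b} → (x , y , b) ∈ P ⊎ (y , x , b) ∈ P → ψ bs y ≡ FMap.α M (ψ bs x)
      edge-α (inj₁ h) = sym (proj₁ (resp h))
      edge-α (inj₂ h) = trans (sym (α-invol _)) (cong (FMap.α M) (proj₁ (resp h)))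
      edge-forest : ∀ {x y b} → (x , y , b) ∈ P ⊎ (y , x , b) ∈ P → FMap.forest M (ψ bs x) ≡ b
      edge-forest (inj₁ h) = proj₂ (resp h)
      edge-forest (inj₂ h) = trans (cong (FMap.forest M) (sym (proj₁ (resp h)))) (trans (forest-α _) (proj₂ (resp h)))
      f-α : ∀ x → f (αM x) ≡ FMap.α M (f x)
      f-α x = trans (cong (ψ bs) (trans (name-α x) (Info.partner-x i))) (edge-α (Info.edge i))
        where i = info (name x) (name<N x)
      f-forest : ∀ x → FMap.forest M (f x) ≡ flag (name x)
      f-forest x = trans (edge-forest (Info.edge i)) (sym (Info.flag-x i))
        where i = info (name x) (name<N x)
      f-root : f (dart (base 0)) ≡ FMap.root M
      f-root = trans (cong (ψ bs) (name-dart {base 0} (s≤s z≤n))) bs0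
      f-injective : ∀ {x y} → f x ≡ f y → x ≡ y
      f-injective {x} {y} e = name-injective (inj (name x) (name y) (name<N x) (name<N y) e)
      onto : ∀ {y} → Conn M y → ∃ λ x → f x ≡ y
      onto cRoot = dart (base 0) , f-root
      onto (cσ c) with onto c
      ... | x , e = σM x , trans (f-σ x) (cong (FMap.σ M) e)
      onto (cα c) with onto c
      ... | x , e = αM x , trans (f-α x) (cong (FMap.α M) e)

  Canonical : ∀ {w P k} → Tr 1 (vertex 0) [] [] w P k → AnyMap
  Canonical t = _ , Map.M s t

  loop-length : ∀ {i j : ℕ} {w w′ : Word} → _≡_ {A = Word} (loop i ∷ w) (loop j ∷ w′) → i ≡ j
  loop-length refl = refl

  split-unique : ∀ (l₁ : List Name) {l₁′ e l₂ e′ l₂′} → l₁ ++ e ∷ l₂ ≡ l₁′ ++ e′ ∷ l₂′ → length l₁ ≡ length l₁′ → l₁ ≡ l₁′ × e ≡ e′ × l₂ ≡ l₂′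
  split-unique [] {[]} refl _ = refl , refl , refl
  split-unique (x ∷ l₁) {y ∷ l₁′} eq len with List.∷-injective eq
  ... | refl , eq′ with split-unique l₁ eq′ (ℕ.suc-injective len)
  ...   | refl , refl , refl = refl , refl , refl

  -- Every step but `bad` determines the edge it creates, as `loop` carries the position of the
  -- partner. So a word without `bad` determines the rebuilt map.
  deterministic : ∀ {n U K L w P k w′ P′ k′} → Tr n U K L w P k → Tr n U K L w′ P′ k′ → bads w ≡ 0 → w ≡ w′ → P ≡ P′ × k ≡ k′
  deterministic stop stop h e = refl , refl
  deterministic (nil t) (nil t′) h e = deterministic t t′ h (List.∷-injectiveʳ e)
  deterministic (mark t) (mark t′) h e = deterministic t t′ h (List.∷-injectiveʳ e)
  deterministic (mark t) (fnew t′) h ()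
  deterministic (fnew t) (mark t′) h ()
  deterministic (fnew t) (fnew t′) h e with deterministic t t′ h (List.∷-injectiveʳ e)
  ... | refl , refl = refl , refl
  deterministic (unew t) (unew t′) h e with deterministic t t′ h (List.∷-injectiveʳ e)
  ... | refl , refl = refl , refl
  deterministic (unew t) (loop _ t′) h ()
  deterministic (unew t) (bad _ t′) h ()
  deterministic (loop _ t) (unew t′) h ()
  deterministic (loop _ t) (bad _ t′) h ()
  deterministic (loop {l₁ = l₁} refl t) (loop e′ t′) h e with split-unique l₁ e′ (loop-length e)
  ... | refl , refl , refl with deterministic t t′ h (List.∷-injectiveʳ e)
  ...   | refl , refl = refl , refl
  deterministic (bad _ t) t′ () e

  -- The two namings fed to `lockstep` are that of the second map and that of the first one carried
  -- over by the isomorphism.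
  word-unique : ∀ {w P k w′ P′ k′} (t : Tr 1 (vertex 0) [] [] w P k) (t′ : Tr 1 (vertex 0) [] [] w′ P′ k′) → bads w ≡ 0 → bads w′ ≡ 0 →
    Iso (Map.M s t) (Map.M s t′) → w ≡ w′
  word-unique t t′ h h′ I = lockstep t t′ h h′ keeps keeps′ inj inj′ X.unique-ends fine
    where
    open Iso I
    module X = Map s t
    module X′ = Map s t′
    open Lockstep X′.σM X′.αM X′.flag′ (ψ ∘ X.dart) X′.dart (λ x → trans (cong ψ (X.dart-σ x)) (ψ-σ (X.dart x))) X′.dart-σ
    keeps : Respects (ψ ∘ X.dart) _
    keeps m = trans (sym (ψ-α _)) (cong ψ (proj₁ (X.dart-α m))) , trans (ψ-forest _) (proj₁ (X.dart-flag m)) , trans (ψ-forest _) (proj₂ (X.dart-flag m))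
    keeps′ : Respects X′.dart _
    keeps′ m = proj₁ (X′.dart-α m) , X′.dart-flag m
    inj : Injective (ψ ∘ X.dart) X.N
    inj hx hy e = X.dart-injective hx hy (trans (sym (ψ-left _)) (trans (cong ψ⁻ e) (ψ-left _)))
    inj′ : Injective X′.dart X′.N
    inj′ = X′.dart-injective
    fine-0 : ∀ {x} → x ∈ vertex 0 → Fine 1 x
    fine-0 (here refl) = s≤s z≤n , ψ-root
    fine-0 (there m) = fine-vertex 0 ψ-root m
    fine : ∀ {x} → x ∈ vertex 0 ++ [] → Fine 1 x
    fine {x} m = fine-0 (subst (x ∈_) (List.++-identityʳ (vertex 0)) m)

  Traced₀ : Word → ℕ → ℕ → Set
  Traced₀ w f u = Traced 1 (vertex 0) [] [] w f u

  mapOf : ∀ {w f u} → Traced₀ w f u → AnyMap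
  mapOf (P , k , t , _) = Canonical t

  mapOf-good : ∀ {w f u} (T : Traced₀ w f u) → Good p f u (mapOf T)
  mapOf-good (P , k , t , refl , refl , h) = Map.valid s t h , ℕ.≤-antisym (Map.faces-≤ s t) (Map.faces-≥ s t h) , Map.components-M s t

  module Encode {m : ℕ} (M : FMap m) (V : Valid p M) {w : Word} {P : List Edge} {k : ℕ} (t : Tr 1 (vertex 0) [] [] w P k)
    (bs : ℕ → Fin m) (bs0 : bs 0 ≡ FMap.root M) (keeps : Exploration.Respects s M V bs P) (inj : Exploration.Injective s M V bs (suc k)) where
    module V = Valid V
    module X = Map s t

    iso : Iso (Map.M s t) M
    iso = Encoded.rebuilt-iso M V t bs bs0 keeps inj

    faces-≤ : faces M ≤ nils w
    faces-≤ = ℕ.≤-trans (cycles-mono _ _ (φ-injective {M = M} V.σ-left V.σ-right V.α-invol V.forest-α) X.φM-injective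
      (Iso.ψ⁻ iso) (Iso.ψ iso) (Iso.ψ-right iso) (λ x → trans (Iso.ψ-σ (iso-sym iso) _) (cong X.σM (Iso.ψ-α (iso-sym iso) x)))) X.faces-≤

    vertices-≤ : vertices M ≤ suc k
    vertices-≤ = ℕ.≤-trans (cycles-mono _ _ (σ-injective {M = M} V.σ-left V.σ-right V.α-invol V.forest-α) X.σM-injective
      (Iso.ψ⁻ iso) (Iso.ψ iso) (Iso.ψ-right iso) (Iso.ψ-σ (iso-sym iso))) (ℕ.≤-reflexive X.vertices-M)

    darts-≤ : X.m ≤ m
    darts-≤ = Fin.injective⇒≤ {f = Iso.ψ iso} λ {x} {y} e → trans (sym (Iso.ψ-left iso x)) (trans (cong (Iso.ψ⁻ iso) e) (Iso.ψ-left iso y))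

    -- Upper bounds suffice: at most k + 1 vertices, at most n faces and at least 2 l darts give l +
    -- 2 ≤ k + 1 + n by planarity, whereas l + 1 = n + k + 2 b.
    no-handles : ∀ {v f l n k b m₀ m : ℕ} → v ≤ suc k → f ≤ n → m₀ ≤ m → 2 * l ≡ m₀ → 2 * (v + f) ≡ m + 4 → n + k + 2 * b ≡ suc l → b ≡ 0
    no-handles {v} {f} {l} {n} {k} {b} {m₀} {m} hv hf hm e₁ e₂ e₃ = ℕ.n≤0⇒n≡0 (ℕ.≤-trans (ℕ.m≤m+n b (b + 0)) (ℕ.+-cancelˡ-≤ (suc (n + k)) (2 * b) 0 (begin
      suc (n + k + 2 * b) ≡⟨ cong suc e₃ ⟩
      suc (suc l) ≤⟨ ℕ.*-cancelˡ-≤ 2 (begin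
        2 * suc (suc l) ≡⟨ lem l ⟩
        2 * l + 4 ≡⟨ cong (_+ 4) e₁ ⟩
        m₀ + 4 ≤⟨ ℕ.+-monoˡ-≤ 4 hm ⟩
        m + 4 ≡⟨ sym e₂ ⟩
        2 * (v + f) ≤⟨ ℕ.*-monoʳ-≤ 2 (ℕ.+-mono-≤ hv hf) ⟩
        2 * (suc k + n) ∎) ⟩
      suc k + n ≡⟨ lem′ k n ⟩
      suc (n + k) + 0 ∎)))
      where
      open ℕ.≤-Reasoning
      lem : ∀ x → 2 * suc (suc x) ≡ 2 * x + 4
      lem = solve-∀
      lem′ : ∀ a b → suc a + b ≡ suc (b + a) + 0
      lem′ = solve-∀

    planar-word : bads w ≡ 0
    planar-word = no-handles vertices-≤ faces-≤ darts-≤ X.length-2P V.planar X.nils-euler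

    V₀ : Valid p (Map.M s t)
    V₀ = X.valid planar-word

    -- The lower bound on the faces of the rebuilt map becomes available here, after handle steps
    -- have been excluded.
    faces-eq : nils w ≡ faces M
    faces-eq = ℕ.≤-antisym (ℕ.≤-trans (X.faces-≥ planar-word) (Invariance.faces-mono V₀ V iso)) faces-≤

    components-eq : suc (unews w) ≡ components M
    components-eq = trans (sym X.components-M) (components-iso V₀ V iso)

    iso-to : ∀ {P′ k′} (t′ : Tr 1 (vertex 0) [] [] w P′ k′) → P ≡ P′ × k ≡ k′ → Iso M (Map.M s t′)
    iso-to t′ (refl , refl) = iso-sym (Encoded.rebuilt-iso M V t′ bs bs0 keeps inj)

  Code : AnyMap → ℕ → ℕ → Set
  Code x f u = Σ Word λ w → (∀ (T : Traced₀ w f u) → IsoA x (mapOf T)) × Traced₀ w f u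

  encode-explored : ∀ {m f u} (M : FMap m) (V : Valid p M) → faces M ≡ f → components M ≡ suc u →
    Exploration.Explored s M V (Exploration.start s M V) 1 (vertex 0) [] [] → Code (m , M) f u
  encode-explored M V hf hc (w , P , k , bs , t , agree , keeps , inj) =
    w , (λ T → E.iso-to (proj₁ (proj₂ (proj₂ T))) (deterministic t (proj₁ (proj₂ (proj₂ T))) E.planar-word refl)) ,
    (P , k , t , trans E.faces-eq hf , ℕ.suc-injective (trans E.components-eq hc) , E.planar-word)
    where module E = Encode M V t bs (agree (s≤s z≤n)) keeps inj

  encode : ∀ {f u} x → Good p f u x → Code x f u
  encode (m , M) (V , hf , hc) = encode-explored M V hf hc (Exploration.explored s M V)

  build : ∀ {f u} (ws : List Word) → (∀ {w} → w ∈ ws → Traced₀ w f u) → List AnyMap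
  build [] h = []
  build (w ∷ ws) h = mapOf (h (here refl)) ∷ build ws (h ∘ there)

  build-length : ∀ {f u} ws (h : ∀ {w} → w ∈ ws → Traced₀ w f u) → length (build ws h) ≡ length ws
  build-length [] h = refl
  build-length (w ∷ ws) h = cong suc (build-length ws (h ∘ there))

  build-good : ∀ {f u} ws (h : ∀ {w} → w ∈ ws → Traced₀ w f u) → All (Good p f u) (build ws h)
  build-good [] h = []
  build-good (w ∷ ws) h = mapOf-good (h (here refl)) ∷ build-good ws (h ∘ there)

  build-all : ∀ {f u} {Q : AnyMap → Set} ws (h : ∀ {w} → w ∈ ws → Traced₀ w f u) → (∀ {w} → w ∈ ws → (T : Traced₀ w f u) → Q (mapOf T)) → All Q (build ws h)
  build-all [] h g = []
  build-all (w ∷ ws) h g = g (here refl) (h (here refl)) ∷ build-all ws (h ∘ there) (g ∘ there)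

  mapOf-word : ∀ {f u w w′} (T : Traced₀ w f u) (T′ : Traced₀ w′ f u) → IsoA (mapOf T) (mapOf T′) → w ≡ w′
  mapOf-word (_ , _ , t , _ , _ , h) (_ , _ , t′ , _ , _ , h′) I = word-unique t t′ h h′ I

  build-distinct : ∀ {f u} ws (h : ∀ {w} → w ∈ ws → Traced₀ w f u) → AllPairs _≢_ ws → AllPairs (λ x y → ¬ IsoA x y) (build ws h)
  build-distinct [] h [] = []
  build-distinct (w ∷ ws) h (n ∷ ns) = build-all ws (h ∘ there) (λ m T I → All.lookup n m (mapOf-word (h (here refl)) T I)) ∷ build-distinct ws (h ∘ there) ns

  build-any : ∀ {f u w} {Q : AnyMap → Set} ws (h : ∀ {w} → w ∈ ws → Traced₀ w f u) → w ∈ ws → (∀ (T : Traced₀ w f u) → Q (mapOf T)) → Any Q (build ws h)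
  build-any (w ∷ ws) h (here refl) g = here (g (h (here refl)))
  build-any (w ∷ ws) h (there m) g = there (build-any ws (h ∘ there) m g)

  open ExplorationWords.Enumerate s using (codes; codes-words)

  classes : ∀ f u → ClassCount p f u (length (codes p f u))
  classes f u = build (codes p f u) h , build-length (codes p f u) h , build-good (codes p f u) h , build-distinct (codes p f u) h unique-codes , λ x g → complete (encode x g)
    where
    h : ∀ {w} → w ∈ codes p f u → Traced₀ w f u
    h = traced-all f u
    unique-codes : AllPairs _≢_ (codes p f u)
    unique-codes = subst (AllPairs _≢_) (sym (codes-words p f u)) (unique-words (8 * f + (2 * p + 1)) p 0 [] f u)
    complete : ∀ {x} → Code x f u → Any (IsoA x) (build (codes p f u) h)
    complete (w , isos , (P , k , t , ef , eu , nb)) = build-any (codes p f u) h (≡.subst₂ (λ f u → w ∈ codes p f u) ef eu (enumerated-all t nb)) isos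

-- A list meeting every class is at least as long as any list of pairwise non-isomorphic maps;
-- applied both ways, this makes the count independent of representatives.
count-unique : ∀ {p f u N N′} → ClassCount p f u N → ClassCount p f u N′ → N ≤ N′
count-unique (L , refl , good , distinct , _) (L′ , refl , _ , _ , complete) =
  inequivalent-≤ IsoA iso-sym iso-trans L′ distinct (All.map (λ {x} g → complete x g) good)

theorem3p1 : (p : ℕ) → 3 ≤ p →
    Σ Series λ R → Σ Series λ S →
    (PolyCoeffs R × PolyCoeffs S × ZeroConst R × ZeroConst S
    × (∀ n k → R n k ≡ (zS ⊕ uMul (subst₂ (Φ₁c p) R S)) n k)
    × (∀ n k → S n k ≡ uMul (subst₂ (Φ₂c p) R S) n k))
    × (∀ R′ S′ → PolyCoeffs R′ → PolyCoeffs S′ → ZeroConst R′ → ZeroConst S′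
    → (∀ n k → R′ n k ≡ (zS ⊕ uMul (subst₂ (Φ₁c p) R′ S′)) n k)
    → (∀ n k → S′ n k ≡ uMul (subst₂ (Φ₂c p) R′ S′) n k)
    → (∀ n k → R′ n k ≡ R n k) × (∀ n k → S′ n k ≡ S n k))
    × (∀ f k → ∃ λ N → ClassCount p f k N)
    × (∀ k N → ClassCount p 0 k N → N ≡ 0)
    × (∀ n k N → ClassCount p (suc n) k N
    → ℕtoℚ (suc n) ℚ* ℕtoℚ N ≡ subst₂ (θc p) R S n k)
theorem3p1 (suc (suc (suc r))) (s≤s (s≤s (s≤s _))) =
  solR , solS ,
  (graded-polynomial Poly.solR-graded , graded-polynomial Poly.solS-graded , R0 , S0
  , (λ n k → trans (solR-eq n k) (sym (eqR≡ solR solS n k)))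
  , (λ n k → trans (solS-eq n k) (sym (eqS≡ solR solS n k))))
  , (λ R′ S′ _ _ _ _ e e′ →
      -- Agreement modulo u^(k + 1) covers the coefficient of u^k.
      (λ n k → proj₁ (FP.unique (λ n k → trans (e n k) (eqR≡ R′ S′ n k)) (λ n k → trans (e′ n k) (eqS≡ R′ S′ n k)) solR-eq solS-eq (suc k)) n k ℕ.≤-refl)
    , (λ n k → proj₂ (FP.unique (λ n k → trans (e n k) (eqR≡ R′ S′ n k)) (λ n k → trans (e′ n k) (eqS≡ R′ S′ n k)) solR-eq solS-eq (suc k)) n k ℕ.≤-refl))
  , (λ f k → _ , classes f k)
  , (λ k N c → ℕ.n≤0⇒n≡0 (ℕ.≤-trans (count-unique c (classes 0 k)) (ℕ.≤-reflexive (cong length (codes-[] (3 + r) k)))))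
  , (λ n k N c → trans (cong (λ N → ℕtoℚ (suc n) ℚ* ℕtoℚ N) (ℕ.≤-antisym (count-unique c (classes (suc n) k)) (count-unique (classes (suc n) k) c))) (θ-count n k))
  where
  open TreeNumbers r
  open Reconstruction r
  open ExplorationWords.Enumerate (suc r) using (codes-[])
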